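{- For every sufficiently small $\eta>0$ there exists a constant $C'$ such that for all positive integers $n$, $$|Forb(n,T_5,\eta)| < (1+C'2^{ -n/10})\,S(n).$$
   Context: A 3-graph on $[n]$ is a set of 3-element subsets of $[n]$. $T_5$ is the 3-graph $\{123,124,125,345\}$. For an ordered partition $P=(X,Y)$ of the vertex set of a 3-graph $\mathcal{H}$, an edge is consistent with $P$ if it has exactly two vertices in $X$, and inconsistent otherwise. $D_{\mathcal{H}}$ is the minimum over all ordered partitions of the number of inconsistent edges. $Forb(n,T_5,\eta)=\{\mathcal{H}\subset\binom{[n]}{3}: T_5\not\subset\mathcal{H},\ D_{\mathcal{H}}\le \eta n^3\}$. A 3-graph is semi-bipartite if it has an ordered vertex partition $(X,Y)$ with every edge consistent (exactly two vertices in $X$). $S(n)$ is the number of semi-bipartite 3-graphs on vertex set $[n]$. -}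

module Defs where

open import Data.Bool using (Bool; true; false; _∧_; _∨_; not; if_then_else_)
open import Data.Nat using (ℕ; zero; suc; _+_; _^_; _<ᵇ_; _≡ᵇ_; _⊓_)
open import Data.Fin using (Fin; toℕ)
open import Data.Fin.Properties using () renaming (_≟_ to _≟ᶠ_)
open import Data.List using (List; []; _∷_; _++_; map; concatMap; filter; filterᵇ; length; allFin; zip; foldr)
open import Data.Bool.ListAction using (any)
open import Data.Vec using (Vec; []; _∷_; lookup; toList)
open import Data.Product using (_×_; _,_; proj₁; proj₂)
open import Data.Integer using (+_)
open import Data.Rational using (ℚ; _/_; _*_; _≤_)
open import Data.Rational.Properties using (_≤?_)
open import Relation.Nullary using (does)
open import Relation.Nullary.Decidable using (_×-dec_)
open import Relation.Binary.PropositionalEquality using (_≡_)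
import Data.Bool.Properties as BoolP

Triple : ℕ → Set
Triple n = Fin n × Fin n × Fin n

triples : (n : ℕ) → List (Triple n)
triples n =
  concatMap (λ i → concatMap (λ j → map (λ k → (i , j , k))
      (filterᵇ (λ k → toℕ j <ᵇ toℕ k) (allFin n)))
    (filterᵇ (λ j → toℕ i <ᵇ toℕ j) (allFin n)))
  (allFin n)

-- A 3-graph on [n]: a subset of the set of 3-subsets of [n], given by its
-- characteristic vector indexed by (triples n).
record Graph3 (n : ℕ) : Set where
  constructor mkGraph3
  field
    bits : Vec Bool (length (triples n))
open Graph3 public

edges : {n : ℕ} → Graph3 n → List (Triple n)
edges {n} H = map proj₁ (filterᵇ proj₂ (zip (triples n) (toList (bits H))))

_==_ : {n : ℕ} → Fin n → Fin n → Bool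
a == b = does (a ≟ᶠ b)

memb : {n : ℕ} → Fin n → Triple n → Bool
memb v (i , j , k) = (v == i) ∨ (v == j) ∨ (v == k)

distinct3 : {n : ℕ} → Fin n → Fin n → Fin n → Bool
distinct3 a b c = not (a == b) ∧ not (a == c) ∧ not (b == c)

isEdge : {n : ℕ} → Graph3 n → Fin n → Fin n → Fin n → Bool
isEdge H a b c =
  distinct3 a b c ∧ any (λ t → memb a t ∧ memb b t ∧ memb c t) (edges H)

allBoolVecs : (m : ℕ) → List (Vec Bool m)
allBoolVecs zero = [] ∷ []
allBoolVecs (suc m) = map (true ∷_) (allBoolVecs m) ++ map (false ∷_) (allBoolVecs m)

allGraphs : (n : ℕ) → List (Graph3 n)
allGraphs n = map mkGraph3 (allBoolVecs (length (triples n)))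

containsT5 : {n : ℕ} → Graph3 n → Bool
containsT5 {n} H =
  any (λ v1 → any (λ v2 → any (λ v3 → any (λ v4 → any (λ v5 →
      distinct3 v1 v2 v3 ∧ distinct3 v1 v2 v4 ∧ distinct3 v1 v2 v5
      ∧ distinct3 v3 v4 v5
      ∧ isEdge H v1 v2 v3 ∧ isEdge H v1 v2 v4 ∧ isEdge H v1 v2 v5
      ∧ isEdge H v3 v4 v5)
    (allFin n)) (allFin n)) (allFin n)) (allFin n)) (allFin n)

-- Ordered partition (X , Y) of [n] given by the characteristic vector of X.
Partition : ℕ → Set
Partition n = Vec Bool n

inX : {n : ℕ} → Partition n → Fin n → ℕ
inX X v = if lookup X v then 1 else 0

consistent : {n : ℕ} → Partition n → Triple n → Bool
consistent X (i , j , k) = (inX X i + inX X j + inX X k) ≡ᵇ 2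

inconsistentCount : {n : ℕ} → Graph3 n → Partition n → ℕ
inconsistentCount H X = length (filterᵇ (λ e → not (consistent X e)) (edges H))

-- D_H: minimum over all ordered partitions of the number of inconsistent edges.
-- (The fold starts at |E(H)|, an upper bound for every term, so this is the
-- minimum over the nonempty list of all partitions.)
D : {n : ℕ} → Graph3 n → ℕ
D {n} H = foldr (λ X acc → inconsistentCount H X ⊓ acc) (length (edges H)) (allBoolVecs n)

semiBipartite : {n : ℕ} → Graph3 n → Bool
semiBipartite {n} H = any (λ X → inconsistentCount H X ≡ᵇ 0) (allBoolVecs n)

S : ℕ → ℕ
S n = length (filterᵇ semiBipartite (allGraphs n))

ℕtoℚ : ℕ → ℚ
ℕtoℚ m = (+ m) / 1

InForb : (n : ℕ) → ℚ → Graph3 n → Set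
InForb n η H = (containsT5 H ≡ false) × (ℕtoℚ (D H) ≤ η * ℕtoℚ (n ^ 3))

|Forb| : ℕ → ℚ → ℕ
|Forb| n η = length (filter (λ H → (containsT5 H BoolP.≟ false) ×-dec (ℕtoℚ (D H) ≤? η * ℕtoℚ (n ^ 3))) (allGraphs n))

{-# OPTIONS --safe #-}
module Submission where

-- Fix an ordered partition P = (X , Y) and call a triple good if exactly two of its vertices lie in X.
-- The T5-free graphs for which P is optimal and which have few, but at least one, bad edges are compared
-- with the 2^(#good) ≤ S(n) graphs without bad edges.  A proportion below 2^(-1.1 n) suffices: it leaves
-- room for the union over the 2^n partitions.  So every bound below weighs the number of bits saved by
-- forbidden configurations of good edges against the number of bits needed to describe the bad edges.
--   * If the link of some vertex is dense in two suitable ways, T5-freeness saves Ω(n³) bits, which pays for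
--     all bad edges at once.  By optimality of P the remaining graphs have few bad edges at every vertex,
--     up to two exceptional kinds of vertices, and this property passes to induced subgraphs.
--   * A vertex of an exceptional kind, a bad edge inside X or inside Y, and a bad edge x y y′ (x ∈ X, y, y′ ∈ Y)
--     with x y of large codegree each save Ω(n²) bits on the edges at the (at most three) vertices involved,
--     independently of the rest of the graph.  Removing them repeatedly, the savings add up.
--   * What remains has only bad edges x y y′ with both x y and x y′ of small codegree.  Already one such edge
--     costs 2|X| ≈ 4n/3 bits, and at every further x the loss of good edges outweighs the choice of bad ones.
-- A partition with |X| far from 2n/3 has Ω(n³) fewer good triples than the best one.

open import Defs
open import Data.Nat using (ℕ; _∸_; _^_; _≤_; _<_)
open import Data.Nat using () renaming (_*_ to _*ℕ_)
open import Data.Product using (Σ; _×_)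
open import Data.Rational using (ℚ; 0ℚ; mkℚ) renaming (_<_ to _<ℚ_; _≤_ to _≤ℚ_)

open import Data.Bool using (Bool; true; false; if_then_else_; _∨_; _∧_; not; T)
open import Data.Bool.Properties using () renaming (_≟_ to _≟ᵇ_)
import Data.Bool.ListAction
open import Data.Nat
open import Data.Nat.Properties
open import Data.Nat.DivMod using (m≡m%n+[m/n]*n; m%n<n)
open import Data.Nat.Tactic.RingSolver using (solve-∀)
import Data.Nat.Coprimality as Cop
import Data.Integer as ℤ
import Data.Integer.Properties as ℤ
import Data.Rational as ℚ
import Data.Rational.Properties as ℚ
import Data.Rational.Unnormalised as ℚᵘ
import Data.Rational.Unnormalised.Properties as ℚᵘ
open import Data.Fin using (Fin; zero; suc; toℕ)
open import Data.Fin.Properties using (any?; all?; toℕ-injective) renaming (_≟_ to _≟ᶠ_; suc-injective to sucᶠ-injective)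
open import Data.List as List using (List; []; _∷_; length; map; filter; filterᵇ; zip; concatMap; allFin; foldr)
open import Data.List.Properties using (filter-++; length-++; length-filter)
open import Data.List.Membership.Propositional using (find; lose) renaming (_∈_ to _∈ˡ_)
open import Data.List.Membership.Propositional.Properties
open import Data.List.Relation.Unary.Any using (here; there; index)
open import Data.List.Relation.Unary.Any.Properties using (any⁺; lookup-index)
open import Data.List.Relation.Unary.Unique.Propositional using (Unique; []; _∷_)
import Data.List.Relation.Unary.Unique.Propositional.Properties as Unique
import Data.List.Relation.Unary.All as All
import Data.List.Relation.Unary.All.Properties as All
import Data.List.Relation.Unary.AllPairs as AllPairs
import Data.List.Relation.Unary.AllPairs.Properties as AllPairs
open import Data.Vec using (Vec; []; _∷_; lookup; tabulate; replicate; toList; _[_]≔_)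
open import Data.Vec.Properties using (lookup∘tabulate; lookup∘updateAt; lookup∘updateAt′; tabulate-cong; tabulate∘lookup; lookup-replicate)
open import Data.Product using (_,_; proj₁; proj₂; ∃)
open import Data.Sum using (_⊎_; inj₁; inj₂)
open import Data.Empty using (⊥; ⊥-elim)
open import Function using (_∘_; case_of_)
open import Relation.Nullary using (Dec; yes; no; does; ¬_; contradiction)
open import Relation.Nullary.Decidable using (_×-dec_; ¬?; _⊎-dec_; _→-dec_; decidable-stable; T?)
open import Relation.Binary.Definitions using (tri<; tri≈; tri>)
open import Relation.Binary.PropositionalEquality hiding (J)
open import Algebra.Properties.Semiring.Sum +-*-semiring
  using (sum; sum-cong-≗; ∑-distrib-+; ∑-comm; *-distribˡ-sum; *-distribʳ-sum)
open import Algebra.Properties.CommutativeMonoid.Sum *-1-commutativeMonoid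
  using () renaming (sum to prod)

-- Sums over finite sets and over the cube

-- Counting is probability without division: `∑ᶜ f * 2 ^ a ≤ 2 ^ b * 2 ^ m` says that f has mean at
-- most 2^(b - a) on a uniformly random graph. Savings multiply only if the events are decided by
-- disjoint sets of edges, and this shapes most definitions: an event refers to the edges it owns
-- and to nothing else, even where T5-freeness would give more. The recursive removal has quadratic
-- gains to spend, so crude constants suffice there. The obstacle is the last kind of bad edge, with
-- a linear gain: for |X| > 0.598 n it is about 1.17 n, of which n are lost to the choice of the
-- partition. At most n removals with linear gains cannot make up for the cubic number of bits that
-- describe the bad edges. Instead one vertex x on such an edge is removed, and all remaining bad
-- edges of this kind are treated in a single product over the vertices of X. Two vertices of X
-- share good edges, so these are first distributed by a tournament on X; about a third of |X| is
-- left to each pair x y, which is enough, since for this product a mean of at most 2 will do.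

ind : {A : Set} → Dec A → ℕ
ind d = if does d then 1 else 0

ind≤1 : {A : Set} (d : Dec A) → ind d ≤ 1
ind≤1 (yes _) = ≤-refl
ind≤1 (no _) = z≤n

ind-yes : {A : Set} (d : Dec A) → A → ind d ≡ 1
ind-yes (yes _) _ = refl
ind-yes (no ¬a) a = contradiction a ¬a

ind-no : {A : Set} (d : Dec A) → ¬ A → ind d ≡ 0
ind-no (yes a) ¬a = contradiction a ¬a
ind-no (no _) _ = refl

ind≤ : {A : Set} (d : Dec A) {k : ℕ} → (A → 1 ≤ k) → ind d ≤ k
ind≤ (yes a) h = h a
ind≤ (no _) _ = z≤n

1≤ind : {A : Set} (d : Dec A) → A → 1 ≤ ind d
1≤ind d a = ≤-reflexive (sym (ind-yes d a))

ind-mono : {A B : Set} (d : Dec A) (d′ : Dec B) → (A → B) → ind d ≤ ind d′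
ind-mono d d′ f = ind≤ d (1≤ind d′ ∘ f)

ind-cong : {A B : Set} (d : Dec A) (d′ : Dec B) → (A → B) → (B → A) → ind d ≡ ind d′
ind-cong d d′ f g = ≤-antisym (ind-mono d d′ f) (ind-mono d′ d g)

ind-× : {A B : Set} (d : Dec A) (d′ : Dec B) → ind (d ×-dec d′) ≡ ind d * ind d′
ind-× (yes _) (yes _) = refl
ind-× (yes _) (no _) = refl
ind-× (no _) _ = refl

ind-¬ : {A : Set} (d : Dec A) → ind d + ind (¬? d) ≡ 1
ind-¬ (yes _) = refl
ind-¬ (no _) = refl

1≤* : ∀ {a b} → 1 ≤ a → 1 ≤ b → 1 ≤ a * b
1≤* {a} {b} p q = *-mono-≤ {1} {a} {1} {b} p q

1≤^ : ∀ a k → 1 ≤ a → 1 ≤ a ^ k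
1≤^ a zero p = ≤-refl
1≤^ a (suc k) p = 1≤* p (1≤^ a k p)

1≤2^ : ∀ k → 1 ≤ 2 ^ k
1≤2^ k = 1≤^ 2 k (s≤s z≤n)

*-cancelʳ-2^ : ∀ k {a b} → a * 2 ^ k ≤ b * 2 ^ k → a ≤ b
*-cancelʳ-2^ k {a} {b} p = *-cancelʳ-≤ a b (2 ^ k) {{m^n≢0 2 k}} p

2^-mono : ∀ {a b} → a ≤ b → 2 ^ a ≤ 2 ^ b
2^-mono = ^-monoʳ-≤ 2

sum-mono : ∀ {n} {f g : Fin n → ℕ} → (∀ i → f i ≤ g i) → sum f ≤ sum g
sum-mono {zero} h = z≤n
sum-mono {suc n} h = +-mono-≤ (h zero) (sum-mono (h ∘ suc))

sum-const : ∀ n c → sum {n} (λ _ → c) ≡ n * c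
sum-const zero c = refl
sum-const (suc n) c = cong (c +_) (sum-const n c)

sum-≤const : ∀ {n c} {f : Fin n → ℕ} → (∀ i → f i ≤ c) → sum f ≤ n * c
sum-≤const {n} {c} h = ≤-trans (sum-mono h) (≤-reflexive (sum-const n c))

≤sum : ∀ {n} (f : Fin n → ℕ) i → f i ≤ sum f
≤sum f zero = m≤m+n _ _
≤sum f (suc i) = ≤-trans (≤sum (f ∘ suc) i) (m≤n+m _ _)

sum-zero : ∀ {n} {f : Fin n → ℕ} → (∀ i → f i ≡ 0) → sum f ≡ 0
sum-zero {zero} h = refl
sum-zero {suc n} h = cong₂ _+_ (h zero) (sum-zero (h ∘ suc))

1≤prod : ∀ {n} {f : Fin n → ℕ} → (∀ i → 1 ≤ f i) → 1 ≤ prod f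
1≤prod {zero} h = ≤-refl
1≤prod {suc n} h = 1≤* (h zero) (1≤prod (h ∘ suc))

prod-^ : ∀ {n} a (k : Fin n → ℕ) → prod (λ i → a ^ k i) ≡ a ^ sum k
prod-^ {zero} a k = refl
prod-^ {suc n} a k = trans (cong (a ^ k zero *_) (prod-^ a (k ∘ suc))) (sym (^-distribˡ-+-* a (k zero) _))

opaque
  card : ∀ {m} {P : Fin m → Set} → ((e : Fin m) → Dec (P e)) → ℕ
  card P? = sum (λ e → ind (P? e))

  card-mono : ∀ {m} {P Q : Fin m → Set} (P? : ∀ e → Dec (P e)) (Q? : ∀ e → Dec (Q e)) →
    (∀ e → P e → Q e) → card P? ≤ card Q?
  card-mono P? Q? h = sum-mono (λ e → ind-mono (P? e) (Q? e) (h e))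

  card-cong : ∀ {m} {P Q : Fin m → Set} (P? : ∀ e → Dec (P e)) (Q? : ∀ e → Dec (Q e)) →
    (∀ e → P e → Q e) → (∀ e → Q e → P e) → card P? ≡ card Q?
  card-cong P? Q? h k = ≤-antisym (card-mono P? Q? h) (card-mono Q? P? k)

  card≤ : ∀ {m} {P : Fin m → Set} (P? : ∀ e → Dec (P e)) → card P? ≤ m
  card≤ {m} P? = ≤-trans (sum-≤const (λ e → ind≤1 (P? e))) (≤-reflexive (*-identityʳ m))

  card-empty : ∀ {m} {P : Fin m → Set} (P? : ∀ e → Dec (P e)) → (∀ e → ¬ P e) → card P? ≡ 0
  card-empty P? h = sum-zero (λ e → ind-no (P? e) (h e))

  1≤card : ∀ {m} {P : Fin m → Set} (P? : ∀ e → Dec (P e)) e → P e → 1 ≤ card P?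
  1≤card P? e p = ≤-trans (1≤ind (P? e) p) (≤sum _ e)

  card-≤1 : ∀ {m} {P : Fin m → Set} (P? : ∀ e → Dec (P e)) → (∀ e f → P e → P f → e ≡ f) → card P? ≤ 1
  card-≤1 {zero} P? h = z≤n
  card-≤1 {suc m} P? h with P? zero
  ... | yes p = ≤-reflexive (cong suc (card-empty (P? ∘ suc) (λ e q → case h zero (suc e) p q of λ ())))
  ... | no _ = card-≤1 (P? ∘ suc) (λ e f p q → sucᶠ-injective (h (suc e) (suc f) p q))

  card-+ : ∀ {m} {P Q R : Fin m → Set} (P? : ∀ e → Dec (P e)) (Q? : ∀ e → Dec (Q e)) (R? : ∀ e → Dec (R e)) →
    (∀ e → P e → Q e ⊎ R e) → card P? ≤ card Q? + card R?
  card-+ P? Q? R? h = ≤-trans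
    (sum-mono (λ e → ind≤ (P? e) (λ p → case h e p of λ
      { (inj₁ q) → ≤-trans (1≤ind (Q? e) q) (m≤m+n _ _)
      ; (inj₂ r) → ≤-trans (1≤ind (R? e) r) (m≤n+m _ _) })))
    (≤-reflexive (∑-distrib-+ (λ e → ind (Q? e)) (λ e → ind (R? e))))

  card-disj : ∀ {m} {P Q R : Fin m → Set} (P? : ∀ e → Dec (P e)) (Q? : ∀ e → Dec (Q e)) (R? : ∀ e → Dec (R e)) →
    (∀ e → Q e → P e) → (∀ e → R e → P e) → (∀ e → Q e → R e → ⊥) → card Q? + card R? ≤ card P?
  card-disj {P = P} {Q} {R} P? Q? R? h k d = ≤-trans (≤-reflexive (sym (∑-distrib-+ (λ e → ind (Q? e)) (λ e → ind (R? e)))))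
    (sum-mono (λ e → go e (Q? e) (R? e)))
    where
    go : ∀ e (q : Dec (Q e)) (r : Dec (R e)) → ind q + ind r ≤ ind (P? e)
    go e (yes q) (yes r) = ⊥-elim (d e q r)
    go e (yes q) (no _) = 1≤ind (P? e) (h e q)
    go e (no _) r = ind-mono r (P? e) (k e)

  card-cover : ∀ {m k} {P : Fin m → Set} {Q : Fin k → Fin m → Set}
    (P? : ∀ e → Dec (P e)) (Q? : ∀ u e → Dec (Q u e)) →
    (∀ e → P e → ∃ λ u → Q u e) → card P? ≤ sum (λ u → card (Q? u))
  card-cover P? Q? h = ≤-trans
    (sum-mono (λ e → ind≤ (P? e) (λ p → let u , q = h e p in ≤-trans (1≤ind (Q? u e) q) (≤sum (λ u → ind (Q? u e)) u))))
    (≤-reflexive (∑-comm (λ e u → ind (Q? u e))))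

  card-sum : ∀ {m} {P : Fin m → Set} (P? : ∀ e → Dec (P e)) → card P? ≡ sum (λ e → ind (P? e))
  card-sum P? = refl

pigeon : ∀ {m} {P Q : Fin m → Set} (P? : ∀ e → Dec (P e)) (Q? : ∀ e → Dec (Q e)) →
  card Q? < card P? → ∃ λ e → P e × ¬ Q e
pigeon P? Q? lt with any? (λ e → P? e ×-dec ¬? (Q? e))
... | yes x = x
... | no ¬x = contradiction lt (≤⇒≯ (card-mono P? Q? (λ e p → decidable-stable (Q? e) (λ ¬q → ¬x (e , p , ¬q)))))

on : ∀ {m} → Vec Bool m → Fin m → Set
on H e = lookup H e ≡ true

on? : ∀ {m} (H : Vec Bool m) e → Dec (on H e)
on? H e = lookup H e ≟ᵇ true

cnt off : ∀ {m} {P : Fin m → Set} → (∀ e → Dec (P e)) → Vec Bool m → ℕ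
cnt P? H = card (λ e → P? e ×-dec on? H e)
off P? H = card (λ e → P? e ×-dec ¬? (on? H e))

mixᵇ : ∀ {m} → (Fin m → Bool) → Vec Bool m → Vec Bool m → Vec Bool m
mixᵇ β H₀ H = tabulate (λ e → if β e then lookup H₀ e else lookup H e)

opaque
  ∑ᶜ : ∀ {m} → (Vec Bool m → ℕ) → ℕ
  ∑ᶜ {zero} f = f []
  ∑ᶜ {suc m} f = ∑ᶜ (λ H → f (true ∷ H)) + ∑ᶜ (λ H → f (false ∷ H))

  ∑ᶜ-mono : ∀ {m} {f g : Vec Bool m → ℕ} → (∀ H → f H ≤ g H) → ∑ᶜ f ≤ ∑ᶜ g
  ∑ᶜ-mono {zero} h = h []
  ∑ᶜ-mono {suc m} h = +-mono-≤ (∑ᶜ-mono (h ∘ (true ∷_))) (∑ᶜ-mono (h ∘ (false ∷_)))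

  ∑ᶜ-cong : ∀ {m} {f g : Vec Bool m → ℕ} → (∀ H → f H ≡ g H) → ∑ᶜ f ≡ ∑ᶜ g
  ∑ᶜ-cong {zero} h = h []
  ∑ᶜ-cong {suc m} h = cong₂ _+_ (∑ᶜ-cong (h ∘ (true ∷_))) (∑ᶜ-cong (h ∘ (false ∷_)))

  +-swap : ∀ a b c d → (a + b) + (c + d) ≡ (a + c) + (b + d)
  +-swap = solve-∀

  ∑ᶜ-+ : ∀ {m} (f g : Vec Bool m → ℕ) → ∑ᶜ (λ H → f H + g H) ≡ ∑ᶜ f + ∑ᶜ g
  ∑ᶜ-+ {zero} f g = refl
  ∑ᶜ-+ {suc m} f g = trans (cong₂ _+_ (∑ᶜ-+ {m} _ _) (∑ᶜ-+ {m} _ _))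
    (+-swap (∑ᶜ {m} (f ∘ (true ∷_))) _ _ _)

  ∑ᶜ-*ˡ : ∀ {m} c (f : Vec Bool m → ℕ) → ∑ᶜ (λ H → c * f H) ≡ c * ∑ᶜ f
  ∑ᶜ-*ˡ {zero} c f = refl
  ∑ᶜ-*ˡ {suc m} c f = trans (cong₂ _+_ (∑ᶜ-*ˡ {m} c _) (∑ᶜ-*ˡ {m} c _)) (sym (*-distribˡ-+ c _ _))

  ∑ᶜ-*ʳ : ∀ {m} c (f : Vec Bool m → ℕ) → ∑ᶜ (λ H → f H * c) ≡ ∑ᶜ f * c
  ∑ᶜ-*ʳ c f = trans (∑ᶜ-cong (λ H → *-comm (f H) c)) (trans (∑ᶜ-*ˡ c f) (*-comm c _))

  ∑ᶜ-const : ∀ m c → ∑ᶜ {m} (λ _ → c) ≡ c * 2 ^ m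
  ∑ᶜ-const zero c = sym (*-identityʳ c)
  ∑ᶜ-const (suc m) c = trans (cong₂ _+_ (∑ᶜ-const m c) (∑ᶜ-const m c)) (eq c (2 ^ m))
    where
    eq : ∀ a b → a * b + a * b ≡ a * (2 * b)
    eq = solve-∀

  ∑ᶜ-sum : ∀ {m n} (f : Fin n → Vec Bool m → ℕ) → ∑ᶜ (λ H → sum (λ i → f i H)) ≡ sum (λ i → ∑ᶜ (f i))
  ∑ᶜ-sum {m} {n = zero} f = ∑ᶜ-const m 0
  ∑ᶜ-sum {m} {n = suc n} f = trans (∑ᶜ-+ {m} (f zero) _) (cong (∑ᶜ (f zero) +_) (∑ᶜ-sum (f ∘ suc)))

  ∑ᶜ-comm : ∀ {m k} (f : Vec Bool k → Vec Bool m → ℕ) → ∑ᶜ (λ H → ∑ᶜ (λ K → f K H)) ≡ ∑ᶜ (λ K → ∑ᶜ (f K))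
  ∑ᶜ-comm {k = zero} f = refl
  ∑ᶜ-comm {m} {k = suc k} f = trans (∑ᶜ-+ {m} _ _) (cong₂ _+_ (∑ᶜ-comm {m} {k} (λ K → f (true ∷ K))) (∑ᶜ-comm {m} {k} (λ K → f (false ∷ K))))

  ≤∑ᶜ : ∀ {m} (f : Vec Bool m → ℕ) H → f H ≤ ∑ᶜ f
  ≤∑ᶜ f [] = ≤-refl
  ≤∑ᶜ f (true ∷ H) = ≤-trans (≤∑ᶜ (f ∘ (true ∷_)) H) (m≤m+n _ _)
  ≤∑ᶜ f (false ∷ H) = ≤-trans (≤∑ᶜ (f ∘ (false ∷_)) H) (m≤n+m _ _)

  -- Every vector is the mixture of exactly 2^m pairs, so a mixture of two independent uniform
  -- points is again uniform.
  ∑ᶜ-mixᵇ : ∀ {m} (β : Fin m → Bool) (F : Vec Bool m → ℕ) →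
    ∑ᶜ (λ H₀ → ∑ᶜ (λ H → F (mixᵇ β H₀ H))) ≡ 2 ^ m * ∑ᶜ F
  ∑ᶜ-mixᵇ {zero} β F = sym (+-identityʳ _)
  ∑ᶜ-mixᵇ {suc m} β F = trans
    (cong₂ _+_ (∑ᶜ-+ {m} (λ H₀ → Ψ (c true true) H₀) (λ H₀ → Ψ (c true false) H₀))
               (∑ᶜ-+ {m} (λ H₀ → Ψ (c false true) H₀) (λ H₀ → Ψ (c false false) H₀)))
    (trans (cong₂ _+_ (cong₂ _+_ (∑ᶜ-mixᵇ {m} (β ∘ suc) _) (∑ᶜ-mixᵇ {m} (β ∘ suc) _))
                      (cong₂ _+_ (∑ᶜ-mixᵇ {m} (β ∘ suc) _) (∑ᶜ-mixᵇ {m} (β ∘ suc) _)))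
           (combine (β zero)))
    where
    c : Bool → Bool → Bool
    c x y = if β zero then x else y
    Ψ : Bool → Vec Bool m → ℕ
    Ψ b H₀ = ∑ᶜ (λ H → F (b ∷ mixᵇ (β ∘ suc) H₀ H))
    φ : Bool → ℕ
    φ b = 2 ^ m * ∑ᶜ (λ H → F (b ∷ H))
    eq₁ : ∀ p a b → (p * a + p * a) + (p * b + p * b) ≡ 2 * p * (a + b)
    eq₁ = solve-∀
    eq₂ : ∀ p a b → (p * a + p * b) + (p * a + p * b) ≡ 2 * p * (a + b)
    eq₂ = solve-∀
    combine : ∀ b → (φ (if b then true else true) + φ (if b then true else false))
                  + (φ (if b then false else true) + φ (if b then false else false))
                  ≡ 2 ^ suc m * ∑ᶜ F
    combine true = eq₁ (2 ^ m) _ _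
    combine false = eq₂ (2 ^ m) _ _

opaque
  unfolding ∑ᶜ card

  -- Each bit of P contributes the mean (α + β)/2 independently; the denominators are cleared. The
  -- weights (0,1), (1,0) and (1,Q) give the three tail estimates below.
  weight-sum : ∀ {m} {P : Fin m → Set} (P? : ∀ e → Dec (P e)) α β →
    ∑ᶜ (λ H → α ^ cnt P? H * β ^ off P? H) * 2 ^ card P? ≡ (α + β) ^ card P? * 2 ^ m
  weight-sum {zero} P? α β = refl
  weight-sum {suc m} {P} P? α β = go (P? zero)
    where
    W : Vec Bool m → ℕ
    W H = α ^ cnt (P? ∘ suc) H * β ^ off (P? ∘ suc) H
    c : ℕ
    c = card (P? ∘ suc)
    IH : ∑ᶜ W * 2 ^ c ≡ (α + β) ^ c * 2 ^ m
    IH = weight-sum (P? ∘ suc) α β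
    scale : ∀ a b p q → a * p * (b * q) ≡ a * b * (p * q)
    scale = solve-∀
    eq₁ : ∀ a b s p → (a * s + b * s) * (2 * p) ≡ 2 * (a + b) * (s * p)
    eq₁ = solve-∀
    eq₂ : ∀ a b s p → 2 * (a + b) * (s * p) ≡ (a + b) * s * (2 * p)
    eq₂ = solve-∀
    eq₃ : ∀ s p → (s + s) * p ≡ 2 * (s * p)
    eq₃ = solve-∀
    eq₄ : ∀ s p → 2 * (s * p) ≡ s * (2 * p)
    eq₄ = solve-∀
    go : (d : Dec (P zero)) →
      (∑ᶜ (λ H → α ^ (ind (d ×-dec (true ≟ᵇ true)) + cnt (P? ∘ suc) H) * β ^ (ind (d ×-dec ¬? (true ≟ᵇ true)) + off (P? ∘ suc) H))
      + ∑ᶜ (λ H → α ^ (ind (d ×-dec (false ≟ᵇ true)) + cnt (P? ∘ suc) H) * β ^ (ind (d ×-dec ¬? (false ≟ᵇ true)) + off (P? ∘ suc) H)))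
      * 2 ^ (ind d + c) ≡ (α + β) ^ (ind d + c) * 2 ^ suc m
    go (yes _) = begin
      (∑ᶜ (λ H → α * α ^ cnt (P? ∘ suc) H * β ^ off (P? ∘ suc) H)
        + ∑ᶜ (λ H → α ^ cnt (P? ∘ suc) H * (β * β ^ off (P? ∘ suc) H))) * (2 * 2 ^ c)
        ≡⟨ cong (_* (2 * 2 ^ c)) (cong₂ _+_
             (trans (∑ᶜ-cong {m} (λ H → *-assoc α _ _)) (∑ᶜ-*ˡ {m} α W))
             (trans (∑ᶜ-cong {m} (λ H → x*yz (α ^ cnt (P? ∘ suc) H) β (β ^ off (P? ∘ suc) H))) (∑ᶜ-*ˡ {m} β W))) ⟩
      (α * ∑ᶜ W + β * ∑ᶜ W) * (2 * 2 ^ c) ≡⟨ eq₁ α β (∑ᶜ W) (2 ^ c) ⟩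
      2 * (α + β) * (∑ᶜ W * 2 ^ c) ≡⟨ cong (2 * (α + β) *_) IH ⟩
      2 * (α + β) * ((α + β) ^ c * 2 ^ m) ≡⟨ eq₂ α β ((α + β) ^ c) (2 ^ m) ⟩
      (α + β) * (α + β) ^ c * (2 * 2 ^ m) ∎
      where
      open ≡-Reasoning
      x*yz : ∀ x y z → x * (y * z) ≡ y * (x * z)
      x*yz = solve-∀
    go (no _) = begin
      (∑ᶜ W + ∑ᶜ W) * 2 ^ c ≡⟨ eq₃ (∑ᶜ W) (2 ^ c) ⟩
      2 * (∑ᶜ W * 2 ^ c) ≡⟨ cong (2 *_) IH ⟩
      2 * ((α + β) ^ c * 2 ^ m) ≡⟨ eq₄ ((α + β) ^ c) (2 ^ m) ⟩
      (α + β) ^ c * (2 * 2 ^ m) ∎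
      where open ≡-Reasoning

-- Functions of few coordinates: conditioning and independence

Local : ∀ {m} → (Fin m → Set) → (Vec Bool m → ℕ) → Set
Local P f = ∀ H H′ → (∀ e → P e → lookup H e ≡ lookup H′ e) → f H ≡ f H′

Local-⊆ : ∀ {m} {P Q : Fin m → Set} {f : Vec Bool m → ℕ} → (∀ e → P e → Q e) → Local P f → Local Q f
Local-⊆ s l H H′ h = l H H′ (λ e p → h e (s e p))

Local-* : ∀ {m} {P : Fin m → Set} {f g : Vec Bool m → ℕ} → Local P f → Local P g → Local P (λ H → f H * g H)
Local-* l k H H′ h = cong₂ _*_ (l H H′ h) (k H H′ h)

Local-prod : ∀ {m k} {P : Fin m → Set} {f : Fin k → Vec Bool m → ℕ} → (∀ i → Local P (f i)) → Local P (λ H → prod (λ i → f i H))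
Local-prod {k = zero} l H H′ h = refl
Local-prod {k = suc k} l H H′ h = cong₂ _*_ (l zero H H′ h) (Local-prod (l ∘ suc) H H′ h)

Local-∑ᶜ : ∀ {m k} {P : Fin m → Set} {f : Vec Bool k → Vec Bool m → ℕ} → (∀ K → Local P (f K)) → Local P (λ H → ∑ᶜ (λ K → f K H))
Local-∑ᶜ l H H′ h = ∑ᶜ-cong (λ K → l K H H′ h)

opaque
  mix : ∀ {m} {P : Fin m → Set} → (∀ e → Dec (P e)) → Vec Bool m → Vec Bool m → Vec Bool m
  mix P? = mixᵇ (λ e → does (P? e))

  lookup-mix-yes : ∀ {m} {P : Fin m → Set} (P? : ∀ e → Dec (P e)) H₀ H e → P e → lookup (mix P? H₀ H) e ≡ lookup H₀ e
  lookup-mix-yes P? H₀ H e p rewrite lookup∘tabulate (λ e → if does (P? e) then lookup H₀ e else lookup H e) e with P? e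
  ... | yes _ = refl
  ... | no ¬p = contradiction p ¬p

  lookup-mix-no : ∀ {m} {P : Fin m → Set} (P? : ∀ e → Dec (P e)) H₀ H e → ¬ P e → lookup (mix P? H₀ H) e ≡ lookup H e
  lookup-mix-no P? H₀ H e ¬p rewrite lookup∘tabulate (λ e → if does (P? e) then lookup H₀ e else lookup H e) e with P? e
  ... | yes p = contradiction p ¬p
  ... | no _ = refl

  -- The coordinates in P can be drawn first. They determine w, and whatever they are, the sum of g
  -- over the other coordinates obeys the bound B.
  cond : ∀ {m} {P : Fin m → Set} (P? : ∀ e → Dec (P e)) (w g : Vec Bool m → ℕ) B → Local P w →
    (∀ H₀ → ∑ᶜ (λ H → g (mix P? H₀ H)) ≤ B) → ∑ᶜ (λ H → w H * g H) * 2 ^ m ≤ ∑ᶜ w * B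
  cond {m} P? w g B l h = begin
    ∑ᶜ (λ H → w H * g H) * 2 ^ m
      ≡⟨ *-comm _ (2 ^ m) ⟩
    2 ^ m * ∑ᶜ (λ H → w H * g H)
      ≡⟨ ∑ᶜ-mixᵇ (λ e → does (P? e)) (λ H → w H * g H) ⟨
    ∑ᶜ (λ H₀ → ∑ᶜ (λ H → w (mix P? H₀ H) * g (mix P? H₀ H)))
      ≡⟨ ∑ᶜ-cong (λ H₀ → ∑ᶜ-cong (λ H → cong (_* g (mix P? H₀ H)) (l _ _ (lookup-mix-yes P? H₀ H)))) ⟩
    ∑ᶜ (λ H₀ → ∑ᶜ (λ H → w H₀ * g (mix P? H₀ H)))
      ≡⟨ ∑ᶜ-cong (λ H₀ → ∑ᶜ-*ˡ (w H₀) _) ⟩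
    ∑ᶜ (λ H₀ → w H₀ * ∑ᶜ (λ H → g (mix P? H₀ H)))
      ≤⟨ ∑ᶜ-mono (λ H₀ → *-monoʳ-≤ (w H₀) (h H₀)) ⟩
    ∑ᶜ (λ H₀ → w H₀ * B)
      ≡⟨ ∑ᶜ-*ʳ B w ⟩
    ∑ᶜ w * B ∎
    where open ≤-Reasoning

indep₂ : ∀ {m} {P : Fin m → Set} (P? : ∀ e → Dec (P e)) (f g : Vec Bool m → ℕ) → Local P f → Local (λ e → ¬ P e) g →
  ∑ᶜ (λ H → f H * g H) * 2 ^ m ≤ ∑ᶜ f * ∑ᶜ g
indep₂ P? f g l k = cond P? f g (∑ᶜ g) l
  (λ H₀ → ≤-reflexive (∑ᶜ-cong (λ H → k _ _ (lookup-mix-no P? H₀ H))))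

-- Means multiply over pairwise disjoint sets of coordinates. The bound on the mean of `f i` is the
-- fraction `d i` over `c i`.
indep : ∀ {m k} {J : Fin k → Fin m → Set} (J? : ∀ i e → Dec (J i e)) (f : Fin k → Vec Bool m → ℕ) (c d : Fin k → ℕ) →
  (∀ i → Local (J i) (f i)) → (∀ i j e → J i e → J j e → i ≡ j) →
  (∀ i → ∑ᶜ (f i) * c i ≤ d i * 2 ^ m) → ∑ᶜ (λ H → prod (λ i → f i H)) * prod c ≤ prod d * 2 ^ m
indep {m} {zero} J? f c d l disj h = ≤-reflexive (trans (*-identityʳ _) (∑ᶜ-const m 1))
indep {m} {suc k} {J} J? f c d l disj h = *-cancelʳ-2^ m (begin
  ∑ᶜ (λ H → f zero H * F H) * (c zero * C) * 2 ^ m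
    ≡⟨ eq₁ (∑ᶜ (λ H → f zero H * F H)) (c zero) C (2 ^ m) ⟩
  (∑ᶜ (λ H → f zero H * F H) * 2 ^ m) * (c zero * C)
    ≤⟨ *-monoˡ-≤ (c zero * C) (indep₂ (J? zero) (f zero) F (l zero) (Local-prod (λ i → Local-⊆ (λ e j j₀ → case disj zero (suc i) e j₀ j of λ ()) (l (suc i))))) ⟩
  ∑ᶜ (f zero) * ∑ᶜ F * (c zero * C)
    ≡⟨ eq₂ (∑ᶜ (f zero)) (∑ᶜ F) (c zero) C ⟩
  (∑ᶜ (f zero) * c zero) * (∑ᶜ F * C)
    ≤⟨ *-mono-≤ (h zero) (indep (J? ∘ suc) (f ∘ suc) (c ∘ suc) (d ∘ suc) (l ∘ suc) (λ i j e p q → sucᶠ-injective (disj (suc i) (suc j) e p q)) (h ∘ suc)) ⟩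
  (d zero * 2 ^ m) * (prod (d ∘ suc) * 2 ^ m)
    ≡⟨ eq₃ (d zero) (2 ^ m) (prod (d ∘ suc)) ⟩
  d zero * prod (d ∘ suc) * 2 ^ m * 2 ^ m ∎)
  where
  open ≤-Reasoning
  F : Vec Bool m → ℕ
  F H = prod (λ i → f (suc i) H)
  C = prod (c ∘ suc)
  eq₁ : ∀ a b c d → a * (b * c) * d ≡ (a * d) * (b * c)
  eq₁ = solve-∀
  eq₂ : ∀ a b c d → a * b * (c * d) ≡ (a * c) * (b * d)
  eq₂ = solve-∀
  eq₃ : ∀ a b c → (a * b) * (c * b) ≡ a * c * b * b
  eq₃ = solve-∀

cnt-local : ∀ {m} {P : Fin m → Set} (P? : ∀ e → Dec (P e)) H H′ →
  (∀ e → P e → lookup H e ≡ lookup H′ e) → cnt P? H ≡ cnt P? H′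
cnt-local P? H H′ h = card-cong _ _ (λ e (p , o) → p , trans (sym (h e p)) o) (λ e (p , o) → p , trans (h e p) o)

ind-cnt-Local : ∀ {m} {P Q : Fin m → Set} (P? : ∀ e → Dec (P e)) k → (∀ e → P e → Q e) →
  Local Q (λ H → ind (cnt P? H ≤? k))
ind-cnt-Local P? k s H H′ h = cong (λ c → ind (c ≤? k)) (cnt-local P? H H′ (λ e p → h e (s e p)))

cnt-mono : ∀ {m} {P Q : Fin m → Set} (P? : ∀ e → Dec (P e)) (Q? : ∀ e → Dec (Q e)) H H′ →
  (∀ e → P e → on H e → Q e × on H′ e) → cnt P? H ≤ cnt Q? H′
cnt-mono P? Q? H H′ h = card-mono _ _ (λ e (p , o) → h e p o)

cnt-zero : ∀ {m} {P : Fin m → Set} (P? : ∀ e → Dec (P e)) H → (∀ e → P e → on H e → ⊥) → cnt P? H ≡ 0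
cnt-zero P? H h = card-empty _ (λ e (p , o) → h e p o)

opaque
  unfolding card

  cnt+off : ∀ {m} {P : Fin m → Set} (P? : ∀ e → Dec (P e)) H → cnt P? H + off P? H ≡ card P?
  cnt+off P? H = trans (sym (∑-distrib-+ (λ e → ind (P? e ×-dec on? H e)) (λ e → ind (P? e ×-dec ¬? (on? H e))))) (sum-cong-≗ (λ e → go (P? e) (on? H e)))
    where
    go : ∀ {A B : Set} (p : Dec A) (q : Dec B) → ind (p ×-dec q) + ind (p ×-dec ¬? q) ≡ ind p
    go (yes _) (yes _) = refl
    go (yes _) (no _) = refl
    go (no _) _ = refl

none-sum : ∀ {m} {P : Fin m → Set} (P? : ∀ e → Dec (P e)) →
  ∑ᶜ (λ H → ind (cnt P? H ≤? 0)) * 2 ^ card P? ≤ 2 ^ m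
none-sum {m} P? = begin
  ∑ᶜ (λ H → ind (cnt P? H ≤? 0)) * 2 ^ card P?
    ≤⟨ *-monoˡ-≤ _ (∑ᶜ-mono (λ H → ind≤ (cnt P? H ≤? 0) (λ z → ≤-reflexive (sym (cong₂ _*_ (cong (0 ^_) (n≤0⇒n≡0 z)) (^-zeroˡ (off P? H))))))) ⟩
  ∑ᶜ (λ H → 0 ^ cnt P? H * 1 ^ off P? H) * 2 ^ card P? ≡⟨ weight-sum P? 0 1 ⟩
  1 ^ card P? * 2 ^ m ≡⟨ cong (_* 2 ^ m) (^-zeroˡ (card P?)) ⟩
  1 * 2 ^ m ≡⟨ *-identityˡ _ ⟩
  2 ^ m ∎
  where open ≤-Reasoning

none-sum≥ : ∀ {m} {P : Fin m → Set} (P? : ∀ e → Dec (P e)) →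
  2 ^ m ≤ ∑ᶜ (λ H → ind (cnt P? H ≤? 0)) * 2 ^ card P?
none-sum≥ {m} P? = begin
  2 ^ m ≡⟨ *-identityˡ _ ⟨
  1 * 2 ^ m ≡⟨ cong (_* 2 ^ m) (^-zeroˡ (card P?)) ⟨
  1 ^ card P? * 2 ^ m ≡⟨ weight-sum P? 0 1 ⟨
  ∑ᶜ (λ H → 0 ^ cnt P? H * 1 ^ off P? H) * 2 ^ card P?
    ≤⟨ *-monoˡ-≤ _ (∑ᶜ-mono (λ H → go (cnt P? H) (off P? H))) ⟩
  ∑ᶜ (λ H → ind (cnt P? H ≤? 0)) * 2 ^ card P? ∎
  where
  open ≤-Reasoning
  go : ∀ c o → 0 ^ c * 1 ^ o ≤ ind (c ≤? 0)
  go zero o = ≤-reflexive (trans (+-identityʳ _) (^-zeroˡ o))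
  go (suc c) o = z≤n

-- A conjunction of at most three independent bits fails with probability at most 7/8.
not-all-sum : ∀ {m} {P : Fin m → Set} (P? : ∀ e → Dec (P e)) → card P? ≤ 3 →
  ∑ᶜ (λ H → ind (1 ≤? off P? H)) * 8 ≤ 7 * 2 ^ m
not-all-sum {m} P? c≤3 = +-cancelʳ-≤ (2 ^ m) _ _ (begin
  N * 8 + 2 ^ m ≤⟨ +-monoʳ-≤ (N * 8) below ⟩
  N * 8 + A * 8 ≡⟨ *-distribʳ-+ 8 N A ⟨
  (N + A) * 8 ≡⟨ cong (_* 8) (∑ᶜ-+ _ _) ⟨
  ∑ᶜ (λ H → ind (1 ≤? off P? H) + 1 ^ cnt P? H * 0 ^ off P? H) * 8
    ≤⟨ *-monoˡ-≤ 8 (∑ᶜ-mono (λ H → go (cnt P? H) (off P? H))) ⟩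
  ∑ᶜ {m} (λ H → 1) * 8 ≡⟨ cong (_* 8) (∑ᶜ-const m 1) ⟩
  1 * 2 ^ m * 8 ≡⟨ eq (2 ^ m) ⟩
  7 * 2 ^ m + 2 ^ m ∎)
  where
  open ≤-Reasoning
  N = ∑ᶜ (λ H → ind (1 ≤? off P? H))
  A = ∑ᶜ (λ H → 1 ^ cnt P? H * 0 ^ off P? H)
  below : 2 ^ m ≤ A * 8
  below = begin
    2 ^ m ≡⟨ *-identityˡ _ ⟨
    1 * 2 ^ m ≡⟨ cong (_* 2 ^ m) (^-zeroˡ (card P?)) ⟨
    1 ^ card P? * 2 ^ m ≡⟨ weight-sum P? 1 0 ⟨
    A * 2 ^ card P? ≤⟨ *-monoʳ-≤ A (2^-mono c≤3) ⟩
    A * 8 ∎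
  go : ∀ c o → ind (1 ≤? o) + 1 ^ c * 0 ^ o ≤ 1
  go c zero = ≤-reflexive (trans (*-identityʳ _) (^-zeroˡ c))
  go c (suc o) = ≤-reflexive (cong suc (*-zeroʳ (1 ^ c)))
  eq : ∀ x → 1 * x * 8 ≡ 7 * x + x
  eq = solve-∀

-- Powers close to one and the bounds drawn from them

^-distribʳ-* : ∀ k a b → (a * b) ^ k ≡ a ^ k * b ^ k
^-distribʳ-* zero a b = refl
^-distribʳ-* (suc k) a b = trans (cong (a * b *_) (^-distribʳ-* k a b)) (eq a b (a ^ k) (b ^ k))
  where
  eq : ∀ a b c d → a * b * (c * d) ≡ a * c * (b * d)
  eq = solve-∀

-- The mean value inequality for the power j + 1 between Q and Q + 1, with the derivative taken at
-- the right end, where it is largest.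
bernoulli : ∀ Q j → suc Q ^ suc j ≤ Q ^ suc j + suc j * suc Q ^ j
bernoulli Q zero = ≤-reflexive (eq Q)
  where
  eq : ∀ Q → (1 + Q) * 1 ≡ Q * 1 + (1 + 0) * 1
  eq = solve-∀
bernoulli Q (suc j) = begin
  suc Q * suc Q ^ suc j ≡⟨⟩
  suc Q ^ suc j + Q * suc Q ^ suc j ≤⟨ +-monoʳ-≤ (suc Q ^ suc j) (*-monoʳ-≤ Q (bernoulli Q j)) ⟩
  suc Q ^ suc j + Q * (Q ^ suc j + suc j * suc Q ^ j) ≤⟨ +-monoʳ-≤ (suc Q ^ suc j) (≤-trans (≤-reflexive (eq₁ Q (Q ^ suc j) j (suc Q ^ j)))
      (+-monoʳ-≤ (Q * Q ^ suc j) (*-monoʳ-≤ (suc j) (m≤n+m (Q * suc Q ^ j) (suc Q ^ j))))) ⟩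
  suc Q ^ suc j + (Q * Q ^ suc j + suc j * suc Q ^ suc j) ≡⟨ eq₂ (suc Q ^ suc j) (Q * Q ^ suc j) j ⟩
  Q * Q ^ suc j + suc (suc j) * suc Q ^ suc j ∎
  where
  open ≤-Reasoning
  eq₁ : ∀ Q a j b → Q * (a + (1 + j) * b) ≡ Q * a + (1 + j) * (Q * b)
  eq₁ = solve-∀
  eq₂ : ∀ p b j → p + (b + (1 + j) * p) ≡ b + (2 + j) * p
  eq₂ = solve-∀

-- By `bernoulli` the two powers differ by at most j (Q + 1)^(j - 1), which is at most half of (Q +
-- 1)^j.
half-ratio : ∀ Q j → 2 * j ≤ suc Q → suc Q ^ j ≤ 2 * Q ^ j
half-ratio Q zero _ = s≤s z≤n
half-ratio Q (suc j) h = +-cancelʳ-≤ (suc Q ^ suc j) _ _ (begin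
  suc Q ^ suc j + suc Q ^ suc j ≡⟨ eq₁ (suc Q ^ suc j) ⟩
  2 * suc Q ^ suc j ≤⟨ *-monoʳ-≤ 2 (bernoulli Q j) ⟩
  2 * (Q ^ suc j + suc j * suc Q ^ j) ≡⟨ eq₂ (Q ^ suc j) j (suc Q ^ j) ⟩
  2 * Q ^ suc j + 2 * suc j * suc Q ^ j ≤⟨ +-monoʳ-≤ (2 * Q ^ suc j) (*-monoˡ-≤ (suc Q ^ j) h) ⟩
  2 * Q ^ suc j + suc Q ^ suc j ∎)
  where
  open ≤-Reasoning
  eq₁ : ∀ a → a + a ≡ 2 * a
  eq₁ = solve-∀
  eq₂ : ∀ a j b → 2 * (a + (1 + j) * b) ≡ 2 * a + 2 * (1 + j) * b
  eq₂ = solve-∀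

-- Filled up to 2^k r, the exponent splits into r blocks of length 2^k = Q/2, and by `half-ratio`
-- each block contributes at most a factor 2.
ratio-bound : ∀ k s r → s ≤ 2 ^ k * r → suc (2 ^ suc k) ^ s ≤ (2 ^ suc k) ^ s * 2 ^ r
ratio-bound k s r h = *-cancelʳ-≤ _ _ (Q ^ s′) {{m^n≢0 Q s′ {{m^n≢0 2 (suc k)}}}} (begin
  suc Q ^ s * Q ^ s′ ≤⟨ *-monoʳ-≤ (suc Q ^ s) (^-monoˡ-≤ s′ (n≤1+n Q)) ⟩
  suc Q ^ s * suc Q ^ s′ ≡⟨ ^-distribˡ-+-* (suc Q) s s′ ⟨
  suc Q ^ (s + s′) ≡⟨ cong (suc Q ^_) s+s′ ⟩
  suc Q ^ (2 ^ k * r) ≡⟨ ^-*-assoc (suc Q) (2 ^ k) r ⟨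
  (suc Q ^ (2 ^ k)) ^ r ≤⟨ ^-monoˡ-≤ r (half-ratio Q (2 ^ k) (n≤1+n Q)) ⟩
  (2 * Q ^ (2 ^ k)) ^ r ≡⟨ ^-distribʳ-* r 2 (Q ^ (2 ^ k)) ⟩
  2 ^ r * (Q ^ (2 ^ k)) ^ r ≡⟨ cong (2 ^ r *_) (trans (^-*-assoc Q (2 ^ k) r) (trans (cong (Q ^_) (sym s+s′)) (^-distribˡ-+-* Q s s′))) ⟩
  2 ^ r * (Q ^ s * Q ^ s′) ≡⟨ eq (2 ^ r) (Q ^ s) (Q ^ s′) ⟩
  Q ^ s * 2 ^ r * Q ^ s′ ∎)
  where
  open ≤-Reasoning
  Q = 2 ^ suc k
  s′ = 2 ^ k * r ∸ s
  s+s′ : s + s′ ≡ 2 ^ k * r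
  s+s′ = m+[n∸m]≡n h
  eq : ∀ a b c → a * (b * c) ≡ b * a * c
  eq = solve-∀

-- Few bits are on: a Chernoff-type bound with Q = 2^(1+k), each permitted bit costing a factor Q.
few-sum : ∀ {m} {P : Fin m → Set} (P? : ∀ e → Dec (P e)) b k r → card P? ≤ 2 ^ k * r →
  ∑ᶜ (λ H → ind (cnt P? H ≤? b)) * 2 ^ card P? ≤ 2 ^ (suc k * b + r) * 2 ^ m
few-sum {m} P? b k r h = *-cancelʳ-≤ _ _ (Q ^ s) {{m^n≢0 Q s {{m^n≢0 2 (suc k)}}}} (begin
  F * 2 ^ s * Q ^ s ≡⟨ eq₁ F (2 ^ s) (Q ^ s) ⟩
  F * Q ^ s * 2 ^ s ≡⟨ cong (_* 2 ^ s) (∑ᶜ-*ʳ (Q ^ s) _) ⟨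
  ∑ᶜ (λ H → ind (cnt P? H ≤? b) * Q ^ s) * 2 ^ s
    ≤⟨ *-monoˡ-≤ (2 ^ s) (∑ᶜ-mono (λ H → pt (cnt P? H ≤? b) (cnt P? H) (off P? H) (cnt+off P? H) (λ z → z))) ⟩
  ∑ᶜ (λ H → Q ^ b * (1 ^ cnt P? H * Q ^ off P? H)) * 2 ^ s ≡⟨ cong (_* 2 ^ s) (∑ᶜ-*ˡ (Q ^ b) _) ⟩
  Q ^ b * ∑ᶜ (λ H → 1 ^ cnt P? H * Q ^ off P? H) * 2 ^ s ≡⟨ *-assoc (Q ^ b) _ _ ⟩
  Q ^ b * (∑ᶜ (λ H → 1 ^ cnt P? H * Q ^ off P? H) * 2 ^ s) ≡⟨ cong (Q ^ b *_) (weight-sum P? 1 Q) ⟩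
  Q ^ b * (suc Q ^ s * 2 ^ m) ≤⟨ *-monoʳ-≤ (Q ^ b) (*-monoˡ-≤ (2 ^ m) (ratio-bound k s r h)) ⟩
  Q ^ b * (Q ^ s * 2 ^ r * 2 ^ m) ≡⟨ eq₂ (Q ^ b) (Q ^ s) (2 ^ r) (2 ^ m) ⟩
  Q ^ b * 2 ^ r * 2 ^ m * Q ^ s ≡⟨ cong (λ z → z * 2 ^ r * 2 ^ m * Q ^ s) (^-*-assoc 2 (suc k) b) ⟩
  2 ^ (suc k * b) * 2 ^ r * 2 ^ m * Q ^ s ≡⟨ cong (λ z → z * 2 ^ m * Q ^ s) (^-distribˡ-+-* 2 (suc k * b) r) ⟨
  2 ^ (suc k * b + r) * 2 ^ m * Q ^ s ∎)
  where
  open ≤-Reasoning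
  Q = 2 ^ suc k
  s = card P?
  F = ∑ᶜ (λ H → ind (cnt P? H ≤? b))
  eq₁ : ∀ a b c → a * b * c ≡ a * c * b
  eq₁ = solve-∀
  eq₂ : ∀ a b c d → a * (b * c * d) ≡ a * c * d * b
  eq₂ = solve-∀
  pt : ∀ {A : Set} (d : Dec A) c o → c + o ≡ s → (A → c ≤ b) → ind d * Q ^ s ≤ Q ^ b * (1 ^ c * Q ^ o)
  pt (no _) c o e f = z≤n
  pt (yes a) c o e f = begin
    1 * Q ^ s ≡⟨ *-identityˡ _ ⟩
    Q ^ s ≡⟨ cong (Q ^_) e ⟨
    Q ^ (c + o) ≡⟨ ^-distribˡ-+-* Q c o ⟩
    Q ^ c * Q ^ o ≤⟨ *-monoˡ-≤ (Q ^ o) (^-monoʳ-≤ Q {{m^n≢0 2 (suc k)}} (f a)) ⟩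
    Q ^ b * Q ^ o ≡⟨ cong (Q ^ b *_) (trans (cong (_* Q ^ o) (^-zeroˡ c)) (*-identityˡ _)) ⟨
    Q ^ b * (1 ^ c * Q ^ o) ∎

sum-point : ∀ {n} (w : Fin n → ℕ) x → sum (λ v → ind (v ≟ᶠ x) * w v) ≡ w x
sum-point {suc n} w zero = trans (cong₂ _+_ (+-identityʳ (w zero)) (sum-zero {n} (λ i → refl))) (+-identityʳ _)
sum-point {suc n} w (suc x) = trans (sum-cong-≗ (λ v → cong (_* w (suc v)) (ind-cong (suc v ≟ᶠ suc x) (v ≟ᶠ x) sucᶠ-injective (cong suc)))) (sum-point (w ∘ suc) x)

exp-merge : ∀ x a b → x * 2 ^ a * 2 ^ b ≡ x * 2 ^ (a + b)
exp-merge x a b = trans (*-assoc x _ _) (cong (x *_) (sym (^-distribˡ-+-* 2 a b)))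

-- The two bounds multiply although h may depend on the bits in M: these are exposed first, they
-- decide the event on B, and the mean of h is at most 2^-σ for every outcome.
few-cond : ∀ {m} {B M : Fin m → Set} (B? : ∀ e → Dec (B e)) (M? : ∀ e → Dec (M e)) → (∀ e → B e → M e) →
  ∀ b k r σ (h : Vec Bool m → ℕ) → card B? ≤ 2 ^ k * r →
  (∀ H₀ → ∑ᶜ (λ H → h (mix M? H₀ H)) * 2 ^ σ ≤ 2 ^ m) →
  ∑ᶜ (λ H → ind (cnt B? H ≤? b) * h H) * 2 ^ card B? * 2 ^ σ ≤ 2 ^ (suc k * b + r) * 2 ^ m
few-cond {m} B? M? B⊆M b k r σ h small hyp = begin
  ∑ᶜ (λ H → w H * h H) * 2 ^ card B? * 2 ^ σ ≡⟨ eq (∑ᶜ (λ H → w H * h H)) (2 ^ card B?) (2 ^ σ) ⟩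
  ∑ᶜ (λ H → w H * h H) * 2 ^ σ * 2 ^ card B? ≤⟨ *-monoˡ-≤ (2 ^ card B?) step ⟩
  ∑ᶜ w * 2 ^ card B? ≤⟨ few-sum B? b k r small ⟩
  2 ^ (suc k * b + r) * 2 ^ m ∎
  where
  open ≤-Reasoning
  w : Vec Bool m → ℕ
  w H = ind (cnt B? H ≤? b)
  eq : ∀ a b c → a * b * c ≡ a * c * b
  eq = solve-∀
  step : ∑ᶜ (λ H → w H * h H) * 2 ^ σ ≤ ∑ᶜ w
  step = *-cancelʳ-2^ m (begin
    ∑ᶜ (λ H → w H * h H) * 2 ^ σ * 2 ^ m ≡⟨ cong (_* 2 ^ m) (∑ᶜ-*ʳ (2 ^ σ) _) ⟨
    ∑ᶜ (λ H → w H * h H * 2 ^ σ) * 2 ^ m ≡⟨ cong (_* 2 ^ m) (∑ᶜ-cong (λ H → *-assoc (w H) (h H) (2 ^ σ))) ⟩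
    ∑ᶜ (λ H → w H * (h H * 2 ^ σ)) * 2 ^ m
      ≤⟨ cond M? w (λ H → h H * 2 ^ σ) (2 ^ m) (ind-cnt-Local B? b B⊆M)
           (λ H₀ → ≤-trans (≤-reflexive (∑ᶜ-*ʳ (2 ^ σ) _)) (hyp H₀)) ⟩
    ∑ᶜ w * 2 ^ m ∎)

-- Six factors 7/8 are worth one bit, because 2 * 7^6 ≤ 8^6. This is the origin of the factor 6 in
-- later hypotheses on numbers of blocks.
7/8-power : ∀ s c → 6 * s ≤ c → 2 ^ s * 7 ^ c ≤ 8 ^ c
7/8-power s c h = subst (λ c → 2 ^ s * 7 ^ c ≤ 8 ^ c) (m+[n∸m]≡n h) (begin
  2 ^ s * 7 ^ (6 * s + t) ≡⟨ cong (2 ^ s *_) (trans (^-distribˡ-+-* 7 (6 * s) t) (cong (_* 7 ^ t) (sym (^-*-assoc 7 6 s)))) ⟩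
  2 ^ s * ((7 ^ 6) ^ s * 7 ^ t) ≡⟨ *-assoc (2 ^ s) _ _ ⟨
  2 ^ s * (7 ^ 6) ^ s * 7 ^ t ≡⟨ cong (_* 7 ^ t) (^-distribʳ-* s 2 (7 ^ 6)) ⟨
  (2 * 7 ^ 6) ^ s * 7 ^ t ≤⟨ *-mono-≤ (^-monoˡ-≤ s (≤ᵇ⇒≤ (2 * 7 ^ 6) (8 ^ 6) _)) (^-monoˡ-≤ t (≤ᵇ⇒≤ 7 8 _)) ⟩
  (8 ^ 6) ^ s * 8 ^ t ≡⟨ cong (_* 8 ^ t) (^-*-assoc 8 6 s) ⟩
  8 ^ (6 * s) * 8 ^ t ≡⟨ ^-distribˡ-+-* 8 (6 * s) t ⟨
  8 ^ (6 * s + t) ∎)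
  where
  open ≤-Reasoning
  t = c ∸ 6 * s

-- Where the label L is absent the factor is constantly 1, so that products can run over all
-- indices.
block : ∀ {m} {L : Set} {J : Fin m → Set} → Dec L → (∀ e → Dec (J e)) → Vec Bool m → ℕ
block L? J? H = ind (L? →-dec (1 ≤? off J? H))

block-Local : ∀ {m} {L : Set} {J : Fin m → Set} (L? : Dec L) (J? : ∀ e → Dec (J e)) → Local J (block L? J?)
block-Local L? J? H H′ h = cong (λ o → ind (L? →-dec (1 ≤? o)))
  (card-cong _ _ (λ e (j , x) → j , λ y → x (trans (h e j) y)) (λ e (j , x) → j , λ y → x (trans (sym (h e j)) y)))

block-single : ∀ {m} {L : Set} {J : Fin m → Set} (L? : Dec L) (J? : ∀ e → Dec (J e)) → (L → card J? ≤ 3) →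
  ∑ᶜ (block L? J?) * 8 ^ ind L? ≤ 7 ^ ind L? * 2 ^ m
block-single {m} (yes l) J? h = begin
  ∑ᶜ (block (yes l) J?) * 8 ≤⟨ *-monoˡ-≤ 8 (∑ᶜ-mono (λ H → ind-mono (yes l →-dec (1 ≤? off J? H)) (1 ≤? off J? H) (λ f → f l))) ⟩
  ∑ᶜ (λ H → ind (1 ≤? off J? H)) * 8 ≤⟨ not-all-sum J? (h l) ⟩
  7 * 2 ^ m ∎
  where open ≤-Reasoning
block-single {m} (no ¬l) J? h = ≤-reflexive (trans (*-identityʳ _) (trans (∑ᶜ-cong (λ H → ind-yes (no ¬l →-dec (1 ≤? off J? H)) (λ l → contradiction l ¬l))) (∑ᶜ-const m 1)))

blocks : ∀ {m k} {L : Fin k → Set} {J : Fin k → Fin m → Set}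
  (L? : ∀ i → Dec (L i)) (J? : ∀ i e → Dec (J i e)) → (∀ i j e → J i e → J j e → i ≡ j) → (∀ i → L i → card (J? i) ≤ 3) →
  ∑ᶜ (λ H → prod (λ i → block (L? i) (J? i) H)) * 8 ^ card L? ≤ 7 ^ card L? * 2 ^ m
blocks {m} {L = L} {J} L? J? disj h = begin
  ∑ᶜ (λ H → prod (λ i → block (L? i) (J? i) H)) * 8 ^ card L? ≡⟨ cong (∑ᶜ (λ H → prod (λ i → block (L? i) (J? i) H)) *_) (trans (prod-^ 8 (λ i → ind (L? i))) (cong (8 ^_) (sym (card-sum L?)))) ⟨
  ∑ᶜ (λ H → prod (λ i → block (L? i) (J? i) H)) * prod (λ i → 8 ^ ind (L? i))
    ≤⟨ indep J? (λ i → block (L? i) (J? i)) _ _ (λ i → block-Local (L? i) (J? i)) disj (λ i → block-single (L? i) (J? i) (h i)) ⟩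
  prod (λ i → 7 ^ ind (L? i)) * 2 ^ m ≡⟨ cong (_* 2 ^ m) (trans (prod-^ 7 (λ i → ind (L? i))) (cong (7 ^_) (sym (card-sum L?)))) ⟩
  7 ^ card L? * 2 ^ m ∎
  where open ≤-Reasoning

7/8-cancel : ∀ x y s c → 6 * s ≤ c → x * 8 ^ c ≤ 7 ^ c * y → x * 2 ^ s ≤ y
7/8-cancel x y s c h p = *-cancelʳ-≤ _ _ (7 ^ c) {{m^n≢0 7 c}} (begin
  x * 2 ^ s * 7 ^ c ≡⟨ *-assoc x _ _ ⟩
  x * (2 ^ s * 7 ^ c) ≤⟨ *-monoʳ-≤ x (7/8-power s c h) ⟩
  x * 8 ^ c ≤⟨ p ⟩
  7 ^ c * y ≡⟨ *-comm (7 ^ c) y ⟩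
  y * 7 ^ c ∎)
  where open ≤-Reasoning

blocks-bound : ∀ {m k} {L : Fin k → Set} {J : Fin k → Fin m → Set}
  (L? : ∀ i → Dec (L i)) (J? : ∀ i e → Dec (J i e)) → (∀ i j e → J i e → J j e → i ≡ j) → (∀ i → L i → card (J? i) ≤ 3) →
  ∀ s → 6 * s ≤ card L? → ∑ᶜ (λ H → prod (λ i → block (L? i) (J? i) H)) * 2 ^ s ≤ 2 ^ m
blocks-bound L? J? disj h s le = 7/8-cancel (∑ᶜ (λ H → prod (λ i → block (L? i) (J? i) H))) _ s (card L?) le (blocks L? J? disj h)

blocks₂-bound : ∀ {m k l} {L : Fin k → Fin l → Set} {J : Fin k → Fin l → Fin m → Set}
  (L? : ∀ i j → Dec (L i j)) (J? : ∀ i j e → Dec (J i j e)) →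
  (∀ i i′ j j′ e → J i j e → J i′ j′ e → i ≡ i′ × j ≡ j′) → (∀ i j → L i j → card (J? i j) ≤ 3) →
  ∀ s → 6 * s ≤ sum (λ i → card (L? i)) → ∑ᶜ (λ H → prod (λ i → prod (λ j → block (L? i j) (J? i j) H))) * 2 ^ s ≤ 2 ^ m
blocks₂-bound {m} {l = l} {J = J} L? J? disj h s le = 7/8-cancel (∑ᶜ (λ H → prod (λ i → f i H))) _ s (sum (λ i → card (L? i))) le (begin
  ∑ᶜ (λ H → prod (λ i → f i H)) * 8 ^ sum (λ i → card (L? i)) ≡⟨ cong (∑ᶜ (λ H → prod (λ i → f i H)) *_) (prod-^ 8 (λ i → card (L? i))) ⟨
  ∑ᶜ (λ H → prod (λ i → f i H)) * prod (λ i → 8 ^ card (L? i))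
    ≤⟨ indep (λ i e → any? (λ j → J? i j e)) f _ _
         (λ i → Local-prod (λ j → Local-⊆ (λ e x → j , x) (block-Local (L? i j) (J? i j))))
         (λ i i′ e (j , x) (j′ , y) → proj₁ (disj i i′ j j′ e x y))
         (λ i → blocks (L? i) (J? i) (λ j j′ e x y → proj₂ (disj i i j j′ e x y)) (h i)) ⟩
  prod (λ i → 7 ^ card (L? i)) * 2 ^ m ≡⟨ cong (_* 2 ^ m) (prod-^ 7 (λ i → card (L? i))) ⟩
  7 ^ sum (λ i → card (L? i)) * 2 ^ m ∎)
  where
  open ≤-Reasoning
  f : Fin _ → Vec Bool m → ℕ
  f i H = prod (λ j → block (L? i j) (J? i j) H)

card-guard : ∀ {m} {A : Set} {Q : Fin m → Set} (d : Dec A) (Q? : ∀ e → Dec (Q e)) k →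
  (∀ e → Q e → A) → (A → card Q? ≤ k) → card Q? ≤ ind d * k
card-guard (yes a) Q? k h f = ≤-trans (f a) (≤-reflexive (sym (*-identityˡ k)))
card-guard (no ¬a) Q? k h f = ≤-reflexive (card-empty Q? (λ e q → ¬a (h e q)))

card-guard₁ : ∀ {m} {A : Set} {Q : Fin m → Set} (d : Dec A) (Q? : ∀ e → Dec (Q e)) →
  (∀ e → Q e → A) → (A → card Q? ≤ 1) → card Q? ≤ ind d
card-guard₁ d Q? h f = ≤-trans (card-guard d Q? 1 h f) (≤-reflexive (*-identityʳ (ind d)))

sum-ind-* : ∀ {n} {P : Fin n → Set} (P? : ∀ v → Dec (P v)) k → sum (λ v → ind (P? v) * k) ≡ card P? * k
sum-ind-* P? k = trans (sym (*-distribʳ-sum k (λ v → ind (P? v)))) (cong (_* k) (sym (card-sum P?)))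

vec-ext : ∀ {m} (H H′ : Vec Bool m) → (∀ e → lookup H e ≡ lookup H′ e) → H ≡ H′
vec-ext H H′ h = trans (sym (tabulate∘lookup H)) (trans (tabulate-cong h) (tabulate∘lookup H′))

indep-bound : ∀ {m} {P : Fin m → Set} (P? : ∀ e → Dec (P e)) (f g : Vec Bool m → ℕ) → Local P f → Local (λ e → ¬ P e) g →
  ∀ p q s t → ∑ᶜ f * p ≤ s * 2 ^ m → ∑ᶜ g * q ≤ t * 2 ^ m → ∑ᶜ (λ H → f H * g H) * (p * q) ≤ s * t * 2 ^ m
indep-bound {m} P? f g lf lg p q s t hf hg = *-cancelʳ-2^ m (begin
  ∑ᶜ (λ H → f H * g H) * (p * q) * 2 ^ m ≡⟨ eq₁ (∑ᶜ (λ H → f H * g H)) (p * q) (2 ^ m) ⟩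
  ∑ᶜ (λ H → f H * g H) * 2 ^ m * (p * q) ≤⟨ *-monoˡ-≤ (p * q) (indep₂ P? f g lf lg) ⟩
  ∑ᶜ f * ∑ᶜ g * (p * q) ≡⟨ eq₂ (∑ᶜ f) (∑ᶜ g) p q ⟩
  (∑ᶜ f * p) * (∑ᶜ g * q) ≤⟨ *-mono-≤ hf hg ⟩
  (s * 2 ^ m) * (t * 2 ^ m) ≡⟨ eq₃ s t (2 ^ m) ⟩
  s * t * 2 ^ m * 2 ^ m ∎)
  where
  open ≤-Reasoning
  eq₁ : ∀ a b c → a * b * c ≡ a * c * b
  eq₁ = solve-∀
  eq₂ : ∀ a b c d → a * b * (c * d) ≡ (a * c) * (b * d)
  eq₂ = solve-∀
  eq₃ : ∀ a b c → (a * c) * (b * c) ≡ a * b * c * c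
  eq₃ = solve-∀

2^-cancel : ∀ x {y} a b c → a + b ≤ c → x * 2 ^ c ≤ 2 ^ b * y → x * 2 ^ a ≤ y
2^-cancel x {y} a b c h p = *-cancelʳ-2^ b (begin
  x * 2 ^ a * 2 ^ b ≡⟨ exp-merge x a b ⟩
  x * 2 ^ (a + b) ≤⟨ *-monoʳ-≤ x (2^-mono h) ⟩
  x * 2 ^ c ≤⟨ p ⟩
  2 ^ b * y ≡⟨ *-comm (2 ^ b) y ⟩
  y * 2 ^ b ∎)
  where open ≤-Reasoning

-- The sum of 2^(-τ|T|) over all T is (1 + 2^-τ)^n. If every element of T yields τ bits, the choice
-- of T is therefore almost free, instead of costing n bits.
geometric : ∀ {n} τ B (F : Vec Bool n → ℕ) → (∀ T → F T * 2 ^ (τ * card (on? T)) ≤ B) →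
  ∑ᶜ F * 2 ^ (τ * n) ≤ suc (2 ^ τ) ^ n * B
geometric {n} τ B F h = begin
  ∑ᶜ F * 2 ^ (τ * n) ≡⟨ ∑ᶜ-*ʳ (2 ^ (τ * n)) F ⟨
  ∑ᶜ (λ T → F T * 2 ^ (τ * n)) ≤⟨ ∑ᶜ-mono pt ⟩
  ∑ᶜ (λ T → B * W T) ≡⟨ ∑ᶜ-*ˡ B W ⟩
  B * ∑ᶜ W ≡⟨ cong (B *_) W-sum ⟩
  B * suc (2 ^ τ) ^ n ≡⟨ *-comm B _ ⟩
  suc (2 ^ τ) ^ n * B ∎
  where
  open ≤-Reasoning
  all : ∀ (e : Fin n) → Dec (e ≡ e)
  all e = yes refl
  W : Vec Bool n → ℕ
  W T = 1 ^ cnt all T * (2 ^ τ) ^ off all T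
  card-all : card all ≡ n
  card-all = trans (card-sum all) (trans (sum-const n 1) (*-identityʳ n))
  cnt-all : ∀ T → card (on? T) ≡ cnt all T
  cnt-all T = card-cong (on? T) (λ e → all e ×-dec on? T e) (λ e o → refl , o) (λ e → proj₂)
  W-sum : ∑ᶜ W ≡ suc (2 ^ τ) ^ n
  W-sum = *-cancelʳ-≡ (∑ᶜ W) _ (2 ^ n) {{m^n≢0 2 n}} (subst (λ c → ∑ᶜ W * 2 ^ c ≡ suc (2 ^ τ) ^ c * 2 ^ n) card-all (weight-sum all 1 (2 ^ τ)))
  split : ∀ T → τ * n ≡ τ * card (on? T) + τ * off all T
  split T = trans (cong (τ *_) (trans (sym card-all) (trans (sym (cnt+off all T)) (cong (_+ off all T) (sym (cnt-all T)))))) (*-distribˡ-+ τ (card (on? T)) (off all T))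
  pt : ∀ T → F T * 2 ^ (τ * n) ≤ B * W T
  pt T = begin
    F T * 2 ^ (τ * n) ≡⟨ cong (λ x → F T * 2 ^ x) (split T) ⟩
    F T * 2 ^ (τ * card (on? T) + τ * off all T) ≡⟨ exp-merge (F T) (τ * card (on? T)) (τ * off all T) ⟨
    F T * 2 ^ (τ * card (on? T)) * 2 ^ (τ * off all T) ≤⟨ *-monoˡ-≤ _ (h T) ⟩
    B * 2 ^ (τ * off all T) ≡⟨ cong (B *_) (^-*-assoc 2 τ (off all T)) ⟨
    B * (2 ^ τ) ^ off all T ≡⟨ cong (B *_) (trans (cong (_* (2 ^ τ) ^ off all T) (^-zeroˡ (cnt all T))) (*-identityˡ _)) ⟨
    B * W T ∎

-- Subsets of prescribed size and cyclic tournaments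

insert : ∀ {m} → (Fin m → Bool) → Fin m → Fin m → Bool
insert β x f = β f ∨ does (f ≟ᶠ x)

Is? : ∀ {m} (β : Fin m → Bool) e → Dec (β e ≡ true)
Is? β e = β e ≟ᵇ true

insert-case : ∀ {m} (β : Fin m → Bool) x f → insert β x f ≡ true → β f ≡ true ⊎ f ≡ x
insert-case β x f p with β f | f ≟ᶠ x
... | true | _ = inj₁ refl
... | false | yes q = inj₂ q

insert-old : ∀ {m} (β : Fin m → Bool) x f → β f ≡ true → insert β x f ≡ true
insert-old β x f p rewrite p = refl

insert-new : ∀ {m} (β : Fin m → Bool) x f → f ≡ x → insert β x f ≡ true
insert-new β x f p with β f | f ≟ᶠ x
... | true | _ = refl
... | false | yes _ = refl
... | false | no ¬p = contradiction p ¬p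

card-insert : ∀ {m} (β : Fin m → Bool) x → β x ≢ true → card (Is? (insert β x)) ≡ suc (card (Is? β))
card-insert β x ¬p = trans
  (≤-antisym (card-+ (Is? (insert β x)) (Is? β) (λ f → f ≟ᶠ x) (insert-case β x))
             (card-disj (Is? (insert β x)) (Is? β) (λ f → f ≟ᶠ x) (insert-old β x) (insert-new β x) (λ { f p refl → ¬p p })))
  (trans (cong (card (Is? β) +_) one) (+-comm (card (Is? β)) 1))
  where
  one : card (λ f → f ≟ᶠ x) ≡ 1
  one = ≤-antisym (card-≤1 _ (λ _ _ p q → trans p (sym q))) (1≤card (λ f → f ≟ᶠ x) x refl)

pick : ∀ {n} {P : Fin n → Set} (P? : ∀ v → Dec (P v)) j → j ≤ card P? →
  ∃ λ β → (∀ v → β v ≡ true → P v) × card (Is? β) ≡ j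
pick P? zero h = (λ _ → false) , (λ _ ()) , card-empty (Is? (λ _ → false)) (λ _ ())
pick {P = P} P? (suc j) h with pick P? j (<⇒≤ h)
... | β , β⊆ , cβ with pigeon P? (Is? β) (≤-trans (s≤s (≤-reflexive cβ)) h)
...   | v , Pv , ¬β = insert β v , (λ w p → case insert-case β v w p of λ { (inj₁ q) → β⊆ w q ; (inj₂ refl) → Pv }) , trans (card-insert β v ¬β) (cong suc cβ)

card-two : ∀ {n} {P : Fin n → Set} (P? : ∀ v → Dec (P v)) {a b} → a ≢ b → P a → P b → 2 ≤ card P?
card-two P? {a} {b} a≢b Pa Pb = begin
  2 ≤⟨ +-mono-≤ (1≤card (λ v → v ≟ᶠ a) a refl) (1≤card (λ v → v ≟ᶠ b) b refl) ⟩
  card (λ v → v ≟ᶠ a) + card (λ v → v ≟ᶠ b)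
    ≤⟨ card-disj P? (λ v → v ≟ᶠ a) (λ v → v ≟ᶠ b) (λ { v refl → Pa }) (λ { v refl → Pb }) (λ { v refl q → a≢b q }) ⟩
  card P? ∎
  where open ≤-Reasoning

-- P is split into three parts, each beating the next one cyclically.
three-parts : ∀ {n} {P : Fin n → Set} (P? : ∀ v → Dec (P v)) z → 3 * z ≤ card P? →
  Σ (Fin n → Fin n → Set) λ B → Σ (∀ v w → Dec (B v w)) λ B? →
  (∀ v w → B v w → B w v → ⊥) × (∀ v → P v → z ≤ card (λ w → P? w ×-dec B? v w))
three-parts {n} {P} P? z h = B , B? , asym , out
  where
  h₁ : z ≤ card P?
  h₁ = ≤-trans (m≤m+n z _) h
  α = proj₁ (pick P? z h₁)
  α⊆ = proj₁ (proj₂ (pick P? z h₁))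
  cα = proj₂ (proj₂ (pick P? z h₁))
  Q? : ∀ v → Dec (P v × ¬ (α v ≡ true))
  Q? v = P? v ×-dec ¬? (Is? α v)
  split : ∀ {R : Fin n → Set} (R? : ∀ v → Dec (R v)) β → card R? ≤ card (Is? β) + card (λ v → R? v ×-dec ¬? (Is? β v))
  split R? β = card-+ R? (Is? β) (λ v → R? v ×-dec ¬? (Is? β v)) (λ v r → case Is? β v of λ { (yes p) → inj₁ p ; (no ¬p) → inj₂ (r , ¬p) })
  h₂ : 2 * z ≤ card Q?
  h₂ = +-cancelˡ-≤ z (2 * z) (card Q?) (≤-trans h (≤-trans (split P? α) (≤-reflexive (cong (_+ card Q?) cα))))
  β = proj₁ (pick Q? z (≤-trans (m≤m+n z _) h₂))
  β⊆ = proj₁ (proj₂ (pick Q? z (≤-trans (m≤m+n z _) h₂)))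
  cβ = proj₂ (proj₂ (pick Q? z (≤-trans (m≤m+n z _) h₂)))
  R? : ∀ v → Dec ((P v × ¬ (α v ≡ true)) × ¬ (β v ≡ true))
  R? v = Q? v ×-dec ¬? (Is? β v)
  h₃ : z ≤ card R?
  h₃ = +-cancelˡ-≤ z z (card R?) (≤-trans (≤-reflexive (cong (z +_) (sym (+-identityʳ z)))) (≤-trans h₂ (≤-trans (split Q? β) (≤-reflexive (cong (_+ card R?) cβ)))))
  Γ : Fin n → Set
  Γ v = ¬ (α v ≡ true) × ¬ (β v ≡ true)
  Γ? : ∀ v → Dec (Γ v)
  Γ? v = ¬? (Is? α v) ×-dec ¬? (Is? β v)
  B : Fin n → Fin n → Set
  B v w = (α v ≡ true × β w ≡ true) ⊎ ((β v ≡ true × Γ w) ⊎ (Γ v × α w ≡ true))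
  B? : ∀ v w → Dec (B v w)
  B? v w = (Is? α v ×-dec Is? β w) ⊎-dec ((Is? β v ×-dec Γ? w) ⊎-dec (Γ? v ×-dec Is? α w))
  αβ : ∀ v → α v ≡ true → β v ≡ true → ⊥
  αβ v p q = proj₂ (β⊆ v q) p
  asym : ∀ v w → B v w → B w v → ⊥
  asym v w (inj₁ (av , bw)) (inj₁ (aw , bv)) = αβ v av bv
  asym v w (inj₁ (av , bw)) (inj₂ (inj₁ (_ , (¬av , _)))) = ¬av av
  asym v w (inj₁ (av , bw)) (inj₂ (inj₂ ((_ , ¬bw) , _))) = ¬bw bw
  asym v w (inj₂ (inj₁ (bv , (¬aw , ¬bw)))) (inj₁ (aw , _)) = ¬aw aw
  asym v w (inj₂ (inj₁ (bv , (¬aw , ¬bw)))) (inj₂ (inj₁ (bw , _))) = ¬bw bw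
  asym v w (inj₂ (inj₁ (bv , (¬aw , ¬bw)))) (inj₂ (inj₂ (_ , av))) = αβ v av bv
  asym v w (inj₂ (inj₂ ((¬av , ¬bv) , aw))) (inj₁ (_ , bv)) = ¬bv bv
  asym v w (inj₂ (inj₂ ((¬av , ¬bv) , aw))) (inj₂ (inj₁ (bw , _))) = αβ w aw bw
  asym v w (inj₂ (inj₂ ((¬av , ¬bv) , aw))) (inj₂ (inj₂ (_ , av))) = ¬av av
  out : ∀ v → P v → z ≤ card (λ w → P? w ×-dec B? v w)
  out v Pv = case Is? α v of λ
    { (yes av) → ≤-trans (≤-reflexive (sym cβ)) (card-mono (Is? β) _ (λ w bw → proj₁ (β⊆ w bw) , inj₁ (av , bw)))
    ; (no ¬av) → case Is? β v of λ
      { (yes bv) → ≤-trans h₃ (card-mono R? _ (λ w ((Pw , ¬aw) , ¬bw) → Pw , inj₂ (inj₁ (bv , (¬aw , ¬bw)))))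
      ; (no ¬bv) → ≤-trans (≤-reflexive (sym cα)) (card-mono (Is? α) _ (λ w aw → α⊆ w aw , inj₂ (inj₂ ((¬av , ¬bv) , aw)))) } }

opaque
  cyclic-tournament : ∀ {n} {P : Fin n → Set} (P? : ∀ v → Dec (P v)) z → 3 * z ≤ card P? →
    Σ (Fin n → Fin n → Set) λ B → Σ (∀ v w → Dec (B v w)) λ B? →
    (∀ v w → B v w → B w v → ⊥) × (∀ v → P v → z ≤ card (λ w → P? w ×-dec B? v w))
  cyclic-tournament = three-parts

-- Partitions of the vertex set and the edges of the complete 3-graph

_∈³_ : ∀ {n} → Fin n → Fin n × Fin n × Fin n → Set
v ∈³ (i , j , k) = v ≡ i ⊎ v ≡ j ⊎ v ≡ k

opaque
  _∈³?_ : ∀ {n} (v : Fin n) t → Dec (v ∈³ t)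
  v ∈³? (i , j , k) = (v ≟ᶠ i) ⊎-dec ((v ≟ᶠ j) ⊎-dec (v ≟ᶠ k))

Distinct : ∀ {n} → Fin n × Fin n × Fin n → Set
Distinct (i , j , k) = i ≢ j × i ≢ k × j ≢ k

opaque
  unfolding _∈³?_

  sum-triple : ∀ {n} (w : Fin n → ℕ) x y z → Distinct (x , y , z) →
    sum (λ v → ind (v ∈³? (x , y , z)) * w v) ≡ w x + w y + w z
  sum-triple w x y z (x≢y , x≢z , y≢z) = begin
    sum (λ v → ind (v ∈³? (x , y , z)) * w v)
      ≡⟨ sum-cong-≗ (λ v → trans (cong (_* w v) (pt v)) (trans (*-distribʳ-+ (w v) (ind (v ≟ᶠ x) + ind (v ≟ᶠ y)) _) (cong (_+ ind (v ≟ᶠ z) * w v) (*-distribʳ-+ (w v) (ind (v ≟ᶠ x)) _)))) ⟩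
    sum (λ v → ind (v ≟ᶠ x) * w v + ind (v ≟ᶠ y) * w v + ind (v ≟ᶠ z) * w v)
      ≡⟨ trans (∑-distrib-+ (λ v → ind (v ≟ᶠ x) * w v + ind (v ≟ᶠ y) * w v) (λ v → ind (v ≟ᶠ z) * w v)) (cong (_+ sum (λ v → ind (v ≟ᶠ z) * w v)) (∑-distrib-+ (λ v → ind (v ≟ᶠ x) * w v) (λ v → ind (v ≟ᶠ y) * w v))) ⟩
    sum (λ v → ind (v ≟ᶠ x) * w v) + sum (λ v → ind (v ≟ᶠ y) * w v) + sum (λ v → ind (v ≟ᶠ z) * w v)
      ≡⟨ cong₂ _+_ (cong₂ _+_ (sum-point w x) (sum-point w y)) (sum-point w z) ⟩
    w x + w y + w z ∎
    where
    open ≡-Reasoning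
    pt : ∀ v → ind (v ∈³? (x , y , z)) ≡ ind (v ≟ᶠ x) + ind (v ≟ᶠ y) + ind (v ≟ᶠ z)
    pt v with v ≟ᶠ x | v ≟ᶠ y | v ≟ᶠ z
    ... | yes refl | yes q | _ = contradiction q x≢y
    ... | yes refl | no _ | yes q = contradiction q x≢z
    ... | yes p | no _ | no _ = refl
    ... | no _ | yes refl | yes q = contradiction q y≢z
    ... | no _ | yes _ | no _ = refl
    ... | no _ | no _ | yes _ = refl
    ... | no _ | no _ | no _ = refl

-- Edges of the complete 3-graph on n vertices, indexed by Fin m.
module EdgeSystem {n m : ℕ} (vs : Fin m → Fin n × Fin n × Fin n)
  (vs-distinct : ∀ e → Distinct (vs e))
  (exists : ∀ a b c → Distinct (a , b , c) → ∃ λ e → a ∈³ vs e × b ∈³ vs e × c ∈³ vs e)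
  (unique : ∀ e f → (∀ v → v ∈³ vs e → v ∈³ vs f) → e ≡ f) where

  infix 4 _∈_ _∈?_
  _∈_ : Fin n → Fin m → Set
  v ∈ e = v ∈³ vs e

  _∈?_ : ∀ v e → Dec (v ∈ e)
  v ∈? e = v ∈³? vs e

  Tri : Fin m → Fin n → Fin n → Fin n → Set
  Tri e a b c = (a ∈ e × b ∈ e × c ∈ e) × Distinct (a , b , c)

  opaque
    Tri? : ∀ e a b c → Dec (Tri e a b c)
    Tri? e a b c = ((a ∈? e) ×-dec ((b ∈? e) ×-dec (c ∈? e))) ×-dec (¬? (a ≟ᶠ b) ×-dec (¬? (a ≟ᶠ c) ×-dec ¬? (b ≟ᶠ c)))

  private
    two-values : ∀ {a b c j k : Fin n} → Distinct (a , b , c) →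
      a ≡ j ⊎ a ≡ k → b ≡ j ⊎ b ≡ k → c ≡ j ⊎ c ≡ k → ⊥
    two-values (p , q , r) (inj₁ refl) (inj₁ refl) _ = p refl
    two-values (p , q , r) (inj₁ refl) (inj₂ refl) (inj₁ refl) = q refl
    two-values (p , q , r) (inj₁ refl) (inj₂ refl) (inj₂ refl) = r refl
    two-values (p , q , r) (inj₂ refl) (inj₂ refl) _ = p refl
    two-values (p , q , r) (inj₂ refl) (inj₁ refl) (inj₂ refl) = q refl
    two-values (p , q , r) (inj₂ refl) (inj₁ refl) (inj₁ refl) = r refl

    others : ∀ {i j k v : Fin n} → v ∈³ (i , j , k) → ∃ λ (p : Fin n × Fin n) → ∀ x → x ∈³ (i , j , k) → x ≢ v → x ≡ proj₁ p ⊎ x ≡ proj₂ p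
    others {i} {j} {k} (inj₁ refl) = (j , k) , λ { x (inj₁ p) q → contradiction p q ; x (inj₂ p) q → p }
    others {i} {j} {k} (inj₂ (inj₁ refl)) = (i , k) , λ { x (inj₁ p) q → inj₁ p ; x (inj₂ (inj₁ p)) q → contradiction p q ; x (inj₂ (inj₂ p)) q → inj₂ p }
    others {i} {j} {k} (inj₂ (inj₂ refl)) = (i , j) , λ { x (inj₁ p) q → inj₁ p ; x (inj₂ (inj₁ p)) q → inj₂ p ; x (inj₂ (inj₂ p)) q → contradiction p q }

  -- Otherwise the three distinct vertices a, b, c would fill the two places of the edge not taken
  -- by v.
  only : ∀ {e a b c v} → Tri e a b c → v ∈ e → v ≡ a ⊎ v ≡ b ⊎ v ≡ c
  only {e} {a} {b} {c} {v} ((a∈ , b∈ , c∈) , d) v∈ with v ≟ᶠ a | v ≟ᶠ b | v ≟ᶠ c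
  ... | yes p | _ | _ = inj₁ p
  ... | no _ | yes p | _ = inj₂ (inj₁ p)
  ... | no _ | no _ | yes p = inj₂ (inj₂ p)
  ... | no p | no q | no r = let _ , h = others v∈ in
    ⊥-elim (two-values d (h a a∈ (p ∘ sym)) (h b b∈ (q ∘ sym)) (h c c∈ (r ∘ sym)))

  Tri-unique : ∀ {e f a b c} → Tri e a b c → Tri f a b c → e ≡ f
  Tri-unique {e} {f} t ((a∈ , b∈ , c∈) , _) = unique e f (λ v v∈ → case only t v∈ of λ
    { (inj₁ refl) → a∈ ; (inj₂ (inj₁ refl)) → b∈ ; (inj₂ (inj₂ refl)) → c∈ })

  edge : ∀ a b c → Distinct (a , b , c) → ∃ λ e → Tri e a b c
  edge a b c d = let e , x = exists a b c d in e , x , d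

  swap₁₂ : ∀ {e a b c} → Tri e a b c → Tri e b a c
  swap₁₂ ((x , y , z) , (p , q , r)) = (y , x , z) , (p ∘ sym , r , q)

  swap₂₃ : ∀ {e a b c} → Tri e a b c → Tri e a c b
  swap₂₃ ((x , y , z) , (p , q , r)) = (x , z , y) , (q , p , r ∘ sym)

  swap₁₃ : ∀ {e a b c} → Tri e a b c → Tri e c b a
  swap₁₃ = swap₁₂ ∘ swap₂₃ ∘ swap₁₂

  Tri-self : ∀ e → Tri e (proj₁ (vs e)) (proj₁ (proj₂ (vs e))) (proj₂ (proj₂ (vs e)))
  Tri-self e = (inj₁ refl , inj₂ (inj₁ refl) , inj₂ (inj₂ refl)) , vs-distinct e

  split₁ : ∀ {e v} → v ∈ e → ∃ λ b → ∃ λ c → Tri e v b c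
  split₁ {e} (inj₁ refl) = _ , _ , Tri-self e
  split₁ {e} (inj₂ (inj₁ refl)) = _ , _ , swap₁₂ (Tri-self e)
  split₁ {e} (inj₂ (inj₂ refl)) = _ , _ , swap₁₃ (Tri-self e)

  split₂ : ∀ {e v w} → v ∈ e → w ∈ e → v ≢ w → ∃ λ u → Tri e v w u
  split₂ v∈ w∈ v≢w with split₁ v∈
  ... | b , c , t with only t w∈
  ...   | inj₁ p = contradiction (sym p) v≢w
  ...   | inj₂ (inj₁ refl) = c , t
  ...   | inj₂ (inj₂ refl) = b , swap₂₃ t

  card-Tri : ∀ a b c → card (λ e → Tri? e a b c) ≤ 1
  card-Tri a b c = card-≤1 (λ e → Tri? e a b c) (λ e f → Tri-unique)

  sum-vertices : ∀ (w : Fin n → ℕ) {e a b c} → Tri e a b c → sum (λ v → ind (v ∈? e) * w v) ≡ w a + w b + w c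
  sum-vertices w {e} {a} {b} {c} t@((a∈ , b∈ , c∈) , d) = trans
    (sum-cong-≗ (λ v → cong (_* w v) (ind-cong (v ∈? e) (v ∈³? (a , b , c)) (only t)
      (λ { (inj₁ refl) → a∈ ; (inj₂ (inj₁ refl)) → b∈ ; (inj₂ (inj₂ refl)) → c∈ }))))
    (sum-triple w a b c d)

  sum-∈ : ∀ e → sum (λ v → ind (v ∈? e)) ≡ 3
  sum-∈ e = trans (sum-cong-≗ (λ v → sym (*-identityʳ (ind (v ∈? e))))) (sum-vertices (λ _ → 1) (Tri-self e))

  card-∋₂ : ∀ {v w} → v ≢ w → card (λ e → (v ∈? e) ×-dec (w ∈? e)) ≤ n
  card-∋₂ {v} {w} v≢w = begin
    card (λ e → (v ∈? e) ×-dec (w ∈? e)) ≤⟨ card-cover _ (λ u e → Tri? e v w u) (λ e (v∈ , w∈) → split₂ v∈ w∈ v≢w) ⟩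
    sum (λ u → card (λ e → Tri? e v w u)) ≤⟨ sum-≤const (λ u → card-Tri v w u) ⟩
    n * 1 ≡⟨ *-identityʳ n ⟩
    n ∎
    where open ≤-Reasoning

  -- Each edge at v has two other vertices, hence is counted for exactly two ordered pairs.
  card-pairs : ∀ v {φ : Fin n → Fin n → Set} {Q : Fin m → Set} (φ? : ∀ a b → Dec (φ a b)) (Q? : ∀ e → Dec (Q e)) →
    (∀ a b → φ a b → ∃ λ e → Tri e v a b × Q e) → sum (λ a → card (φ? a)) ≤ 2 * card Q?
  card-pairs v {φ} {Q} φ? Q? h = begin
    sum (λ a → card (φ? a)) ≡⟨ sum-cong-≗ (λ a → card-sum (φ? a)) ⟩
    sum (λ a → sum (λ b → ind (φ? a b)))
      ≤⟨ sum-mono (λ a → sum-mono (λ b → ind≤ (φ? a b) (λ p → let e , t , q = h a b p in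
           ≤-trans (1≤ind (Tri? e v a b ×-dec Q? e) (t , q)) (≤sum (λ e → ind (Tri? e v a b ×-dec Q? e)) e)))) ⟩
    sum (λ a → sum (λ b → sum (λ e → ind (Tri? e v a b ×-dec Q? e))))
      ≡⟨ sum-cong-≗ (λ a → ∑-comm (λ b e → ind (Tri? e v a b ×-dec Q? e))) ⟩
    sum (λ a → sum (λ e → sum (λ b → ind (Tri? e v a b ×-dec Q? e))))
      ≡⟨ ∑-comm (λ a e → sum (λ b → ind (Tri? e v a b ×-dec Q? e))) ⟩
    sum (λ e → sum (λ a → sum (λ b → ind (Tri? e v a b ×-dec Q? e)))) ≤⟨ sum-mono per-edge ⟩
    sum (λ e → 2 * ind (Q? e)) ≡⟨ *-distribˡ-sum 2 (λ e → ind (Q? e)) ⟨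
    2 * sum (λ e → ind (Q? e)) ≡⟨ cong (2 *_) (card-sum Q?) ⟨
    2 * card Q? ∎
    where
    open ≤-Reasoning
    one : ∀ x → sum (λ v → ind (v ≟ᶠ x)) ≡ 1
    one x = trans (sum-cong-≗ (λ v → sym (*-identityʳ (ind (v ≟ᶠ x))))) (sum-point (λ _ → 1) x)
    per-edge : ∀ e → sum (λ a → sum (λ b → ind (Tri? e v a b ×-dec Q? e))) ≤ 2 * ind (Q? e)
    per-edge e with (v ∈? e) ×-dec Q? e
    ... | no ¬p = ≤-trans (≤-reflexive (sum-zero (λ a → sum-zero (λ b → ind-no (Tri? e v a b ×-dec Q? e) (λ (t , q) → ¬p (proj₁ (proj₁ t) , q)))))) z≤n
    ... | yes (v∈ , q) with split₁ v∈
    ...   | x , y , t = begin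
      sum (λ a → sum (λ b → ind (Tri? e v a b ×-dec Q? e)))
        ≤⟨ sum-mono (λ a → sum-mono (λ b → ind≤ (Tri? e v a b ×-dec Q? e) (λ (t′ , _) → pt a b t′))) ⟩
      sum (λ a → sum (λ b → ind (a ≟ᶠ x) * ind (b ≟ᶠ y) + ind (a ≟ᶠ y) * ind (b ≟ᶠ x)))
        ≡⟨ sum-cong-≗ (λ a → trans (∑-distrib-+ (λ b → ind (a ≟ᶠ x) * ind (b ≟ᶠ y)) (λ b → ind (a ≟ᶠ y) * ind (b ≟ᶠ x)))
             (cong₂ _+_ (row a x y) (row a y x))) ⟩
      sum (λ a → ind (a ≟ᶠ x) + ind (a ≟ᶠ y)) ≡⟨ ∑-distrib-+ (λ a → ind (a ≟ᶠ x)) (λ a → ind (a ≟ᶠ y)) ⟩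
      sum (λ a → ind (a ≟ᶠ x)) + sum (λ a → ind (a ≟ᶠ y)) ≡⟨ cong₂ _+_ (one x) (one y) ⟩
      2 ≡⟨ cong (2 *_) (ind-yes (Q? e) q) ⟨
      2 * ind (Q? e) ∎
      where
      row : ∀ a x y → sum (λ b → ind (a ≟ᶠ x) * ind (b ≟ᶠ y)) ≡ ind (a ≟ᶠ x)
      row a x y = trans (sym (*-distribˡ-sum (ind (a ≟ᶠ x)) (λ b → ind (b ≟ᶠ y)))) (trans (cong (ind (a ≟ᶠ x) *_) (one y)) (*-identityʳ _))
      pt : ∀ a b → Tri e v a b → 1 ≤ ind (a ≟ᶠ x) * ind (b ≟ᶠ y) + ind (a ≟ᶠ y) * ind (b ≟ᶠ x)
      pt a b ((_ , a∈ , b∈) , (v≢a , v≢b , a≢b)) with only t a∈ | only t b∈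
      ... | inj₁ p | _ = contradiction (sym p) v≢a
      ... | inj₂ _ | inj₁ p = contradiction (sym p) v≢b
      ... | inj₂ (inj₁ p) | inj₂ (inj₁ r) = contradiction (trans p (sym r)) a≢b
      ... | inj₂ (inj₂ p) | inj₂ (inj₂ r) = contradiction (trans p (sym r)) a≢b
      ... | inj₂ (inj₁ p) | inj₂ (inj₂ r) = ≤-trans (1≤* (1≤ind (a ≟ᶠ x) p) (1≤ind (b ≟ᶠ y) r)) (m≤m+n _ _)
      ... | inj₂ (inj₂ p) | inj₂ (inj₁ r) = ≤-trans (1≤* (1≤ind (a ≟ᶠ y) p) (1≤ind (b ≟ᶠ x) r)) (m≤n+m _ _)

  card-third : ∀ v w {φ : Fin n → Set} {Q : Fin m → Set} (φ? : ∀ u → Dec (φ u)) (Q? : ∀ e → Dec (Q e)) →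
    (∀ u → φ u → ∃ λ e → Tri e v w u × Q e) → card φ? ≤ card Q?
  card-third v w φ? Q? h = begin
    card φ? ≤⟨ card-cover φ? (λ e u → Tri? e v w u ×-dec Q? e) h ⟩
    sum (λ e → card (λ u → Tri? e v w u ×-dec Q? e)) ≤⟨ sum-mono per-edge ⟩
    sum (λ e → ind (Q? e)) ≡⟨ card-sum Q? ⟨
    card Q? ∎
    where
    open ≤-Reasoning
    third : ∀ e u u′ → Tri e v w u → Tri e v w u′ → u ≡ u′
    third e u u′ t ((_ , _ , u∈) , (_ , v≢u , w≢u)) with only t u∈
    ... | inj₁ p = contradiction (sym p) v≢u
    ... | inj₂ (inj₁ p) = contradiction (sym p) w≢u
    ... | inj₂ (inj₂ p) = sym p
    per-edge : ∀ e → card (λ u → Tri? e v w u ×-dec Q? e) ≤ ind (Q? e)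
    per-edge e with Q? e
    ... | yes q = card-≤1 _ (λ u u′ (t , _) (t′ , _) → third e u u′ t t′)
    ... | no ¬q = ≤-reflexive (card-empty _ (λ u (_ , q) → ¬q q))

  -- The two other vertices determine the edge. Ordered pairs are counted, which gives away a factor
  -- of two.
  card-inside : ∀ x {φ : Fin n → Set} {Q : Fin m → Set} (φ? : ∀ u → Dec (φ u)) (Q? : ∀ e → Dec (Q e)) →
    (∀ e → Q e → x ∈ e × (∀ w → w ∈ e → w ≢ x → φ w)) → card Q? ≤ card φ? * card φ?
  card-inside x φ? Q? h = begin
    card Q? ≤⟨ card-cover Q? (λ a e → φ? a ×-dec any? (λ b → φ? b ×-dec Tri? e x a b))
        (λ e q → let x∈ , f = h e q ; a , b , t@((_ , a∈ , b∈) , (x≢a , x≢b , _)) = split₁ x∈ in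
           a , f a a∈ (x≢a ∘ sym) , b , f b b∈ (x≢b ∘ sym) , t) ⟩
    sum (λ a → card (λ e → φ? a ×-dec any? (λ b → φ? b ×-dec Tri? e x a b))) ≤⟨ sum-mono per-a ⟩
    sum (λ a → ind (φ? a) * card φ?) ≡⟨ *-distribʳ-sum (card φ?) (λ a → ind (φ? a)) ⟨
    sum (λ a → ind (φ? a)) * card φ? ≡⟨ cong (_* card φ?) (card-sum φ?) ⟨
    card φ? * card φ? ∎
    where
    open ≤-Reasoning
    per-b : ∀ a b → card (λ e → φ? b ×-dec Tri? e x a b) ≤ ind (φ? b)
    per-b a b with φ? b
    ... | yes p = card-≤1 _ (λ e f (_ , t) (_ , t′) → Tri-unique t t′)
    ... | no ¬p = ≤-reflexive (card-empty _ (λ e (p , _) → ¬p p))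
    per-a : ∀ a → card (λ e → φ? a ×-dec any? (λ b → φ? b ×-dec Tri? e x a b)) ≤ ind (φ? a) * card φ?
    per-a a with φ? a
    ... | no ¬p = ≤-reflexive (card-empty _ (λ e (p , _) → ¬p p))
    ... | yes p = begin
      card (λ e → yes p ×-dec any? (λ b → φ? b ×-dec Tri? e x a b)) ≤⟨ card-cover _ (λ b e → φ? b ×-dec Tri? e x a b) (λ e (_ , x) → x) ⟩
      sum (λ b → card (λ e → φ? b ×-dec Tri? e x a b)) ≤⟨ sum-mono (per-b a) ⟩
      sum (λ b → ind (φ? b)) ≡⟨ card-sum φ? ⟨
      card φ? ≡⟨ *-identityˡ _ ⟨
      1 * card φ? ∎

  card-∋ : ∀ v → card (λ e → v ∈? e) ≤ n * n
  card-∋ v = ≤-trans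
    (card-inside v {φ = λ _ → v ≡ v} (λ _ → v ≟ᶠ v) (λ e → v ∈? e) (λ e v∈ → v∈ , λ _ _ _ → refl))
    (*-mono-≤ (card≤ (λ _ → v ≟ᶠ v)) (card≤ (λ _ → v ≟ᶠ v)))

-- Edges coloured by a fixed ordered partition

module Coloured {n m : ℕ} (vs : Fin m → Fin n × Fin n × Fin n)
  (vs-distinct : ∀ e → Distinct (vs e))
  (exists : ∀ a b c → Distinct (a , b , c) → ∃ λ e → a ∈³ vs e × b ∈³ vs e × c ∈³ vs e)
  (unique : ∀ e f → (∀ v → v ∈³ vs e → v ∈³ vs f) → e ≡ f)
  (P : Vec Bool n) where

  open EdgeSystem vs vs-distinct exists unique

  X Y : Fin n → Set
  X v = lookup P v ≡ true
  Y v = lookup P v ≡ false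

  X? : ∀ v → Dec (X v)
  X? v = lookup P v ≟ᵇ true

  Y? : ∀ v → Dec (Y v)
  Y? v = lookup P v ≟ᵇ false

  X⊎Y : ∀ v → X v ⊎ Y v
  X⊎Y v with lookup P v
  ... | true = inj₁ refl
  ... | false = inj₂ refl

  X≢Y : ∀ {u v} → X u → Y v → u ≢ v
  X≢Y x y refl = case trans (sym x) y of λ ()

  wt : Fin n → ℕ
  wt = inX P

  wt-X : ∀ {v} → X v → wt v ≡ 1
  wt-X x rewrite x = refl

  wt-Y : ∀ {v} → Y v → wt v ≡ 0
  wt-Y y rewrite y = refl

  1⇒X : ∀ {v} → wt v ≡ 1 → X v
  1⇒X {v} p with lookup P v
  ... | true = refl

  0⇒Y : ∀ {v} → wt v ≡ 0 → Y v
  0⇒Y {v} p with lookup P v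
  ... | false = refl

  wt≤1 : ∀ v → wt v ≤ 1
  wt≤1 v with lookup P v
  ... | true = ≤-refl
  ... | false = z≤n

  -- The number of vertices in X: types 0, 1, 2, 3 are YYY, XYY, XXY and XXX.
  typ : Fin m → ℕ
  typ e = wt (proj₁ (vs e)) + wt (proj₁ (proj₂ (vs e))) + wt (proj₂ (proj₂ (vs e)))

  typ-Tri : ∀ {e a b c} → Tri e a b c → typ e ≡ wt a + wt b + wt c
  typ-Tri {e} t = trans (sym (sum-vertices wt (Tri-self e))) (sum-vertices wt t)

  typ-wts : ∀ {e a b c p q r} → Tri e a b c → wt a ≡ p → wt b ≡ q → wt c ≡ r → typ e ≡ p + q + r
  typ-wts t refl refl refl = typ-Tri t

  typ-third : ∀ {e a b c p q s r} → Tri e a b c → wt a ≡ p → wt b ≡ q → typ e ≡ s → s ≡ p + q + r → wt c ≡ r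
  typ-third {p = p} {q} {r = r} t refl refl refl eq = +-cancelˡ-≡ (p + q) _ r (trans (sym (typ-Tri t)) eq)

  Good Bad : Fin m → Set
  Good e = typ e ≡ 2
  Bad e = ¬ Good e

  Good? : ∀ e → Dec (Good e)
  Good? e = typ e ≟ 2

  Bad? : ∀ e → Dec (Bad e)
  Bad? e = ¬? (Good? e)

  -- T5 = {abc, abd, abf, cdf}
  T5-free : Vec Bool m → Set
  T5-free H = ∀ a b c d f e₁ e₂ e₃ e₄ →
    (Tri e₁ a b c × Tri e₂ a b d × Tri e₃ a b f × Tri e₄ c d f) ×
    (on H e₁ × on H e₂ × on H e₃ × on H e₄) → ⊥

  opaque
    T5-free? : ∀ H → Dec (T5-free H)
    T5-free? H = all? λ a → all? λ b → all? λ c → all? λ d → all? λ f → all? λ e₁ → all? λ e₂ → all? λ e₃ → all? λ e₄ →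
      ¬? ((Tri? e₁ a b c ×-dec (Tri? e₂ a b d ×-dec (Tri? e₃ a b f ×-dec Tri? e₄ c d f))) ×-dec
          (on? H e₁ ×-dec (on? H e₂ ×-dec (on? H e₃ ×-dec on? H e₄))))

  T5-free-mono : ∀ {H H′} → (∀ e → on H′ e → on H e) → T5-free H → T5-free H′
  T5-free-mono s h a b c d f e₁ e₂ e₃ e₄ (t , (o₁ , o₂ , o₃ , o₄)) =
    h a b c d f e₁ e₂ e₃ e₄ (t , (s _ o₁ , s _ o₂ , s _ o₃ , s _ o₄))

  At : ℕ → Fin n → Fin m → Set
  At c v e = v ∈ e × typ e ≡ c

  At? : ∀ c v e → Dec (At c v e)
  At? c v e = (v ∈? e) ×-dec (typ e ≟ c)

  deg : ℕ → Fin n → Vec Bool m → ℕ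
  deg c v H = cnt (At? c v) H

  Link : Fin n → Fin n → Fin m → Set
  Link x y e = x ∈ e × y ∈ e × Good e

  Link? : ∀ x y e → Dec (Link x y e)
  Link? x y e = (x ∈? e) ×-dec ((y ∈? e) ×-dec Good? e)

  codeg : Fin n → Fin n → Vec Bool m → ℕ
  codeg x y H = cnt (Link? x y) H

  -- For v in X this is a bad edge v y y′ in which at least one of the pairs v y, v y′ has codegree
  -- above l.
  Thick : ℕ → Vec Bool m → Fin n → Fin m → Set
  Thick l H v e = At 1 v e × (∃ λ y → y ∈ e × Y y × l < codeg v y H)

  opaque
    Thick? : ∀ l H v e → Dec (Thick l H v e)
    Thick? l H v e = At? 1 v e ×-dec any? (λ y → (y ∈? e) ×-dec (Y? y ×-dec (l <? codeg v y H)))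

  thickdeg : ℕ → Fin n → Vec Bool m → ℕ
  thickdeg l v H = cnt (Thick? l H v) H

  third-nbr : Vec Bool m → Fin n → Fin n → Fin n → Set
  third-nbr H x y u = ∃ λ e → Tri e x y u × Good e × on H e

  opaque
    third-nbr? : ∀ H x y u → Dec (third-nbr H x y u)
    third-nbr? H x y u = any? (λ e → Tri? e x y u ×-dec (Good? e ×-dec on? H e))

  codeg≤nbrs : ∀ {x y} H → x ≢ y → codeg x y H ≤ card (third-nbr? H x y)
  codeg≤nbrs {x} {y} H x≢y = begin
    codeg x y H ≤⟨ card-cover _ (λ u e → Tri? e x y u ×-dec third-nbr? H x y u)
      (λ e ((x∈ , y∈ , g) , o) → let u , t = split₂ x∈ y∈ x≢y in u , t , e , t , g , o) ⟩
    sum (λ u → card (λ e → Tri? e x y u ×-dec third-nbr? H x y u)) ≤⟨ sum-mono per-u ⟩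
    sum (λ u → ind (third-nbr? H x y u)) ≡⟨ card-sum (third-nbr? H x y) ⟨
    card (third-nbr? H x y) ∎
    where
    open ≤-Reasoning
    per-u : ∀ u → card (λ e → Tri? e x y u ×-dec third-nbr? H x y u) ≤ ind (third-nbr? H x y u)
    per-u u with third-nbr? H x y u
    ... | yes _ = card-≤1 _ (λ e f (t , _) (t′ , _) → Tri-unique t t′)
    ... | no ¬p = ≤-reflexive (card-empty _ (λ e (_ , p) → ¬p p))

  -- The strict hypothesis makes up for the diagonal: every element has at least l partners other
  -- than itself.
  many-pairs : ∀ {L : Fin n → Set} (L? : ∀ u → Dec (L u)) l → l < card L? →
    l * l ≤ sum (λ a → card (λ b → L? a ×-dec (L? b ×-dec ¬? (a ≟ᶠ b))))
  many-pairs L? l l< = begin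
    l * l ≤⟨ *-monoˡ-≤ l (<⇒≤ l<) ⟩
    card L? * l ≡⟨ cong (_* l) (card-sum L?) ⟩
    sum (λ a → ind (L? a)) * l ≡⟨ *-distribʳ-sum l (λ a → ind (L? a)) ⟩
    sum (λ a → ind (L? a) * l) ≤⟨ sum-mono per-a ⟩
    sum (λ a → card (λ b → L? a ×-dec (L? b ×-dec ¬? (a ≟ᶠ b)))) ∎
    where
    open ≤-Reasoning
    per-a : ∀ a → ind (L? a) * l ≤ card (λ b → L? a ×-dec (L? b ×-dec ¬? (a ≟ᶠ b)))
    per-a a with L? a
    ... | no _ = z≤n
    ... | yes p = +-cancelʳ-≤ 1 _ _ (begin
      1 * l + 1 ≡⟨ trans (cong (_+ 1) (*-identityˡ l)) (+-comm l 1) ⟩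
      suc l ≤⟨ l< ⟩
      card L? ≤⟨ card-+ L? (λ b → yes p ×-dec (L? b ×-dec ¬? (a ≟ᶠ b))) (λ b → a ≟ᶠ b)
        (λ b q → case a ≟ᶠ b of λ { (yes r) → inj₂ r ; (no r) → inj₁ (p , q , r) }) ⟩
      card (λ b → yes p ×-dec (L? b ×-dec ¬? (a ≟ᶠ b))) + card (λ b → a ≟ᶠ b)
        ≤⟨ +-monoʳ-≤ _ (card-≤1 (λ b → a ≟ᶠ b) (λ b c r s → trans (sym r) s)) ⟩
      card (λ b → yes p ×-dec (L? b ×-dec ¬? (a ≟ᶠ b))) + 1 ∎)

  -- The coordinates exposed first in the dense cases. Only the good edges avoiding v stay random.
  BadAt : Fin n → Fin m → Set
  BadAt v e = Bad e ⊎ v ∈ e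

  BadAt? : ∀ v e → Dec (BadAt v e)
  BadAt? v e = Bad? e ⊎-dec (v ∈? e)

  -- Vertices whose link is dense in two ways

  module Matching (v : Fin n) where

    Hit : (Fin m → Bool) → Fin m → Set
    Hit β e = ∃ λ w → w ∈ e × w ≢ v × (∃ λ f → β f ≡ true × w ∈ f)

    opaque
      Hit? : ∀ β e → Dec (Hit β e)
      Hit? β e = any? λ w → (w ∈? e) ×-dec (¬? (w ≟ᶠ v) ×-dec any? (λ f → Is? β f ×-dec (w ∈? f)))

    hit-bound : ∀ β → card (λ e → (v ∈? e) ×-dec Hit? β e) ≤ card (Is? β) * (3 * n)
    hit-bound β = begin
      card (λ e → (v ∈? e) ×-dec Hit? β e)
        ≤⟨ card-cover _ Q? (λ e (v∈ , w , w∈ , w≢v , f , βf , w∈f) → f , βf , w , w∈f , w≢v , v∈ , w∈) ⟩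
      sum (λ f → card (Q? f)) ≤⟨ sum-mono per-f ⟩
      sum (λ f → ind (Is? β f) * (3 * n)) ≡⟨ sum-ind-* (Is? β) (3 * n) ⟩
      card (Is? β) * (3 * n) ∎
      where
      open ≤-Reasoning
      R? : ∀ f w e → Dec (w ∈ f × w ≢ v × v ∈ e × w ∈ e)
      R? f w e = (w ∈? f) ×-dec (¬? (w ≟ᶠ v) ×-dec ((v ∈? e) ×-dec (w ∈? e)))
      Q? : ∀ f e → Dec (β f ≡ true × ∃ λ w → w ∈ f × w ≢ v × v ∈ e × w ∈ e)
      Q? f e = Is? β f ×-dec any? (λ w → R? f w e)
      per-w : ∀ f w → card (R? f w) ≤ ind (w ∈? f) * n
      per-w f w = card-guard (w ∈? f) (R? f w) n (λ e → proj₁) (λ _ → case w ≟ᶠ v of λ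
        { (yes q) → ≤-trans (≤-reflexive (card-empty _ (λ e (_ , ¬q , _) → ¬q q))) z≤n
        ; (no ¬q) → ≤-trans (card-mono _ (λ e → (v ∈? e) ×-dec (w ∈? e)) (λ e (_ , _ , x) → x)) (card-∋₂ (¬q ∘ sym)) })
      per-f : ∀ f → card (Q? f) ≤ ind (Is? β f) * (3 * n)
      per-f f = card-guard (Is? β f) (Q? f) (3 * n) (λ e → proj₁) λ _ → begin
        card (Q? f) ≤⟨ card-cover _ (R? f) (λ e (_ , x) → x) ⟩
        sum (λ w → card (R? f w)) ≤⟨ sum-mono (per-w f) ⟩
        sum (λ w → ind (w ∈? f) * n) ≡⟨ *-distribʳ-sum n (λ w → ind (w ∈? f)) ⟨
        sum (λ w → ind (w ∈? f)) * n ≡⟨ cong (_* n) (sum-∈ f) ⟩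
        3 * n ∎

    IsMatching : (Fin m → Bool) → Set
    IsMatching β = ∀ e f w → β e ≡ true → β f ≡ true → w ∈ e → w ∈ f → w ≢ v → e ≡ f

    -- A greedy choice: an edge already chosen meets at most 3n edges at v outside v, so an
    -- unblocked edge of R remains as long as fewer than j are chosen.
    matching : ∀ {R : Fin m → Set} (R? : ∀ e → Dec (R e)) → (∀ e → R e → v ∈ e) → ∀ j → j * (3 * n) < card R? →
      ∃ λ β → (∀ e → β e ≡ true → R e) × IsMatching β × card (Is? β) ≡ j
    matching R? R∋ zero h = (λ _ → false) , (λ _ ()) , (λ _ _ _ ()) , card-empty (Is? (λ _ → false)) (λ _ ())
    matching {R} R? R∋ (suc j) h = β′ , β′⊆R , matching′ , card′
      where
      IH = matching R? R∋ j (≤-<-trans (m≤n+m _ (3 * n)) h)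
      β = proj₁ IH
      β⊆R = proj₁ (proj₂ IH)
      match = proj₁ (proj₂ (proj₂ IH))
      new : ∃ λ e → R e × ¬ (v ∈ e × Hit β e)
      new = pigeon R? (λ e → (v ∈? e) ×-dec Hit? β e)
        (≤-<-trans (hit-bound β) (≤-<-trans (≤-reflexive (cong (_* (3 * n)) (proj₂ (proj₂ (proj₂ IH))))) (≤-<-trans (m≤n+m _ (3 * n)) h)))
      e₀ = proj₁ new
      R₀ = proj₁ (proj₂ new)
      free : ∀ f w → β f ≡ true → w ∈ f → w ∈ e₀ → w ≢ v → ⊥
      free f w βf w∈f w∈ w≢v = proj₂ (proj₂ new) (R∋ e₀ R₀ , w , w∈ , w≢v , f , βf , w∈f)
      β′ = insert β e₀
      e₀∉β : ∀ f → β f ≡ true → f ≡ e₀ → ⊥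
      e₀∉β f p refl = let w , _ , (_ , w∈ , _) , (v≢w , _) = split₁ (R∋ f R₀) in free f w p w∈ w∈ (v≢w ∘ sym)
      β′⊆R : ∀ f → β′ f ≡ true → R f
      β′⊆R f p = case insert-case β e₀ f p of λ { (inj₁ q) → β⊆R f q ; (inj₂ refl) → R₀ }
      matching′ : IsMatching β′
      matching′ e f w p q w∈e w∈f w≢v with insert-case β e₀ e p | insert-case β e₀ f q
      ... | inj₁ p′ | inj₁ q′ = match e f w p′ q′ w∈e w∈f w≢v
      ... | inj₁ p′ | inj₂ refl = ⊥-elim (free e w p′ w∈e w∈f w≢v)
      ... | inj₂ refl | inj₁ q′ = ⊥-elim (free f w q′ w∈f w∈e w≢v)
      ... | inj₂ refl | inj₂ refl = refl
      card′ : card (Is? β′) ≡ suc j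
      card′ = trans (card-insert β e₀ (λ p → e₀∉β e₀ p refl)) (cong suc (proj₂ (proj₂ (proj₂ IH))))

  -- The vertex v lies in many edges of type cM and of type cQ.  For a matching edge v x y of type cM
  -- and an edge v a b of type cQ, T5-freeness forbids having both a b x and a b y, which are good.
  module DoubleDegree (v : Fin n) (cM cQ ω : ℕ)
    -- `level` says that an edge of type cQ at v becomes good when v is replaced by a vertex u as in
    -- `far`.
    (far : ∀ e u → v ∈ e → typ e ≡ cM → u ∈ e → u ≢ v → wt u ≡ ω) (level : cQ + ω ≡ wt v + 2) (Δ : ℕ) where
    open Matching v

    Rich : Vec Bool m → Set
    Rich H = T5-free H × Δ < deg cM v H × Δ < deg cQ v H

    Rich? : ∀ H → Dec (Rich H)
    Rich? H = T5-free? H ×-dec ((Δ <? deg cM v H) ×-dec (Δ <? deg cQ v H))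

    module Fixed (H₀ : Vec Bool m) (β : Fin m → Bool)
      (β⊆ : ∀ e → β e ≡ true → At cM v e × on H₀ e) (match : IsMatching β) where

      A : Fin m → Set
      A e = (At cQ v e × on H₀ e) × ¬ (v ∈ e × Hit β e)

      A? : ∀ e → Dec (A e)
      A? e = (At? cQ v e ×-dec on? H₀ e) ×-dec ¬? ((v ∈? e) ×-dec Hit? β e)

      L? : ∀ e e′ → Dec (A e × β e′ ≡ true)
      L? e e′ = A? e ×-dec Is? β e′

      -- For e = v a b and e′ = v x y these are the edges a b x and a b y, described without
      -- choosing an order of the vertices.
      J : Fin m → Fin m → Fin m → Set
      J e e′ f = (A e × β e′ ≡ true) × ¬ (v ∈ f) × (∀ w → w ∈ e → w ≢ v → w ∈ f) × (∃ λ u → u ∈ f × u ∈ e′ × u ≢ v)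

      opaque
        J? : ∀ e e′ f → Dec (J e e′ f)
        J? e e′ f = L? e e′ ×-dec (¬? (v ∈? f) ×-dec
          (all? (λ w → (w ∈? e) →-dec (¬? (w ≟ᶠ v) →-dec (w ∈? f))) ×-dec any? (λ u → (u ∈? f) ×-dec ((u ∈? e′) ×-dec ¬? (u ≟ᶠ v)))))

      clear : ∀ {e e′ w} → A e → β e′ ≡ true → w ∈ e → w ≢ v → w ∈ e′ → ⊥
      clear {e} {e′} {w} (((v∈ , _) , _) , ¬hit) βe′ w∈ w≢v w∈e′ = ¬hit (v∈ , w , w∈ , w≢v , e′ , βe′ , w∈e′)

      shape : ∀ {e e′ f} → J e e′ f → ∃ λ a → ∃ λ b → ∃ λ u → Tri e v a b × Tri f a b u × u ∈ e′ × u ≢ v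
      shape {e} {e′} {f} ((Ae@(((v∈ , _) , _) , _) , βe′) , _ , sub , u , u∈f , u∈e′ , u≢v) with split₁ v∈
      ... | a , b , t@((_ , a∈ , b∈) , (v≢a , v≢b , a≢b)) = a , b , u , t ,
        ((sub a a∈ (v≢a ∘ sym) , sub b b∈ (v≢b ∘ sym) , u∈f) ,
          (a≢b , (λ { refl → clear Ae βe′ a∈ u≢v u∈e′ }) , (λ { refl → clear Ae βe′ b∈ u≢v u∈e′ }))) , u∈e′ , u≢v

      -- The edges in `A` avoid the matching outside v. Hence f has a single vertex on the matching,
      -- which determines the matching edge, and its other two vertices together with v determine e.
      disjoint : ∀ e₁ e₂ e₁′ e₂′ f → J e₁ e₁′ f → J e₂ e₂′ f → e₁ ≡ e₂ × e₁′ ≡ e₂′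
      disjoint e₁ e₂ e₁′ e₂′ f j₁@((A₁ , β₁) , _) j₂@((A₂ , β₂) , _) with shape j₁ | shape j₂
      ... | a , b , u , t@((_ , a∈ , b∈) , (v≢a , v≢b , a≢b)) , s@((a∈f , b∈f , u∈f) , (_ , a≢u , b≢u)) , u∈ , u≢v
          | a′ , b′ , u′ , t′@((v∈′ , a′∈ , b′∈) , (v≢a′ , v≢b′ , _)) , s′ , u′∈ , u′≢v = same-e , match e₁′ e₂′ u β₁ β₂ u∈ (subst (_∈ e₂′) (sym u≡u′) u′∈) u≢v
        where
        u≡u′ : u ≡ u′
        u≡u′ with only s′ u∈f
        ... | inj₁ refl = ⊥-elim (clear A₂ β₁ a′∈ u≢v u∈)
        ... | inj₂ (inj₁ refl) = ⊥-elim (clear A₂ β₁ b′∈ u≢v u∈)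
        ... | inj₂ (inj₂ p) = p
        in₂ : ∀ {w} → w ∈ f → w ≢ u → w ∈ e₂
        in₂ w∈ w≢u with only s′ w∈
        ... | inj₁ refl = a′∈
        ... | inj₂ (inj₁ refl) = b′∈
        ... | inj₂ (inj₂ p) = contradiction (trans p (sym u≡u′)) w≢u
        same-e : e₁ ≡ e₂
        same-e = Tri-unique t ((v∈′ , in₂ a∈f a≢u , in₂ b∈f b≢u) , (v≢a , v≢b , a≢b))

      small : ∀ e e′ → A e × β e′ ≡ true → card (J? e e′) ≤ 3
      small e e′ (Ae@(((v∈ , _) , _) , _) , βe′) with split₁ v∈
      ... | a , b , t@((_ , a∈ , b∈) , (v≢a , v≢b , a≢b)) = begin
        card (J? e e′) ≤⟨ card-cover (J? e e′) (λ u f → (u ∈? e′) ×-dec Tri? f a b u) (λ f (_ , _ , sub , u , u∈f , u∈e′ , u≢v) →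
          u , u∈e′ , (sub a a∈ (v≢a ∘ sym) , sub b b∈ (v≢b ∘ sym) , u∈f) ,
          (a≢b , (λ { refl → clear Ae βe′ a∈ u≢v u∈e′ }) , (λ { refl → clear Ae βe′ b∈ u≢v u∈e′ }))) ⟩
        sum (λ u → card (λ f → (u ∈? e′) ×-dec Tri? f a b u))
          ≤⟨ sum-mono (λ u → card-guard₁ (u ∈? e′) (λ f → (u ∈? e′) ×-dec Tri? f a b u) (λ _ → proj₁) (λ _ → card-≤1 _ (λ _ _ (_ , t) (_ , t′) → Tri-unique t t′))) ⟩
        sum (λ u → ind (u ∈? e′)) ≡⟨ sum-∈ e′ ⟩
        3 ∎
        where open ≤-Reasoning

      -- Around the common pair a b, the edges a b v, a b x, a b y and v x y would form T5. The
      -- first and the last are present, since they were exposed.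
      open-block : ∀ H → T5-free (mix (BadAt? v) H₀ H) → ∀ e e′ → A e × β e′ ≡ true → 1 ≤ off (J? e e′) H
      open-block H free e e′ l@(Ae@(((v∈ , te) , one) , _) , βe′)
        with split₁ v∈ | split₁ (proj₁ (proj₁ (β⊆ e′ βe′)))
      ... | a , b , t@((_ , a∈ , b∈) , (v≢a , v≢b , a≢b)) | x , y , s@((_ , x∈ , y∈) , (v≢x , v≢y , x≢y)) =
        case on? H f of λ
          { (no p) → 1≤card (λ f → J? e e′ f ×-dec ¬? (on? H f)) f (Jf x∈ (v≢x ∘ sym) tf , p)
          ; (yes p) → case on? H g of λ
          { (no p) → 1≤card (λ f → J? e e′ f ×-dec ¬? (on? H f)) g (Jf y∈ (v≢y ∘ sym) tg , p)
          ; (yes q) → ⊥-elim (free a b v x y e f g e′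
              ((swap₂₃ (swap₁₂ t) , tf , tg , s) ,
               (trans (lookup-mix-yes (BadAt? v) H₀ H e (inj₂ v∈)) one ,
                outer x∈ (v≢x ∘ sym) tf p , outer y∈ (v≢y ∘ sym) tg q ,
                trans (lookup-mix-yes (BadAt? v) H₀ H e′ (inj₂ (proj₁ (proj₁ s)))) (proj₂ (β⊆ e′ βe′))))) } }
        where
        dis : ∀ {u} → u ∈ e′ → u ≢ v → Distinct (a , b , u)
        dis u∈ u≢v = a≢b , (λ { refl → clear Ae βe′ a∈ u≢v u∈ }) , (λ { refl → clear Ae βe′ b∈ u≢v u∈ })
        f = proj₁ (edge a b x (dis x∈ (v≢x ∘ sym)))
        tf = proj₂ (edge a b x (dis x∈ (v≢x ∘ sym)))
        g = proj₁ (edge a b y (dis y∈ (v≢y ∘ sym)))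
        tg = proj₂ (edge a b y (dis y∈ (v≢y ∘ sym)))
        v∉ : ∀ {f u} → u ≢ v → Tri f a b u → ¬ (v ∈ f)
        v∉ u≢v tf v∈f with only tf v∈f
        ... | inj₁ p = v≢a p
        ... | inj₂ (inj₁ p) = v≢b p
        ... | inj₂ (inj₂ p) = u≢v (sym p)
        Jf : ∀ {f u} → u ∈ e′ → u ≢ v → Tri f a b u → J e e′ f
        Jf {f} {u} u∈ u≢v tf@((a∈f , b∈f , u∈f) , _) = l , v∉ u≢v tf ,
          (λ w w∈ w≢v → case only t w∈ of λ { (inj₁ p) → contradiction p w≢v ; (inj₂ (inj₁ refl)) → a∈f ; (inj₂ (inj₂ refl)) → b∈f }) ,
          u , u∈f , u∈ , u≢v
        good : ∀ {f u} → u ∈ e′ → u ≢ v → Tri f a b u → Good f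
        good {f} {u} u∈ u≢v tf = +-cancelˡ-≡ (wt v) (typ f) 2 (begin
          wt v + typ f ≡⟨ cong (wt v +_) (typ-Tri tf) ⟩
          wt v + (wt a + wt b + wt u) ≡⟨ eq (wt v) (wt a) (wt b) (wt u) ⟩
          wt v + wt a + wt b + wt u ≡⟨ cong₂ _+_ (trans (sym (typ-Tri t)) te) (far e′ u (proj₁ (proj₁ s)) (proj₂ (proj₁ (β⊆ e′ βe′))) u∈ u≢v) ⟩
          cQ + ω ≡⟨ level ⟩
          wt v + 2 ∎)
          where
          open ≡-Reasoning
          eq : ∀ a b c d → a + (b + c + d) ≡ a + b + c + d
          eq = solve-∀
        outer : ∀ {f u} → u ∈ e′ → u ≢ v → Tri f a b u → on H f → on (mix (BadAt? v) H₀ H) f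
        outer {f} u∈ u≢v tf o = trans (lookup-mix-no (BadAt? v) H₀ H f λ { (inj₁ bad) → bad (good u∈ u≢v tf) ; (inj₂ v∈f) → v∉ u≢v tf v∈f }) o

    -- At least Δ - 3nj of the edges of type cQ avoid a matching of size j. Paired with its edges
    -- they give (Δ - 3nj) j independent blocks, and six blocks save one bit.
    rich-sum : ∀ b k r s j → card Bad? ≤ 2 ^ k * r → j * (3 * n) ≤ Δ → 6 * s + j * (j * (3 * n)) ≤ Δ * j →
      ∑ᶜ (λ H → ind (cnt Bad? H ≤? b) * ind (Rich? H)) * 2 ^ card Bad? * 2 ^ s ≤ 2 ^ (suc k * b + r) * 2 ^ m
    rich-sum b k r s j small j≤ s≤ = few-cond Bad? (BadAt? v) (λ _ → inj₁) b k r s (λ H → ind (Rich? H)) small per-H₀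
      where
      open ≤-Reasoning
      deg-mix : ∀ c H₀ H → deg c v (mix (BadAt? v) H₀ H) ≡ deg c v H₀
      deg-mix c H₀ H = cnt-local (At? c v) (mix (BadAt? v) H₀ H) H₀ (λ e (v∈ , _) → lookup-mix-yes (BadAt? v) H₀ H e (inj₂ v∈))
      Bound : Vec Bool m → Set
      Bound H₀ = ∑ᶜ (λ H → ind (Rich? (mix (BadAt? v) H₀ H))) * 2 ^ s ≤ 2 ^ m
      poor : ∀ H₀ → ¬ (Δ < deg cM v H₀ × Δ < deg cQ v H₀) → Bound H₀
      poor H₀ ¬p = ≤-trans (≤-reflexive (cong (_* 2 ^ s) (trans (∑ᶜ-cong (λ H → ind-no (Rich? (mix (BadAt? v) H₀ H))
        (λ (_ , x , y) → ¬p (subst (Δ <_) (deg-mix cM H₀ H) x , subst (Δ <_) (deg-mix cQ H₀ H) y)))) (∑ᶜ-const m 0)))) z≤n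
      rich : ∀ H₀ → Δ < deg cQ v H₀ →
        (∃ λ β → (∀ e → β e ≡ true → At cM v e × on H₀ e) × IsMatching β × card (Is? β) ≡ j) → Bound H₀
      rich H₀ dQ (β , β⊆ , match , cβ) = begin
        ∑ᶜ (λ H → ind (Rich? (mix (BadAt? v) H₀ H))) * 2 ^ s
          ≤⟨ *-monoˡ-≤ (2 ^ s) (∑ᶜ-mono (λ H → ind≤ (Rich? (mix (BadAt? v) H₀ H)) (λ (free , _) →
               1≤prod (λ e → 1≤prod (λ e′ → 1≤ind (L? e e′ →-dec (1 ≤? off (J? e e′) H)) (open-block H free e e′)))))) ⟩
        ∑ᶜ (λ H → prod (λ e → prod (λ e′ → block (L? e e′) (J? e e′) H))) * 2 ^ s
          ≤⟨ blocks₂-bound L? J? disjoint small₃ s count ⟩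
        2 ^ m ∎
        where
        open Fixed H₀ β β⊆ match renaming (small to small₃)
        labels : card A? * j ≤ sum (λ e → card (L? e))
        labels = begin
          card A? * j ≡⟨ sum-ind-* A? j ⟨
          sum (λ e → ind (A? e) * j) ≤⟨ sum-mono (λ e → per-e e (A? e)) ⟩
          sum (λ e → card (L? e)) ∎
          where
          per-e : ∀ e (d : Dec (A e)) → ind d * j ≤ card (λ e′ → d ×-dec Is? β e′)
          per-e e (no _) = z≤n
          per-e e (yes a) = ≤-trans (≤-reflexive (trans (*-identityˡ j) (sym cβ))) (card-mono (Is? β) _ (λ e′ p → a , p))
        many : Δ ≤ card A? + j * (3 * n)
        many = begin
          Δ ≤⟨ <⇒≤ dQ ⟩
          deg cQ v H₀ ≤⟨ card-+ (λ e → At? cQ v e ×-dec on? H₀ e) A? (λ e → (v ∈? e) ×-dec Hit? β e)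
            (λ e p → case (v ∈? e) ×-dec Hit? β e of λ { (yes q) → inj₂ q ; (no ¬q) → inj₁ (p , ¬q) }) ⟩
          card A? + card (λ e → (v ∈? e) ×-dec Hit? β e) ≤⟨ +-monoʳ-≤ (card A?) (≤-trans (hit-bound β) (≤-reflexive (cong (_* (3 * n)) cβ))) ⟩
          card A? + j * (3 * n) ∎
        count : 6 * s ≤ sum (λ e → card (L? e))
        count = ≤-trans (+-cancelʳ-≤ (j * (j * (3 * n))) _ _ (begin
          6 * s + j * (j * (3 * n)) ≤⟨ s≤ ⟩
          Δ * j ≤⟨ *-monoˡ-≤ j many ⟩
          (card A? + j * (3 * n)) * j ≡⟨ eq (card A?) j (j * (3 * n)) ⟩
          card A? * j + j * (j * (3 * n)) ∎)) labels
          where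
          eq : ∀ a b c → (a + c) * b ≡ a * b + b * c
          eq = solve-∀
      per-H₀ : ∀ H₀ → Bound H₀
      per-H₀ H₀ = case (Δ <? deg cM v H₀) ×-dec (Δ <? deg cQ v H₀) of λ
        { (no ¬p) → poor H₀ ¬p
        ; (yes (dM , dQ)) → rich H₀ dQ (matching (λ e → At? cM v e ×-dec on? H₀ e) (λ e → proj₁ ∘ proj₁) j (≤-<-trans j≤ dM)) }

  deg-mono : ∀ c v H H′ → (∀ e → on H e → on H′ e) → deg c v H ≤ deg c v H′
  deg-mono c v H H′ s = cnt-mono (At? c v) (At? c v) H H′ (λ e p o → p , s e o)

  codeg-mono : ∀ x y H H′ → (∀ e → x ∈ e → on H e → on H′ e) → codeg x y H ≤ codeg x y H′
  codeg-mono x y H H′ s = cnt-mono (Link? x y) (Link? x y) H H′ (λ e p o → p , s e (proj₁ p) o)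

  thickdeg-mono : ∀ l v H H′ → (∀ e → v ∈ e → on H e → on H′ e) → thickdeg l v H ≤ thickdeg l v H′
  thickdeg-mono l v H H′ s = cnt-mono (Thick? l H v) (Thick? l H′ v) H H′ (λ e (at , y , y∈ , Yy , lt) o →
    (at , y , y∈ , Yy , ≤-trans lt (codeg-mono v y H H′ s)) , s e (proj₁ at) o)

  nbr-X : ∀ H {x y u} → X x → Y y → third-nbr H x y u → X u
  nbr-X H Xx Yy (e , t , g , _) = 1⇒X (typ-third t (wt-X Xx) (wt-Y Yy) g refl)

  sum-incidence : ∀ {Q : Fin m → Set} (Q? : ∀ e → Dec (Q e)) → sum (λ w → card (λ e → Q? e ×-dec (w ∈? e))) ≤ 3 * card Q?
  sum-incidence Q? = begin
    sum (λ w → card (λ e → Q? e ×-dec (w ∈? e))) ≡⟨ sum-cong-≗ (λ w → trans (card-sum (λ e → Q? e ×-dec (w ∈? e))) (sum-cong-≗ (λ e → ind-× (Q? e) (w ∈? e)))) ⟩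
    sum (λ w → sum (λ e → ind (Q? e) * ind (w ∈? e))) ≡⟨ ∑-comm (λ w e → ind (Q? e) * ind (w ∈? e)) ⟩
    sum (λ e → sum (λ w → ind (Q? e) * ind (w ∈? e)))
      ≡⟨ sum-cong-≗ (λ e → trans (sym (*-distribˡ-sum (ind (Q? e)) (λ w → ind (w ∈? e)))) (cong (ind (Q? e) *_) (sum-∈ e))) ⟩
    sum (λ e → ind (Q? e) * 3) ≡⟨ sum-ind-* Q? 3 ⟩
    card Q? * 3 ≡⟨ *-comm (card Q?) 3 ⟩
    3 * card Q? ∎
    where open ≤-Reasoning

  forced-count : ∀ {v y y′} H l → X v → Y y → Y y′ → l < codeg v y H →
    ∀ {Q : Fin m → Set} (Q? : ∀ e → Dec (Q e)) →
    (∀ f a b → Tri f y′ a b → third-nbr H v y a → third-nbr H v y b → Q f) → l * l ≤ 2 * card Q?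
  forced-count {v} {y} {y′} H l Xv Yy Yy′ lt Q? h = ≤-trans
    (many-pairs (third-nbr? H v y) l (≤-trans lt (codeg≤nbrs H (X≢Y Xv Yy))))
    (card-pairs y′ (λ a b → third-nbr? H v y a ×-dec (third-nbr? H v y b ×-dec ¬? (a ≟ᶠ b))) Q?
      (λ a b (na , nb , a≢b) →
        let f , t = edge y′ a b ((X≢Y (nbr-X H Xv Yy na) Yy′ ∘ sym) , (X≢Y (nbr-X H Xv Yy nb) Yy′ ∘ sym) , a≢b)
        in f , t , h f a b t na nb))

  -- T5 with common pair v y, completed by y′, a and b.
  nbr-T5 : ∀ H {v y y′ e f a b} → T5-free H → Tri e v y y′ → on H e →
    third-nbr H v y a → third-nbr H v y b → Tri f y′ a b → on H f → ⊥
  nbr-T5 H free t o (e₁ , t₁ , _ , o₁) (e₂ , t₂ , _ , o₂) tf of = free _ _ _ _ _ _ _ _ _ ((t , t₁ , t₂ , tf) , (o , o₁ , o₂ , of))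

  -- Fixing all edges at v, every pair of common neighbours of v y forces an edge with y′ to be absent.
  module ThickDegree (v : Fin n) (Xv : X v) (l Δ : ℕ) where

    ManyThick : Vec Bool m → Set
    ManyThick H = T5-free H × Δ < thickdeg l v H

    ManyThick? : ∀ H → Dec (ManyThick H)
    ManyThick? H = T5-free? H ×-dec (Δ <? thickdeg l v H)

    Forced : Vec Bool m → Fin m → Set
    Forced H₀ f = ∃ λ y′ → ∃ λ y → ∃ λ a → ∃ λ b → Tri f y′ a b × (Good f × ¬ (v ∈ f)) × (∃ λ e → Tri e v y y′ × on H₀ e) ×
      third-nbr H₀ v y a × third-nbr H₀ v y b

    opaque
      Forced? : ∀ H₀ f → Dec (Forced H₀ f)
      Forced? H₀ f = any? λ y′ → any? λ y → any? λ a → any? λ b → Tri? f y′ a b ×-dec ((Good? f ×-dec ¬? (v ∈? f)) ×-dec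
        (any? (λ e → Tri? e v y y′ ×-dec on? H₀ e) ×-dec (third-nbr? H₀ v y a ×-dec third-nbr? H₀ v y b)))

    Partner : Vec Bool m → Fin n → Set
    Partner H₀ y′ = Y y′ × ∃ λ y → ∃ λ e → Tri e v y y′ × on H₀ e × Y y × l < codeg v y H₀

    opaque
      Partner? : ∀ H₀ y′ → Dec (Partner H₀ y′)
      Partner? H₀ y′ = Y? y′ ×-dec any? λ y → any? λ e → Tri? e v y y′ ×-dec (on? H₀ e ×-dec (Y? y ×-dec (l <? codeg v y H₀)))

    -- By `forced-count` every partner y′ lies in at least l²/2 forced edges, and each edge is
    -- counted for at most three partners.
    forced-many : ∀ H₀ → card (Partner? H₀) * (l * l) ≤ 6 * card (Forced? H₀)
    forced-many H₀ = begin
      card (Partner? H₀) * (l * l) ≡⟨ sum-ind-* (Partner? H₀) (l * l) ⟨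
      sum (λ y′ → ind (Partner? H₀ y′) * (l * l)) ≤⟨ sum-mono (λ y′ → per y′ (Partner? H₀ y′)) ⟩
      sum (λ y′ → 2 * card (λ f → Forced? H₀ f ×-dec (y′ ∈? f))) ≡⟨ *-distribˡ-sum 2 (λ y′ → card (λ f → Forced? H₀ f ×-dec (y′ ∈? f))) ⟨
      2 * sum (λ y′ → card (λ f → Forced? H₀ f ×-dec (y′ ∈? f))) ≤⟨ *-monoʳ-≤ 2 (sum-incidence (Forced? H₀)) ⟩
      2 * (3 * card (Forced? H₀)) ≡⟨ *-assoc 2 3 (card (Forced? H₀)) ⟨
      6 * card (Forced? H₀) ∎
      where
      open ≤-Reasoning
      per : ∀ y′ (d : Dec (Partner H₀ y′)) → ind d * (l * l) ≤ 2 * card (λ f → Forced? H₀ f ×-dec (y′ ∈? f))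
      per y′ (no _) = z≤n
      per y′ (yes (Yy′ , y , e , t@(_ , (_ , v≢y′ , _)) , o , Yy , lt)) = ≤-trans (≤-reflexive (*-identityˡ (l * l)))
        (forced-count H₀ l Xv Yy Yy′ lt (λ f → Forced? H₀ f ×-dec (y′ ∈? f)) (λ f a b tf na@(_ , (_ , (_ , v≢a , _)) , _) nb@(_ , (_ , (_ , v≢b , _)) , _) →
          (y′ , y , a , b , tf ,
            (typ-wts tf (wt-Y Yy′) (wt-X (nbr-X H₀ Xv Yy na)) (wt-X (nbr-X H₀ Xv Yy nb)) ,
             (λ v∈f → case only tf v∈f of λ { (inj₁ p) → v≢y′ p ; (inj₂ (inj₁ p)) → v≢a p ; (inj₂ (inj₂ p)) → v≢b p })) ,
            (e , t , o) , na , nb) , proj₁ (proj₁ tf)))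

    partners : ∀ H₀ → thickdeg l v H₀ ≤ card (Partner? H₀) * n
    partners H₀ = begin
      thickdeg l v H₀ ≤⟨ card-cover (λ e → Thick? l H₀ v e ×-dec on? H₀ e) Q? (λ e (((v∈ , ty) , y , y∈ , Yy , lt) , o) →
        let y′ , t = split₂ v∈ y∈ (X≢Y Xv Yy) in
        y′ , (0⇒Y (typ-third t (wt-X Xv) (wt-Y Yy) ty refl) , y , e , t , o , Yy , lt) , v∈ , proj₂ (proj₂ (proj₁ t))) ⟩
      sum (λ y′ → card (Q? y′)) ≤⟨ sum-mono (λ y′ → card-guard (Partner? H₀ y′) (Q? y′) n (λ _ → proj₁) (λ p →
        ≤-trans (card-mono (Q? y′) (λ e → (v ∈? e) ×-dec (y′ ∈? e)) (λ _ → proj₂)) (card-∋₂ (X≢Y Xv (proj₁ p))))) ⟩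
      sum (λ y′ → ind (Partner? H₀ y′) * n) ≡⟨ sum-ind-* (Partner? H₀) n ⟩
      card (Partner? H₀) * n ∎
      where
      open ≤-Reasoning
      Q? : ∀ y′ e → Dec (Partner H₀ y′ × v ∈ e × y′ ∈ e)
      Q? y′ e = Partner? H₀ y′ ×-dec ((v ∈? e) ×-dec (y′ ∈? e))

    -- The variable g stands for the number of partners, each of which accounts for at most n thick
    -- edges at v.
    thick-sum : ∀ b k r s → card Bad? ≤ 2 ^ k * r → (∀ g → Δ < g * n → 6 * s ≤ g * (l * l)) →
      ∑ᶜ (λ H → ind (cnt Bad? H ≤? b) * ind (ManyThick? H)) * 2 ^ card Bad? * 2 ^ s ≤ 2 ^ (suc k * b + r) * 2 ^ m
    thick-sum b k r s small num = few-cond Bad? (BadAt? v) (λ _ → inj₁) b k r s (λ H → ind (ManyThick? H)) small per-H₀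
      where
      open ≤-Reasoning
      to : ∀ {H₀ H e} → v ∈ e → on H₀ e → on (mix (BadAt? v) H₀ H) e
      to {H₀} {H} {e} v∈ o = trans (lookup-mix-yes (BadAt? v) H₀ H e (inj₂ v∈)) o
      from : ∀ {H₀ H e} → v ∈ e → on (mix (BadAt? v) H₀ H) e → on H₀ e
      from {H₀} {H} {e} v∈ o = trans (sym (lookup-mix-yes (BadAt? v) H₀ H e (inj₂ v∈))) o
      nbr : ∀ {H₀ H y a} → third-nbr H₀ v y a → third-nbr (mix (BadAt? v) H₀ H) v y a
      nbr {H₀} {H} (e , t , g , o) = e , t , g , to {H₀} {H} (proj₁ (proj₁ t)) o
      per-H₀ : ∀ H₀ → ∑ᶜ (λ H → ind (ManyThick? (mix (BadAt? v) H₀ H))) * 2 ^ s ≤ 2 ^ m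
      per-H₀ H₀ = case Δ <? thickdeg l v H₀ of λ
        { (no ¬p) → ≤-trans (≤-reflexive (cong (_* 2 ^ s) (trans (∑ᶜ-cong (λ H → ind-no (ManyThick? (mix (BadAt? v) H₀ H))
            (λ (_ , x) → ¬p (≤-trans x (thickdeg-mono l v (mix (BadAt? v) H₀ H) H₀ (λ e v∈ → from {H₀} {H} v∈)))))) (∑ᶜ-const m 0)))) z≤n
        ; (yes p) → begin
            ∑ᶜ (λ H → ind (ManyThick? (mix (BadAt? v) H₀ H))) * 2 ^ s
              ≤⟨ *-mono-≤ (∑ᶜ-mono (λ H → ind≤ (ManyThick? (mix (BadAt? v) H₀ H)) (λ (free , _) →
                   1≤ind (cnt (Forced? H₀) H ≤? 0) (≤-reflexive (cnt-zero (Forced? H₀) H (λ f F o → absent H₀ H free F o))))))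
                 (2^-mono {s} {card (Forced? H₀)} (*-cancelˡ-≤ {s} {card (Forced? H₀)} 6 (≤-trans (num (card (Partner? H₀)) (≤-trans p (partners H₀))) (forced-many H₀)))) ⟩
            ∑ᶜ (λ H → ind (cnt (Forced? H₀) H ≤? 0)) * 2 ^ card (Forced? H₀) ≤⟨ none-sum (Forced? H₀) ⟩
            2 ^ m ∎ }
        where
        absent : ∀ H₀ H {f} → T5-free (mix (BadAt? v) H₀ H) → Forced H₀ f → on H f → ⊥
        absent H₀ H {f} free (y′ , y , a , b , tf , (gf , v∉) , (e , t , o) , na , nb) of =
          nbr-T5 (mix (BadAt? v) H₀ H) free t (to {H₀} {H} (proj₁ (proj₁ t)) o) (nbr {H₀} {H} na) (nbr {H₀} {H} nb) tf
            (trans (lookup-mix-no (BadAt? v) H₀ H f λ { (inj₁ b) → b gf ; (inj₂ v∈) → v∉ v∈ }) of)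

  -- Induced subgraphs and the removal step

  VSet : Set
  VSet = Fin n → Bool

  Inside : VSet → Fin m → Set
  Inside A e = ∀ w → w ∈ e → A w ≡ true

  opaque
    Inside? : ∀ A e → Dec (Inside A e)
    Inside? A e = all? λ w → (w ∈? e) →-dec (A w ≟ᵇ true)

  infixl 6 _−_
  _−_ : VSet → Fin n → VSet
  (A − v) w = A w ∧ not (does (w ≟ᶠ v))

  −-intro : ∀ A {v w} → A w ≡ true → w ≢ v → (A − v) w ≡ true
  −-intro A {v} {w} p w≢v rewrite p with w ≟ᶠ v
  ... | yes q = contradiction q w≢v
  ... | no _ = refl

  −-⊆ : ∀ A v w → (A − v) w ≡ true → A w ≡ true
  −-⊆ A v w p with A w
  ... | true = refl

  −-≢ : ∀ A v w → (A − v) w ≡ true → w ≢ v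
  −-≢ A v w p with A w | w ≟ᶠ v
  ... | true | no q = q

  Inside-⊆ : ∀ {A A′ e} → (∀ w → A′ w ≡ true → A w ≡ true) → Inside A′ e → Inside A e
  Inside-⊆ s i w w∈ = s w (i w w∈)

  infix 7 _↾_
  -- The induced subgraph remains a point of the same cube: edges leaving A are switched off, and
  -- vertices and edges keep their indices throughout the recursion.
  _↾_ : Vec Bool m → VSet → Vec Bool m
  H ↾ A = mix (Inside? A) H (replicate m false)

  on-↾ : ∀ {H A e} → on (H ↾ A) e → Inside A e × on H e
  on-↾ {H} {A} {e} o with Inside? A e
  ... | yes i = i , trans (sym (lookup-mix-yes (Inside? A) H (replicate m false) e i)) o
  ... | no ¬i = case trans (sym o) (trans (lookup-mix-no (Inside? A) H (replicate m false) e ¬i) (lookup-replicate e false)) of λ ()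

  ↾-on : ∀ {H A e} → Inside A e → on H e → on (H ↾ A) e
  ↾-on {H} {A} {e} i o = trans (lookup-mix-yes (Inside? A) H (replicate m false) e i) o

  ↾-local : ∀ A H H′ → (∀ e → Inside A e → lookup H e ≡ lookup H′ e) → H ↾ A ≡ H′ ↾ A
  ↾-local A H H′ h = vec-ext _ _ λ e → case Inside? A e of λ
    { (yes i) → trans (lookup-mix-yes (Inside? A) H _ e i) (trans (h e i) (sym (lookup-mix-yes (Inside? A) H′ _ e i)))
    ; (no ¬i) → trans (lookup-mix-no (Inside? A) H _ e ¬i) (sym (lookup-mix-no (Inside? A) H′ _ e ¬i)) }

  XA? : ∀ (A : VSet) v → Dec (A v ≡ true × X v)
  XA? A v = (A v ≟ᵇ true) ×-dec X? v

  YA? : ∀ (A : VSet) v → Dec (A v ≡ true × Y v)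
  YA? A v = (A v ≟ᵇ true) ×-dec Y? v

  -- The sum of f over the cube is compared with the number of graphs having no bad edge inside A,
  -- so bounds take the form  ∑ᶜ f * 2 ^ badIn A ≤ ρ * 2 ^ m.
  badIn : VSet → ℕ
  badIn A = card (λ e → Inside? A e ×-dec Bad? e)

  card-− : ∀ {Q : Fin n → Set} (Q? : ∀ v → Dec (Q v)) A v →
    card (λ w → (A w ≟ᵇ true) ×-dec Q? w) ≤ suc (card (λ w → ((A − v) w ≟ᵇ true) ×-dec Q? w))
  card-− Q? A v = begin
    card (λ w → (A w ≟ᵇ true) ×-dec Q? w)
      ≤⟨ card-+ (λ w → (A w ≟ᵇ true) ×-dec Q? w) (λ w → v ≟ᶠ w) (λ w → ((A − v) w ≟ᵇ true) ×-dec Q? w)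
          (λ w (p , q) → case v ≟ᶠ w of λ { (yes r) → inj₁ r ; (no r) → inj₂ (−-intro A p (r ∘ sym) , q) }) ⟩
    card (λ w → v ≟ᶠ w) + card (λ w → ((A − v) w ≟ᵇ true) ×-dec Q? w)
      ≤⟨ +-monoˡ-≤ _ (card-≤1 (λ w → v ≟ᶠ w) (λ _ _ p q → trans (sym p) q)) ⟩
    suc (card (λ w → ((A − v) w ≟ᵇ true) ×-dec Q? w)) ∎
    where open ≤-Reasoning

  -- The factors f and g look at disjoint sets of edges, so their bounds multiply. The local event g
  -- has to pay for the at most bt bad edges lost with the removed vertices, and saves σ bits beyond
  -- that.
  step : ∀ A A′ (f g : Vec Bool m → ℕ) bt σ q ρ → Local (Inside A′) f → Local (λ e → ¬ Inside A′ e) g → badIn A ≤ badIn A′ + bt →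
    ∑ᶜ f * 2 ^ badIn A′ * q ≤ ρ * 2 ^ m → ∑ᶜ g * 2 ^ bt * 2 ^ σ ≤ 2 ^ m →
    ∑ᶜ (λ H → f H * g H) * 2 ^ badIn A * 2 ^ σ * q ≤ ρ * 2 ^ m
  step A A′ f g bt σ q ρ lf lg b≤ hf hg = begin
    ∑ᶜ (λ H → f H * g H) * 2 ^ badIn A * 2 ^ σ * q ≤⟨ *-monoˡ-≤ q (*-monoˡ-≤ (2 ^ σ) (*-monoʳ-≤ (∑ᶜ (λ H → f H * g H)) (2^-mono b≤))) ⟩
    ∑ᶜ (λ H → f H * g H) * 2 ^ (badIn A′ + bt) * 2 ^ σ * q ≡⟨ cong (λ z → ∑ᶜ (λ H → f H * g H) * z * 2 ^ σ * q) (^-distribˡ-+-* 2 (badIn A′) bt) ⟩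
    ∑ᶜ (λ H → f H * g H) * (2 ^ badIn A′ * 2 ^ bt) * 2 ^ σ * q ≡⟨ eq (∑ᶜ (λ H → f H * g H)) (2 ^ badIn A′) (2 ^ bt) (2 ^ σ) q ⟩
    ∑ᶜ (λ H → f H * g H) * (2 ^ badIn A′ * q * (2 ^ bt * 2 ^ σ))
      ≤⟨ indep-bound (Inside? A′) f g lf lg (2 ^ badIn A′ * q) (2 ^ bt * 2 ^ σ) ρ 1
           (≤-trans (≤-reflexive (sym (*-assoc (∑ᶜ f) (2 ^ badIn A′) q))) hf)
           (≤-trans (≤-reflexive (sym (*-assoc (∑ᶜ g) (2 ^ bt) (2 ^ σ)))) (≤-trans hg (≤-reflexive (sym (*-identityˡ _))))) ⟩
    ρ * 1 * 2 ^ m ≡⟨ cong (_* 2 ^ m) (*-identityʳ ρ) ⟩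
    ρ * 2 ^ m ∎
    where
    open ≤-Reasoning
    eq : ∀ a b c d q → a * (b * c) * d * q ≡ a * (b * q * (c * d))
    eq = solve-∀

  -- Exceptional vertices

  Within : Fin n → Vec Bool n → Fin m → Set
  Within x T e = ∀ w → w ∈ e → w ≢ x → on T w

  opaque
    Within? : ∀ x T e → Dec (Within x T e)
    Within? x T e = all? λ w → (w ∈? e) →-dec (¬? (w ≟ᶠ x) →-dec on? T w)

  -- The bad edges x y y′ with y, y′ in T are left free, at a price of at most |T|² bits. In return
  -- every pair x y with y in T has small codegree, which saves almost all its owned good edges,
  -- about |T| times |X| if all edges inside A at x are owned.
  module Star (x : Fin n) {Own : Fin m → Set} (Own? : ∀ e → Dec (Own e)) (T : Vec Bool n) (b l : ℕ) where

    Stray : Fin m → Set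
    Stray e = Own e × Bad e × ¬ (x ∈ e × Within x T e)

    Stray? : ∀ e → Dec (Stray e)
    Stray? e = Own? e ×-dec (Bad? e ×-dec ¬? ((x ∈? e) ×-dec Within? x T e))

    Ray : Fin n → Fin m → Set
    Ray y e = on T y × Own e × Link x y e

    Ray? : ∀ y e → Dec (Ray y e)
    Ray? y e = on? T y ×-dec (Own? e ×-dec Link? x y e)

    star : Vec Bool m → ℕ
    star H = ind (cnt Stray? H ≤? b) * prod (λ y → ind (cnt (Ray? y) H ≤? l))

    star-Local : Local Own star
    star-Local = Local-* (ind-cnt-Local Stray? b (λ _ → proj₁)) (Local-prod (λ y → ind-cnt-Local (Ray? y) l (λ _ (_ , o , _) → o)))

    1≤star : ∀ H → cnt Stray? H ≤ b → (∀ y → on T y → codeg x y H ≤ l) → 1 ≤ star H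
    1≤star H h k = 1≤* (1≤ind (cnt Stray? H ≤? b) h) (1≤prod (λ y → 1≤ind (cnt (Ray? y) H ≤? l) (case on? T y of λ
      { (yes o) → ≤-trans (cnt-mono (Ray? y) (Link? x y) H H (λ e (_ , _ , p) q → p , q)) (k y o)
      ; (no ¬o) → ≤-trans (≤-reflexive (cnt-zero (Ray? y) H (λ e (o , _) _ → ¬o o))) z≤n })))

    t : ℕ
    t = card (on? T)

    Fits : Set
    Fits = ∀ y → on T y → Y y × X x

    -- An edge through x and two vertices of T has type 1 and is not good.
    rays-disjoint : Fits → ∀ y y′ e → Ray y e → Ray y′ e → y ≡ y′
    rays-disjoint T⊆Y y y′ e (o , _ , x∈ , y∈ , g) (o′ , _ , _ , y′∈ , _) with y ≟ᶠ y′
    ... | yes p = p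
    ... | no y≢y′ = case trans (sym g) (typ-wts tr (wt-X Xx) (wt-Y Yy) (wt-Y Yy′)) of λ ()
      where
      Xx = proj₂ (T⊆Y y o)
      Yy = proj₁ (T⊆Y y o)
      Yy′ = proj₁ (T⊆Y y′ o′)
      tr : Tri e x y y′
      tr = (x∈ , y∈ , y′∈) , (X≢Y Xx Yy , X≢Y Xx Yy′ , y≢y′)

    star-sum : Fits → ∀ k r E z → n ≤ 2 ^ k * r → (∀ y → on T y → z ≤ card (Ray? y)) →
      ∑ᶜ (λ H → ind (cnt Stray? H ≤? b)) * 2 ^ card Stray? ≤ 2 ^ E * 2 ^ m →
      ∑ᶜ star * 2 ^ card (λ e → Own? e ×-dec Bad? e) * 2 ^ (t * z) ≤ 2 ^ (E + t * (suc k * l + r) + t * t) * 2 ^ m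
    star-sum T⊆Y k r E z small long hS = begin
      ∑ᶜ star * 2 ^ bO * 2 ^ (t * z) ≤⟨ *-mono-≤ (*-monoʳ-≤ (∑ᶜ star) (2^-mono bO≤)) (2^-mono rays≥) ⟩
      ∑ᶜ star * 2 ^ (card Stray? + t * t) * 2 ^ R ≡⟨ cong (λ q → ∑ᶜ star * q * 2 ^ R) (^-distribˡ-+-* 2 (card Stray?) (t * t)) ⟩
      ∑ᶜ star * (2 ^ card Stray? * 2 ^ (t * t)) * 2 ^ R ≡⟨ eq (∑ᶜ star) (2 ^ card Stray?) (2 ^ (t * t)) (2 ^ R) ⟩
      ∑ᶜ star * (2 ^ card Stray? * 2 ^ R) * 2 ^ (t * t) ≤⟨ *-monoˡ-≤ (2 ^ (t * t)) both ⟩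
      2 ^ E * 2 ^ (t * c) * 2 ^ m * 2 ^ (t * t) ≡⟨ eq′ (2 ^ E * 2 ^ (t * c)) (2 ^ m) (2 ^ (t * t)) ⟩
      2 ^ E * 2 ^ (t * c) * 2 ^ (t * t) * 2 ^ m ≡⟨ cong (_* 2 ^ m) (trans (cong (_* 2 ^ (t * t)) (sym (^-distribˡ-+-* 2 E (t * c)))) (sym (^-distribˡ-+-* 2 (E + t * c) (t * t)))) ⟩
      2 ^ (E + t * c + t * t) * 2 ^ m ∎
      where
      open ≤-Reasoning
      c = suc k * l + r
      bO = card (λ e → Own? e ×-dec Bad? e)
      R = sum (λ y → card (Ray? y))
      eq : ∀ a b c d → a * (b * c) * d ≡ a * (b * d) * c
      eq = solve-∀
      eq′ : ∀ a b c → a * b * c ≡ a * c * b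
      eq′ = solve-∀
      inner? : ∀ e → Dec ((Own e × Bad e) × x ∈ e × Within x T e)
      inner? e = (Own? e ×-dec Bad? e) ×-dec ((x ∈? e) ×-dec Within? x T e)
      bO≤ : bO ≤ card Stray? + t * t
      bO≤ = ≤-trans (card-+ (λ e → Own? e ×-dec Bad? e) Stray? inner? (λ e (o , bd) → case (x ∈? e) ×-dec Within? x T e of λ
          { (yes p) → inj₂ ((o , bd) , p) ; (no ¬p) → inj₁ (o , bd , ¬p) }))
        (+-monoʳ-≤ (card Stray?) (card-inside x (on? T) inner? (λ e (_ , p) → p)))
      rays≥ : t * z ≤ R
      rays≥ = begin
        t * z ≡⟨ sum-ind-* (on? T) z ⟨
        sum (λ y → ind (on? T y) * z) ≤⟨ sum-mono (λ y → per y (on? T y)) ⟩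
        R ∎
        where
        per : ∀ y (d : Dec (on T y)) → ind d * z ≤ card (Ray? y)
        per y (no _) = z≤n
        per y (yes o) = ≤-trans (≤-reflexive (*-identityˡ z)) (long y o)
      rays : ∑ᶜ (λ H → prod (λ y → ind (cnt (Ray? y) H ≤? l))) * 2 ^ R ≤ 2 ^ (t * c) * 2 ^ m
      rays = begin
        ∑ᶜ F * 2 ^ R ≡⟨ cong (∑ᶜ F *_) (prod-^ 2 (λ y → card (Ray? y))) ⟨
        ∑ᶜ F * prod (λ y → 2 ^ card (Ray? y))
          ≤⟨ indep Ray? (λ y H → ind (cnt (Ray? y) H ≤? l)) (λ y → 2 ^ card (Ray? y)) (λ y → 2 ^ (ind (on? T y) * c))
               (λ y → ind-cnt-Local (Ray? y) l (λ _ p → p)) (rays-disjoint T⊆Y) (λ y → per y (on? T y) refl) ⟩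
        prod (λ y → 2 ^ (ind (on? T y) * c)) * 2 ^ m ≡⟨ cong (_* 2 ^ m) (trans (prod-^ 2 (λ y → ind (on? T y) * c)) (cong (2 ^_) (sum-ind-* (on? T) c))) ⟩
        2 ^ (t * c) * 2 ^ m ∎
        where
        F : Vec Bool m → ℕ
        F H = prod (λ y → ind (cnt (Ray? y) H ≤? l))
        per : ∀ y (d : Dec (on T y)) → d ≡ on? T y → ∑ᶜ (λ H → ind (cnt (Ray? y) H ≤? l)) * 2 ^ card (Ray? y) ≤ 2 ^ (ind d * c) * 2 ^ m
        per y (yes o) _ = ≤-trans (few-sum (Ray? y) l k r (≤-trans (≤-trans (card-mono (Ray? y) (λ e → (x ∈? e) ×-dec (y ∈? e)) (λ e (_ , _ , p , q , _) → p , q))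
            (card-∋₂ (X≢Y (proj₂ (T⊆Y y o)) (proj₁ (T⊆Y y o))))) small))
          (≤-reflexive (cong (λ q → 2 ^ q * 2 ^ m) (sym (*-identityˡ c))))
        per y (no ¬o) _ = begin
          ∑ᶜ (λ H → ind (cnt (Ray? y) H ≤? l)) * 2 ^ card (Ray? y) ≤⟨ *-mono-≤ (∑ᶜ-mono (λ H → ind≤1 (cnt (Ray? y) H ≤? l))) (≤-reflexive (cong (2 ^_) (card-empty (Ray? y) (λ e (o , _) → ¬o o)))) ⟩
          ∑ᶜ {m} (λ _ → 1) * 1 ≡⟨ trans (*-identityʳ _) (∑ᶜ-const m 1) ⟩
          1 * 2 ^ m ∎
      both : ∑ᶜ star * (2 ^ card Stray? * 2 ^ R) ≤ 2 ^ E * 2 ^ (t * c) * 2 ^ m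
      both = indep-bound Stray? (λ H → ind (cnt Stray? H ≤? b)) (λ H → prod (λ y → ind (cnt (Ray? y) H ≤? l)))
        (ind-cnt-Local Stray? b (λ _ p → p))
        (Local-prod (λ y → ind-cnt-Local (Ray? y) l (λ e (_ , _ , _ , _ , g) (_ , bd , _) → bd g)))
        (2 ^ card Stray?) (2 ^ R) (2 ^ E) (2 ^ (t * c)) hS rays

  Own : VSet → Fin n → Fin m → Set
  Own A v e = Inside A e × v ∈ e

  Own? : ∀ A v e → Dec (Own A v e)
  Own? A v e = Inside? A e ×-dec (v ∈? e)

  Own⇒∉ : ∀ A v e → Own A v e → ¬ Inside (A − v) e
  Own⇒∉ A v e (_ , v∈) i = −-≢ A v v (i v v∈) refl

  badIn-− : ∀ A v → badIn A ≤ badIn (A − v) + card (λ e → Own? A v e ×-dec Bad? e)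
  badIn-− A v = card-+ (λ e → Inside? A e ×-dec Bad? e) (λ e → Inside? (A − v) e ×-dec Bad? e) (λ e → Own? A v e ×-dec Bad? e)
    (λ e (i , bd) → case v ∈? e of λ
      { (yes v∈) → inj₂ ((i , v∈) , bd)
      ; (no v∉) → inj₁ ((λ w w∈ → −-intro A (i w w∈) (λ { refl → v∉ w∈ })) , bd) })

  -- Few edges of types 1 and 2 at v ∈ Y: the (|X| choose 2) good edges lost outweigh the |Y|² edges of type 0.
  module LowY (A : VSet) (v : Fin n) (Av : A v ≡ true) (Yv : Y v) (b : ℕ) where

    S? : ∀ e → Dec (Own A v e × (typ e ≡ 1 ⊎ typ e ≡ 2))
    S? e = Own? A v e ×-dec ((typ e ≟ 1) ⊎-dec (typ e ≟ 2))

    lowY : Vec Bool m → ℕ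
    lowY H = ind (cnt S? H ≤? b)

    lowY-Local : Local (λ e → ¬ Inside (A − v) e) lowY
    lowY-Local = ind-cnt-Local S? b (λ e (o , _) → Own⇒∉ A v e o)

    lowY-sum : ∀ k r σ x₀ y₁ → n * n ≤ 2 ^ k * r → x₀ < card (XA? A) → card (YA? A) ≤ y₁ →
      2 * (y₁ * y₁ + (suc k * b + r) + σ) ≤ x₀ * x₀ →
      ∑ᶜ lowY * 2 ^ card (λ e → Own? A v e ×-dec Bad? e) * 2 ^ σ ≤ 2 ^ m
    lowY-sum k r σ x₀ y₁ small x₀< y≤ num = ≤-trans (≤-reflexive (exp-merge (∑ᶜ lowY) bt σ))
      (2^-cancel (∑ᶜ lowY) (bt + σ) (suc k * b + r) (card S?) exps
        (few-sum S? b k r (≤-trans (≤-trans (card-mono S? (λ e → v ∈? e) (λ e → proj₂ ∘ proj₁)) (card-∋ v)) small)))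
      where
      bt = card (λ e → Own? A v e ×-dec Bad? e)
      S₁? : ∀ e → Dec (Own A v e × typ e ≡ 1)
      S₁? e = Own? A v e ×-dec (typ e ≟ 1)
      S₂? : ∀ e → Dec (Own A v e × typ e ≡ 2)
      S₂? e = Own? A v e ×-dec (typ e ≟ 2)
      S₀? : ∀ e → Dec (Own A v e × typ e ≡ 0)
      S₀? e = Own? A v e ×-dec (typ e ≟ 0)
      types : ∀ e → v ∈ e → Bad e → typ e ≡ 1 ⊎ typ e ≡ 0
      types e v∈ bd with split₁ v∈
      ... | a , c , t with X⊎Y a | X⊎Y c
      ...   | inj₁ p | inj₁ q = ⊥-elim (bd (typ-wts t (wt-Y Yv) (wt-X p) (wt-X q)))
      ...   | inj₁ p | inj₂ q = inj₁ (typ-wts t (wt-Y Yv) (wt-X p) (wt-Y q))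
      ...   | inj₂ p | inj₁ q = inj₁ (typ-wts t (wt-Y Yv) (wt-Y p) (wt-X q))
      ...   | inj₂ p | inj₂ q = inj₂ (typ-wts t (wt-Y Yv) (wt-Y p) (wt-Y q))
      bt≤ : bt ≤ card S₁? + card S₀?
      bt≤ = card-+ (λ e → Own? A v e ×-dec Bad? e) S₁? S₀? (λ e (o , bd) → case types e (proj₂ o) bd of λ
        { (inj₁ p) → inj₁ (o , p) ; (inj₂ p) → inj₂ (o , p) })
      S≥ : card S₁? + card S₂? ≤ card S?
      S≥ = card-disj S? S₁? S₂? (λ e (o , p) → o , inj₁ p) (λ e (o , p) → o , inj₂ p) (λ e (_ , p) (_ , q) → case trans (sym p) q of λ ())
      S₀≤ : card S₀? ≤ y₁ * y₁
      S₀≤ = ≤-trans (card-inside v (YA? A) S₀? (λ e ((i , v∈) , ty) → v∈ , λ w w∈ w≢v → i w w∈ , inY e ty v∈ w∈ (w≢v ∘ sym)))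
        (*-mono-≤ y≤ y≤)
        where
        inY : ∀ e {w} → typ e ≡ 0 → v ∈ e → w ∈ e → v ≢ w → Y w
        inY e ty v∈ w∈ v≢w with split₂ v∈ w∈ v≢w
        ... | u , t = 0⇒Y (m+n≡0⇒m≡0 _ (trans (cong (λ z → z + wt _ + wt u) (sym (wt-Y Yv))) (trans (sym (typ-Tri t)) ty)))
      S₂≥ : x₀ * x₀ ≤ 2 * card S₂?
      S₂≥ = ≤-trans (many-pairs (XA? A) x₀ x₀<)
        (card-pairs v (λ a c → XA? A a ×-dec (XA? A c ×-dec ¬? (a ≟ᶠ c))) S₂? (λ a c ((Aa , Xa) , (Ac , Xc) , a≢c) →
          let e , t = edge v a c ((X≢Y Xa Yv ∘ sym) , (X≢Y Xc Yv ∘ sym) , a≢c) in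
          e , t , ((λ w w∈ → case only t w∈ of λ { (inj₁ refl) → Av ; (inj₂ (inj₁ refl)) → Aa ; (inj₂ (inj₂ refl)) → Ac }) , proj₁ (proj₁ t)) ,
          typ-wts t (wt-Y Yv) (wt-X Xa) (wt-X Xc)))
      -- Edges of type 1 cancel: they must be paid for as bad edges, but they also belong to the set
      -- in which only few edges are on.
      exps : bt + σ + (suc k * b + r) ≤ card S?
      exps = begin
        bt + σ + E ≤⟨ +-monoˡ-≤ E (+-monoˡ-≤ σ (≤-trans bt≤ (+-monoʳ-≤ (card S₁?) S₀≤))) ⟩
        card S₁? + y₁ * y₁ + σ + E ≡⟨ eq (card S₁?) (y₁ * y₁) σ E ⟩
        card S₁? + (y₁ * y₁ + E + σ) ≤⟨ +-monoʳ-≤ (card S₁?) (*-cancelˡ-≤ {y₁ * y₁ + E + σ} {card S₂?} 2 (≤-trans num S₂≥)) ⟩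
        card S₁? + card S₂? ≤⟨ S≥ ⟩
        card S? ∎
        where
        open ≤-Reasoning
        E = suc k * b + r
        eq : ∀ a b c d → a + b + c + d ≡ a + (b + d + c)
        eq = solve-∀

  -- A union bound over the set T of those y for which the pair x y has small codegree.
  module Fan (x : Fin n) {Q : Fin m → Set} (Q? : ∀ e → Dec (Q e)) {φ : Vec Bool n → Set} (φ? : ∀ T → Dec (φ T)) (b l : ℕ) where

    private module St (T : Vec Bool n) = Star x Q? T b l

    fan : Vec Bool m → ℕ
    fan H = ∑ᶜ (λ T → ind (φ? T) * St.star T H)

    fan-Local : Local Q fan
    fan-Local = Local-∑ᶜ (λ T H H′ h → cong (ind (φ? T) *_) (St.star-Local T H H′ h))

    1≤fan : ∀ H T → φ T → cnt (St.Stray? T) H ≤ b → (∀ y → on T y → codeg x y H ≤ l) → 1 ≤ fan H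
    1≤fan H T p h k = ≤-trans (1≤* (1≤ind (φ? T) p) (St.1≤star T H h k)) (≤∑ᶜ (λ T → ind (φ? T) * St.star T H) T)

    bO : ℕ
    bO = card (λ e → Q? e ×-dec Bad? e)

    private
      swap-sum : ∀ q → ∑ᶜ fan * q ≡ ∑ᶜ (λ T → ind (φ? T) * ∑ᶜ (St.star T) * q)
      swap-sum q = trans (cong (_* q) (trans (∑ᶜ-comm (λ T H → ind (φ? T) * St.star T H)) (∑ᶜ-cong (λ T → ∑ᶜ-*ˡ (ind (φ? T)) (St.star T)))))
        (sym (∑ᶜ-*ʳ q _))

      guarded : ∀ {C : Set} (d : Dec C) {s q p B} → (C → s * q * p ≤ B) → ind d * s * q * p ≤ B
      guarded (yes c) {s} {q} {p} h = ≤-trans (≤-reflexive (cong (λ z → z * q * p) (*-identityˡ s))) (h c)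
      guarded (no _) h = z≤n

    -- Summing over T costs nothing when each element of T gains a factor 2^τ with 2^τ ≥ 2n.
    fan-geometric : ∀ τ q → (∀ T → φ T → ∑ᶜ (St.star T) * q * 2 ^ (τ * card (on? T)) ≤ 2 ^ m) →
      ∑ᶜ fan * q * 2 ^ (τ * n) ≤ suc (2 ^ τ) ^ n * 2 ^ m
    fan-geometric τ q h = ≤-trans (≤-reflexive (cong (_* 2 ^ (τ * n)) (swap-sum q)))
      (geometric τ (2 ^ m) (λ T → ind (φ? T) * ∑ᶜ (St.star T) * q) (λ T → guarded (φ? T) {∑ᶜ (St.star T)} {q} {2 ^ (τ * card (on? T))} (h T)))

    -- The plain union bound at a cost of n bits, affordable where T is so large that its star saves
    -- quadratically many.
    fan-union : ∀ q → (∀ T → φ T → ∑ᶜ (St.star T) * q * 2 ^ n ≤ 2 ^ m) → ∑ᶜ fan * q ≤ 2 ^ m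
    fan-union q h = *-cancelʳ-2^ n (begin
      ∑ᶜ fan * q * 2 ^ n ≡⟨ cong (_* 2 ^ n) (swap-sum q) ⟩
      ∑ᶜ (λ T → ind (φ? T) * ∑ᶜ (St.star T) * q) * 2 ^ n ≡⟨ ∑ᶜ-*ʳ (2 ^ n) _ ⟨
      ∑ᶜ (λ T → ind (φ? T) * ∑ᶜ (St.star T) * q * 2 ^ n) ≤⟨ ∑ᶜ-mono (λ T → guarded (φ? T) {∑ᶜ (St.star T)} {q} {2 ^ n} (h T)) ⟩
      ∑ᶜ {n} (λ _ → 2 ^ m) ≡⟨ ∑ᶜ-const n (2 ^ m) ⟩
      2 ^ m * 2 ^ n ∎)
      where open ≤-Reasoning

    star-gain : ∀ T → (∀ y → on T y → Y y × X x) → ∀ k r E z a → n ≤ 2 ^ k * r → (∀ y → on T y → z ≤ card (St.Ray? T y)) →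
      ∑ᶜ (λ H → ind (cnt (St.Stray? T) H ≤? b)) * 2 ^ card (St.Stray? T) ≤ 2 ^ E * 2 ^ m →
      a + (E + card (on? T) * (suc k * l + r) + card (on? T) * card (on? T)) ≤ card (on? T) * z →
      ∑ᶜ (St.star T) * 2 ^ bO * 2 ^ a ≤ 2 ^ m
    star-gain T fits k r E z a small long hS num = 2^-cancel (∑ᶜ (St.star T) * 2 ^ bO) a _ _ num (St.star-sum T fits k r E z small long hS)

  rays-inside : ∀ A x T → A x ≡ true → (∀ y → on T y → (A y ≡ true × Y y) × X x) → ∀ b l x₀ → x₀ < card (XA? A) →
    ∀ y → on T y → x₀ ≤ card (Star.Ray? x (Own? A x) T b l y)
  rays-inside A x T Ax fits b l x₀ x₀< y o = ≤-pred (≤-trans x₀< (≤-trans (card-− X? A x) (s≤s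
    (card-third x y (XA? (A − x)) (Star.Ray? x (Own? A x) T b l y) (λ u (A′u , Xu) →
      let x≢y = X≢Y Xx Yy ; x≢u = −-≢ A x u A′u ∘ sym
          e , t = edge x y u (x≢y , x≢u , X≢Y Xu Yy ∘ sym) in
      e , t , o , ((λ w w∈ → case only t w∈ of λ { (inj₁ refl) → Ax ; (inj₂ (inj₁ refl)) → Ay ; (inj₂ (inj₂ refl)) → −-⊆ A x u A′u }) , proj₁ (proj₁ t)) ,
      proj₁ (proj₁ t) , proj₁ (proj₂ (proj₁ t)) , typ-wts t (wt-X Xx) (wt-Y Yy) (wt-X Xu))))))
    where
    Ay = proj₁ (proj₁ (fits y o))
    Yy = proj₂ (proj₁ (fits y o))
    Xx = proj₂ (fits y o)

  InY : VSet → Vec Bool n → Set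
  InY A T = ∀ y → on T y → A y ≡ true × Y y

  opaque
    InY? : ∀ A T → Dec (InY A T)
    InY? A T = all? λ y → on? T y →-dec ((A y ≟ᵇ true) ×-dec Y? y)

  power-double : ∀ τ → 2 * n ≤ suc (2 ^ τ) → suc (2 ^ τ) ^ n ≤ 2 * 2 ^ (τ * n)
  power-double τ h = ≤-trans (half-ratio (2 ^ τ) n h) (*-monoʳ-≤ 2 (≤-reflexive (^-*-assoc 2 τ n)))

  -- Each y ∈ T loses almost all of the |X| good edges at x y but allows at most |T| bad edges at x y.
  module LowX (A : VSet) (x : Fin n) (b l τ : ℕ) where

    Large? : ∀ T → Dec (InY A T × τ ≤ card (on? T))
    Large? T = InY? A T ×-dec (τ ≤? card (on? T))

    open Fan x (Own? A x) Large? b l public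

    lowX-sum : A x ≡ true → X x → ∀ k r r₁ σ x₀ y₁ w → n * n ≤ 2 ^ k * r → n ≤ 2 ^ k * r₁ →
      x₀ < card (XA? A) → card (YA? A) ≤ y₁ →
      suc k * l + r₁ + y₁ + w ≤ x₀ → σ + n + (suc k * b + r) ≤ τ * w →
      ∑ᶜ fan * 2 ^ bO * 2 ^ σ ≤ 2 ^ m
    lowX-sum Ax Xx k r r₁ σ x₀ y₁ w small small₁ x₀< y≤ h₁ h₂ =
      ≤-trans (≤-reflexive (*-assoc (∑ᶜ fan) (2 ^ bO) (2 ^ σ))) (fan-union (2 ^ bO * 2 ^ σ) per-T)
      where
      open ≤-Reasoning
      E = suc k * b + r
      c = suc k * l + r₁
      per-T : ∀ T → InY A T × τ ≤ card (on? T) → ∑ᶜ (Star.star x (Own? A x) T b l) * (2 ^ bO * 2 ^ σ) * 2 ^ n ≤ 2 ^ m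
      per-T T (inY , τ≤) = ≤-trans (≤-reflexive (trans (cong (_* 2 ^ n) (sym (*-assoc s (2 ^ bO) (2 ^ σ)))) (exp-merge (s * 2 ^ bO) σ n)))
        (star-gain T (λ y o → proj₂ (inY y o) , Xx) k r₁ E x₀ (σ + n) small₁
          (rays-inside A x T Ax (λ y o → inY y o , Xx) b l x₀ x₀<)
          (few-sum (Star.Stray? x (Own? A x) T b l) b k r (≤-trans (≤-trans (card-mono (Star.Stray? x (Own? A x) T b l) (λ e → x ∈? e) (λ e → proj₂ ∘ proj₁)) (card-∋ x)) small))
          (begin
            σ + n + (E + t * c + t * t) ≡⟨ eq₁ (σ + n) E (t * c) (t * t) ⟩
            σ + n + E + (t * c + t * t) ≤⟨ +-mono-≤ (≤-trans h₂ (*-monoˡ-≤ w τ≤)) (+-monoʳ-≤ (t * c) (*-monoʳ-≤ t (≤-trans (card-mono (on? T) (YA? A) inY) y≤))) ⟩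
            t * w + (t * c + t * y₁) ≡⟨ eq₂ t w c y₁ ⟩
            t * (c + y₁ + w) ≤⟨ *-monoʳ-≤ t h₁ ⟩
            t * x₀ ∎))
        where
        s = ∑ᶜ (Star.star x (Own? A x) T b l)
        t = card (on? T)
        eq₁ : ∀ a b c d → a + (b + c + d) ≡ a + b + (c + d)
        eq₁ = solve-∀
        eq₂ : ∀ t a b c → t * a + (t * b + t * c) ≡ t * (b + c + a)
        eq₂ = solve-∀

  -- A bad edge x y y′ within T gives two pairs x y, x y′ of small codegree, costing 2|X| bits.
  module Special (A : VSet) (x : Fin n) (l τ : ℕ) where

    Small? : ∀ T → Dec (InY A T × 2 ≤ card (on? T) × card (on? T) ≤ τ)
    Small? T = InY? A T ×-dec ((2 ≤? card (on? T)) ×-dec (card (on? T) ≤? τ))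

    open Fan x (Own? A x) Small? 0 l public

    special-sum : A x ≡ true → X x → ∀ k r₁ σ ς x₀ → n ≤ 2 ^ k * r₁ → x₀ < card (XA? A) → 2 * n ≤ suc (2 ^ τ) →
      suc k * l + r₁ + 2 * τ + ς ≤ x₀ → suc σ ≤ 2 * ς → ∑ᶜ fan * 2 ^ bO * 2 ^ σ ≤ 2 ^ m
    -- The bit by which 2ς exceeds σ pays for the factor 2 from `power-double`.
    special-sum Ax Xx k r₁ σ ς x₀ small₁ x₀< τ-big h₁ h₂ = 2^-cancel (∑ᶜ fan * 2 ^ bO) σ 1 (2 * ς) (≤-trans (≤-reflexive (+-comm σ 1)) h₂)
      (*-cancelʳ-2^ (τ * n) (begin
        ∑ᶜ fan * 2 ^ bO * 2 ^ (2 * ς) * 2 ^ (τ * n) ≡⟨ cong (_* 2 ^ (τ * n)) (*-assoc (∑ᶜ fan) (2 ^ bO) (2 ^ (2 * ς))) ⟩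
        ∑ᶜ fan * (2 ^ bO * 2 ^ (2 * ς)) * 2 ^ (τ * n) ≤⟨ fan-geometric τ (2 ^ bO * 2 ^ (2 * ς)) per-T ⟩
        suc (2 ^ τ) ^ n * 2 ^ m ≤⟨ *-monoˡ-≤ (2 ^ m) (power-double τ τ-big) ⟩
        2 * 2 ^ (τ * n) * 2 ^ m ≡⟨ eq₀ (2 ^ (τ * n)) (2 ^ m) ⟩
        2 * 2 ^ m * 2 ^ (τ * n) ∎))
      where
      open ≤-Reasoning
      eq₀ : ∀ a b → 2 * a * b ≡ 2 * b * a
      eq₀ = solve-∀
      c = suc k * l + r₁
      -- Here τ has two roles: as a bound for |T| it gives |T|² ≤ τ|T|, and as an exponent it is the
      -- number of bits each element of T contributes towards the sum over T. This explains 2τ in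
      -- the hypothesis.
      per-T : ∀ T → InY A T × 2 ≤ card (on? T) × card (on? T) ≤ τ →
        ∑ᶜ (Star.star x (Own? A x) T 0 l) * (2 ^ bO * 2 ^ (2 * ς)) * 2 ^ (τ * card (on? T)) ≤ 2 ^ m
      per-T T (inY , 2≤ , ≤τ) = ≤-trans (≤-reflexive (trans (cong (_* 2 ^ (τ * t)) (sym (*-assoc s (2 ^ bO) (2 ^ (2 * ς))))) (exp-merge (s * 2 ^ bO) (2 * ς) (τ * t))))
        (star-gain T (λ y o → proj₂ (inY y o) , Xx) k r₁ 0 x₀ (2 * ς + τ * t) small₁
          (rays-inside A x T Ax (λ y o → inY y o , Xx) 0 l x₀ x₀<)
          (≤-trans (none-sum (Star.Stray? x (Own? A x) T 0 l)) (≤-reflexive (sym (*-identityˡ (2 ^ m)))))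
          (begin
            2 * ς + τ * t + (0 + t * c + t * t) ≤⟨ +-mono-≤ (+-mono-≤ (*-monoˡ-≤ ς 2≤) (≤-reflexive (*-comm τ t))) (+-monoʳ-≤ (t * c) (*-monoʳ-≤ t ≤τ)) ⟩
            t * ς + t * τ + (t * c + t * τ) ≡⟨ eq₂ t ς τ c ⟩
            t * (c + 2 * τ + ς) ≤⟨ *-monoʳ-≤ t h₁ ⟩
            t * x₀ ∎))
        where
        s = ∑ᶜ (Star.star x (Own? A x) T 0 l)
        t = card (on? T)
        eq₂ : ∀ t a b c → t * a + t * b + (t * c + t * b) ≡ t * (c + 2 * b + a)
        eq₂ = solve-∀

  -- Bad edges whose three vertices are removed

  module Remove₃ (A : VSet) (a b c : Fin n) where

    A₃ : VSet
    A₃ = A − a − b − c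

    Touch : Fin m → Set
    Touch e = Inside A e × ∃ λ u → u ∈ e × u ∈³ (a , b , c)

    opaque
      Touch? : ∀ e → Dec (Touch e)
      Touch? e = Inside? A e ×-dec any? (λ u → (u ∈? e) ×-dec (u ∈³? (a , b , c)))

    TouchBad? : ∀ e → Dec (Touch e × Bad e)
    TouchBad? e = Touch? e ×-dec Bad? e

    A₃-intro : ∀ {w} → A w ≡ true → ¬ (w ∈³ (a , b , c)) → A₃ w ≡ true
    A₃-intro p h = −-intro (A − a − b) (−-intro (A − a) (−-intro A p (h ∘ inj₁)) (h ∘ inj₂ ∘ inj₁)) (h ∘ inj₂ ∘ inj₂)

    A₃-⊆ : ∀ w → A₃ w ≡ true → A w ≡ true
    A₃-⊆ w p = −-⊆ A a w (−-⊆ (A − a) b w (−-⊆ (A − a − b) c w p))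

    A₃-avoids : ∀ w → A₃ w ≡ true → ¬ (w ∈³ (a , b , c))
    A₃-avoids w p (inj₁ q) = −-≢ A a w (−-⊆ (A − a) b w (−-⊆ (A − a − b) c w p)) q
    A₃-avoids w p (inj₂ (inj₁ q)) = −-≢ (A − a) b w (−-⊆ (A − a − b) c w p) q
    A₃-avoids w p (inj₂ (inj₂ q)) = −-≢ (A − a − b) c w p q

    Touch⇒∉ : ∀ e → Touch e → ¬ Inside A₃ e
    Touch⇒∉ e (_ , u , u∈ , u∈R) i = A₃-avoids u (i u u∈) u∈R

    badIn-A₃ : badIn A ≤ badIn A₃ + card TouchBad?
    badIn-A₃ = card-+ (λ e → Inside? A e ×-dec Bad? e) (λ e → Inside? A₃ e ×-dec Bad? e) TouchBad?
      (λ e (i , bd) → case Touch? e of λ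
        { (yes t) → inj₂ (t , bd)
        ; (no ¬t) → inj₁ ((λ w w∈ → A₃-intro (i w w∈) (λ r → ¬t (i , w , w∈ , r))) , bd) })

    card-A₃ : ∀ {Q : Fin n → Set} (Q? : ∀ v → Dec (Q v)) →
      card (λ w → (A w ≟ᵇ true) ×-dec Q? w) ≤ 3 + card (λ w → (A₃ w ≟ᵇ true) ×-dec Q? w)
    card-A₃ Q? = ≤-trans (card-− Q? A a) (s≤s (≤-trans (card-− Q? (A − a) b) (s≤s (card-− Q? (A − a − b) c))))

    card-Touch : card TouchBad? ≤ 3 * (n * n)
    card-Touch = begin
      card TouchBad? ≤⟨ card-cover TouchBad? (λ u e → (u ∈³? (a , b , c)) ×-dec (u ∈? e)) (λ e ((_ , u , u∈ , r) , _) → u , r , u∈) ⟩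
      sum (λ u → card (λ e → (u ∈³? (a , b , c)) ×-dec (u ∈? e)))
        ≤⟨ sum-mono (λ u → card-guard (u ∈³? (a , b , c)) (λ e → (u ∈³? (a , b , c)) ×-dec (u ∈? e)) (n * n) (λ _ → proj₁)
             (λ _ → ≤-trans (card-mono _ (λ e → u ∈? e) (λ _ → proj₂)) (card-∋ u))) ⟩
      sum (λ u → ind (u ∈³? (a , b , c)) * (n * n)) ≡⟨ sum-ind-* (λ u → u ∈³? (a , b , c)) (n * n) ⟩
      card (λ u → u ∈³? (a , b , c)) * (n * n) ≤⟨ *-monoˡ-≤ (n * n) three ⟩
      3 * (n * n) ∎
      where
      open ≤-Reasoning
      one : ∀ x → card (λ u → u ≟ᶠ x) ≤ 1
      one x = card-≤1 (λ u → u ≟ᶠ x) (λ _ _ p q → trans p (sym q))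
      three : card (λ u → u ∈³? (a , b , c)) ≤ 3
      three = ≤-trans (card-+ (λ u → u ∈³? (a , b , c)) (λ u → u ≟ᶠ a) (λ u → (u ≟ᶠ b) ⊎-dec (u ≟ᶠ c)) (λ _ p → p))
        (+-mono-≤ (one a) (≤-trans (card-+ (λ u → (u ≟ᶠ b) ⊎-dec (u ≟ᶠ c)) (λ u → u ≟ᶠ b) (λ u → u ≟ᶠ c) (λ _ p → p)) (+-mono-≤ (one b) (one c))))

  -- If a b c is an edge inside one part, then for each good edge a p q, not all of a p q, b p q, c p q are present.
  module MonoEdge (A : VSet) (a b c : Fin n) (Aabc : A a ≡ true × A b ≡ true × A c ≡ true)
    (dabc : Distinct (a , b , c)) (same : wt a ≡ wt b × wt a ≡ wt c) (Δ₃ : ℕ) where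
    open Remove₃ A a b c

    Lab : Fin m → Set
    Lab e = Inside A e × Good e × a ∈ e × ¬ (b ∈ e) × ¬ (c ∈ e)

    Lab? : ∀ e → Dec (Lab e)
    Lab? e = Inside? A e ×-dec (Good? e ×-dec ((a ∈? e) ×-dec (¬? (b ∈? e) ×-dec ¬? (c ∈? e))))

    J : Fin m → Fin m → Set
    J e f = Lab e × (∀ w → w ∈ e → w ≢ a → w ∈ f) × ∃ λ u → u ∈ f × u ∈³ (a , b , c)

    opaque
      J? : ∀ e f → Dec (J e f)
      J? e f = Lab? e ×-dec (all? (λ w → (w ∈? e) →-dec (¬? (w ≟ᶠ a) →-dec (w ∈? f))) ×-dec any? (λ u → (u ∈? f) ×-dec (u ∈³? (a , b , c))))

    wt-R : ∀ {u} → u ∈³ (a , b , c) → wt u ≡ wt a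
    wt-R (inj₁ refl) = refl
    wt-R (inj₂ (inj₁ refl)) = sym (proj₁ same)
    wt-R (inj₂ (inj₂ refl)) = sym (proj₂ same)

    A-R : ∀ {u} → u ∈³ (a , b , c) → A u ≡ true
    A-R (inj₁ refl) = proj₁ Aabc
    A-R (inj₂ (inj₁ refl)) = proj₁ (proj₂ Aabc)
    A-R (inj₂ (inj₂ refl)) = proj₂ (proj₂ Aabc)

    avoid : ∀ {e p} → Lab e → p ∈ e → p ≢ a → ¬ (p ∈³ (a , b , c))
    avoid _ _ p≢a (inj₁ q) = p≢a q
    avoid (_ , _ , _ , b∉ , _) p∈ _ (inj₂ (inj₁ refl)) = b∉ p∈
    avoid (_ , _ , _ , _ , c∉) p∈ _ (inj₂ (inj₂ refl)) = c∉ p∈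

    around : ∀ {e} → Lab e → ∃ λ p → ∃ λ q → Tri e a p q × ¬ (p ∈³ (a , b , c)) × ¬ (q ∈³ (a , b , c))
    around L@(_ , _ , a∈ , _) with split₁ a∈
    ... | p , q , t@((_ , p∈ , q∈) , (a≢p , a≢q , _)) = p , q , t , avoid L p∈ (a≢p ∘ sym) , avoid L q∈ (a≢q ∘ sym)

    shape : ∀ {e f p q} → J e f → Tri e a p q → ¬ (p ∈³ (a , b , c)) → ¬ (q ∈³ (a , b , c)) →
      ∃ λ u → Tri f p q u × u ∈³ (a , b , c)
    shape (_ , sub , u , u∈ , u∈R) ((_ , p∈ , q∈) , (a≢p , a≢q , p≢q)) p∉R q∉R =
      u , ((sub _ p∈ (a≢p ∘ sym) , sub _ q∈ (a≢q ∘ sym) , u∈) , (p≢q , (λ { refl → p∉R u∈R }) , (λ { refl → q∉R u∈R }))) , u∈R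

    -- The vertices of f outside {a, b, c} are p and q, and together with a they give back e.
    disjoint : ∀ e e′ f → J e f → J e′ f → e ≡ e′
    disjoint e e′ f j@(L , _) j′@(L′ , _) with around L | around L′
    ... | p , q , t , p∉ , q∉ | p′ , q′ , t′ , p′∉ , q′∉ with shape j t p∉ q∉ | shape j′ t′ p′∉ q′∉
    ...   | u , s , u∈R | u′ , s′ , u′∈R = Tri-unique t
      ((proj₁ (proj₁ t′) , in′ p∉ (proj₁ (proj₁ s)) , in′ q∉ (proj₁ (proj₂ (proj₁ s)))) , proj₂ t)
      where
      in′ : ∀ {w} → ¬ (w ∈³ (a , b , c)) → w ∈ f → w ∈ e′
      in′ w∉R w∈f with only s′ w∈f
      ... | inj₁ refl = proj₁ (proj₂ (proj₁ t′))
      ... | inj₂ (inj₁ refl) = proj₂ (proj₂ (proj₁ t′))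
      ... | inj₂ (inj₂ refl) = ⊥-elim (w∉R u′∈R)

    block-size : ∀ e → Lab e → card (J? e) ≤ 3
    block-size e L with around L
    ... | p , q , t , p∉ , q∉ = begin
      card (J? e) ≤⟨ card-cover (J? e) (λ u f → (u ∈³? (a , b , c)) ×-dec Tri? f p q u) (λ f j → let u , s , u∈R = shape j t p∉ q∉ in u , u∈R , s) ⟩
      sum (λ u → card (λ f → (u ∈³? (a , b , c)) ×-dec Tri? f p q u))
        ≤⟨ sum-mono (λ u → card-guard₁ (u ∈³? (a , b , c)) (λ f → (u ∈³? (a , b , c)) ×-dec Tri? f p q u) (λ _ → proj₁) (λ _ → card-≤1 _ (λ _ _ (_ , s) (_ , s′) → Tri-unique s s′))) ⟩
      sum (λ u → ind (u ∈³? (a , b , c))) ≡⟨ sum-cong-≗ (λ u → sym (*-identityʳ (ind (u ∈³? (a , b , c))))) ⟩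
      sum (λ u → ind (u ∈³? (a , b , c)) * 1) ≡⟨ sum-triple (λ _ → 1) a b c dabc ⟩
      3 ∎
      where open ≤-Reasoning

    J-touch : ∀ e f → J e f → Touch f × Good f
    J-touch e f j@(L@(i , g , a∈ , _) , _) with around L
    ... | p , q , t , p∉ , q∉ with shape j t p∉ q∉
    ...   | u , s , u∈R = ((λ w w∈ → case only s w∈ of λ
              { (inj₁ refl) → i w (proj₁ (proj₂ (proj₁ t))) ; (inj₂ (inj₁ refl)) → i w (proj₂ (proj₂ (proj₁ t))) ; (inj₂ (inj₂ refl)) → A-R u∈R })
            , u , proj₂ (proj₂ (proj₁ s)) , u∈R) ,
            (trans (typ-Tri s) (trans (cong (wt p + wt q +_) (wt-R u∈R)) (trans (rotate (wt p) (wt q) (wt a)) (trans (sym (typ-Tri t)) g))))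
      where
      rotate : ∀ x y z → x + y + z ≡ z + x + y
      rotate = solve-∀

    mono : Vec Bool m → ℕ
    mono H = ind (cnt TouchBad? H ≤? Δ₃) * prod (λ e → block (Lab? e) (J? e) H)

    mono-Local : Local (λ e → ¬ Inside A₃ e) mono
    mono-Local = Local-* (ind-cnt-Local TouchBad? Δ₃ (λ e (t , _) → Touch⇒∉ e t))
      (Local-prod (λ e → Local-⊆ (λ f j → Touch⇒∉ f (proj₁ (J-touch e f j))) (block-Local (Lab? e) (J? e))))

    1≤mono : ∀ H e₀ → T5-free (H ↾ A) → Tri e₀ a b c → on H e₀ → cnt TouchBad? H ≤ Δ₃ → 1 ≤ mono H
    1≤mono H e₀ free t₀ o₀ h = 1≤* (1≤ind (cnt TouchBad? H ≤? Δ₃) h)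
      (1≤prod (λ e → 1≤ind (Lab? e →-dec (1 ≤? off (J? e) H)) (λ L → openb e L (around L))))
      where
      i₀ : Inside A e₀
      i₀ w w∈ = A-R (only t₀ w∈)
      openb : ∀ e → Lab e → (∃ λ p → ∃ λ q → Tri e a p q × ¬ (p ∈³ (a , b , c)) × ¬ (q ∈³ (a , b , c))) → 1 ≤ off (J? e) H
      openb e L (p , q , t , p∉ , q∉) = case (on? H f₁ ×-dec (on? H f₂ ×-dec on? H f₃)) of λ
        -- T5 with common pair p q, the edge a b c being the one that joins the three other
        -- vertices.
        { (yes (o₁ , o₂ , o₃)) → ⊥-elim (free p q a b c f₁ f₂ f₃ e₀
            ((s₁ , s₂ , s₃ , t₀) , (↾-on {H} (proj₁ (proj₁ (J-touch e f₁ (Jf s₁ a∈R)))) o₁ , ↾-on {H} (proj₁ (proj₁ (J-touch e f₂ (Jf s₂ b∈R)))) o₂ ,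
              ↾-on {H} (proj₁ (proj₁ (J-touch e f₃ (Jf s₃ c∈R)))) o₃ , ↾-on {H} i₀ o₀)))
        ; (no ¬all) → case on? H f₁ of λ
          { (no ¬o) → missing f₁ (Jf s₁ a∈R) ¬o
          ; (yes o₁) → case on? H f₂ of λ
            { (no ¬o) → missing f₂ (Jf s₂ b∈R) ¬o
            ; (yes o₂) → missing f₃ (Jf s₃ c∈R) (λ o₃ → ¬all (o₁ , o₂ , o₃)) } } }
        where
        p≢q = proj₂ (proj₂ (proj₂ t))
        a∈R : a ∈³ (a , b , c)
        a∈R = inj₁ refl
        b∈R : b ∈³ (a , b , c)
        b∈R = inj₂ (inj₁ refl)
        c∈R : c ∈³ (a , b , c)
        c∈R = inj₂ (inj₂ refl)
        mk : ∀ u → u ∈³ (a , b , c) → ∃ λ f → Tri f p q u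
        mk u u∈R = edge p q u (p≢q , (λ { refl → p∉ u∈R }) , (λ { refl → q∉ u∈R }))
        f₁ = proj₁ (mk a a∈R)
        s₁ = proj₂ (mk a a∈R)
        f₂ = proj₁ (mk b b∈R)
        s₂ = proj₂ (mk b b∈R)
        f₃ = proj₁ (mk c c∈R)
        s₃ = proj₂ (mk c c∈R)
        Jf : ∀ {f u} → Tri f p q u → u ∈³ (a , b , c) → J e f
        Jf ((p∈ , q∈ , u∈) , _) u∈R = L , (λ w w∈ w≢a → case only t w∈ of λ
          { (inj₁ r) → contradiction r w≢a ; (inj₂ (inj₁ refl)) → p∈ ; (inj₂ (inj₂ refl)) → q∈ }) , _ , u∈ , u∈R
        missing : ∀ f → J e f → ¬ on H f → 1 ≤ off (J? e) H
        missing f j ¬o = 1≤card (λ f → J? e f ×-dec ¬? (on? H f)) f (j , ¬o)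

    labels : ∀ z → z < card (XA? A₃) → z < card (YA? A₃) → z * z ≤ 2 * card Lab?
    labels z z<X z<Y = case X⊎Y a of λ
      { (inj₁ Xa) → ≤-trans (mixed Xa) (card-pairs a (λ p q → XA? A₃ p ×-dec YA? A₃ q) Lab? (λ p q ((Ap , Xp) , (Aq , Yq)) →
          lab p q Ap Aq (X≢Y Xp Yq) (cong₂ _+_ (cong₂ _+_ (wt-X Xa) (wt-X Xp)) (wt-Y Yq))))
      ; (inj₂ Ya) → ≤-trans (many-pairs (XA? A₃) z z<X) (card-pairs a (λ p q → XA? A₃ p ×-dec (XA? A₃ q ×-dec ¬? (p ≟ᶠ q))) Lab? (λ p q ((Ap , Xp) , (Aq , Xq) , p≢q) →
          lab p q Ap Aq p≢q (cong₂ _+_ (cong₂ _+_ (wt-Y Ya) (wt-X Xp)) (wt-X Xq)))) }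
      where
      open ≤-Reasoning
      lab : ∀ p q → A₃ p ≡ true → A₃ q ≡ true → p ≢ q → wt a + wt p + wt q ≡ 2 → ∃ λ e → Tri e a p q × Lab e
      lab p q Ap Aq p≢q two = e , t , (λ w w∈ → case only t w∈ of λ { (inj₁ refl) → proj₁ Aabc ; (inj₂ (inj₁ refl)) → A₃-⊆ w Ap ; (inj₂ (inj₂ refl)) → A₃-⊆ w Aq }) ,
        trans (typ-Tri t) two , proj₁ (proj₁ t) , out (inj₂ (inj₁ refl)) (proj₁ dabc ∘ sym) , out (inj₂ (inj₂ refl)) (proj₁ (proj₂ dabc) ∘ sym)
        where
        p∉ = A₃-avoids p Ap
        q∉ = A₃-avoids q Aq
        E = edge a p q ((λ { refl → p∉ (inj₁ refl) }) , (λ { refl → q∉ (inj₁ refl) }) , p≢q)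
        e = proj₁ E
        t = proj₂ E
        out : ∀ {u} → u ∈³ (a , b , c) → u ≢ a → ¬ (u ∈ e)
        out u∈R u≢a u∈ with only t u∈
        ... | inj₁ r = u≢a r
        ... | inj₂ (inj₁ refl) = p∉ u∈R
        ... | inj₂ (inj₂ refl) = q∉ u∈R
      mixed : X a → z * z ≤ sum (λ p → card (λ q → XA? A₃ p ×-dec YA? A₃ q))
      mixed _ = begin
        z * z ≤⟨ *-mono-≤ (<⇒≤ z<X) (<⇒≤ z<Y) ⟩
        card (XA? A₃) * card (YA? A₃) ≡⟨ sum-ind-* (XA? A₃) (card (YA? A₃)) ⟨
        sum (λ p → ind (XA? A₃ p) * card (YA? A₃)) ≤⟨ sum-mono (λ p → row p (XA? A₃ p)) ⟩
        sum (λ p → card (λ q → XA? A₃ p ×-dec YA? A₃ q)) ∎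
        where
        row : ∀ p (d : Dec (A₃ p ≡ true × X p)) → ind d * card (YA? A₃) ≤ card (λ q → d ×-dec YA? A₃ q)
        row p (no _) = z≤n
        row p (yes h) = ≤-trans (≤-reflexive (*-identityˡ _)) (card-mono (YA? A₃) _ (λ _ q → h , q))

    -- The factor 12 is 2 * 6: ordered pairs count every label twice, and six labels save one bit.
    mono-sum : ∀ k r σ z → 3 * (n * n) ≤ 2 ^ k * r → z < card (XA? A₃) → z < card (YA? A₃) →
      12 * (σ + (suc k * Δ₃ + r)) ≤ z * z → ∑ᶜ mono * 2 ^ card TouchBad? * 2 ^ σ ≤ 2 ^ m
    mono-sum k r σ z small z<X z<Y num = 2^-cancel (∑ᶜ mono * 2 ^ card TouchBad?) σ E (σ + E) ≤-refl (begin
      ∑ᶜ mono * 2 ^ card TouchBad? * 2 ^ (σ + E) ≡⟨ *-assoc (∑ᶜ mono) _ _ ⟩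
      ∑ᶜ mono * (2 ^ card TouchBad? * 2 ^ (σ + E))
        ≤⟨ indep-bound TouchBad? (λ H → ind (cnt TouchBad? H ≤? Δ₃)) (λ H → prod (λ e → block (Lab? e) (J? e) H))
             (ind-cnt-Local TouchBad? Δ₃ (λ _ p → p))
             (Local-prod (λ e → Local-⊆ (λ f j (_ , bd) → bd (proj₂ (J-touch e f j))) (block-Local (Lab? e) (J? e))))
             (2 ^ card TouchBad?) (2 ^ (σ + E)) (2 ^ E) 1
             (few-sum TouchBad? Δ₃ k r (≤-trans card-Touch small))
             (≤-trans (blocks-bound Lab? J? disjoint block-size (σ + E) (*-cancelˡ-≤ {6 * (σ + E)} {card Lab?} 2 (≤-trans (≤-reflexive (sym (*-assoc 2 6 (σ + E)))) (≤-trans num (labels z z<X z<Y)))))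
               (≤-reflexive (sym (*-identityˡ _)))) ⟩
      2 ^ E * 1 * 2 ^ m ≡⟨ cong (_* 2 ^ m) (*-identityʳ (2 ^ E)) ⟩
      2 ^ E * 2 ^ m ∎)
      where
      open ≤-Reasoning
      E = suc k * Δ₃ + r

  -- Any two neighbours a, b of the pair x y forbid the edge y′ a b, so at least l²/2 edges must be
  -- absent. The edges at x y are exposed first; the forbidden edges do not contain y and are
  -- therefore still random.
  module ThickEdge (A : VSet) (x y y′ : Fin n) (Ax : A x ≡ true) (Ay : A y ≡ true) (Ay′ : A y′ ≡ true)
    (Xx : X x) (Yy : Y y) (Yy′ : Y y′) (y≢y′ : y ≢ y′) (l Δ₃ : ℕ) where
    open Remove₃ A x y y′

    -- The consequence of T5-freeness that only looks at edges inside A meeting x, y or y′.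
    -- T5-freeness itself would not be local, and the event could not be separated from the
    -- remaining graph.
    Free : Vec Bool m → Set
    Free H = l < codeg x y (H ↾ A) × (∀ f a b → (Tri f y′ a b × third-nbr (H ↾ A) x y a × third-nbr (H ↾ A) x y b) × on (H ↾ A) f → ⊥)

    opaque
      Free? : ∀ H → Dec (Free H)
      Free? H = (l <? codeg x y (H ↾ A)) ×-dec all? λ f → all? λ a → all? λ b →
        ¬? ((Tri? f y′ a b ×-dec (third-nbr? (H ↾ A) x y a ×-dec third-nbr? (H ↾ A) x y b)) ×-dec on? (H ↾ A) f)

    T5⇒Free : ∀ H e₀ → T5-free (H ↾ A) → Tri e₀ x y y′ → on (H ↾ A) e₀ → l < codeg x y (H ↾ A) → Free H
    T5⇒Free H e₀ free t o lt = lt , λ f a b ((tf , na , nb) , of) → nbr-T5 (H ↾ A) free t o na nb tf of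

    private
      transfer : ∀ H H′ → (∀ e → Touch e → lookup H e ≡ lookup H′ e) → ∀ e u → u ∈ e → u ∈³ (x , y , y′) → on (H ↾ A) e → on (H′ ↾ A) e
      transfer H H′ h e u u∈ u∈R o = let i , o′ = on-↾ {H} {A} o in ↾-on {H′} i (trans (sym (h e (i , u , u∈ , u∈R))) o′)

      Free-transfer : ∀ H H′ → (∀ e → Touch e → lookup H e ≡ lookup H′ e) → Free H → Free H′
      Free-transfer H H′ h (lt , forbid) =
        ≤-trans lt (codeg-mono x y (H ↾ A) (H′ ↾ A) (λ e x∈ → transfer H H′ h e x x∈ (inj₁ refl))) ,
        λ f a b ((tf , na , nb) , o) → forbid f a b ((tf , back na , back nb) , transfer H′ H h′ f y′ (proj₁ (proj₁ tf)) (inj₂ (inj₂ refl)) o)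
        where
        h′ : ∀ e → Touch e → lookup H′ e ≡ lookup H e
        h′ e t = sym (h e t)
        back : ∀ {a} → third-nbr (H′ ↾ A) x y a → third-nbr (H ↾ A) x y a
        back (e , t , g , o) = e , t , g , transfer H′ H h′ e x (proj₁ (proj₁ t)) (inj₁ refl) o

    thick : Vec Bool m → ℕ
    thick H = ind (cnt TouchBad? H ≤? Δ₃) * ind (Free? H)

    thick-Local : Local (λ e → ¬ Inside A₃ e) thick
    thick-Local = Local-* (ind-cnt-Local TouchBad? Δ₃ (λ e (t , _) → Touch⇒∉ e t))
      (Local-⊆ Touch⇒∉ (λ H H′ h → ind-cong (Free? H) (Free? H′) (Free-transfer H H′ h) (Free-transfer H′ H (λ e t → sym (h e t)))))

    Forced : Vec Bool m → Fin m → Set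
    Forced H₀ f = (Inside A f × Good f × ¬ (y ∈ f)) × ∃ λ a → ∃ λ b → Tri f y′ a b × third-nbr (H₀ ↾ A) x y a × third-nbr (H₀ ↾ A) x y b

    opaque
      Forced? : ∀ H₀ f → Dec (Forced H₀ f)
      Forced? H₀ f = (Inside? A f ×-dec (Good? f ×-dec ¬? (y ∈? f))) ×-dec any? λ a → any? λ b →
        Tri? f y′ a b ×-dec (third-nbr? (H₀ ↾ A) x y a ×-dec third-nbr? (H₀ ↾ A) x y b)

    Fixed : Fin m → Set
    Fixed e = (Touch e × Bad e) ⊎ Link x y e

    Fixed? : ∀ e → Dec (Fixed e)
    Fixed? e = TouchBad? e ⊎-dec Link? x y e

    thick-sum : ∀ k r σ → 3 * (n * n) ≤ 2 ^ k * r → 2 * (σ + (suc k * Δ₃ + r)) ≤ l * l → ∑ᶜ thick * 2 ^ card TouchBad? * 2 ^ σ ≤ 2 ^ m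
    thick-sum k r σ small num = 2^-cancel (∑ᶜ thick * 2 ^ card TouchBad?) σ E (σ + E) ≤-refl
      (few-cond TouchBad? Fixed? (λ _ → inj₁) Δ₃ k r (σ + E) (λ H → ind (Free? H)) (≤-trans card-Touch small) per-H₀)
      where
      open ≤-Reasoning
      E = suc k * Δ₃ + r
      per-H₀ : ∀ H₀ → ∑ᶜ (λ H → ind (Free? (mix Fixed? H₀ H))) * 2 ^ (σ + E) ≤ 2 ^ m
      per-H₀ H₀ = case l <? codeg x y (H₀ ↾ A) of λ
        { (no ¬p) → ≤-trans (≤-reflexive (cong (_* 2 ^ (σ + E)) (trans (∑ᶜ-cong (λ H → ind-no (Free? (mix Fixed? H₀ H)) (λ (lt , _) → ¬p (≤-trans lt
            (cnt-mono (Link? x y) (Link? x y) (mix Fixed? H₀ H ↾ A) (H₀ ↾ A) (λ e L o → L , to-H₀ H e L o)))))) (∑ᶜ-const m 0)))) z≤n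
        ; (yes lt) → begin
            ∑ᶜ (λ H → ind (Free? (mix Fixed? H₀ H))) * 2 ^ (σ + E)
              ≤⟨ *-mono-≤ (∑ᶜ-mono (λ H → ind≤ (Free? (mix Fixed? H₀ H)) (λ free →
                   1≤ind (cnt (Forced? H₀) H ≤? 0) (≤-reflexive (cnt-zero (Forced? H₀) H (λ f F o → absent H f free F o))))))
                 (2^-mono {σ + E} {card (Forced? H₀)} (*-cancelˡ-≤ {σ + E} {card (Forced? H₀)} 2 (≤-trans num
                   (forced-count (H₀ ↾ A) l Xx Yy Yy′ lt (Forced? H₀) forced)))) ⟩
            ∑ᶜ (λ H → ind (cnt (Forced? H₀) H ≤? 0)) * 2 ^ card (Forced? H₀) ≤⟨ none-sum (Forced? H₀) ⟩
            2 ^ m ∎ }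
        where
        to-H₀ : ∀ H e → Link x y e → on (mix Fixed? H₀ H ↾ A) e → on (H₀ ↾ A) e
        to-H₀ H e L o = let i , o′ = on-↾ {mix Fixed? H₀ H} {A} o in
          ↾-on {H₀} i (trans (sym (lookup-mix-yes Fixed? H₀ H e (inj₂ L))) o′)
        nbr-A : ∀ {a} → third-nbr (H₀ ↾ A) x y a → A a ≡ true
        nbr-A (e , t , _ , o) = proj₁ (on-↾ {H₀} {A} o) _ (proj₂ (proj₂ (proj₁ t)))
        forced : ∀ f a b → Tri f y′ a b → third-nbr (H₀ ↾ A) x y a → third-nbr (H₀ ↾ A) x y b → Forced H₀ f
        forced f a b tf na nb = ((λ w w∈ → case only tf w∈ of λ { (inj₁ refl) → Ay′ ; (inj₂ (inj₁ refl)) → nbr-A na ; (inj₂ (inj₂ refl)) → nbr-A nb }) ,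
          typ-wts tf (wt-Y Yy′) (wt-X (nbr-X (H₀ ↾ A) Xx Yy na)) (wt-X (nbr-X (H₀ ↾ A) Xx Yy nb)) ,
          (λ y∈f → case only tf y∈f of λ
            { (inj₁ p) → y≢y′ p
            ; (inj₂ (inj₁ p)) → X≢Y (nbr-X (H₀ ↾ A) Xx Yy na) Yy (sym p)
            ; (inj₂ (inj₂ p)) → X≢Y (nbr-X (H₀ ↾ A) Xx Yy nb) Yy (sym p) })) ,
          a , b , tf , na , nb
        absent : ∀ H f → Free (mix Fixed? H₀ H) → Forced H₀ f → on H f → ⊥
        absent H f (_ , forbid) ((i , g , y∉) , a , b , tf , na , nb) o = forbid f a b
          ((tf , keep na , keep nb) , ↾-on {mix Fixed? H₀ H} i (trans (lookup-mix-no Fixed? H₀ H f λ { (inj₁ (_ , bd)) → bd g ; (inj₂ (_ , y∈ , _)) → y∉ y∈ }) o))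
          where
          keep : ∀ {a} → third-nbr (H₀ ↾ A) x y a → third-nbr (mix Fixed? H₀ H ↾ A) x y a
          keep (e , t@((x∈ , y∈ , _) , _) , g , o) = let i , o′ = on-↾ {H₀} {A} o in
            e , t , g , ↾-on {mix Fixed? H₀ H} i (trans (lookup-mix-yes Fixed? H₀ H e (inj₂ (x∈ , y∈ , g))) o′)

  -- Thin graphs: all bad edges are XYY with both codegrees small

  has-X : ∀ e → typ e ≡ 1 → ∃ λ v → v ∈ e × X v
  has-X e ty with X⊎Y (proj₁ (vs e)) | X⊎Y (proj₁ (proj₂ (vs e))) | X⊎Y (proj₂ (proj₂ (vs e)))
  ... | inj₁ p | _ | _ = _ , inj₁ refl , p
  ... | inj₂ _ | inj₁ p | _ = _ , inj₂ (inj₁ refl) , p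
  ... | inj₂ _ | inj₂ _ | inj₁ p = _ , inj₂ (inj₂ refl) , p
  ... | inj₂ p | inj₂ q | inj₂ s = case trans (sym ty) (typ-wts (Tri-self e) (wt-Y p) (wt-Y q) (wt-Y s)) of λ ()

  -- Each good edge with vertices x, x′ ∈ X is owned by x if B x x′; then the small codegree events at different x are independent.
  module Tournament (A : VSet) (B : Fin n → Fin n → Set) (B? : ∀ v w → Dec (B v w)) (asym : ∀ v w → B v w → B w v → ⊥) (l τ : ℕ) where

    first : Fin m → Fin n
    first e = proj₁ (vs e)

    -- An edge XYY belongs to its vertex in X. Bad edges of the other types go to their first
    -- vertex, an arbitrary choice: every bad edge needs an owner, as the product over the vertices
    -- has to pay for all of them.
    O : Fin n → Fin m → Set
    O v e = Inside A e × ((Good e × (v ∈ e × X v) × ∃ λ w → (w ∈ e × X w) × B v w) ⊎ ((typ e ≡ 1 × v ∈ e × X v) ⊎ ((Bad e × typ e ≢ 1) × v ≡ first e)))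

    opaque
      O? : ∀ v e → Dec (O v e)
      O? v e = Inside? A e ×-dec ((Good? e ×-dec (((v ∈? e) ×-dec X? v) ×-dec any? (λ w → ((w ∈? e) ×-dec X? w) ×-dec B? v w))) ⊎-dec
        (((typ e ≟ 1) ×-dec ((v ∈? e) ×-dec X? v)) ⊎-dec ((Bad? e ×-dec ¬? (typ e ≟ 1)) ×-dec (v ≟ᶠ first e))))

    third-Y : ∀ {e v w u} → Tri e v w u → X v → X w → Good e → Y u
    third-Y t Xv Xw g = 0⇒Y (typ-third t (wt-X Xv) (wt-X Xw) g refl)

    O-unique : ∀ v v′ e → O v e → O v′ e → v ≡ v′
    O-unique v v′ e (_ , inj₁ (g , (v∈ , Xv) , w , (w∈ , Xw) , b)) (_ , inj₁ (_ , (v′∈ , Xv′) , w′ , (w′∈ , Xw′) , b′)) with v ≟ᶠ v′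
    ... | yes p = p
    ... | no v≢v′ = ⊥-elim (asym v v′ (subst (B v) (partner v≢v′ v∈ v′∈ Xv Xv′ w∈ Xw b) b) (subst (B v′) (partner (v≢v′ ∘ sym) v′∈ v∈ Xv′ Xv w′∈ Xw′ b′) b′))
      where
      partner : ∀ {v v′ w} → v ≢ v′ → v ∈ e → v′ ∈ e → X v → X v′ → w ∈ e → X w → B v w → w ≡ v′
      partner v≢v′ v∈ v′∈ Xv Xv′ w∈ Xw b with split₂ v∈ v′∈ v≢v′
      ... | u , t with only t w∈
      ...   | inj₁ refl = ⊥-elim (asym _ _ b b)
      ...   | inj₂ (inj₁ p) = p
      ...   | inj₂ (inj₂ refl) = contradiction refl (X≢Y Xw (third-Y t Xv Xv′ g))
    O-unique v v′ e (_ , inj₁ (g , _)) (_ , inj₂ (inj₁ (ty , _))) = case trans (sym g) ty of λ ()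
    O-unique v v′ e (_ , inj₁ (g , _)) (_ , inj₂ (inj₂ ((bd , _) , _))) = contradiction g bd
    O-unique v v′ e (_ , inj₂ (inj₁ (ty , _))) (_ , inj₁ (g , _)) = case trans (sym g) ty of λ ()
    O-unique v v′ e (_ , inj₂ (inj₁ (ty , v∈ , Xv))) (_ , inj₂ (inj₁ (_ , v′∈ , Xv′))) with v ≟ᶠ v′
    ... | yes p = p
    ... | no v≢v′ = let u , t = split₂ v∈ v′∈ v≢v′ in
      case trans (sym ty) (trans (typ-Tri t) (cong (_+ wt u) (cong₂ _+_ (wt-X Xv) (wt-X Xv′)))) of λ ()
    O-unique v v′ e (_ , inj₂ (inj₁ (ty , _))) (_ , inj₂ (inj₂ ((_ , ¬ty) , _))) = contradiction ty ¬ty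
    O-unique v v′ e (_ , inj₂ (inj₂ ((bd , _) , _))) (_ , inj₁ (g , _)) = contradiction g bd
    O-unique v v′ e (_ , inj₂ (inj₂ ((_ , ¬ty) , _))) (_ , inj₂ (inj₁ (ty , _))) = contradiction ty ¬ty
    O-unique v v′ e (_ , inj₂ (inj₂ (_ , p))) (_ , inj₂ (inj₂ (_ , q))) = trans p (sym q)

    badIn≤ : badIn A ≤ sum (λ v → card (λ e → O? v e ×-dec Bad? e))
    badIn≤ = card-cover _ (λ v e → O? v e ×-dec Bad? e) (λ e (i , bd) → case typ e ≟ 1 of λ
      { (no ¬ty) → first e , (i , inj₂ (inj₂ ((bd , ¬ty) , refl))) , bd
      ; (yes ty) → let v , v∈ , Xv = has-X e ty in v , (i , inj₂ (inj₁ (ty , v∈ , Xv))) , bd })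

    -- The conditions on v apply only if T is nonempty. So every vertex fits the empty set, and the
    -- product can run over all vertices.
    Fit : Fin n → Vec Bool n → Set
    Fit v T = (∀ y → on T y → (A y ≡ true × Y y) × (A v ≡ true × X v)) × card (on? T) ≤ τ

    opaque
      Fit? : ∀ v T → Dec (Fit v T)
      Fit? v T = all? (λ y → on? T y →-dec (YA? A y ×-dec XA? A v)) ×-dec (card (on? T) ≤? τ)

    private module F (v : Fin n) = Fan v (O? v) (Fit? v) 0 l

    thin : Vec Bool m → ℕ
    thin H = prod (λ v → F.fan v H)

    thin-Local : Local (Inside A) thin
    thin-Local = Local-prod (λ v → Local-⊆ (λ e → proj₁) (F.fan-Local v))

    1≤thin : ∀ H (Tf : Fin n → Vec Bool n) → (∀ v → Fit v (Tf v)) → (∀ v y → on (Tf v) y → codeg v y (H ↾ A) ≤ l) →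
      (∀ e → on (H ↾ A) e → Bad e → typ e ≡ 1 × (∀ v → v ∈ e → X v → Within v (Tf v) e)) → 1 ≤ thin H
    1≤thin H Tf fit small bad = ≤-trans
      (1≤prod (λ v → F.1≤fan v (H ↾ A) (Tf v) (fit v)
        (≤-reflexive (cnt-zero (Star.Stray? v (O? v) (Tf v) 0 l) (H ↾ A) (λ e (Oe , bd , ¬w) o → ¬w (stray v e Oe bd o)))) (small v)))
      (≤-reflexive (thin-Local (H ↾ A) H (λ e i → lookup-mix-yes (Inside? A) H _ e i)))
      where
      stray : ∀ v e → O v e → Bad e → on (H ↾ A) e → v ∈ e × Within v (Tf v) e
      stray v e (_ , inj₁ (g , _)) bd o = contradiction g bd
      stray v e (_ , inj₂ (inj₁ (_ , v∈ , Xv))) bd o = v∈ , proj₂ (bad e o bd) v v∈ Xv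
      stray v e (_ , inj₂ (inj₂ ((_ , ¬ty) , _))) bd o = contradiction (proj₁ (bad e o bd)) ¬ty

    -- Each vertex contributes a factor of at most (1 + 2^-τ)^n, and the product of all n of them is
    -- at most 2, since 2n² ≤ 2^τ + 1.
    thin-sum : ∀ k r₁ z → n ≤ 2 ^ k * r₁ → (∀ v → A v ≡ true → X v → z ≤ card (λ w → XA? A w ×-dec B? v w)) →
      suc k * l + r₁ + 2 * τ ≤ z → 2 * (n * n) ≤ suc (2 ^ τ) → ∑ᶜ thin * 2 ^ badIn A ≤ 2 * 2 ^ m
    thin-sum k r₁ z small₁ out num τ-big = *-cancelʳ-2^ (n * (τ * n)) (begin
      ∑ᶜ thin * 2 ^ badIn A * 2 ^ (n * (τ * n)) ≤⟨ *-monoˡ-≤ _ (*-monoʳ-≤ (∑ᶜ thin) (2^-mono badIn≤)) ⟩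
      ∑ᶜ thin * 2 ^ sum F.bO * 2 ^ (n * (τ * n)) ≡⟨ exp-merge (∑ᶜ thin) (sum F.bO) (n * (τ * n)) ⟩
      ∑ᶜ thin * 2 ^ (sum F.bO + n * (τ * n)) ≡⟨ cong (λ z → ∑ᶜ thin * 2 ^ z) (trans (cong (sum F.bO +_) (sym (sum-const n (τ * n)))) (sym (∑-distrib-+ F.bO (λ _ → τ * n)))) ⟩
      ∑ᶜ thin * 2 ^ sum (λ v → F.bO v + τ * n) ≡⟨ cong (∑ᶜ thin *_) (prod-^ 2 (λ v → F.bO v + τ * n)) ⟨
      ∑ᶜ thin * prod (λ v → 2 ^ (F.bO v + τ * n))
        ≤⟨ indep O? F.fan (λ v → 2 ^ (F.bO v + τ * n)) (λ _ → suc (2 ^ τ) ^ n) F.fan-Local O-unique per-v ⟩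
      prod {n} (λ _ → suc (2 ^ τ) ^ n) * 2 ^ m ≡⟨ cong (_* 2 ^ m) (trans (prod-^ {n} (suc (2 ^ τ)) (λ _ → n)) (cong (suc (2 ^ τ) ^_) (sum-const n n))) ⟩
      suc (2 ^ τ) ^ (n * n) * 2 ^ m ≤⟨ *-monoˡ-≤ (2 ^ m) (half-ratio (2 ^ τ) (n * n) τ-big) ⟩
      2 * (2 ^ τ) ^ (n * n) * 2 ^ m ≡⟨ cong (λ z → 2 * z * 2 ^ m) (trans (^-*-assoc 2 τ (n * n)) (cong (2 ^_) (eq₁ τ n))) ⟩
      2 * 2 ^ (n * (τ * n)) * 2 ^ m ≡⟨ eq₂ (2 ^ (n * (τ * n))) (2 ^ m) ⟩
      2 * 2 ^ m * 2 ^ (n * (τ * n)) ∎)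
      where
      open ≤-Reasoning
      c = suc k * l + r₁
      eq₁ : ∀ t n → t * (n * n) ≡ n * (t * n)
      eq₁ = solve-∀
      eq₂ : ∀ a b → 2 * a * b ≡ 2 * b * a
      eq₂ = solve-∀
      long : ∀ v T → Fit v T → ∀ y → on T y → z ≤ card (Star.Ray? v (O? v) T 0 l y)
      long v T (fits , _) y o = ≤-trans (out v Av Xv) (card-third v y (λ w → XA? A w ×-dec B? v w) (Star.Ray? v (O? v) T 0 l y)
        (λ u ((Au , Xu) , b) →
          let e , t = edge v y u (X≢Y Xv Yy , (λ { refl → asym v v b b }) , X≢Y Xu Yy ∘ sym)
              (v∈ , y∈ , u∈) , _ = t
              g = typ-wts t (wt-X Xv) (wt-Y Yy) (wt-X Xu) in
          e , t , o ,
          ((λ w w∈ → case only t w∈ of λ { (inj₁ refl) → Av ; (inj₂ (inj₁ refl)) → Ay ; (inj₂ (inj₂ refl)) → Au }) ,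
           inj₁ (g , (v∈ , Xv) , u , (u∈ , Xu) , b)) , v∈ , y∈ , g))
        where
        Ay = proj₁ (proj₁ (fits y o))
        Yy = proj₂ (proj₁ (fits y o))
        Av = proj₁ (proj₂ (fits y o))
        Xv = proj₂ (proj₂ (fits y o))
      per-T : ∀ v T → Fit v T → ∑ᶜ (Star.star v (O? v) T 0 l) * 2 ^ F.bO v * 2 ^ (τ * card (on? T)) ≤ 2 ^ m
      per-T v T f@(fits , ≤τ) = F.star-gain v T (λ y o → proj₂ (proj₁ (fits y o)) , proj₂ (proj₂ (fits y o))) k r₁ 0 z (τ * card (on? T)) small₁
        (long v T f) (≤-trans (none-sum (Star.Stray? v (O? v) T 0 l)) (≤-reflexive (sym (*-identityˡ (2 ^ m)))))
        (begin
          τ * t + (0 + t * c + t * t) ≤⟨ +-mono-≤ (≤-reflexive (*-comm τ t)) (+-monoʳ-≤ (t * c) (*-monoʳ-≤ t ≤τ)) ⟩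
          t * τ + (t * c + t * τ) ≡⟨ eq₃ t τ c ⟩
          t * (c + 2 * τ) ≤⟨ *-monoʳ-≤ t num ⟩
          t * z ∎)
        where
        t = card (on? T)
        eq₃ : ∀ t b c → t * b + (t * c + t * b) ≡ t * (c + 2 * b)
        eq₃ = solve-∀
      per-v : ∀ v → ∑ᶜ (F.fan v) * 2 ^ (F.bO v + τ * n) ≤ suc (2 ^ τ) ^ n * 2 ^ m
      per-v v = ≤-trans (≤-reflexive (sym (exp-merge (∑ᶜ (F.fan v)) (F.bO v) (τ * n)))) (F.fan-geometric v τ (2 ^ F.bO v) (per-T v))

  -- The class of tame graphs

  guard : ∀ {C : Set} → Dec C → (C → Vec Bool m → ℕ) → Vec Bool m → ℕ
  guard (yes c) f = f c
  guard (no _) f = λ _ → 0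

  1≤guard : ∀ {C : Set} (d : Dec C) (f : C → Vec Bool m → ℕ) H → C → (∀ c → 1 ≤ f c H) → 1 ≤ guard d f H
  1≤guard (yes c) f H _ h = h c
  1≤guard (no ¬c) f H c _ = contradiction c ¬c

  guard-sum : ∀ {C : Set} (d : Dec C) (f : C → Vec Bool m → ℕ) p q r {B} → (∀ c → ∑ᶜ (f c) * p * q * r ≤ B) → ∑ᶜ (guard d f) * p * q * r ≤ B
  guard-sum (yes c) f p q r h = h c
  guard-sum (no _) f p q r h = ≤-trans (≤-reflexive (cong (λ z → z * p * q * r) (∑ᶜ-const m 0))) z≤n

  sum-terms : ∀ {N} (f : Fin N → Vec Bool m → ℕ) p q r {B} → (∀ i → ∑ᶜ (f i) * p * q * r ≤ B) → ∑ᶜ (λ H → sum (λ i → f i H)) * p * q * r ≤ N * B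
  sum-terms {N} f p q r {B} h = begin
    ∑ᶜ (λ H → sum (λ i → f i H)) * p * q * r ≡⟨ cong (λ z → z * p * q * r) (∑ᶜ-sum f) ⟩
    sum (λ i → ∑ᶜ (f i)) * p * q * r ≡⟨ eq (sum (λ i → ∑ᶜ (f i))) p q r ⟩
    sum (λ i → ∑ᶜ (f i)) * (p * q * r) ≡⟨ *-distribʳ-sum (p * q * r) (λ i → ∑ᶜ (f i)) ⟩
    sum (λ i → ∑ᶜ (f i) * (p * q * r)) ≤⟨ sum-≤const (λ i → ≤-trans (≤-reflexive (sym (eq (∑ᶜ (f i)) p q r))) (h i)) ⟩
    N * B ∎
    where
    open ≤-Reasoning
    eq : ∀ s p q r → s * p * q * r ≡ s * (p * q * r)
    eq = solve-∀

  1≤sum : ∀ {N} (f : Fin N → ℕ) i → 1 ≤ f i → 1 ≤ sum f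
  1≤sum f i h = ≤-trans h (≤sum f i)

  card-XA-− : ∀ A x {x₀} → x₀ < card (XA? A) → x₀ ≤ card (XA? (A − x))
  card-XA-− A x h = ≤-pred (≤-trans h (card-− X? A x))

  module Class (l Δ Δ₃ b τ z : ℕ) where

    -- Not bounded here: the bad edges v y y′ with both codegrees small (removed by lowXT when numerous),
    -- and deg 0 v when deg 2 v is small (removed by lowYT).
    Tame : Fin n → Vec Bool m → Set
    Tame v H = (X v → deg 3 v H ≤ Δ × thickdeg l v H ≤ Δ) × (Y v → deg 1 v H ≤ Δ × (deg 2 v H ≤ Δ ⊎ deg 0 v H ≤ Δ))

    K : Vec Bool m → Set
    K H = T5-free H × cnt Bad? H ≤ b × (∀ v → Tame v H)

    opaque
      K? : ∀ H → Dec (K H)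
      K? H = T5-free? H ×-dec ((cnt Bad? H ≤? b) ×-dec all? (λ v →
        (X? v →-dec ((deg 3 v H ≤? Δ) ×-dec (thickdeg l v H ≤? Δ))) ×-dec
        (Y? v →-dec ((deg 1 v H ≤? Δ) ×-dec ((deg 2 v H ≤? Δ) ⊎-dec (deg 0 v H ≤? Δ))))))

    -- All conditions of the class are upper bounds and survive the deletion of edges. Local
    -- optimality of the partition does not, and this is why it is traded for tameness before the
    -- recursion starts.
    K-mono : ∀ H H′ → (∀ e → on H′ e → on H e) → K H → K H′
    K-mono H H′ s (free , bad , tame) = T5-free-mono {H} {H′} s free , ≤-trans (cnt-mono Bad? Bad? H′ H (λ e p o → p , s e o)) bad , λ v →
      (λ Xv → let p , q = proj₁ (tame v) Xv in ≤-trans (deg-mono 3 v H′ H s) p , ≤-trans (thickdeg-mono l v H′ H (λ e _ → s e)) q) ,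
      (λ Yv → let p , q = proj₂ (tame v) Yv in ≤-trans (deg-mono 1 v H′ H s) p ,
        (case q of λ { (inj₁ q) → inj₁ (≤-trans (deg-mono 2 v H′ H s) q) ; (inj₂ q) → inj₂ (≤-trans (deg-mono 0 v H′ H s) q) }))

    cls : VSet → Vec Bool m → ℕ
    cls A H = ind (K? (H ↾ A))

    cls-Local : ∀ A → Local (Inside A) (cls A)
    cls-Local A H H′ h = cong (λ G → ind (K? G)) (↾-local A H H′ h)

    1≤cls : ∀ A A′ H → (∀ w → A′ w ≡ true → A w ≡ true) → K (H ↾ A) → 1 ≤ cls A′ H
    1≤cls A A′ H s h = 1≤ind (K? (H ↾ A′)) (K-mono (H ↾ A) (H ↾ A′)
      (λ e o → let i , o′ = on-↾ {H} {A′} o in ↾-on {H} (Inside-⊆ s i) o′) h)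

    -- Like the other terms of `rest`, it pairs the class on the remaining vertices with an event at
    -- the removed ones. The two factors see disjoint sets of edges, as `step` requires.
    lowYT : VSet → Fin n → Vec Bool m → ℕ
    lowYT A v = guard (YA? A v) (λ (Av , Yv) H → cls (A − v) H * LowY.lowY A v Av Yv (Δ + Δ) H)

    lowXT : VSet → Fin n → Vec Bool m → ℕ
    lowXT A x = guard (XA? A x) (λ _ H → cls (A − x) H * LowX.fan A x (Δ + Δ) l τ H)

    Mono : VSet → Fin n → Fin n → Fin n → Set
    Mono A p q s = (A p ≡ true × A q ≡ true × A s ≡ true) × Distinct (p , q , s) × (wt p ≡ wt q × wt p ≡ wt s)

    Mono? : ∀ A p q s → Dec (Mono A p q s)
    Mono? A p q s = ((A p ≟ᵇ true) ×-dec ((A q ≟ᵇ true) ×-dec (A s ≟ᵇ true))) ×-dec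
      ((¬? (p ≟ᶠ q) ×-dec (¬? (p ≟ᶠ s) ×-dec ¬? (q ≟ᶠ s))) ×-dec ((wt p ≟ wt q) ×-dec (wt p ≟ wt s)))

    monoT : VSet → Fin n → Fin n → Fin n → Vec Bool m → ℕ
    monoT A p q s = guard (Mono? A p q s) (λ (As , ds , ws) H → cls (Remove₃.A₃ A p q s) H * MonoEdge.mono A p q s As ds ws Δ₃ H)

    XYY : VSet → Fin n → Fin n → Fin n → Set
    XYY A x y y′ = (A x ≡ true × X x) × (A y ≡ true × Y y) × (A y′ ≡ true × Y y′) × y ≢ y′

    XYY? : ∀ A x y y′ → Dec (XYY A x y y′)
    XYY? A x y y′ = XA? A x ×-dec (YA? A y ×-dec (YA? A y′ ×-dec ¬? (y ≟ᶠ y′)))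

    thickT : VSet → Fin n → Fin n → Fin n → Vec Bool m → ℕ
    thickT A x y y′ = guard (XYY? A x y y′) (λ ((Ax , Xx) , (Ay , Yy) , (Ay′ , Yy′) , y≢y′) H →
      cls (Remove₃.A₃ A x y y′) H * ThickEdge.thick A x y y′ Ax Ay Ay′ Xx Yy Yy′ y≢y′ l Δ₃ H)

    rest : VSet → Vec Bool m → ℕ
    rest A H = sum (λ v → lowYT A v H) + sum (λ v → lowXT A v H)
      + sum (λ p → sum (λ q → sum (λ s → monoT A p q s H))) + sum (λ p → sum (λ q → sum (λ s → thickT A p q s H)))

    Wide : VSet → Set
    Wide A = 3 * z ≤ card (XA? A)

    thinOf : ∀ A → Wide A → Vec Bool m → ℕ
    thinOf A w = let B , B? , asym , _ = cyclic-tournament (XA? A) z w in Tournament.thin A B B? asym l τ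

    -- The remaining graph is required to be thin instead of merely being in the class. Its mean is
    -- then bounded directly, and the recursion stops at a special event.
    specialT : ∀ A → (∀ x → Wide (A − x)) → Fin n → Vec Bool m → ℕ
    specialT A w x = guard (XA? A x) (λ _ H → thinOf (A − x) (w x) H * Special.fan A x l τ H)

    special : ∀ A → (∀ x → Wide (A − x)) → Vec Bool m → ℕ
    special A w H = sum (λ x → specialT A w x H)

    -- Every tame graph with a bad edge falls under one of the events

    module Cases (A : VSet) (w : ∀ x → Wide (A − x)) (H : Vec Bool m) (KG : K (H ↾ A))
      (Δ₃≥ : 3 * (2 * Δ + τ * τ) ≤ Δ₃) where

      G : Vec Bool m
      G = H ↾ A

      G-in : ∀ {e} → on G e → Inside A e
      G-in o = proj₁ (on-↾ {H} {A} o)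

      to-G : ∀ {e} → Inside A e → on H e → on G e
      to-G i o = ↾-on {H} {A} i o

      tame = proj₂ (proj₂ KG)

      Small : Fin n → Fin n → Set
      Small x y = (A y ≡ true × Y y) × (A x ≡ true × X x) × codeg x y G ≤ l

      opaque
        Small? : ∀ x y → Dec (Small x y)
        Small? x y = YA? A y ×-dec (XA? A x ×-dec (codeg x y G ≤? l))

      Tset : Fin n → Vec Bool n
      Tset x = tabulate (λ y → does (Small? x y))

      on-Tset : ∀ x y → on (Tset x) y → Small x y
      on-Tset x y o with Small? x y | trans (sym (lookup∘tabulate (λ y → does (Small? x y)) y)) o
      ... | yes p | _ = p

      Tset-on : ∀ x y → Small x y → on (Tset x) y
      Tset-on x y p = trans (lookup∘tabulate (λ y → does (Small? x y)) y) (go (Small? x y))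
        where
        go : (d : Dec (Small x y)) → does d ≡ true
        go (yes _) = refl
        go (no ¬p) = contradiction p ¬p

      types-X : ∀ {e x} → X x → x ∈ e → Bad e → typ e ≡ 3 ⊎ typ e ≡ 1
      types-X Xx x∈ bd with split₁ x∈
      ... | a , c , t with X⊎Y a | X⊎Y c
      ...   | inj₁ p | inj₁ q = inj₁ (typ-wts t (wt-X Xx) (wt-X p) (wt-X q))
      ...   | inj₁ p | inj₂ q = ⊥-elim (bd (typ-wts t (wt-X Xx) (wt-X p) (wt-Y q)))
      ...   | inj₂ p | inj₁ q = ⊥-elim (bd (typ-wts t (wt-X Xx) (wt-Y p) (wt-X q)))
      ...   | inj₂ p | inj₂ q = inj₂ (typ-wts t (wt-X Xx) (wt-Y p) (wt-Y q))

      types-Y : ∀ {e y} → Y y → y ∈ e → Bad e → typ e ≡ 1 ⊎ typ e ≡ 0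
      types-Y Yy y∈ bd with split₁ y∈
      ... | a , c , t with X⊎Y a | X⊎Y c
      ...   | inj₁ p | inj₁ q = ⊥-elim (bd (typ-wts t (wt-Y Yy) (wt-X p) (wt-X q)))
      ...   | inj₁ p | inj₂ q = inj₁ (typ-wts t (wt-Y Yy) (wt-X p) (wt-Y q))
      ...   | inj₂ p | inj₁ q = inj₁ (typ-wts t (wt-Y Yy) (wt-Y p) (wt-X q))
      ...   | inj₂ p | inj₂ q = inj₂ (typ-wts t (wt-Y Yy) (wt-Y p) (wt-Y q))

      other-Y : ∀ {e x w} → typ e ≡ 1 → X x → x ∈ e → w ∈ e → w ≢ x → Y w
      other-Y ty Xx x∈ w∈ w≢x with split₂ x∈ w∈ (w≢x ∘ sym) | X⊎Y _
      ... | u , t | inj₂ Yw = Yw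
      ... | u , t | inj₁ Xw = case trans (sym ty) (trans (typ-Tri t) (cong (_+ wt u) (cong₂ _+_ (wt-X Xx) (wt-X Xw)))) of λ ()

      -- An edge x y y′ that is not thick has small codegree at both x y and x y′, so y and y′ lie
      -- in `Tset x`.
      bad-at-X : ∀ {e x} → A x ≡ true → X x → x ∈ e → Bad e → on G e →
        (typ e ≡ 3) ⊎ (Thick l G x e ⊎ (typ e ≡ 1 × Within x (Tset x) e))
      bad-at-X {e} {x} Ax Xx x∈ bd o = case types-X Xx x∈ bd of λ
        { (inj₁ ty) → inj₁ ty
        ; (inj₂ ty) → case Thick? l G x e of λ
          { (yes th) → inj₂ (inj₁ th)
          ; (no ¬th) → inj₂ (inj₂ (ty , λ w w∈ w≢x → let Yw = other-Y ty Xx x∈ w∈ w≢x in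
              Tset-on x w ((G-in o w w∈ , Yw) , (Ax , Xx) , ≮⇒≥ (λ lt → ¬th ((x∈ , ty) , w , w∈ , Yw , lt))))) } }

      BadOn? : ∀ v e → Dec ((v ∈ e × Bad e) × on G e)
      BadOn? v e = ((v ∈? e) ×-dec Bad? e) ×-dec on? G e

      -- Large deg 0 leaves only the other alternative of tameness, deg 2 at most Δ. With deg 1 at
      -- most Δ this bounds the edges of types 1 and 2 by 2Δ.
      case-lowY : ∀ v → A v ≡ true → Y v → Δ < deg 0 v G → 1 ≤ lowYT A v H
      case-lowY v Av Yv lt = 1≤guard (YA? A v) _ H (Av , Yv) (λ (Av , Yv) → 1≤* (1≤cls A (A − v) H (−-⊆ A v) KG)
        (1≤ind (cnt (LowY.S? A v Av Yv (Δ + Δ)) H ≤? (Δ + Δ)) (few Av Yv)))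
        where
        few : ∀ Av Yv → cnt (LowY.S? A v Av Yv (Δ + Δ)) H ≤ Δ + Δ
        few Av Yv = ≤-trans
          (card-+ (λ e → LowY.S? A v Av Yv (Δ + Δ) e ×-dec on? H e) (λ e → At? 1 v e ×-dec on? G e) (λ e → At? 2 v e ×-dec on? G e)
            (λ { e (((i , v∈) , inj₁ ty) , o) → inj₁ ((v∈ , ty) , to-G i o) ; e (((i , v∈) , inj₂ ty) , o) → inj₂ ((v∈ , ty) , to-G i o) }))
          (+-mono-≤ (proj₁ (proj₂ (tame v) Yv)) (case proj₂ (proj₂ (tame v) Yv) of λ { (inj₁ p) → p ; (inj₂ p) → contradiction lt (≤⇒≯ p) }))

      fan-G : ∀ x {φ : Vec Bool n → Set} (φ? : ∀ T → Dec (φ T)) b → φ (Tset x) → cnt (Star.Stray? x (Own? A x) (Tset x) b l) G ≤ b →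
        1 ≤ Fan.fan x (Own? A x) φ? b l H
      fan-G x φ? b p h = ≤-trans
        (Fan.1≤fan x (Own? A x) φ? b l G (Tset x) p h (λ y o → proj₂ (proj₂ (on-Tset x y o))))
        (≤-reflexive (Fan.fan-Local x (Own? A x) φ? b l G H (λ e (i , _) → lookup-mix-yes (Inside? A) H _ e i)))

      case-lowX : ∀ x → A x ≡ true → X x → τ ≤ card (on? (Tset x)) → 1 ≤ lowXT A x H
      case-lowX x Ax Xx τ≤ = 1≤guard (XA? A x) _ H (Ax , Xx) (λ _ → 1≤* (1≤cls A (A − x) H (−-⊆ A x) KG)
        (fan-G x (LowX.Large? A x (Δ + Δ) l τ) (Δ + Δ) ((λ y o → proj₁ (on-Tset x y o)) , τ≤) (≤-trans
          (card-+ (λ e → Star.Stray? x (Own? A x) (Tset x) (Δ + Δ) l e ×-dec on? G e) (λ e → At? 3 x e ×-dec on? G e) (λ e → Thick? l G x e ×-dec on? G e)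
            (λ e (((i , x∈) , bd , ¬w) , o) → case bad-at-X Ax Xx x∈ bd o of λ
              { (inj₁ ty) → inj₁ ((x∈ , ty) , o) ; (inj₂ (inj₁ th)) → inj₂ (th , o) ; (inj₂ (inj₂ (_ , wi))) → ⊥-elim (¬w (x∈ , wi)) }))
          (+-mono-≤ (proj₁ (proj₁ (tame x) Xx)) (proj₂ (proj₁ (tame x) Xx))))))

      module Rest (¬lowY : ∀ v → A v ≡ true → Y v → deg 0 v G ≤ Δ) (¬lowX : ∀ x → A x ≡ true → X x → card (on? (Tset x)) < τ) where

        -- Only now, with both exceptional kinds excluded, are bad degrees bounded: τ² covers the
        -- bad edges at v with both other vertices in `Tset v`. The events that remove three
        -- vertices rely on this bound, so they have to come later in the case distinction.
        bad-deg : ∀ v → A v ≡ true → card (BadOn? v) ≤ 2 * Δ + τ * τ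
        bad-deg v Av = case X⊎Y v of λ
          { (inj₁ Xv) → begin
              card (BadOn? v)
                ≤⟨ card-+ (BadOn? v) (λ e → At? 3 v e ×-dec on? G e) (λ e → (Thick? l G v e ×-dec on? G e) ⊎-dec In? e)
                    (λ e ((v∈ , bd) , o) → case bad-at-X Av Xv v∈ bd o of λ
                      { (inj₁ ty) → inj₁ ((v∈ , ty) , o) ; (inj₂ (inj₁ th)) → inj₂ (inj₁ (th , o)) ; (inj₂ (inj₂ (_ , wi))) → inj₂ (inj₂ (v∈ , wi)) }) ⟩
              deg 3 v G + card (λ e → (Thick? l G v e ×-dec on? G e) ⊎-dec In? e)
                ≤⟨ +-mono-≤ (proj₁ (proj₁ (tame v) Xv)) (card-+ (λ e → (Thick? l G v e ×-dec on? G e) ⊎-dec In? e) (λ e → Thick? l G v e ×-dec on? G e) In? (λ _ p → p)) ⟩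
              Δ + (thickdeg l v G + card In?)
                ≤⟨ +-monoʳ-≤ Δ (+-mono-≤ (proj₂ (proj₁ (tame v) Xv)) (≤-trans (card-inside v (on? (Tset v)) In? (λ e (v∈ , wi) → v∈ , wi))
                     (*-mono-≤ (<⇒≤ (¬lowX v Av Xv)) (<⇒≤ (¬lowX v Av Xv))))) ⟩
              Δ + (Δ + τ * τ) ≡⟨ eq Δ (τ * τ) ⟩
              2 * Δ + τ * τ ∎
          ; (inj₂ Yv) → begin
              card (BadOn? v)
                ≤⟨ card-+ (BadOn? v) (λ e → At? 1 v e ×-dec on? G e) (λ e → At? 0 v e ×-dec on? G e)
                    (λ e ((v∈ , bd) , o) → case types-Y Yv v∈ bd of λ { (inj₁ ty) → inj₁ ((v∈ , ty) , o) ; (inj₂ ty) → inj₂ ((v∈ , ty) , o) }) ⟩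
              deg 1 v G + deg 0 v G ≤⟨ +-mono-≤ (proj₁ (proj₂ (tame v) Yv)) (¬lowY v Av Yv) ⟩
              Δ + Δ ≤⟨ +-monoʳ-≤ Δ (m≤m+n Δ (τ * τ)) ⟩
              Δ + (Δ + τ * τ) ≡⟨ eq Δ (τ * τ) ⟩
              2 * Δ + τ * τ ∎ }
          where
          open ≤-Reasoning
          In? : ∀ e → Dec (v ∈ e × Within v (Tset v) e)
          In? e = (v ∈? e) ×-dec Within? v (Tset v) e
          eq : ∀ a b → a + (a + b) ≡ 2 * a + b
          eq = solve-∀

        touch-bound : ∀ p q s → A p ≡ true → A q ≡ true → A s ≡ true → cnt (Remove₃.TouchBad? A p q s) H ≤ Δ₃
        touch-bound p q s Ap Aq As = begin
          cnt (Remove₃.TouchBad? A p q s) H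
            ≤⟨ card-+ _ (BadOn? p) (λ e → BadOn? q e ⊎-dec BadOn? s e) (λ { e (((i , u , u∈ , inj₁ refl) , bd) , o) → inj₁ ((u∈ , bd) , to-G i o)
                 ; e (((i , u , u∈ , inj₂ (inj₁ refl)) , bd) , o) → inj₂ (inj₁ ((u∈ , bd) , to-G i o))
                 ; e (((i , u , u∈ , inj₂ (inj₂ refl)) , bd) , o) → inj₂ (inj₂ ((u∈ , bd) , to-G i o)) }) ⟩
          card (BadOn? p) + card (λ e → BadOn? q e ⊎-dec BadOn? s e)
            ≤⟨ +-mono-≤ (bad-deg p Ap) (≤-trans (card-+ _ (BadOn? q) (BadOn? s) (λ _ r → r)) (+-mono-≤ (bad-deg q Aq) (bad-deg s As))) ⟩
          (2 * Δ + τ * τ) + ((2 * Δ + τ * τ) + (2 * Δ + τ * τ)) ≡⟨ eq (2 * Δ + τ * τ) ⟩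
          3 * (2 * Δ + τ * τ) ≤⟨ Δ₃≥ ⟩
          Δ₃ ∎
          where
          open ≤-Reasoning
          eq : ∀ a → a + (a + a) ≡ 3 * a
          eq = solve-∀

        case-mono : ∀ p q s e → Tri e p q s → on G e → wt p ≡ wt q → wt p ≡ wt s → 1 ≤ monoT A p q s H
        case-mono p q s e t o wq ws = 1≤guard (Mono? A p q s) _ H ((Ap , Aq , As) , proj₂ t , (wq , ws)) (λ (As′ , ds , w′) →
          1≤* (1≤cls A (Remove₃.A₃ A p q s) H (Remove₃.A₃-⊆ A p q s) KG)
              (MonoEdge.1≤mono A p q s As′ ds w′ Δ₃ H e (proj₁ KG) t (proj₂ (on-↾ {H} {A} o)) (touch-bound p q s Ap Aq As)))
          where
          Ap = G-in o p (proj₁ (proj₁ t))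
          Aq = G-in o q (proj₁ (proj₂ (proj₁ t)))
          As = G-in o s (proj₂ (proj₂ (proj₁ t)))

        case-thick : ∀ x y y′ e → Tri e x y y′ → on G e → X x → Y y → Y y′ → l < codeg x y G → 1 ≤ thickT A x y y′ H
        case-thick x y y′ e t o Xx Yy Yy′ lt = 1≤guard (XYY? A x y y′) _ H ((Ax , Xx) , (Ay , Yy) , (Ay′ , Yy′) , proj₂ (proj₂ (proj₂ t)))
          (λ ((Ax , Xx) , (Ay , Yy) , (Ay′ , Yy′) , y≢y′) → 1≤* (1≤cls A (Remove₃.A₃ A x y y′) H (Remove₃.A₃-⊆ A x y y′) KG)
            (1≤* (1≤ind (cnt (Remove₃.TouchBad? A x y y′) H ≤? Δ₃) (touch-bound x y y′ Ax Ay Ay′))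
                 (1≤ind (ThickEdge.Free? A x y y′ Ax Ay Ay′ Xx Yy Yy′ y≢y′ l Δ₃ H)
                   (ThickEdge.T5⇒Free A x y y′ Ax Ay Ay′ Xx Yy Yy′ y≢y′ l Δ₃ H e (proj₁ KG) t o lt))))
          where
          Ax = G-in o x (proj₁ (proj₁ t))
          Ay = G-in o y (proj₁ (proj₂ (proj₁ t)))
          Ay′ = G-in o y′ (proj₂ (proj₂ (proj₁ t)))

        module Thin (¬mono : ∀ p q s e → Tri e p q s → on G e → wt p ≡ wt q → wt p ≡ wt s → ⊥)
          (¬thick : ∀ x y y′ e → Tri e x y y′ → on G e → X x → Y y → Y y′ → codeg x y G ≤ l) where

          typ-1 : ∀ {e} → on G e → Bad e → typ e ≡ 1
          typ-1 {e} o bd = go (X⊎Y _) (X⊎Y _) (X⊎Y _)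
            where
            t = Tri-self e
            go : X _ ⊎ Y _ → X _ ⊎ Y _ → X _ ⊎ Y _ → typ e ≡ 1
            go (inj₁ p) (inj₁ q) (inj₁ r) = ⊥-elim (¬mono _ _ _ e t o (trans (wt-X p) (sym (wt-X q))) (trans (wt-X p) (sym (wt-X r))))
            go (inj₁ p) (inj₁ q) (inj₂ r) = ⊥-elim (bd (typ-wts t (wt-X p) (wt-X q) (wt-Y r)))
            go (inj₁ p) (inj₂ q) (inj₁ r) = ⊥-elim (bd (typ-wts t (wt-X p) (wt-Y q) (wt-X r)))
            go (inj₂ p) (inj₁ q) (inj₁ r) = ⊥-elim (bd (typ-wts t (wt-Y p) (wt-X q) (wt-X r)))
            go (inj₁ p) (inj₂ q) (inj₂ r) = typ-wts t (wt-X p) (wt-Y q) (wt-Y r)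
            go (inj₂ p) (inj₁ q) (inj₂ r) = typ-wts t (wt-Y p) (wt-X q) (wt-Y r)
            go (inj₂ p) (inj₂ q) (inj₁ r) = typ-wts t (wt-Y p) (wt-Y q) (wt-X r)
            go (inj₂ p) (inj₂ q) (inj₂ r) = ⊥-elim (¬mono _ _ _ e t o (trans (wt-Y p) (sym (wt-Y q))) (trans (wt-Y p) (sym (wt-Y r))))

          within : ∀ {e v} → on G e → Bad e → X v → v ∈ e → Within v (Tset v) e
          within {e} {v} o bd Xv v∈ w w∈ w≢v = let u , t = split₂ v∈ w∈ (w≢v ∘ sym) ; ty = typ-1 o bd ; Yw = other-Y ty Xv v∈ w∈ w≢v in
            Tset-on v w ((G-in o w w∈ , Yw) , (G-in o v v∈ , Xv) ,
              ¬thick v w u e t o Xv Yw (other-Y ty Xv v∈ (proj₂ (proj₂ (proj₁ t))) (proj₁ (proj₂ (proj₂ t)) ∘ sym)))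

          case-special : ∀ x e → X x → x ∈ e → on G e → Bad e → 1 ≤ specialT A w x H
          case-special x e Xx x∈ o bd = 1≤guard (XA? A x) _ H (Ax , Xx) (λ _ → 1≤* thin≥1 fan≥1)
            where
            Ax = G-in o x x∈
            A′ = A − x
            two : 2 ≤ card (on? (Tset x))
            two = let a , c , t@((_ , a∈ , c∈) , (x≢a , x≢c , a≢c)) = split₁ x∈ in
              card-two (on? (Tset x)) a≢c (within o bd Xx x∈ a a∈ (x≢a ∘ sym)) (within o bd Xx x∈ c c∈ (x≢c ∘ sym))
            fan≥1 : 1 ≤ Special.fan A x l τ H
            fan≥1 = fan-G x (Special.Small? A x l τ) 0 ((λ y o → proj₁ (on-Tset x y o)) , two , <⇒≤ (¬lowX x Ax Xx))
              (≤-reflexive (cnt-zero (Star.Stray? x (Own? A x) (Tset x) 0 l) G (λ e ((i , x∈) , bd , ¬w) o → ¬w (x∈ , within o bd Xx x∈))))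
            -- For the remaining graph the sets are cut down to A′, while the small codegrees are
            -- inherited from the larger graph.
            Small′? : ∀ v y → Dec ((A′ y ≡ true × A′ v ≡ true) × Small v y)
            Small′? v y = ((A′ y ≟ᵇ true) ×-dec (A′ v ≟ᵇ true)) ×-dec Small? v y
            Tf : Fin n → Vec Bool n
            Tf v = tabulate (λ y → does (Small′? v y))
            on-Tf : ∀ v y → on (Tf v) y → (A′ y ≡ true × A′ v ≡ true) × Small v y
            on-Tf v y o = go (Small′? v y) (trans (sym (lookup∘tabulate (λ y → does (Small′? v y)) y)) o)
              where
              go : (d : Dec ((A′ y ≡ true × A′ v ≡ true) × Small v y)) → does d ≡ true → (A′ y ≡ true × A′ v ≡ true) × Small v y
              go (yes p) _ = p
            Tf-on : ∀ v y → (A′ y ≡ true × A′ v ≡ true) × Small v y → on (Tf v) y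
            Tf-on v y p = trans (lookup∘tabulate (λ y → does (Small′? v y)) y) (go (Small′? v y))
              where
              go : (d : Dec ((A′ y ≡ true × A′ v ≡ true) × Small v y)) → does d ≡ true
              go (yes _) = refl
              go (no ¬p) = contradiction p ¬p
            A′⇒G : ∀ e → on (H ↾ A′) e → on G e
            A′⇒G e o = let i , o′ = on-↾ {H} {A′} o in to-G (Inside-⊆ (−-⊆ A x) i) o′
            thin≥1 : 1 ≤ thinOf A′ (w x) H
            thin≥1 = let B , B? , asym , _ = cyclic-tournament (XA? A′) z (w x) in
              Tournament.1≤thin A′ B B? asym l τ H Tf
                (λ v → (λ y o → let (A′y , A′v) , (_ , Yy) , (_ , Xv) , _ = on-Tf v y o in (A′y , Yy) , (A′v , Xv)) , Tf≤ v)
                (λ v y o → ≤-trans (codeg-mono v y (H ↾ A′) G (λ e _ → A′⇒G e)) (proj₂ (proj₂ (proj₂ (on-Tf v y o)))))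
                (λ e o bd → typ-1 (A′⇒G e o) bd , λ v v∈ Xv w w∈ w≢v → let i = proj₁ (on-↾ {H} {A′} o) in
                  Tf-on v w ((i w w∈ , i v v∈) , on-Tset v w (within (A′⇒G e o) bd Xv v∈ w w∈ w≢v)))
              where
              Tf≤ : ∀ v → card (on? (Tf v)) ≤ τ
              Tf≤ v = case XA? A v of λ
                { (yes (Av , Xv)) → ≤-trans (card-mono (on? (Tf v)) (on? (Tset v)) (λ y o → Tset-on v y (proj₂ (on-Tf v y o)))) (<⇒≤ (¬lowX v Av Xv))
                ; (no ¬p) → ≤-trans (≤-reflexive (card-empty (on? (Tf v)) (λ y o → ¬p (proj₁ (proj₂ (proj₂ (on-Tf v y o))))))) z≤n }

      cases : (∀ e → Bad e → on G e → ⊥) ⊎ 1 ≤ special A w H + rest A H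
      cases = case any? (λ v → YA? A v ×-dec (Δ <? deg 0 v G)) of λ
        { (yes (v , (Av , Yv) , lt)) → inj₂ (in-rest (part (inj₁ (1≤sum (λ v → lowYT A v H) v (case-lowY v Av Yv lt)))))
        ; (no ¬1) → case any? (λ x → XA? A x ×-dec (τ ≤? card (on? (Tset x)))) of λ
          { (yes (x , (Ax , Xx) , le)) → inj₂ (in-rest (part (inj₂ (inj₁ (1≤sum (λ x → lowXT A x H) x (case-lowX x Ax Xx le))))))
          ; (no ¬2) → late (λ v Av Yv → ≮⇒≥ (λ lt → ¬1 (v , (Av , Yv) , lt))) (λ x Ax Xx → ≰⇒> (λ le → ¬2 (x , (Ax , Xx) , le))) } }
        where
        p₁ = sum (λ v → lowYT A v H)
        p₂ = sum (λ v → lowXT A v H)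
        p₃ = sum (λ p → sum (λ q → sum (λ s → monoT A p q s H)))
        p₄ = sum (λ p → sum (λ q → sum (λ s → thickT A p q s H)))
        part : 1 ≤ p₁ ⊎ (1 ≤ p₂ ⊎ (1 ≤ p₃ ⊎ 1 ≤ p₄)) → 1 ≤ rest A H
        part (inj₁ h) = ≤-trans h (≤-trans (m≤m+n p₁ p₂) (≤-trans (m≤m+n (p₁ + p₂) p₃) (m≤m+n (p₁ + p₂ + p₃) p₄)))
        part (inj₂ (inj₁ h)) = ≤-trans h (≤-trans (m≤n+m p₂ p₁) (≤-trans (m≤m+n (p₁ + p₂) p₃) (m≤m+n (p₁ + p₂ + p₃) p₄)))
        part (inj₂ (inj₂ (inj₁ h))) = ≤-trans h (≤-trans (m≤n+m p₃ (p₁ + p₂)) (m≤m+n (p₁ + p₂ + p₃) p₄))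
        part (inj₂ (inj₂ (inj₂ h))) = ≤-trans h (m≤n+m p₄ (p₁ + p₂ + p₃))
        in-rest : 1 ≤ rest A H → 1 ≤ special A w H + rest A H
        in-rest h = ≤-trans h (m≤n+m (rest A H) (special A w H))
        late : (∀ v → A v ≡ true → Y v → deg 0 v G ≤ Δ) → (∀ x → A x ≡ true → X x → card (on? (Tset x)) < τ) →
          (∀ e → Bad e → on G e → ⊥) ⊎ 1 ≤ special A w H + rest A H
        late ¬1 ¬2 = case any? (λ p → any? λ q → any? λ s → any? λ e → Tri? e p q s ×-dec (on? G e ×-dec ((wt p ≟ wt q) ×-dec (wt p ≟ wt s)))) of λ
          { (yes (p , q , s , e , t , o , wq , ws)) → inj₂ (in-rest (part (inj₂ (inj₂ (inj₁
              (1≤sum (λ p → sum (λ q → sum (λ s → monoT A p q s H))) p (1≤sum (λ q → sum (λ s → monoT A p q s H)) q (1≤sum (λ s → monoT A p q s H) s (case-mono p q s e t o wq ws)))))))))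
          ; (no ¬3) → case any? (λ x → any? λ y → any? λ y′ → any? λ e → Tri? e x y y′ ×-dec (on? G e ×-dec (X? x ×-dec (Y? y ×-dec (Y? y′ ×-dec (l <? codeg x y G)))))) of λ
            { (yes (x , y , y′ , e , t , o , Xx , Yy , Yy′ , lt)) → inj₂ (in-rest (part (inj₂ (inj₂ (inj₂
                (1≤sum (λ p → sum (λ q → sum (λ s → thickT A p q s H))) x (1≤sum (λ q → sum (λ s → thickT A x q s H)) y (1≤sum (λ s → thickT A x y s H) y′ (case-thick x y y′ e t o Xx Yy Yy′ lt)))))))))
            ; (no ¬4) → final (λ p q s e t o wq ws → ¬3 (p , q , s , e , t , o , wq , ws))
                (λ x y y′ e t o Xx Yy Yy′ → ≮⇒≥ (λ lt → ¬4 (x , y , y′ , e , t , o , Xx , Yy , Yy′ , lt))) } }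
          where
          open Rest ¬1 ¬2
          final : (∀ p q s e → Tri e p q s → on G e → wt p ≡ wt q → wt p ≡ wt s → ⊥) →
            (∀ x y y′ e → Tri e x y y′ → on G e → X x → Y y → Y y′ → codeg x y G ≤ l) →
            (∀ e → Bad e → on G e → ⊥) ⊎ 1 ≤ special A w H + rest A H
          final ¬3 ¬4 = case any? (λ e → Bad? e ×-dec on? G e) of λ
            { (no ¬5) → inj₁ (λ e bd o → ¬5 (e , bd , o))
            ; (yes (e , bd , o)) → let x , x∈ , Xx = has-X e (Thin.typ-1 ¬3 ¬4 o bd) in
                inj₂ (≤-trans (1≤sum (λ x → specialT A w x H) x (Thin.case-special ¬3 ¬4 x e Xx x∈ o bd)) (m≤m+n (special A w H) (rest A H))) }

  -- Local optimality, dense vertices and the recursion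

  LocallyOptimal : Vec Bool m → Set
  LocallyOptimal H = ∀ v → (X v → deg 3 v H ≤ deg 2 v H) × (Y v → deg 1 v H ≤ deg 2 v H)

  Target : ℕ → Vec Bool m → Set
  Target b H = T5-free H × cnt Bad? H ≤ b × 1 ≤ cnt Bad? H × LocallyOptimal H

  opaque
    Target? : ∀ b H → Dec (Target b H)
    Target? b H = T5-free? H ×-dec ((cnt Bad? H ≤? b) ×-dec ((1 ≤? cnt Bad? H) ×-dec
      all? (λ v → (X? v →-dec (deg 3 v H ≤? deg 2 v H)) ×-dec (Y? v →-dec (deg 1 v H ≤? deg 2 v H)))))

  trivial-sum : ∀ b k r → m ≤ 2 ^ k * r → ∑ᶜ (λ H → ind (Target? b H)) * 2 ^ card Bad? ≤ 2 ^ (suc k * b + r) * 2 ^ m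
  trivial-sum b k r h = ≤-trans
    (*-monoˡ-≤ (2 ^ card Bad?) (∑ᶜ-mono (λ H → ind-mono (Target? b H) (cnt Bad? H ≤? b) (proj₁ ∘ proj₂))))
    (few-sum Bad? b k r (≤-trans (card≤ Bad?) h))

  far-XXX : ∀ {v} e u → v ∈ e → typ e ≡ 3 → u ∈ e → u ≢ v → wt u ≡ 1
  far-XXX e u v∈ ty u∈ u≢v = let w , t = split₂ u∈ v∈ u≢v in
    all-one (wt≤1 u) (wt≤1 _) (wt≤1 w) (trans (sym (typ-Tri t)) ty)
    where
    all-one : ∀ {a b c} → a ≤ 1 → b ≤ 1 → c ≤ 1 → a + b + c ≡ 3 → a ≡ 1
    all-one (s≤s z≤n) _ _ _ = refl
    all-one z≤n (s≤s z≤n) (s≤s z≤n) ()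
    all-one z≤n (s≤s z≤n) z≤n ()
    all-one z≤n z≤n (s≤s z≤n) ()
    all-one z≤n z≤n z≤n ()

  far-XX : ∀ {v} → Y v → ∀ e u → v ∈ e → typ e ≡ 2 → u ∈ e → u ≢ v → wt u ≡ 1
  far-XX Yv e u v∈ ty u∈ u≢v = let w , t = split₂ v∈ u∈ (u≢v ∘ sym) in
    both-one (wt≤1 u) (wt≤1 w) (trans (sym (trans (typ-Tri t) (cong (λ z → z + wt u + wt w) (wt-Y Yv)))) ty)
    where
    both-one : ∀ {a b} → a ≤ 1 → b ≤ 1 → a + b ≡ 2 → a ≡ 1
    both-one (s≤s z≤n) _ _ = refl
    both-one z≤n (s≤s z≤n) ()
    both-one z≤n z≤n ()

  far-YYY : ∀ {v} e u → v ∈ e → typ e ≡ 0 → u ∈ e → u ≢ v → wt u ≡ 0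
  far-YYY e u v∈ ty u∈ u≢v = let w , t = split₂ u∈ v∈ u≢v in
    m+n≡0⇒m≡0 (wt u) (m+n≡0⇒m≡0 (wt u + _) (trans (sym (typ-Tri t)) ty))

  -- The budget in bits: ν name an event with its vertices, σ are saved by an event of `rest`, σₛ by
  -- a special one, and σ′ is the net gain of one removal. Describing all bad edges costs κ. The
  -- sizes x₀ and y₀ bound the two parts from below during all removals, and y₁ then bounds |Y| from
  -- above.
  module Recursion (l Δ Δ₃ b τ z k r r₁ σ ν σ′ σₛ ς x₀ y₀ y₁ w z₀ k₃ r₃ : ℕ)
    (hn3 : 3 * (n * n) ≤ 2 ^ k * r) (hn1 : n ≤ 2 ^ k * r₁) (hτ : 2 * (n * n) ≤ suc (2 ^ τ)) (hxy : n ≤ x₀ + y₁)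
    (hLY : 2 * (y₁ * y₁ + (suc k * (Δ + Δ) + r) + σ) ≤ x₀ * x₀)
    (hLX₁ : suc k * l + r₁ + y₁ + w ≤ x₀) (hLX₂ : σ + n + (suc k * (Δ + Δ) + r) ≤ τ * w)
    (hz₀x : 3 + z₀ ≤ x₀) (hz₀y : 3 + z₀ ≤ y₀) (hM : 12 * (σ + (suc k * Δ₃ + r)) ≤ z₀ * z₀)
    (hT : 2 * (σ + (suc k * Δ₃ + r)) ≤ l * l) (hΔ₃ : 3 * (2 * Δ + τ * τ) ≤ Δ₃)
    (hz : 3 * z ≤ x₀) (hth : suc k * l + r₁ + 2 * τ ≤ z)
    (hs : suc k * l + r₁ + 2 * τ + ς ≤ x₀) (hσₛ : suc σₛ ≤ 2 * ς)
    (hν : n + n + n * (n * n) + n * (n * n) ≤ 2 ^ ν) (hνₛ : ν ≤ σₛ) (hσ : suc σ′ + ν ≤ σ)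
    (hκ : m ≤ 2 ^ k₃ * r₃) where

    open Class l Δ Δ₃ b τ z

    κ : ℕ
    κ = suc k₃ * b + r₃

    hn2 : n * n ≤ 2 ^ k * r
    hn2 = ≤-trans (m≤m+n (n * n) _) hn3

    n≤n² : n ≤ n * n
    n≤n² = go n
      where
      go : ∀ j → j ≤ j * j
      go zero = z≤n
      go (suc j) = m≤m+n (suc j) (j * suc j)

    hτ₁ : 2 * n ≤ suc (2 ^ τ)
    hτ₁ = ≤-trans (*-monoʳ-≤ 2 n≤n²) hτ

    parts : ∀ A → card (XA? A) + card (YA? A) ≤ n
    parts A = ≤-trans (card-disj (λ v → v ≟ᶠ v) (XA? A) (YA? A) (λ _ _ → refl) (λ _ _ → refl) (λ _ (_ , p) (_ , q) → X≢Y p q refl))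
      (card≤ (λ v → v ≟ᶠ v))

    Y≤ : ∀ A → x₀ < card (XA? A) → card (YA? A) ≤ y₁
    Y≤ A x< = +-cancelˡ-≤ x₀ _ _ (≤-trans (+-monoˡ-≤ _ (<⇒≤ x<)) (≤-trans (parts A) hxy))

    Child : VSet → VSet → Set
    Child A A′ = card (XA? A) ≤ 3 + card (XA? A′) × card (YA? A) ≤ 3 + card (YA? A′)

    child-− : ∀ A v → Child A (A − v)
    child-− A v = ≤-trans (card-− X? A v) (s≤s (m≤n+m _ 2)) , ≤-trans (card-− Y? A v) (s≤s (m≤n+m _ 2))

    child-A₃ : ∀ A p q s → Child A (Remove₃.A₃ A p q s)
    child-A₃ A p q s = Remove₃.card-A₃ A p q s X? , Remove₃.card-A₃ A p q s Y?

    child< : ∀ {c c′ j} d → d + 3 * suc j < c → c ≤ 3 + c′ → d + 3 * j < c′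
    child< {j = j} d h h′ = +-cancelˡ-≤ 3 _ _ (≤-trans (≤-reflexive (eq d j)) (≤-trans h h′))
      where
      eq : ∀ d j → 3 + (1 + (d + 3 * j)) ≡ 1 + (d + 3 * (1 + j))
      eq = solve-∀

    module _ (A : VSet) (x< : x₀ < card (XA? A)) where

      wide : ∀ x → Wide (A − x)
      wide x = ≤-trans hz (card-XA-− A x x<)

      special-sum : ∑ᶜ (special A wide) * 2 ^ badIn A * 2 ^ σₛ * 1 ≤ n * (2 * 2 ^ m)
      special-sum = sum-terms (specialT A wide) (2 ^ badIn A) (2 ^ σₛ) 1 (λ x → guard-sum (XA? A x) _ (2 ^ badIn A) (2 ^ σₛ) 1 (λ (Ax , Xx) →
        step A (A − x) (thinOf (A − x) (wide x)) (Special.fan A x l τ) (card (λ e → Own? A x e ×-dec Bad? e)) σₛ 1 2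
          (thinL x) (Local-⊆ (Own⇒∉ A x) (Special.fan-Local A x l τ)) (badIn-− A x)
          (≤-trans (≤-reflexive (*-identityʳ _)) (thinB x))
          (Special.special-sum A x l τ Ax Xx k r₁ σₛ ς x₀ hn1 x< hτ₁ hs hσₛ)))
        where
        thinL : ∀ x → Local (Inside (A − x)) (thinOf (A − x) (wide x))
        thinL x = let B , B? , asym , _ = cyclic-tournament (XA? (A − x)) z (wide x) in Tournament.thin-Local (A − x) B B? asym l τ
        thinB : ∀ x → ∑ᶜ (thinOf (A − x) (wide x)) * 2 ^ badIn (A − x) ≤ 2 * 2 ^ m
        thinB x = let B , B? , asym , out = cyclic-tournament (XA? (A − x)) z (wide x) in
          Tournament.thin-sum (A − x) B B? asym l τ k r₁ z hn1 (λ v Av Xv → out v (Av , Xv)) hth hτ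

      rest-sum : y₀ < card (YA? A) → ∀ q ρ → (∀ A′ → Child A A′ → ∑ᶜ (cls A′) * 2 ^ badIn A′ * q ≤ ρ * 2 ^ m) →
        ∑ᶜ (rest A) * 2 ^ badIn A * 2 ^ σ * q ≤ 2 ^ ν * (ρ * 2 ^ m)
      rest-sum y< q ρ IH = begin
        ∑ᶜ (rest A) * p * s * q ≡⟨ cong (λ t → t * p * s * q) (trans (∑ᶜ-+ _ r₄) (cong (_+ ∑ᶜ r₄) (trans (∑ᶜ-+ _ r₃′) (cong (_+ ∑ᶜ r₃′) (∑ᶜ-+ r₁′ r₂′))))) ⟩
        (∑ᶜ r₁′ + ∑ᶜ r₂′ + ∑ᶜ r₃′ + ∑ᶜ r₄) * p * s * q ≡⟨ eq (∑ᶜ r₁′) (∑ᶜ r₂′) (∑ᶜ r₃′) (∑ᶜ r₄) p s q ⟩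
        ∑ᶜ r₁′ * p * s * q + ∑ᶜ r₂′ * p * s * q + ∑ᶜ r₃′ * p * s * q + ∑ᶜ r₄ * p * s * q ≤⟨ +-mono-≤ (+-mono-≤ (+-mono-≤ b₁ b₂) b₃) b₄ ⟩
        n * B + n * B + n * (n * (n * B)) + n * (n * (n * B)) ≡⟨ eq′ n B ⟩
        (n + n + n * (n * n) + n * (n * n)) * B ≤⟨ *-monoˡ-≤ B hν ⟩
        2 ^ ν * B ∎
        where
        open ≤-Reasoning
        p = 2 ^ badIn A
        s = 2 ^ σ
        B = ρ * 2 ^ m
        r₁′ r₂′ r₃′ r₄ : Vec Bool m → ℕ
        r₁′ H = sum (λ v → lowYT A v H)
        r₂′ H = sum (λ v → lowXT A v H)
        r₃′ H = sum (λ p → sum (λ q → sum (λ s → monoT A p q s H)))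
        r₄ H = sum (λ p → sum (λ q → sum (λ s → thickT A p q s H)))
        eq : ∀ a b c d p s q → (a + b + c + d) * p * s * q ≡ a * p * s * q + b * p * s * q + c * p * s * q + d * p * s * q
        eq = solve-∀
        eq′ : ∀ n B → n * B + n * B + n * (n * (n * B)) + n * (n * (n * B)) ≡ (n + n + n * (n * n) + n * (n * n)) * B
        eq′ = solve-∀
        b₁ : ∑ᶜ r₁′ * p * s * q ≤ n * B
        b₁ = sum-terms (lowYT A) p s q (λ v → guard-sum (YA? A v) _ p s q (λ (Av , Yv) →
          step A (A − v) (cls (A − v)) (LowY.lowY A v Av Yv (Δ + Δ)) (card (λ e → Own? A v e ×-dec Bad? e)) σ q ρ
            (cls-Local (A − v)) (LowY.lowY-Local A v Av Yv (Δ + Δ)) (badIn-− A v) (IH (A − v) (child-− A v))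
            (LowY.lowY-sum A v Av Yv (Δ + Δ) k r σ x₀ y₁ hn2 x< (Y≤ A x<) hLY)))
        b₂ : ∑ᶜ r₂′ * p * s * q ≤ n * B
        b₂ = sum-terms (lowXT A) p s q (λ x → guard-sum (XA? A x) _ p s q (λ (Ax , Xx) →
          step A (A − x) (cls (A − x)) (LowX.fan A x (Δ + Δ) l τ) (card (λ e → Own? A x e ×-dec Bad? e)) σ q ρ
            (cls-Local (A − x)) (Local-⊆ (Own⇒∉ A x) (LowX.fan-Local A x (Δ + Δ) l τ)) (badIn-− A x) (IH (A − x) (child-− A x))
            (LowX.lowX-sum A x (Δ + Δ) l τ Ax Xx k r r₁ σ x₀ y₁ w hn2 hn1 x< (Y≤ A x<) hLX₁ hLX₂)))
        triple : ∀ (f : Fin n → Fin n → Fin n → Vec Bool m → ℕ) → (∀ i j k → ∑ᶜ (f i j k) * p * s * q ≤ B) →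
          ∑ᶜ (λ H → sum (λ i → sum (λ j → sum (λ k → f i j k H)))) * p * s * q ≤ n * (n * (n * B))
        triple f h = sum-terms (λ i H → sum (λ j → sum (λ k → f i j k H))) p s q (λ i →
          sum-terms (λ j H → sum (λ k → f i j k H)) p s q (λ j → sum-terms (λ k → f i j k) p s q (h i j)))
        b₃ : ∑ᶜ r₃′ * p * s * q ≤ n * (n * (n * B))
        b₃ = triple (monoT A) (λ i j t → guard-sum (Mono? A i j t) _ p s q (λ (As , ds , ws) →
          step A (Remove₃.A₃ A i j t) (cls (Remove₃.A₃ A i j t)) (MonoEdge.mono A i j t As ds ws Δ₃) (card (Remove₃.TouchBad? A i j t)) σ q ρ
            (cls-Local (Remove₃.A₃ A i j t)) (MonoEdge.mono-Local A i j t As ds ws Δ₃) (Remove₃.badIn-A₃ A i j t)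
            (IH (Remove₃.A₃ A i j t) (child-A₃ A i j t))
            (MonoEdge.mono-sum A i j t As ds ws Δ₃ k r σ z₀ hn3
              (+-cancelˡ-≤ 3 _ _ (≤-trans (≤-reflexive (+-suc 3 z₀)) (≤-trans (s≤s hz₀x) (≤-trans x< (proj₁ (child-A₃ A i j t))))))
              (+-cancelˡ-≤ 3 _ _ (≤-trans (≤-reflexive (+-suc 3 z₀)) (≤-trans (s≤s hz₀y) (≤-trans y< (proj₂ (child-A₃ A i j t)))))) hM)))
        b₄ : ∑ᶜ r₄ * p * s * q ≤ n * (n * (n * B))
        b₄ = triple (thickT A) (λ x y y′ → guard-sum (XYY? A x y y′) _ p s q (λ ((Ax , Xx) , (Ay , Yy) , (Ay′ , Yy′) , y≢y′) →
          step A (Remove₃.A₃ A x y y′) (cls (Remove₃.A₃ A x y y′)) (ThickEdge.thick A x y y′ Ax Ay Ay′ Xx Yy Yy′ y≢y′ l Δ₃)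
            (card (Remove₃.TouchBad? A x y y′)) σ q ρ
            (cls-Local (Remove₃.A₃ A x y y′)) (ThickEdge.thick-Local A x y y′ Ax Ay Ay′ Xx Yy Yy′ y≢y′ l Δ₃) (Remove₃.badIn-A₃ A x y y′)
            (IH (Remove₃.A₃ A x y y′) (child-A₃ A x y y′))
            (ThickEdge.thick-sum A x y y′ Ax Ay Ay′ Xx Yy Yy′ y≢y′ l Δ₃ k r σ hn3 hT)))

    InBad? : ∀ A e → Dec (Inside A e × Bad e)
    InBad? A e = Inside? A e ×-dec Bad? e

    -- Divided by 2^(jσ′), this is the trivial bound after j improvements, plus a constant that
    -- accounts for graphs without bad edges inside A and for special events.
    weight : ℕ → ℕ
    weight j = 2 ^ κ + 4 * 2 ^ (j * σ′)

    -- Each removal step gains a factor 2^σ′ until the trivial bound 2^κ is used up.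
    recursion : ∀ j A → x₀ + 3 * j < card (XA? A) → y₀ + 3 * j < card (YA? A) →
      ∑ᶜ (cls A) * 2 ^ badIn A * 2 ^ (j * σ′) ≤ weight j * 2 ^ m
    recursion zero A x< y< = begin
      ∑ᶜ (cls A) * 2 ^ badIn A * 1 ≡⟨ *-identityʳ _ ⟩
      ∑ᶜ (cls A) * 2 ^ badIn A ≤⟨ *-monoˡ-≤ (2 ^ badIn A) (∑ᶜ-mono (λ H → ind≤ (K? (H ↾ A)) (λ (_ , bad , _) →
        1≤ind (cnt (InBad? A) H ≤? b) (≤-trans (cnt-mono (InBad? A) Bad? H (H ↾ A) (λ e (i , bd) o → bd , ↾-on {H} i o)) bad)))) ⟩
      ∑ᶜ (λ H → ind (cnt (InBad? A) H ≤? b)) * 2 ^ badIn A ≤⟨ few-sum (InBad? A) b k₃ r₃ (≤-trans (card≤ (InBad? A)) hκ) ⟩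
      2 ^ κ * 2 ^ m ≤⟨ *-monoˡ-≤ (2 ^ m) (m≤m+n (2 ^ κ) 4) ⟩
      (2 ^ κ + 4 * 1) * 2 ^ m ∎
      where open ≤-Reasoning
    -- The factor 2 is paid by the spare bit in `hσ`. It halves the contribution of the smaller
    -- vertex sets, which keeps the constant 4 from growing with j.
    recursion (suc j) A x< y< = *-cancelˡ-≤ 2 (begin
      2 * (∑ᶜ (cls A) * p * Q) ≤⟨ *-monoʳ-≤ 2 (*-monoˡ-≤ Q (*-monoˡ-≤ p (∑ᶜ-mono pointwise))) ⟩
      2 * (∑ᶜ (λ H → Z H + (special A wd H + rest A H)) * p * Q)
        ≡⟨ cong (λ t → 2 * (t * p * Q)) (trans (∑ᶜ-+ Z _) (cong (∑ᶜ Z +_) (∑ᶜ-+ (special A wd) (rest A)))) ⟩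
      2 * ((∑ᶜ Z + (∑ᶜ (special A wd) + ∑ᶜ (rest A))) * p * Q) ≡⟨ eq₁ (∑ᶜ Z) (∑ᶜ (special A wd)) (∑ᶜ (rest A)) p Q ⟩
      2 * Q * (∑ᶜ Z * p) + 2 * Q * (∑ᶜ (special A wd) * p) + 2 * Q * (∑ᶜ (rest A) * p)
        ≤⟨ +-mono-≤ (+-mono-≤ (*-monoʳ-≤ (2 * Q) (none-sum (InBad? A))) (*-monoʳ-≤ (2 * Q) sp)) rs ⟩
      2 * Q * M + 2 * Q * M + weight j * M ≤⟨ +-monoʳ-≤ _ (*-monoˡ-≤ M (+-monoʳ-≤ (2 ^ κ) (*-monoʳ-≤ 4 (2^-mono {j * σ′} {suc j * σ′} (m≤n+m _ σ′))))) ⟩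
      2 * Q * M + 2 * Q * M + (2 ^ κ + 4 * Q) * M ≤⟨ m≤m+n _ (2 ^ κ * M) ⟩
      2 * Q * M + 2 * Q * M + (2 ^ κ + 4 * Q) * M + 2 ^ κ * M ≡⟨ eq₂ Q M (2 ^ κ) ⟩
      2 * ((2 ^ κ + 4 * Q) * M) ∎)
      where
      open ≤-Reasoning
      p = 2 ^ badIn A
      Q = 2 ^ (suc j * σ′)
      M = 2 ^ m
      x₀< : x₀ < card (XA? A)
      x₀< = ≤-<-trans (m≤m+n x₀ _) x<
      y₀< : y₀ < card (YA? A)
      y₀< = ≤-<-trans (m≤m+n y₀ _) y<
      wd = wide A x₀<
      Z : Vec Bool m → ℕ
      Z H = ind (cnt (InBad? A) H ≤? 0)
      pointwise : ∀ H → cls A H ≤ Z H + (special A wd H + rest A H)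
      pointwise H = ind≤ (K? (H ↾ A)) (λ KG → case Cases.cases A wd H KG hΔ₃ of λ
        { (inj₁ none) → ≤-trans (1≤ind (cnt (InBad? A) H ≤? 0) (≤-reflexive (cnt-zero (InBad? A) H (λ e (i , bd) o → none e bd (↾-on {H} i o))))) (m≤m+n (Z H) _)
        ; (inj₂ h) → ≤-trans h (m≤n+m _ (Z H)) })
      eq₁ : ∀ a b c p q → 2 * ((a + (b + c)) * p * q) ≡ 2 * q * (a * p) + 2 * q * (b * p) + 2 * q * (c * p)
      eq₁ = solve-∀
      eq₂ : ∀ q m k → 2 * q * m + 2 * q * m + (k + 4 * q) * m + k * m ≡ 2 * ((k + 4 * q) * m)
      eq₂ = solve-∀
      sp : ∑ᶜ (special A wd) * p ≤ M
      sp = ≤-trans (≤-reflexive (sym (*-identityʳ _))) (2^-cancel (∑ᶜ (special A wd) * p) 0 σₛ σₛ ≤-refl (begin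
        ∑ᶜ (special A wd) * p * 2 ^ σₛ ≡⟨ *-identityʳ _ ⟨
        ∑ᶜ (special A wd) * p * 2 ^ σₛ * 1 ≤⟨ special-sum A x₀< ⟩
        n * (2 * M) ≡⟨ eq₃ n M ⟩
        (n + n) * M ≤⟨ *-monoˡ-≤ M (≤-trans (≤-trans (m≤m+n (n + n) _) (m≤m+n _ (n * (n * n)))) (≤-trans hν (2^-mono hνₛ))) ⟩
        2 ^ σₛ * M ∎))
        where
        eq₃ : ∀ n M → n * (2 * M) ≡ (n + n) * M
        eq₃ = solve-∀
      rs : 2 * Q * (∑ᶜ (rest A) * p) ≤ weight j * M
      rs = begin
        2 * Q * (∑ᶜ (rest A) * p) ≡⟨ cong (λ t → 2 * t * (∑ᶜ (rest A) * p)) (^-distribˡ-+-* 2 σ′ (j * σ′)) ⟩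
        2 * (2 ^ σ′ * 2 ^ (j * σ′)) * (∑ᶜ (rest A) * p) ≡⟨ eq₅ (2 ^ σ′) (2 ^ (j * σ′)) (∑ᶜ (rest A) * p) ⟩
        ∑ᶜ (rest A) * p * 2 ^ (j * σ′) * 2 ^ suc σ′ ≤⟨ 2^-cancel (∑ᶜ (rest A) * p * 2 ^ (j * σ′)) (suc σ′) ν σ hσ (begin
          ∑ᶜ (rest A) * p * 2 ^ (j * σ′) * 2 ^ σ ≡⟨ eq₆ (∑ᶜ (rest A) * p) (2 ^ (j * σ′)) (2 ^ σ) ⟩
          ∑ᶜ (rest A) * p * 2 ^ σ * 2 ^ (j * σ′) ≤⟨ rest-sum A x₀< y₀< (2 ^ (j * σ′)) (weight j)
            (λ A′ (cx , cy) → recursion j A′ (child< x₀ x< cx) (child< y₀ y< cy)) ⟩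
          2 ^ ν * (weight j * M) ∎) ⟩
        weight j * M ∎
        where
        eq₅ : ∀ a b c → 2 * (a * b) * c ≡ c * b * (2 * a)
        eq₅ = solve-∀
        eq₆ : ∀ a b c → a * b * c ≡ a * c * b
        eq₆ = solve-∀

    -- J removals absorb the trivial bound and leave a factor of at most 5, covered by the three
    -- extra bits. Graphs without bad edges are left out at the top level, so the gain of the first
    -- event is not hidden behind a constant term.
    top-sum : ∀ J ω A (x< : x₀ < card (XA? A)) → x₀ + 3 * suc J < card (XA? A) → y₀ + 3 * suc J < card (YA? A) → κ ≤ J * σ′ → ω + (ν + 3) ≤ σ → ω + ν ≤ σₛ →
      ∑ᶜ (λ H → special A (wide A x<) H + rest A H) * 2 ^ badIn A * 2 ^ ω ≤ 2 * 2 ^ m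
    top-sum J ω A x₀< x< y< hJ h₁ h₂ = begin
      ∑ᶜ (λ H → special A wd H + rest A H) * p * 2 ^ ω ≡⟨ cong (λ t → t * p * 2 ^ ω) (∑ᶜ-+ (special A wd) (rest A)) ⟩
      (∑ᶜ (special A wd) + ∑ᶜ (rest A)) * p * 2 ^ ω ≡⟨ eq₀ (∑ᶜ (special A wd)) (∑ᶜ (rest A)) p (2 ^ ω) ⟩
      ∑ᶜ (special A wd) * p * 2 ^ ω + ∑ᶜ (rest A) * p * 2 ^ ω ≤⟨ +-mono-≤ sp rs ⟩
      M + M ≡⟨ cong (M +_) (sym (+-identityʳ M)) ⟩
      2 * M ∎
      where
      open ≤-Reasoning
      p = 2 ^ badIn A
      M = 2 ^ m
      wd = wide A x₀<
      eq₀ : ∀ a b p q → (a + b) * p * q ≡ a * p * q + b * p * q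
      eq₀ = solve-∀
      sp : ∑ᶜ (special A wd) * p * 2 ^ ω ≤ M
      sp = 2^-cancel (∑ᶜ (special A wd) * p) ω ν σₛ h₂ (begin
        ∑ᶜ (special A wd) * p * 2 ^ σₛ ≡⟨ *-identityʳ _ ⟨
        ∑ᶜ (special A wd) * p * 2 ^ σₛ * 1 ≤⟨ special-sum A x₀< ⟩
        n * (2 * M) ≡⟨ eq₃ n M ⟩
        (n + n) * M ≤⟨ *-monoˡ-≤ M (≤-trans (≤-trans (m≤m+n (n + n) _) (m≤m+n _ (n * (n * n)))) hν) ⟩
        2 ^ ν * M ∎)
        where
        eq₃ : ∀ n M → n * (2 * M) ≡ (n + n) * M
        eq₃ = solve-∀
      q = 2 ^ (J * σ′)
      rs : ∑ᶜ (rest A) * p * 2 ^ ω ≤ M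
      rs = 2^-cancel (∑ᶜ (rest A) * p) ω (ν + 3) σ h₁ (*-cancelʳ-2^ (J * σ′) (begin
        ∑ᶜ (rest A) * p * 2 ^ σ * q ≤⟨ rest-sum A x₀< (≤-<-trans (m≤m+n y₀ _) y<) q (weight J) (λ A′ (cx , cy) → recursion J A′ (child< x₀ x< cx) (child< y₀ y< cy)) ⟩
        2 ^ ν * (weight J * M) ≤⟨ *-monoʳ-≤ (2 ^ ν) (*-monoˡ-≤ M (≤-trans (+-monoˡ-≤ (4 * q) (2^-mono hJ)) (≤-trans (≤-reflexive (eq₅ q)) (*-monoˡ-≤ q (≤ᵇ⇒≤ 5 8 _))))) ⟩
        2 ^ ν * (8 * q * M) ≡⟨ eq₆ (2 ^ ν) q M ⟩
        2 ^ ν * 8 * M * q ≡⟨ cong (λ t → t * M * q) (^-distribˡ-+-* 2 ν 3) ⟨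
        2 ^ (ν + 3) * M * q ∎))
        where
        eq₅ : ∀ q → q + 4 * q ≡ 5 * q
        eq₅ = solve-∀
        eq₆ : ∀ a q M → a * (8 * q * M) ≡ a * 8 * M * q
        eq₆ = solve-∀

    everything : VSet
    everything _ = true

    module _ (J ω j : ℕ) (hJ : κ ≤ J * σ′) (h₁ : ω + (ν + 3) ≤ σ) (h₂ : ω + ν ≤ σₛ)
      (hj : j * (3 * n) ≤ Δ) (hj₂ : 6 * (ω + ν + κ) + j * (j * (3 * n)) ≤ Δ * j)
      (hg : ∀ g → Δ < g * n → 6 * (ω + ν + κ) ≤ g * (l * l)) where

      private
        -- The matching and the other edges have types XXX and XXY for v in X, then XXY and XYY, or
        -- YYY and XXY, for v in Y. In the first two cases local optimality makes deg 2 large.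
        -- Nothing does so for deg 0, hence the alternative in `Tame`.
        module RX (v : Fin n) (Xv : X v) = DoubleDegree v 3 2 1 far-XXX (cong (_+ 2) (sym (wt-X Xv))) Δ
        module RY (v : Fin n) (Yv : Y v) = DoubleDegree v 2 1 1 (far-XX Yv) (cong (_+ 2) (sym (wt-Y Yv))) Δ
        module RZ (v : Fin n) (Yv : Y v) = DoubleDegree v 0 2 0 far-YYY (cong (_+ 2) (sym (wt-Y Yv))) Δ
        module RT (v : Fin n) (Xv : X v) = ThickDegree v Xv l Δ

      few : Vec Bool m → ℕ
      few H = ind (cnt Bad? H ≤? b)

      richX richY richZ richT : Fin n → Vec Bool m → ℕ
      richX v = guard (X? v) (λ Xv H → few H * ind (RX.Rich? v Xv H))
      richY v = guard (Y? v) (λ Yv H → few H * ind (RY.Rich? v Yv H))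
      richZ v = guard (Y? v) (λ Yv H → few H * ind (RZ.Rich? v Yv H))
      richT v = guard (X? v) (λ Xv H → few H * ind (RT.ManyThick? v Xv H))

      dense : Vec Bool m → ℕ
      dense H = sum (λ v → richX v H) + sum (λ v → richY v H) + sum (λ v → richZ v H) + sum (λ v → richT v H)

      -- Each event saves ω + ν + κ bits, of which κ describe all bad edges at once and ν cover the
      -- choice of the vertex.
      dense-sum : ∑ᶜ dense * 2 ^ card Bad? * 2 ^ ω ≤ 2 * 2 ^ m
      dense-sum = ≤-trans (≤-reflexive (sym (*-identityʳ _))) (begin
        ∑ᶜ dense * p * q * 1 ≡⟨ cong (λ t → t * p * q * 1) (trans (∑ᶜ-+ _ d₄) (cong (_+ ∑ᶜ d₄) (trans (∑ᶜ-+ _ d₃) (cong (_+ ∑ᶜ d₃) (∑ᶜ-+ d₁ d₂))))) ⟩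
        (∑ᶜ d₁ + ∑ᶜ d₂ + ∑ᶜ d₃ + ∑ᶜ d₄) * p * q * 1 ≤⟨ 2^-cancel ((∑ᶜ d₁ + ∑ᶜ d₂ + ∑ᶜ d₃ + ∑ᶜ d₄) * p * q) 0 ν ν ≤-refl (begin
          (∑ᶜ d₁ + ∑ᶜ d₂ + ∑ᶜ d₃ + ∑ᶜ d₄) * p * q * 2 ^ ν ≡⟨ eq (∑ᶜ d₁) (∑ᶜ d₂) (∑ᶜ d₃) (∑ᶜ d₄) p q (2 ^ ν) ⟩
          ∑ᶜ d₁ * p * q * 2 ^ ν + ∑ᶜ d₂ * p * q * 2 ^ ν + ∑ᶜ d₃ * p * q * 2 ^ ν + ∑ᶜ d₄ * p * q * 2 ^ ν
            ≤⟨ +-mono-≤ (+-mono-≤ (+-mono-≤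
                 (family richX (λ v → guard-sum (X? v) _ p q (2 ^ ν) (λ Xv → shift (λ H → few H * ind (RX.Rich? v Xv H)) (RX.rich-sum v Xv b k₃ r₃ (ω + ν + κ) j small hj hj₂))))
                 (family richY (λ v → guard-sum (Y? v) _ p q (2 ^ ν) (λ Yv → shift (λ H → few H * ind (RY.Rich? v Yv H)) (RY.rich-sum v Yv b k₃ r₃ (ω + ν + κ) j small hj hj₂)))))
                 (family richZ (λ v → guard-sum (Y? v) _ p q (2 ^ ν) (λ Yv → shift (λ H → few H * ind (RZ.Rich? v Yv H)) (RZ.rich-sum v Yv b k₃ r₃ (ω + ν + κ) j small hj hj₂)))))
                 (family richT (λ v → guard-sum (X? v) _ p q (2 ^ ν) (λ Xv → shift (λ H → few H * ind (RT.ManyThick? v Xv H)) (RT.thick-sum v Xv b k₃ r₃ (ω + ν + κ) small hg)))) ⟩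
          n * M + n * M + n * M + n * M ≡⟨ eq′ n M ⟩
          (n + n) * (2 * M) ≤⟨ *-monoˡ-≤ (2 * M) (≤-trans (≤-trans (m≤m+n (n + n) _) (m≤m+n _ (n * (n * n)))) hν) ⟩
          2 ^ ν * (2 * M) ∎) ⟩
        2 * M ∎)
        where
        open ≤-Reasoning
        p = 2 ^ card Bad?
        q = 2 ^ ω
        M = 2 ^ m
        small : card Bad? ≤ 2 ^ k₃ * r₃
        small = ≤-trans (card≤ Bad?) hκ
        d₁ d₂ d₃ d₄ : Vec Bool m → ℕ
        d₁ H = sum (λ v → richX v H)
        d₂ H = sum (λ v → richY v H)
        d₃ H = sum (λ v → richZ v H)
        d₄ H = sum (λ v → richT v H)
        eq : ∀ a b c d p q r → (a + b + c + d) * p * q * r ≡ a * p * q * r + b * p * q * r + c * p * q * r + d * p * q * r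
        eq = solve-∀
        eq′ : ∀ n M → n * M + n * M + n * M + n * M ≡ (n + n) * (2 * M)
        eq′ = solve-∀
        family : ∀ (f : Fin n → Vec Bool m → ℕ) → (∀ v → ∑ᶜ (f v) * p * q * 2 ^ ν ≤ M) → ∑ᶜ (λ H → sum (λ v → f v H)) * p * q * 2 ^ ν ≤ n * M
        family f h = sum-terms f p q (2 ^ ν) h
        shift : ∀ f → ∑ᶜ f * p * 2 ^ (ω + ν + κ) ≤ 2 ^ κ * M → ∑ᶜ f * p * q * 2 ^ ν ≤ M
        shift f h = ≤-trans (≤-reflexive (exp-merge (∑ᶜ f * p) ω ν)) (2^-cancel (∑ᶜ f * p) (ω + ν) κ (ω + ν + κ) ≤-refl h)

      balanced-sum : x₀ + 3 * suc J < card X? → y₀ + 3 * suc J < card Y? →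
        ∑ᶜ (λ H → ind (Target? b H)) * 2 ^ card Bad? * 2 ^ ω ≤ 4 * 2 ^ m
      balanced-sum x< y< = begin
        ∑ᶜ (λ H → ind (Target? b H)) * p * q ≤⟨ *-monoˡ-≤ q (*-monoˡ-≤ p (∑ᶜ-mono pointwise)) ⟩
        ∑ᶜ (λ H → dense H + top H) * p * q ≡⟨ cong (λ t → t * p * q) (∑ᶜ-+ dense top) ⟩
        (∑ᶜ dense + ∑ᶜ top) * p * q ≡⟨ eq (∑ᶜ dense) (∑ᶜ top) p q ⟩
        ∑ᶜ dense * p * q + ∑ᶜ top * p * q ≤⟨ +-mono-≤ dense-sum (≤-trans (≤-reflexive (cong (λ t → ∑ᶜ top * 2 ^ t * q) same-bad))
            (top-sum J ω everything x₀< (subst (x₀ + 3 * suc J <_) sameX x<) (subst (y₀ + 3 * suc J <_) sameY y<) hJ h₁ h₂)) ⟩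
        2 * 2 ^ m + 2 * 2 ^ m ≡⟨ *-distribʳ-+ (2 ^ m) 2 2 ⟨
        4 * 2 ^ m ∎
        where
        open ≤-Reasoning
        p = 2 ^ card Bad?
        q = 2 ^ ω
        sameX : card X? ≡ card (XA? everything)
        sameX = card-cong X? (XA? everything) (λ _ x → refl , x) (λ _ → proj₂)
        sameY : card Y? ≡ card (YA? everything)
        sameY = card-cong Y? (YA? everything) (λ _ x → refl , x) (λ _ → proj₂)
        same-bad : card Bad? ≡ badIn everything
        same-bad = card-cong Bad? (λ e → Inside? everything e ×-dec Bad? e) (λ _ x → (λ _ _ → refl) , x) (λ _ → proj₂)
        x₀< : x₀ < card (XA? everything)
        x₀< = ≤-<-trans (m≤m+n x₀ _) (subst (x₀ + 3 * suc J <_) sameX x<)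
        top : Vec Bool m → ℕ
        top H = special everything (wide everything x₀<) H + rest everything H
        eq : ∀ a b p q → (a + b) * p * q ≡ a * p * q + b * p * q
        eq = solve-∀
        pointwise : ∀ H → ind (Target? b H) ≤ dense H + top H
        pointwise H = ind≤ (Target? b H) λ (free , bad , one , opt) →
          let
            d₁ = sum (λ v → richX v H)
            d₂ = sum (λ v → richY v H)
            d₃ = sum (λ v → richZ v H)
            d₄ = sum (λ v → richT v H)
            few≥1 = 1≤ind (cnt Bad? H ≤? b) bad
            in₁ : 1 ≤ d₁ → 1 ≤ dense H + top H
            in₁ h = ≤-trans h (≤-trans (m≤m+n d₁ d₂) (≤-trans (m≤m+n (d₁ + d₂) d₃) (≤-trans (m≤m+n (d₁ + d₂ + d₃) d₄) (m≤m+n (dense H) (top H)))))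
            in₂ : 1 ≤ d₂ → 1 ≤ dense H + top H
            in₂ h = ≤-trans h (≤-trans (m≤n+m d₂ d₁) (≤-trans (m≤m+n (d₁ + d₂) d₃) (≤-trans (m≤m+n (d₁ + d₂ + d₃) d₄) (m≤m+n (dense H) (top H)))))
            in₃ : 1 ≤ d₃ → 1 ≤ dense H + top H
            in₃ h = ≤-trans h (≤-trans (m≤n+m d₃ (d₁ + d₂)) (≤-trans (m≤m+n (d₁ + d₂ + d₃) d₄) (m≤m+n (dense H) (top H))))
            in₄ : 1 ≤ d₄ → 1 ≤ dense H + top H
            in₄ h = ≤-trans h (≤-trans (m≤n+m d₄ (d₁ + d₂ + d₃)) (m≤m+n (dense H) (top H)))
          in
          case any? (λ v → X? v ×-dec (Δ <? deg 3 v H)) of λ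
          { (yes (v , Xv , lt)) → in₁ (1≤sum (λ v → richX v H) v (1≤guard (X? v) _ H Xv (λ Xv →
              1≤* few≥1 (1≤ind (RX.Rich? v Xv H) (free , lt , ≤-trans lt (proj₁ (opt v) Xv))))))
          ; (no ¬1) → case any? (λ v → Y? v ×-dec (Δ <? deg 1 v H)) of λ
            { (yes (v , Yv , lt)) → in₂ (1≤sum (λ v → richY v H) v (1≤guard (Y? v) _ H Yv (λ Yv →
                1≤* few≥1 (1≤ind (RY.Rich? v Yv H) (free , ≤-trans lt (proj₂ (opt v) Yv) , lt)))))
            ; (no ¬2) → case any? (λ v → Y? v ×-dec ((Δ <? deg 0 v H) ×-dec (Δ <? deg 2 v H))) of λ
              { (yes (v , Yv , lt , lt′)) → in₃ (1≤sum (λ v → richZ v H) v (1≤guard (Y? v) _ H Yv (λ Yv →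
                  1≤* few≥1 (1≤ind (RZ.Rich? v Yv H) (free , lt , lt′)))))
              ; (no ¬3) → case any? (λ v → X? v ×-dec (Δ <? thickdeg l v H)) of λ
                { (yes (v , Xv , lt)) → in₄ (1≤sum (λ v → richT v H) v (1≤guard (X? v) _ H Xv (λ Xv →
                    1≤* few≥1 (1≤ind (RT.ManyThick? v Xv H) (free , lt)))))
                ; (no ¬4) → ≤-trans (late H free bad one (λ v →
                    (λ Xv → ≮⇒≥ (λ lt → ¬1 (v , Xv , lt)) , ≮⇒≥ (λ lt → ¬4 (v , Xv , lt))) ,
                    (λ Yv → ≮⇒≥ (λ lt → ¬2 (v , Yv , lt)) , (case deg 2 v H ≤? Δ of λ
                      { (yes le) → inj₁ le ; (no ¬le) → inj₂ (≮⇒≥ (λ lt → ¬3 (v , Yv , lt , ≰⇒> ¬le))) })))) (m≤n+m (top H) (dense H)) } } } }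
          where
          late : ∀ H → T5-free H → cnt Bad? H ≤ b → 1 ≤ cnt Bad? H → (∀ v → Tame v H) → 1 ≤ top H
          late H free bad one tame = case Cases.cases everything (wide everything x₀<) H
              (K-mono H (H ↾ everything) (λ e o → proj₂ (on-↾ {H} {everything} o)) (free , bad , tame)) hΔ₃ of λ
            { (inj₁ none) → contradiction one (<⇒≱ (s≤s (≤-reflexive (cnt-zero Bad? H (λ e bd o → none e bd (↾-on {H} (λ _ _ → refl) o))))))
            ; (inj₂ h) → h }

  -- The number of good triples of a partition

  two≤sum : ∀ {N} (f : Fin N → ℕ) {i j} → i ≢ j → f i + f j ≤ sum f
  two≤sum f {i} {j} i≢j = begin
    f i + f j ≡⟨ cong₂ _+_ (sum-point f i) (sum-point f j) ⟨
    sum (λ v → ind (v ≟ᶠ i) * f v) + sum (λ v → ind (v ≟ᶠ j) * f v) ≡⟨ ∑-distrib-+ (λ v → ind (v ≟ᶠ i) * f v) (λ v → ind (v ≟ᶠ j) * f v) ⟨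
    sum (λ v → ind (v ≟ᶠ i) * f v + ind (v ≟ᶠ j) * f v) ≤⟨ sum-mono (λ v → pt v (v ≟ᶠ i) (v ≟ᶠ j)) ⟩
    sum f ∎
    where
    open ≤-Reasoning
    pt : ∀ v (d : Dec (v ≡ i)) (d′ : Dec (v ≡ j)) → ind d * f v + ind d′ * f v ≤ f v
    pt v (yes p) (yes q) = contradiction (trans (sym p) q) i≢j
    pt v (yes _) (no _) = ≤-reflexive (trans (+-identityʳ _) (*-identityˡ _))
    pt v (no _) (yes _) = ≤-reflexive (*-identityˡ _)
    pt v (no _) (no _) = z≤n

  card-pairs-upper : ∀ v {φ : Fin n → Fin n → Set} {Q : Fin m → Set} (φ? : ∀ a b → Dec (φ a b)) (Q? : ∀ e → Dec (Q e)) →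
    (∀ e → Q e → v ∈ e × ∀ a b → Tri e v a b → φ a b) → 2 * card Q? ≤ sum (λ a → card (φ? a))
  card-pairs-upper v {φ} {Q} φ? Q? h = begin
    2 * card Q? ≡⟨ trans (cong (2 *_) (card-sum Q?)) (*-distribˡ-sum 2 (λ e → ind (Q? e))) ⟩
    sum (λ e → 2 * ind (Q? e)) ≤⟨ sum-mono (λ e → per-edge e (Q? e)) ⟩
    sum (λ e → sum (λ a → sum (λ b → ind (Tri? e v a b ×-dec Q? e)))) ≡⟨ ∑-comm (λ e a → sum (λ b → ind (Tri? e v a b ×-dec Q? e))) ⟩
    sum (λ a → sum (λ e → sum (λ b → ind (Tri? e v a b ×-dec Q? e)))) ≡⟨ sum-cong-≗ (λ a → ∑-comm (λ e b → ind (Tri? e v a b ×-dec Q? e))) ⟩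
    sum (λ a → sum (λ b → sum (λ e → ind (Tri? e v a b ×-dec Q? e)))) ≤⟨ sum-mono (λ a → sum-mono (λ b → per-pair a b)) ⟩
    sum (λ a → sum (λ b → ind (φ? a b))) ≡⟨ sum-cong-≗ (λ a → card-sum (φ? a)) ⟨
    sum (λ a → card (φ? a)) ∎
    where
    open ≤-Reasoning
    per-pair : ∀ a b → sum (λ e → ind (Tri? e v a b ×-dec Q? e)) ≤ ind (φ? a b)
    per-pair a b = ≤-trans (≤-reflexive (sym (card-sum (λ e → Tri? e v a b ×-dec Q? e))))
      (card-guard₁ (φ? a b) (λ e → Tri? e v a b ×-dec Q? e) (λ e (t , q) → proj₂ (h e q) a b t) (λ _ → card-≤1 _ (λ _ _ (t , _) (t′ , _) → Tri-unique t t′)))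
    per-edge : ∀ e (d : Dec (Q e)) → 2 * ind d ≤ sum (λ a → sum (λ b → ind (Tri? e v a b ×-dec Q? e)))
    per-edge e (no _) = z≤n
    per-edge e (yes q) = let x , y , t = split₁ (proj₁ (h e q)) in ≤-trans
      (+-mono-≤ (≤-trans (1≤ind (Tri? e v x y ×-dec Q? e) (t , q)) (≤sum (λ b → ind (Tri? e v x b ×-dec Q? e)) y))
                (≤-trans (1≤ind (Tri? e v y x ×-dec Q? e) (swap₂₃ t , q)) (≤sum (λ b → ind (Tri? e v y b ×-dec Q? e)) x)))
      (two≤sum (λ a → sum (λ b → ind (Tri? e v a b ×-dec Q? e))) (proj₂ (proj₂ (proj₂ t))))

  GoodAt? : ∀ v e → Dec (Y v × (v ∈ e × Good e))
  GoodAt? v e = Y? v ×-dec ((v ∈? e) ×-dec Good? e)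

  Y-vertex : ∀ e → Good e → ∃ λ v → v ∈ e × Y v
  Y-vertex e g = go (X⊎Y _) (X⊎Y _) (X⊎Y _)
    where
    go : X _ ⊎ Y _ → X _ ⊎ Y _ → X _ ⊎ Y _ → ∃ λ v → v ∈ e × Y v
    go (inj₂ p) _ _ = _ , inj₁ refl , p
    go (inj₁ _) (inj₂ p) _ = _ , inj₂ (inj₁ refl) , p
    go (inj₁ _) (inj₁ _) (inj₂ p) = _ , inj₂ (inj₂ refl) , p
    go (inj₁ p) (inj₁ q) (inj₁ s) = case trans (sym g) (typ-wts (Tri-self e) (wt-X p) (wt-X q) (wt-X s)) of λ ()

  good-upper : 2 * card Good? ≤ card Y? * (card X? * card X?)
  good-upper = begin
    2 * card Good? ≤⟨ *-monoʳ-≤ 2 (card-cover Good? GoodAt? (λ e g → let v , v∈ , Yv = Y-vertex e g in v , Yv , v∈ , g)) ⟩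
    2 * sum (λ v → card (GoodAt? v)) ≡⟨ *-distribˡ-sum 2 (λ v → card (GoodAt? v)) ⟩
    sum (λ v → 2 * card (GoodAt? v)) ≤⟨ sum-mono per-v ⟩
    sum (λ v → ind (Y? v) * (card X? * card X?)) ≡⟨ sum-ind-* Y? (card X? * card X?) ⟩
    card Y? * (card X? * card X?) ∎
    where
    open ≤-Reasoning
    pairs : sum (λ a → card (λ b → X? a ×-dec X? b)) ≤ card X? * card X?
    pairs = ≤-trans (sum-mono {g = λ a → ind (X? a) * card X?} (λ a → card-guard (X? a) (λ b → X? a ×-dec X? b) (card X?) (λ _ → proj₁) (λ _ → card-mono (λ b → X? a ×-dec X? b) X? (λ _ → proj₂))))
      (≤-reflexive (sum-ind-* X? (card X?)))
    per-v : ∀ v → 2 * card (GoodAt? v) ≤ ind (Y? v) * (card X? * card X?)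
    per-v v = go (Y? v)
      where
      go : Dec (Y v) → 2 * card (GoodAt? v) ≤ ind (Y? v) * (card X? * card X?)
      go (no ¬p) = ≤-trans (≤-reflexive (cong (2 *_) (card-empty (GoodAt? v) (λ e (p , _) → ¬p p)))) z≤n
      go (yes Yv) = ≤-trans (card-pairs-upper v (λ a b → X? a ×-dec X? b) (GoodAt? v) (λ e (_ , v∈ , g) → v∈ , λ a b t →
          1⇒X (far-XX Yv e a v∈ g (proj₁ (proj₂ (proj₁ t))) (proj₁ (proj₂ t) ∘ sym)) ,
          1⇒X (far-XX Yv e b v∈ g (proj₂ (proj₂ (proj₁ t))) (proj₁ (proj₂ (proj₂ t)) ∘ sym))))
        (≤-trans pairs (≤-reflexive (trans (sym (*-identityˡ _)) (cong (_* (card X? * card X?)) (sym (ind-yes (Y? v) Yv))))))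

  good-lower : ∀ x → x < card X? → card Y? * (x * x) ≤ 2 * card Good?
  good-lower x x< = begin
    card Y? * (x * x) ≡⟨ sum-ind-* Y? (x * x) ⟨
    sum (λ v → ind (Y? v) * (x * x)) ≤⟨ sum-mono (λ v → per-v v (Y? v)) ⟩
    sum (λ v → 2 * card (GoodAt? v)) ≡⟨ *-distribˡ-sum 2 (λ v → card (GoodAt? v)) ⟨
    2 * sum (λ v → card (GoodAt? v)) ≤⟨ *-monoʳ-≤ 2 at-most-one ⟩
    2 * card Good? ∎
    where
    open ≤-Reasoning
    per-v : ∀ v (d : Dec (Y v)) → ind d * (x * x) ≤ 2 * card (GoodAt? v)
    per-v v (no _) = z≤n
    per-v v (yes Yv) = ≤-trans (≤-reflexive (*-identityˡ _)) (≤-trans (many-pairs X? x x<)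
      (card-pairs v (λ a b → X? a ×-dec (X? b ×-dec ¬? (a ≟ᶠ b))) (GoodAt? v) (λ a b (Xa , Xb , a≢b) →
        let e , t = edge v a b ((X≢Y Xa Yv ∘ sym) , (X≢Y Xb Yv ∘ sym) , a≢b) in
        e , t , Yv , proj₁ (proj₁ t) , typ-wts t (wt-Y Yv) (wt-X Xa) (wt-X Xb))))
    at-most-one : sum (λ v → card (GoodAt? v)) ≤ card Good?
    at-most-one = begin
      sum (λ v → card (GoodAt? v)) ≡⟨ sum-cong-≗ (λ v → card-sum (GoodAt? v)) ⟩
      sum (λ v → sum (λ e → ind (GoodAt? v e))) ≡⟨ ∑-comm (λ v e → ind (GoodAt? v e)) ⟩
      sum (λ e → sum (λ v → ind (GoodAt? v e))) ≡⟨ sum-cong-≗ (λ e → card-sum (λ v → GoodAt? v e)) ⟨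
      sum (λ e → card (λ v → GoodAt? v e)) ≤⟨ sum-mono {g = λ e → ind (Good? e)} (λ e → card-guard₁ (Good? e) (λ v → GoodAt? v e) (λ v (_ , _ , g) → g) (λ g → card-≤1 (λ v → GoodAt? v e) (one e))) ⟩
      sum (λ e → ind (Good? e)) ≡⟨ card-sum Good? ⟨
      card Good? ∎
      where
      one : ∀ e v w → Y v × (v ∈ e × Good e) → Y w × (w ∈ e × Good e) → v ≡ w
      one e v w (Yv , v∈ , g) (Yw , w∈ , _) with v ≟ᶠ w
      ... | yes p = p
      ... | no v≢w = case trans (sym (wt-Y Yw)) (far-XX Yv e w v∈ g w∈ (v≢w ∘ sym)) of λ ()

  sum-one : ∀ {N} {f : Fin N → ℕ} → (∀ i → f i ≡ 1) → sum f ≡ N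
  sum-one {N} {f} h = trans (sum-cong-≗ {N} {f} {λ _ → 1} h) (trans (sum-const N 1) (*-identityʳ N))

  good+bad : card Good? + card Bad? ≡ m
  good+bad = trans (cong₂ _+_ (card-sum Good?) (card-sum Bad?)) (trans (sym (∑-distrib-+ (λ e → ind (Good? e)) (λ e → ind (Bad? e))))
    (sum-one (λ e → ind-¬ (Good? e))))

  consistent-sum : 2 ^ card Good? ≤ ∑ᶜ (λ H → ind (cnt Bad? H ≤? 0))
  consistent-sum = *-cancelʳ-2^ (card Bad?) (≤-trans (≤-reflexive (trans (sym (^-distribˡ-+-* 2 (card Good?) (card Bad?))) (cong (2 ^_) good+bad))) (none-sum≥ Bad?))

  to-good : ∀ (f : Vec Bool m → ℕ) c → ∑ᶜ f * 2 ^ card Bad? ≤ c * 2 ^ m → ∑ᶜ f ≤ c * 2 ^ card Good?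
  to-good f c h = *-cancelʳ-2^ (card Bad?) (≤-trans h (≤-reflexive (trans (cong (λ z → c * 2 ^ z) (sym good+bad))
    (trans (cong (c *_) (^-distribˡ-+-* 2 (card Good?) (card Bad?))) (sym (*-assoc c _ _))))))

  edges≤n³ : m ≤ n * (n * n)
  edges≤n³ = begin
    m ≡⟨ trans (card-sum (λ (e : Fin m) → e ≟ᶠ e)) (sum-one (λ e → ind-yes (e ≟ᶠ e) refl)) ⟨
    card (λ (e : Fin m) → e ≟ᶠ e) ≤⟨ card-cover (λ e → e ≟ᶠ e) (λ v e → v ∈? e) (λ e _ → proj₁ (vs e) , inj₁ refl) ⟩
    sum (λ v → card (λ e → v ∈? e)) ≤⟨ sum-≤const (λ v → card-∋ v) ⟩
    n * (n * n) ∎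
    where open ≤-Reasoning

-- P′ arises from P by moving one vertex to the other part.
module Flip {n m : ℕ} (vs : Fin m → Fin n × Fin n × Fin n)
  (vs-distinct : ∀ e → Distinct (vs e))
  (exists : ∀ a b c → Distinct (a , b , c) → ∃ λ e → a ∈³ vs e × b ∈³ vs e × c ∈³ vs e)
  (unique : ∀ e f → (∀ v → v ∈³ vs e → v ∈³ vs f) → e ≡ f)
  (P P′ : Vec Bool n) where

  open EdgeSystem vs vs-distinct exists unique
  open Coloured vs vs-distinct exists unique P
  private module C′ = Coloured vs vs-distinct exists unique P′

  -- Edges avoiding v keep their type. Among the edges at v only those of types 2 and d can be bad
  -- after the move, while those of types p and d were bad before it; the common terms cancel.
  flip : ∀ v H p d → p ≢ 2 → d ≢ 2 → p ≢ d → (∀ w → w ≢ v → inX P′ w ≡ wt w) →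
    (∀ e → v ∈ e → C′.Bad e → typ e ≡ 2 ⊎ typ e ≡ d) → cnt Bad? H ≤ cnt C′.Bad? H → deg p v H ≤ deg 2 v H
  flip v H p d p≢2 d≢2 p≢d same near le = +-cancelʳ-≤ (deg d v H) _ _ (+-cancelˡ-≤ (cnt Away? H) _ _ (begin
    cnt Away? H + (deg p v H + deg d v H) ≤⟨ +-monoʳ-≤ (cnt Away? H) (card-disj (λ e → Near? e ×-dec on? H e) (λ e → At? p v e ×-dec on? H e) (λ e → At? d v e ×-dec on? H e)
        (λ { e ((v∈ , ty) , o) → (v∈ , λ g → p≢2 (trans (sym ty) g)) , o }) (λ { e ((v∈ , ty) , o) → (v∈ , λ g → d≢2 (trans (sym ty) g)) , o })
        (λ e ((_ , x) , _) ((_ , y) , _) → p≢d (trans (sym x) y))) ⟩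
    cnt Away? H + cnt Near? H ≤⟨ card-disj (λ e → Bad? e ×-dec on? H e) (λ e → Away? e ×-dec on? H e) (λ e → Near? e ×-dec on? H e)
        (λ e ((_ , bd) , o) → bd , o) (λ e ((_ , bd) , o) → bd , o) (λ e ((v∉ , _) , _) ((v∈ , _) , _) → v∉ v∈) ⟩
    cnt Bad? H ≤⟨ le ⟩
    cnt C′.Bad? H ≤⟨ card-+ (λ e → C′.Bad? e ×-dec on? H e) (λ e → Away? e ×-dec on? H e) (λ e → (At? 2 v e ×-dec on? H e) ⊎-dec (At? d v e ×-dec on? H e))
        (λ e (bd , o) → case v ∈? e of λ { (no v∉) → inj₁ ((v∉ , λ g → bd (trans (away e v∉) g)) , o)
          ; (yes v∈) → inj₂ (case near e v∈ bd of λ { (inj₁ ty) → inj₁ ((v∈ , ty) , o) ; (inj₂ ty) → inj₂ ((v∈ , ty) , o) }) }) ⟩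
    cnt Away? H + card (λ e → (At? 2 v e ×-dec on? H e) ⊎-dec (At? d v e ×-dec on? H e)) ≤⟨ +-monoʳ-≤ (cnt Away? H) (card-+ _ (λ e → At? 2 v e ×-dec on? H e) (λ e → At? d v e ×-dec on? H e) (λ _ p → p)) ⟩
    cnt Away? H + (deg 2 v H + deg d v H) ∎))
    where
    open ≤-Reasoning
    Away? : ∀ e → Dec (¬ (v ∈ e) × Bad e)
    Away? e = ¬? (v ∈? e) ×-dec Bad? e
    Near? : ∀ e → Dec (v ∈ e × Bad e)
    Near? e = (v ∈? e) ×-dec Bad? e
    away : ∀ e → ¬ (v ∈ e) → C′.typ e ≡ typ e
    away e v∉ = cong₂ _+_ (cong₂ _+_ (same _ (λ p → v∉ (inj₁ (sym p)))) (same _ (λ p → v∉ (inj₂ (inj₁ (sym p)))))) (same _ (λ p → v∉ (inj₂ (inj₂ (sym p)))))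

  flip-X : ∀ v H → X v → (∀ w → w ≢ v → inX P′ w ≡ wt w) → inX P′ v ≡ 0 → cnt Bad? H ≤ cnt C′.Bad? H → deg 3 v H ≤ deg 2 v H
  flip-X v H Xv same v0 = flip v H 3 1 (λ ()) (λ ()) (λ ()) same near
    where
    near : ∀ e → v ∈ e → C′.Bad e → typ e ≡ 2 ⊎ typ e ≡ 1
    near e v∈ bd with split₁ v∈
    ... | a , c , t@(_ , (v≢a , v≢c , _)) with X⊎Y a | X⊎Y c
    ...   | inj₁ p | inj₁ q = ⊥-elim (bd (C′.typ-wts t v0 (trans (same a (v≢a ∘ sym)) (wt-X p)) (trans (same c (v≢c ∘ sym)) (wt-X q))))
    ...   | inj₁ p | inj₂ q = inj₁ (typ-wts t (wt-X Xv) (wt-X p) (wt-Y q))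
    ...   | inj₂ p | inj₁ q = inj₁ (typ-wts t (wt-X Xv) (wt-Y p) (wt-X q))
    ...   | inj₂ p | inj₂ q = inj₂ (typ-wts t (wt-X Xv) (wt-Y p) (wt-Y q))

  flip-Y : ∀ v H → Y v → (∀ w → w ≢ v → inX P′ w ≡ wt w) → inX P′ v ≡ 1 → cnt Bad? H ≤ cnt C′.Bad? H → deg 1 v H ≤ deg 2 v H
  flip-Y v H Yv same v1 = flip v H 1 0 (λ ()) (λ ()) (λ ()) same near
    where
    near : ∀ e → v ∈ e → C′.Bad e → typ e ≡ 2 ⊎ typ e ≡ 0
    near e v∈ bd with split₁ v∈
    ... | a , c , t@(_ , (v≢a , v≢c , _)) with X⊎Y a | X⊎Y c
    ...   | inj₁ p | inj₁ q = inj₁ (typ-wts t (wt-Y Yv) (wt-X p) (wt-X q))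
    ...   | inj₁ p | inj₂ q = ⊥-elim (bd (C′.typ-wts t v1 (trans (same a (v≢a ∘ sym)) (wt-X p)) (trans (same c (v≢c ∘ sym)) (wt-Y q))))
    ...   | inj₂ p | inj₁ q = ⊥-elim (bd (C′.typ-wts t v1 (trans (same a (v≢a ∘ sym)) (wt-Y p)) (trans (same c (v≢c ∘ sym)) (wt-X q))))
    ...   | inj₂ p | inj₂ q = inj₂ (typ-wts t (wt-Y Yv) (wt-Y p) (wt-Y q))

-- Graphs as points of the cube

T-∧⁺ : ∀ {a b} → T a → T b → T (a ∧ b)
T-∧⁺ {true} _ q = q

T-≡ : ∀ {a} → T a → a ≡ true
T-≡ {true} _ = refl

module _ {A : Set} where

  filterᵇ-map : ∀ {B : Set} (P : B → Bool) (f : A → B) xs → length (filterᵇ P (map f xs)) ≡ length (filterᵇ (P ∘ f) xs)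
  filterᵇ-map P f [] = refl
  filterᵇ-map P f (x ∷ xs) with P (f x)
  ... | true = cong suc (filterᵇ-map P f xs)
  ... | false = filterᵇ-map P f xs

  filter-does : ∀ {P : A → Set} (P? : ∀ x → Dec (P x)) xs → length (filter P? xs) ≡ length (filterᵇ (does ∘ P?) xs)
  filter-does P? [] = refl
  filter-does P? (x ∷ xs) with does (P? x)
  ... | true = cong suc (filter-does P? xs)
  ... | false = filter-does P? xs

  lookup-injective : ∀ {xs : List A} → Unique xs → ∀ i j → List.lookup xs i ≡ List.lookup xs j → i ≡ j
  lookup-injective (_ ∷ _) zero zero _ = refl
  lookup-injective {x ∷ xs} (x∉ ∷ _) zero (suc j) p = contradiction p (All.lookup x∉ (∈-lookup j))
  lookup-injective {x ∷ xs} (x∉ ∷ _) (suc i) zero p = contradiction (sym p) (All.lookup x∉ (∈-lookup i))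
  lookup-injective (_ ∷ u) (suc i) (suc j) p = cong suc (lookup-injective u i j p)

  concatMap-unique : ∀ {B : Set} (f : A → List B) {xs} → Unique xs → (∀ x → Unique (f x)) →
    (∀ {x y z} → z ∈ˡ f x → z ∈ˡ f y → x ≡ y) → Unique (concatMap f xs)
  concatMap-unique f {xs} u v w = Unique.concat⁺ (All.map⁺ (All.universal v xs))
    (AllPairs.map⁺ (AllPairs.map (λ x≢y {z} (p , q) → x≢y (w p q)) u))

  selected-count : ∀ (xs : List A) (bs : Vec Bool (length xs)) (q : A → Bool) →
    length (filterᵇ q (map proj₁ (filterᵇ proj₂ (zip xs (toList bs))))) ≡ card (λ e → (q (List.lookup xs e) ≟ᵇ true) ×-dec on? bs e)
  selected-count xs bs q = trans (go xs bs) (sym (card-sum _))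
    where
    go : ∀ xs (bs : Vec Bool (length xs)) → length (filterᵇ q (map proj₁ (filterᵇ proj₂ (zip xs (toList bs))))) ≡
      sum (λ e → ind ((q (List.lookup xs e) ≟ᵇ true) ×-dec on? bs e))
    go [] [] = refl
    go (x ∷ xs) (false ∷ bs) = trans (go xs bs) (cong (_+ sum (λ e → ind ((q (List.lookup xs e) ≟ᵇ true) ×-dec on? bs e))) (sym (ind-no ((q x ≟ᵇ true) ×-dec (false ≟ᵇ true)) (λ ()))))
    go (x ∷ xs) (true ∷ bs) with q x
    ... | true = cong suc (go xs bs)
    ... | false = go xs bs

  selected-∈ : ∀ (xs : List A) (bs : Vec Bool (length xs)) e → on bs e → List.lookup xs e ∈ˡ map proj₁ (filterᵇ proj₂ (zip xs (toList bs)))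
  selected-∈ (x ∷ xs) (true ∷ bs) zero o = here refl
  selected-∈ (x ∷ xs) (true ∷ bs) (suc e) o = there (selected-∈ xs bs e o)
  selected-∈ (x ∷ xs) (false ∷ bs) (suc e) o = selected-∈ xs bs e o

opaque
  unfolding ∑ᶜ

  filterᵇ-count : ∀ m (Q : Vec Bool m → Bool) → length (filterᵇ Q (allBoolVecs m)) ≡ ∑ᶜ (λ v → if Q v then 1 else 0)
  filterᵇ-count zero Q with Q []
  ... | true = refl
  ... | false = refl
  filterᵇ-count (suc m) Q = trans (cong length (filter-++ (T? ∘ Q) (map (true ∷_) (allBoolVecs m)) (map (false ∷_) (allBoolVecs m))))
    (trans (length-++ (filterᵇ Q (map (true ∷_) (allBoolVecs m))))
      (cong₂ _+_ (trans (filterᵇ-map Q (true ∷_) (allBoolVecs m)) (filterᵇ-count m (λ v → Q (true ∷ v))))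
                 (trans (filterᵇ-map Q (false ∷_) (allBoolVecs m)) (filterᵇ-count m (λ v → Q (false ∷ v))))))

∈-allBoolVecs : ∀ {m} (v : Vec Bool m) → v ∈ˡ allBoolVecs m
∈-allBoolVecs [] = here refl
∈-allBoolVecs (true ∷ v) = ∈-++⁺ˡ (∈-map⁺ (true ∷_) (∈-allBoolVecs v))
∈-allBoolVecs {suc m} (false ∷ v) = ∈-++⁺ʳ (map (true ∷_) (allBoolVecs m)) (∈-map⁺ (false ∷_) (∈-allBoolVecs v))

argmin : ∀ {m} (f : Vec Bool m → ℕ) → ∃ λ X → ∀ X′ → f X ≤ f X′
argmin {zero} f = [] , λ { [] → ≤-refl }
argmin {suc m} f with argmin (λ v → f (true ∷ v)) | argmin (λ v → f (false ∷ v))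
... | v , hv | w , hw with ≤-total (f (true ∷ v)) (f (false ∷ w))
...   | inj₁ le = true ∷ v , λ { (true ∷ x) → hv x ; (false ∷ x) → ≤-trans le (hw x) }
...   | inj₂ ge = false ∷ w , λ { (true ∷ x) → ≤-trans ge (hv x) ; (false ∷ x) → hw x }

foldr-⊓-≥ : ∀ {A : Set} (f : A → ℕ) b c xs → c ≤ b → (∀ x → c ≤ f x) → c ≤ foldr (λ x acc → f x ⊓ acc) b xs
foldr-⊓-≥ f b c [] h k = h
foldr-⊓-≥ f b c (x ∷ xs) h k = ⊓-glb (k x) (foldr-⊓-≥ f b c xs h k)

-- Sorted triples as an edge system, and the translation of the given definitions

module Triples (n : ℕ) where

  thirds : Fin n → Fin n → List (Triple n)
  thirds i j = map (λ k → (i , j , k)) (filterᵇ (λ k → toℕ j <ᵇ toℕ k) (allFin n))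

  seconds : Fin n → List (Triple n)
  seconds i = concatMap (thirds i) (filterᵇ (λ j → toℕ i <ᵇ toℕ j) (allFin n))

  Sorted : Triple n → Set
  Sorted (i , j , k) = toℕ i < toℕ j × toℕ j < toℕ k

  ∈-thirds : ∀ {t i j} → t ∈ˡ thirds i j → (proj₁ t ≡ i × proj₁ (proj₂ t) ≡ j) × toℕ j < toℕ (proj₂ (proj₂ t))
  ∈-thirds {i = i} {j} h with ∈-map⁻ (λ k → (i , j , k)) h
  ... | k , k∈ , refl = (refl , refl) , <ᵇ⇒< _ _ (proj₂ (∈-filter⁻ (λ k → T? (toℕ j <ᵇ toℕ k)) {xs = allFin n} k∈))

  ∈-seconds : ∀ {t i} → t ∈ˡ seconds i → proj₁ t ≡ i × Sorted t
  ∈-seconds {i = i} h with find (∈-concatMap⁻ (thirds i) {xs = filterᵇ (λ j → toℕ i <ᵇ toℕ j) (allFin n)} h)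
  ... | j , j∈ , t∈ with ∈-thirds {i = i} {j} t∈
  ...   | (refl , refl) , lt = refl , <ᵇ⇒< _ _ (proj₂ (∈-filter⁻ (λ j → T? (toℕ i <ᵇ toℕ j)) {xs = allFin n} j∈)) , lt

  sorted : ∀ {t} → t ∈ˡ triples n → Sorted t
  sorted h with find (∈-concatMap⁻ seconds {xs = allFin n} h)
  ... | i , _ , t∈ = proj₂ (∈-seconds t∈)

  ∈-triples : ∀ i j k → toℕ i < toℕ j → toℕ j < toℕ k → (i , j , k) ∈ˡ triples n
  ∈-triples i j k i<j j<k = ∈-concatMap⁺ seconds (lose (∈-allFin i) (∈-concatMap⁺ (thirds i)
    (lose (∈-filter⁺ (λ j → T? (toℕ i <ᵇ toℕ j)) (∈-allFin j) (<⇒<ᵇ i<j))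
      (∈-map⁺ (λ k → (i , j , k)) (∈-filter⁺ (λ k → T? (toℕ j <ᵇ toℕ k)) (∈-allFin k) (<⇒<ᵇ j<k))))))

  triples-unique : Unique (triples n)
  triples-unique = concatMap-unique seconds (Unique.allFin⁺ n)
    (λ i → concatMap-unique (thirds i) (Unique.filter⁺ (λ j → T? (toℕ i <ᵇ toℕ j)) (Unique.allFin⁺ n))
      (λ j → Unique.map⁺ (λ { refl → refl }) (Unique.filter⁺ (λ k → T? (toℕ j <ᵇ toℕ k)) (Unique.allFin⁺ n)))
      (λ {j} {j′} p q → trans (sym (proj₂ (proj₁ (∈-thirds {i = i} {j} p)))) (proj₂ (proj₁ (∈-thirds {i = i} {j′} q)))))
    (λ p q → trans (sym (proj₁ (∈-seconds p))) (proj₁ (∈-seconds q)))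

  N : ℕ
  N = length (triples n)

  tri : Fin N → Triple n
  tri = List.lookup (triples n)

  tri-sorted : ∀ e → Sorted (tri e)
  tri-sorted e = sorted (∈-lookup e)

  <⇒≢ᶠ : ∀ {i j : Fin n} → toℕ i < toℕ j → i ≢ j
  <⇒≢ᶠ lt refl = <-irrefl refl lt

  tri-distinct : ∀ e → Distinct (tri e)
  tri-distinct e = let p , q = tri-sorted e in <⇒≢ᶠ p , <⇒≢ᶠ (<-trans p q) , <⇒≢ᶠ q

  -- Only the identical matching of positions respects both orders; every other one produces a
  -- number below itself.
  sorted-unique : ∀ s t → Sorted s → Sorted t → (∀ v → v ∈³ s → v ∈³ t) → s ≡ t
  sorted-unique (i , j , k) (i′ , j′ , k′) (ij , jk) (ij′ , jk′) sub =
    go (sub i (inj₁ refl)) (sub j (inj₂ (inj₁ refl))) (sub k (inj₂ (inj₂ refl)))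
    where
    absurd : ∀ {a} {C : Set} → a < a → C
    absurd lt = ⊥-elim (<-irrefl refl lt)
    go : i ∈³ (i′ , j′ , k′) → j ∈³ (i′ , j′ , k′) → k ∈³ (i′ , j′ , k′) → (i , j , k) ≡ (i′ , j′ , k′)
    go (inj₁ refl) (inj₁ refl) _ = absurd ij
    go (inj₁ refl) (inj₂ (inj₁ refl)) (inj₁ refl) = absurd (<-trans ij jk)
    go (inj₁ refl) (inj₂ (inj₁ refl)) (inj₂ (inj₁ refl)) = absurd jk
    go (inj₁ refl) (inj₂ (inj₁ refl)) (inj₂ (inj₂ refl)) = refl
    go (inj₁ refl) (inj₂ (inj₂ refl)) (inj₁ refl) = absurd (<-trans ij jk)
    go (inj₁ refl) (inj₂ (inj₂ refl)) (inj₂ (inj₁ refl)) = absurd (<-trans jk jk′)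
    go (inj₁ refl) (inj₂ (inj₂ refl)) (inj₂ (inj₂ refl)) = absurd jk
    go (inj₂ (inj₁ refl)) (inj₁ refl) _ = absurd (<-trans ij ij′)
    go (inj₂ (inj₁ refl)) (inj₂ (inj₁ refl)) _ = absurd ij
    go (inj₂ (inj₁ refl)) (inj₂ (inj₂ refl)) (inj₁ refl) = absurd (<-trans (<-trans ij jk) ij′)
    go (inj₂ (inj₁ refl)) (inj₂ (inj₂ refl)) (inj₂ (inj₁ refl)) = absurd (<-trans ij jk)
    go (inj₂ (inj₁ refl)) (inj₂ (inj₂ refl)) (inj₂ (inj₂ refl)) = absurd jk
    go (inj₂ (inj₂ refl)) (inj₁ refl) _ = absurd (<-trans ij (<-trans ij′ jk′))
    go (inj₂ (inj₂ refl)) (inj₂ (inj₁ refl)) _ = absurd (<-trans ij jk′)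
    go (inj₂ (inj₂ refl)) (inj₂ (inj₂ refl)) _ = absurd ij

  tri-unique : ∀ e f → (∀ v → v ∈³ tri e → v ∈³ tri f) → e ≡ f
  tri-unique e f h = lookup-injective triples-unique e f (sorted-unique (tri e) (tri f) (tri-sorted e) (tri-sorted f) h)

  find-edge : ∀ i j k → toℕ i < toℕ j → toℕ j < toℕ k → ∃ λ e → tri e ≡ (i , j , k)
  find-edge i j k p q = let h = ∈-triples i j k p q in index h , sym (lookup-index h)

  at : ∀ {e t v} → tri e ≡ t → v ∈³ t → v ∈³ tri e
  at refl h = h

  tri-exists : ∀ a b c → Distinct (a , b , c) → ∃ λ e → a ∈³ tri e × b ∈³ tri e × c ∈³ tri e
  tri-exists a b c (a≢b , a≢c , b≢c) with <-cmp (toℕ a) (toℕ b) | <-cmp (toℕ a) (toℕ c) | <-cmp (toℕ b) (toℕ c)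
  ... | tri≈ _ p _ | _ | _ = contradiction (toℕ-injective p) a≢b
  ... | _ | tri≈ _ p _ | _ = contradiction (toℕ-injective p) a≢c
  ... | _ | _ | tri≈ _ p _ = contradiction (toℕ-injective p) b≢c
  ... | tri< p _ _ | _ | tri< q _ _ = let e , eq = find-edge a b c p q in e , at eq (inj₁ refl) , at eq (inj₂ (inj₁ refl)) , at eq (inj₂ (inj₂ refl))
  ... | tri< _ _ _ | tri< p _ _ | tri> _ _ q = let e , eq = find-edge a c b p q in e , at eq (inj₁ refl) , at eq (inj₂ (inj₂ refl)) , at eq (inj₂ (inj₁ refl))
  ... | tri< q _ _ | tri> _ _ p | tri> _ _ _ = let e , eq = find-edge c a b p q in e , at eq (inj₂ (inj₁ refl)) , at eq (inj₂ (inj₂ refl)) , at eq (inj₁ refl)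
  ... | tri> _ _ p | tri< q _ _ | tri< _ _ _ = let e , eq = find-edge b a c p q in e , at eq (inj₂ (inj₁ refl)) , at eq (inj₁ refl) , at eq (inj₂ (inj₂ refl))
  ... | tri> _ _ _ | tri> _ _ q | tri< p _ _ = let e , eq = find-edge b c a p q in e , at eq (inj₂ (inj₂ refl)) , at eq (inj₁ refl) , at eq (inj₂ (inj₁ refl))
  ... | tri> _ _ q | _ | tri> _ _ p = let e , eq = find-edge c b a p q in e , at eq (inj₂ (inj₂ refl)) , at eq (inj₂ (inj₁ refl)) , at eq (inj₁ refl)

  module C (P : Vec Bool n) = Coloured tri tri-distinct tri-exists tri-unique P
  open EdgeSystem tri tri-distinct tri-exists tri-unique

  graph : Vec Bool N → Graph3 n
  graph = mkGraph3

  T-memb : ∀ {v : Fin n} (t : Triple n) → v ∈³ t → T (memb v t)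
  T-memb {v} (i , j , k) h with v ≟ᶠ i | v ≟ᶠ j | v ≟ᶠ k
  ... | yes _ | _ | _ = _
  ... | no _ | yes _ | _ = _
  ... | no _ | no _ | yes _ = _
  ... | no p | no q | no r = case h of λ { (inj₁ x) → p x ; (inj₂ (inj₁ x)) → q x ; (inj₂ (inj₂ x)) → r x }

  T-≢ : ∀ {a b : Fin n} → a ≢ b → T (not (a == b))
  T-≢ {a} {b} p with a ≟ᶠ b
  ... | yes q = p q
  ... | no _ = _

  T-distinct : ∀ a b c → Distinct (a , b , c) → T (distinct3 a b c)
  T-distinct a b c (p , q , r) = T-∧⁺ (T-≢ p) (T-∧⁺ (T-≢ q) (T-≢ r))

  T-isEdge : ∀ H {e a b c} → Tri e a b c → on H e → T (isEdge {n} (graph H) a b c)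
  T-isEdge H {e} {a} {b} {c} ((a∈ , b∈ , c∈) , d) o = T-∧⁺ (T-distinct a b c d)
    (any⁺ (λ t → memb a t ∧ memb b t ∧ memb c t) (lose (selected-∈ (triples n) H e o)
      (T-∧⁺ (T-memb (tri e) a∈) (T-∧⁺ (T-memb (tri e) b∈) (T-memb (tri e) c∈)))))

  T-anyFin : ∀ (p : Fin n → Bool) v → T (p v) → T (Data.Bool.ListAction.any p (allFin n))
  T-anyFin p v h = any⁺ p (lose (∈-allFin v) h)

  T5-free-graph : ∀ P H → containsT5 {n} (graph H) ≡ false → C.T5-free P H
  T5-free-graph P H none a b c d f e₁ e₂ e₃ e₄ ((t₁ , t₂ , t₃ , t₄) , (o₁ , o₂ , o₃ , o₄)) =
    case trans (sym none) (T-≡ (T-anyFin _ a (T-anyFin _ b (T-anyFin _ c (T-anyFin _ d (T-anyFin _ f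
      (T-∧⁺ (T-distinct a b c (proj₂ t₁)) (T-∧⁺ (T-distinct a b d (proj₂ t₂)) (T-∧⁺ (T-distinct a b f (proj₂ t₃))
      (T-∧⁺ (T-distinct c d f (proj₂ t₄)) (T-∧⁺ (T-isEdge H t₁ o₁) (T-∧⁺ (T-isEdge H t₂ o₂) (T-∧⁺ (T-isEdge H t₃ o₃) (T-isEdge H t₄ o₄))))))))))))))
    of λ ()

  inconsistent-cnt : ∀ P H → inconsistentCount {n} (graph H) P ≡ cnt (C.Bad? P) H
  inconsistent-cnt P H = trans (selected-count (triples n) H (λ t → not (consistent P t)))
    (card-cong _ _ (λ e (p , o) → to (C.typ P e) p , o) (λ e (p , o) → from (C.typ P e) p , o))
    where
    to : ∀ k → not (k ≡ᵇ 2) ≡ true → ¬ (k ≡ 2)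
    to .2 () refl
    from : ∀ k → ¬ (k ≡ 2) → not (k ≡ᵇ 2) ≡ true
    from 0 _ = refl
    from 1 _ = refl
    from 2 h = contradiction refl h
    from (suc (suc (suc k))) _ = refl

  D-lower : ∀ (H : Graph3 n) c → (∀ P → c ≤ inconsistentCount H P) → c ≤ Defs.D H
  D-lower H c h = foldr-⊓-≥ (inconsistentCount H) (length (edges H)) c (allBoolVecs n)
    -- The fold starts at the number of edges, which bounds the count for any partition, here the
    -- one with X empty.
    (≤-trans (h (replicate n false)) (length-filter (λ t → T? (not (consistent (replicate n false) t))) (edges H))) h

  optimal : ∀ H → ∃ λ P → (∀ P′ → cnt (C.Bad? P) H ≤ cnt (C.Bad? P′) H) × cnt (C.Bad? P) H ≤ Defs.D (graph H)
  optimal H = let P , h = argmin (λ P → cnt (C.Bad? P) H) in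
    P , h , D-lower (graph H) (cnt (C.Bad? P) H) (λ P′ → ≤-trans (h P′) (≤-reflexive (sym (inconsistent-cnt P′ H))))

  locally-optimal : ∀ P H → (∀ P′ → cnt (C.Bad? P) H ≤ cnt (C.Bad? P′) H) → C.LocallyOptimal P H
  locally-optimal P H h v =
    (λ Xv → Flip.flip-X tri tri-distinct tri-exists tri-unique P (P [ v ]≔ false) v H Xv (λ w w≢v → cong (if_then 1 else 0) (lookup∘updateAt′ w v w≢v P)) (cong (if_then 1 else 0) (lookup∘updateAt v P)) (h (P [ v ]≔ false))) ,
    (λ Yv → Flip.flip-Y tri tri-distinct tri-exists tri-unique P (P [ v ]≔ true) v H Yv (λ w w≢v → cong (if_then 1 else 0) (lookup∘updateAt′ w v w≢v P)) (cong (if_then 1 else 0) (lookup∘updateAt v P)) (h (P [ v ]≔ true)))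

  SB : Vec Bool N → ℕ
  SB H = if semiBipartite {n} (graph H) then 1 else 0

  S-sum : Defs.S n ≡ ∑ᶜ SB
  S-sum = trans (filterᵇ-map (semiBipartite {n}) graph (allBoolVecs N)) (filterᵇ-count N (semiBipartite {n} ∘ graph))

  semiBipartite-intro : ∀ P H → cnt (C.Bad? P) H ≡ 0 → semiBipartite {n} (graph H) ≡ true
  semiBipartite-intro P H z = T-≡ (any⁺ (λ X → inconsistentCount {n} (graph H) X ≡ᵇ 0)
    (lose (∈-allBoolVecs P) (≡⇒≡ᵇ _ 0 (trans (inconsistent-cnt P H) z))))

  S-lower : ∀ P → 2 ^ card (C.Good? P) ≤ Defs.S n
  S-lower P = begin
    2 ^ card (C.Good? P) ≤⟨ C.consistent-sum P ⟩
    ∑ᶜ (λ H → ind (cnt (C.Bad? P) H ≤? 0)) ≤⟨ ∑ᶜ-mono (λ H → ind≤ (cnt (C.Bad? P) H ≤? 0) (λ z →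
      ≤-reflexive (sym (cong (if_then 1 else 0) (semiBipartite-intro P H (n≤0⇒n≡0 z)))))) ⟩
    ∑ᶜ SB ≡⟨ S-sum ⟨
    Defs.S n ∎
    where open ≤-Reasoning

  1≤S : 1 ≤ Defs.S n
  1≤S = ≤-trans (1≤2^ (card (C.Good? (replicate n true)))) (S-lower (replicate n true))

  -- With respect to an optimal partition a member of Forb either has no bad edge, and is counted by
  -- S, or it is a target for this partition.
  Forb≤ : ∀ b η → (∀ d → ℕtoℚ d ℚ.≤ η ℚ.* ℕtoℚ (n ^ 3) → d ≤ b) →
    |Forb| n η ≤ Defs.S n + ∑ᶜ (λ P → ∑ᶜ (λ H → ind (C.Target? P b H)))
  Forb≤ b η hη = begin
    |Forb| n η ≡⟨ filter-does forb? (allGraphs n) ⟩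
    length (filterᵇ (does ∘ forb?) (allGraphs n)) ≡⟨ filterᵇ-map (does ∘ forb?) graph (allBoolVecs N) ⟩
    length (filterᵇ (does ∘ forb? ∘ graph) (allBoolVecs N)) ≡⟨ filterᵇ-count N (does ∘ forb? ∘ graph) ⟩
    ∑ᶜ (λ H → ind (forb? (graph H))) ≤⟨ ∑ᶜ-mono (λ H → ind≤ (forb? (graph H)) (pointwise H)) ⟩
    ∑ᶜ (λ H → SB H + ∑ᶜ (λ P → ind (C.Target? P b H))) ≡⟨ trans (∑ᶜ-+ SB _) (cong₂ _+_ (sym S-sum) (∑ᶜ-comm (λ P H → ind (C.Target? P b H)))) ⟩
    Defs.S n + ∑ᶜ (λ P → ∑ᶜ (λ H → ind (C.Target? P b H))) ∎
    where
    open ≤-Reasoning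
    forb? : (H : Graph3 n) → Dec ((containsT5 {n} H ≡ false) × (ℕtoℚ (Defs.D {n} H) ℚ.≤ η ℚ.* ℕtoℚ (n ^ 3)))
    forb? H = (containsT5 {n} H ≟ᵇ false) ×-dec (ℕtoℚ (Defs.D {n} H) ℚ.≤? η ℚ.* ℕtoℚ (n ^ 3))
    pointwise : ∀ H → (containsT5 {n} (graph H) ≡ false) × (ℕtoℚ (Defs.D {n} (graph H)) ℚ.≤ η ℚ.* ℕtoℚ (n ^ 3)) →
      1 ≤ SB H + ∑ᶜ (λ P → ind (C.Target? P b H))
    pointwise H (free , D≤) = let P , h , P≤D = optimal H in case cnt (C.Bad? P) H ≟ 0 of λ
      { (yes z) → ≤-trans (≤-reflexive (sym (cong (if_then 1 else 0) (semiBipartite-intro P H z)))) (m≤m+n (SB H) _)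
      ; (no nz) → ≤-trans (1≤ind (C.Target? P b H) (T5-free-graph P H free , ≤-trans P≤D (hη (Defs.D {n} (graph H)) D≤) , n≢0⇒n>0 nz , locally-optimal P H h))
          (≤-trans (≤∑ᶜ (λ P → ind (C.Target? P b H)) P) (m≤n+m _ (SB H))) }

-- Polynomial inequalities in one variable

infixl 6 _⊕_
infixl 7 _⊗_
-- Inequalities between polynomials in u with natural coefficients are reduced to a Boolean test on
-- coefficient lists, which is settled by evaluation even for very large coefficients.
data Poly : Set where
  u′ : Poly
  #_ : ℕ → Poly
  _⊕_ _⊗_ : Poly → Poly → Poly

⟦_⟧ : Poly → ℕ → ℕ
⟦ u′ ⟧ u = u
⟦ # c ⟧ u = c
⟦ p ⊕ q ⟧ u = ⟦ p ⟧ u + ⟦ q ⟧ u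
⟦ p ⊗ q ⟧ u = ⟦ p ⟧ u * ⟦ q ⟧ u

eval : List ℕ → ℕ → ℕ
eval [] u = 0
eval (c ∷ cs) u = c + u * eval cs u

addᵖ : List ℕ → List ℕ → List ℕ
addᵖ [] q = q
addᵖ (c ∷ p) [] = c ∷ p
addᵖ (c ∷ p) (d ∷ q) = (c + d) ∷ addᵖ p q

mulᵖ : List ℕ → List ℕ → List ℕ
mulᵖ [] q = []
mulᵖ (c ∷ p) q = addᵖ (map (c *_) q) (0 ∷ mulᵖ p q)

coeffs : Poly → List ℕ
coeffs u′ = 0 ∷ 1 ∷ []
coeffs (# c) = c ∷ []
coeffs (p ⊕ q) = addᵖ (coeffs p) (coeffs q)
coeffs (p ⊗ q) = mulᵖ (coeffs p) (coeffs q)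

eval-add : ∀ p q u → eval (addᵖ p q) u ≡ eval p u + eval q u
eval-add [] q u = refl
eval-add (c ∷ p) [] u = sym (+-identityʳ _)
eval-add (c ∷ p) (d ∷ q) u = trans (cong (λ z → c + d + u * z) (eval-add p q u)) (eq c d u (eval p u) (eval q u))
  where
  eq : ∀ c d u p q → c + d + u * (p + q) ≡ c + u * p + (d + u * q)
  eq = solve-∀

eval-scale : ∀ c q u → eval (map (c *_) q) u ≡ c * eval q u
eval-scale c [] u = sym (*-zeroʳ c)
eval-scale c (d ∷ q) u = trans (cong (λ z → c * d + u * z) (eval-scale c q u)) (eq c d u (eval q u))
  where
  eq : ∀ c d u q → c * d + u * (c * q) ≡ c * (d + u * q)
  eq = solve-∀

eval-mul : ∀ p q u → eval (mulᵖ p q) u ≡ eval p u * eval q u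
eval-mul [] q u = refl
eval-mul (c ∷ p) q u = trans (eval-add (map (c *_) q) (0 ∷ mulᵖ p q) u)
  (trans (cong₂ _+_ (eval-scale c q u) (cong (u *_) (eval-mul p q u))) (eq c u (eval p u) (eval q u)))
  where
  eq : ∀ c u p q → c * q + u * (p * q) ≡ (c + u * p) * q
  eq = solve-∀

eval-coeffs : ∀ p u → eval (coeffs p) u ≡ ⟦ p ⟧ u
eval-coeffs u′ u = trans (cong (u *_) (trans (cong (1 +_) (*-zeroʳ u)) refl)) (*-identityʳ u)
eval-coeffs (# c) u = trans (cong (c +_) (*-zeroʳ u)) (+-identityʳ c)
eval-coeffs (p ⊕ q) u = trans (eval-add (coeffs p) (coeffs q) u) (cong₂ _+_ (eval-coeffs p u) (eval-coeffs q u))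
eval-coeffs (p ⊗ q) u = trans (eval-mul (coeffs p) (coeffs q) u) (cong₂ _*_ (eval-coeffs p u) (eval-coeffs q u))

-- For u ≥ 1 mass may be moved to higher powers of u: the carry is the part of the lower coefficients not yet paid for.
dominated : ℕ → List ℕ → List ℕ → Bool
dominated k [] [] = k ≤ᵇ 0
dominated k (c ∷ p) [] = ((k + c) ≤ᵇ 0) ∧ dominated 0 p []
dominated k [] (d ∷ q) = dominated (k ∸ d) [] q
dominated k (c ∷ p) (d ∷ q) = dominated ((k + c) ∸ d) p q

T-∧ : ∀ {a b} → T (a ∧ b) → T a × T b
T-∧ {true} h = _ , h

carry : ∀ {u} → 1 ≤ u → ∀ a d p q → (a ∸ d) + p ≤ q → a + u * p ≤ d + u * q
carry {u} 1≤u a d p q h = begin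
  a + u * p ≤⟨ +-monoˡ-≤ (u * p) (m≤n+m∸n a d) ⟩
  d + (a ∸ d) + u * p ≡⟨ +-assoc d (a ∸ d) (u * p) ⟩
  d + ((a ∸ d) + u * p) ≤⟨ +-monoʳ-≤ d (+-monoˡ-≤ (u * p) (≤-trans (≤-reflexive (sym (*-identityˡ (a ∸ d)))) (*-monoˡ-≤ (a ∸ d) 1≤u))) ⟩
  d + (u * (a ∸ d) + u * p) ≡⟨ cong (d +_) (*-distribˡ-+ u (a ∸ d) p) ⟨
  d + u * ((a ∸ d) + p) ≤⟨ +-monoʳ-≤ d (*-monoʳ-≤ u h) ⟩
  d + u * q ∎
  where open ≤-Reasoning

dominated-sound : ∀ {u} → 1 ≤ u → ∀ k p q → T (dominated k p q) → k + eval p u ≤ eval q u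
dominated-sound 1≤u k [] [] h = ≤-trans (≤-reflexive (+-identityʳ k)) (≤ᵇ⇒≤ k 0 h)
dominated-sound {u} 1≤u k (c ∷ p) [] h = let h₁ , h₂ = T-∧ {(k + c) ≤ᵇ 0} h in begin
  k + (c + u * eval p u) ≡⟨ +-assoc k c _ ⟨
  k + c + u * eval p u ≤⟨ +-mono-≤ (≤ᵇ⇒≤ (k + c) 0 h₁) (*-monoʳ-≤ u (dominated-sound 1≤u 0 p [] h₂)) ⟩
  0 + u * 0 ≡⟨ *-zeroʳ u ⟩
  0 ∎
  where open ≤-Reasoning
dominated-sound {u} 1≤u k [] (d ∷ q) h = ≤-trans (≤-reflexive (cong (k +_) (sym (*-zeroʳ u))))
  (carry 1≤u k d 0 (eval q u) (dominated-sound 1≤u (k ∸ d) [] q h))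
dominated-sound {u} 1≤u k (c ∷ p) (d ∷ q) h = ≤-trans (≤-reflexive (sym (+-assoc k c (u * eval p u))))
  (carry 1≤u (k + c) d (eval p u) (eval q u) (dominated-sound 1≤u ((k + c) ∸ d) p q h))

poly-≤ : ∀ p q {u} → 1 ≤ u → {T (dominated 0 (coeffs p) (coeffs q))} → ⟦ p ⟧ u ≤ ⟦ q ⟧ u
poly-≤ p q {u} 1≤u {h} = subst₂ _≤_ (eval-coeffs p u) (eval-coeffs q u) (dominated-sound 1≤u 0 (coeffs p) (coeffs q) h)


-- Choice of the parameters

unit-fraction : ℕ → ℚ
unit-fraction k = mkℚ (ℤ.+ 1) k (Cop.1-coprimeTo (suc k))

0<unit-fraction : ∀ k → 0ℚ ℚ.< unit-fraction k
0<unit-fraction k = ℚ.positive⁻¹ (unit-fraction k)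

scaled-bound : ∀ k η d N → η ℚ.≤ unit-fraction k → ℕtoℚ d ℚ.≤ η ℚ.* ℕtoℚ N → d * suc k ≤ N
scaled-bound k η d N η≤ h = ℤ.drop‿+≤+ (subst₂ ℤ._≤_ left right (ℚᵘ.drop-*≤* u))
  where
  instance
    nn : ℚ.NonNegative (ℕtoℚ N)
    nn = ℚ.normalize-nonNeg N 1
  h′ : ℕtoℚ d ℚ.≤ unit-fraction k ℚ.* ℕtoℚ N
  h′ = ℚ.≤-trans h (ℚ.*-monoʳ-≤-nonNeg (ℕtoℚ N) η≤)
  u : ℚᵘ.mkℚᵘ (ℤ.+ d) 0 ℚᵘ.≤ ℚᵘ.mkℚᵘ (ℤ.+ 1) k ℚᵘ.* ℚᵘ.mkℚᵘ (ℤ.+ N) 0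
  u = ℚᵘ.≤-respˡ-≃ (ℚ.toℚᵘ-fromℚᵘ (ℚᵘ.mkℚᵘ (ℤ.+ d) 0))
    (ℚᵘ.≤-respʳ-≃ (ℚᵘ.≃-trans (ℚ.toℚᵘ-homo-* (unit-fraction k) (ℕtoℚ N)) (ℚᵘ.*-congˡ {ℚᵘ.mkℚᵘ (ℤ.+ 1) k} (ℚ.toℚᵘ-fromℚᵘ (ℚᵘ.mkℚᵘ (ℤ.+ N) 0))))
      (ℚ.toℚᵘ-mono-≤ h′))
  left : ℤ.+ d ℤ.* (ℚᵘ.ℚᵘ.denominator (ℚᵘ.mkℚᵘ (ℤ.+ 1) k ℚᵘ.* ℚᵘ.mkℚᵘ (ℤ.+ N) 0)) ≡ ℤ.+ (d * suc k)
  left = trans (sym (ℤ.pos-* d (suc k * 1))) (cong (λ z → ℤ.+ (d * z)) (*-identityʳ (suc k)))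
  right : (ℚᵘ.ℚᵘ.numerator (ℚᵘ.mkℚᵘ (ℤ.+ 1) k ℚᵘ.* ℚᵘ.mkℚᵘ (ℤ.+ N) 0)) ℤ.* ℤ.+ 1 ≡ ℤ.+ N
  right = trans (ℤ.*-identityʳ (ℤ.+ 1 ℤ.* ℤ.+ N)) (ℤ.*-identityˡ (ℤ.+ N))

opaque
  -- In `few-sum` a permitted bit costs k + 1 bits, and N candidate bits cost N / 2^k in total. The
  -- value 35 serves the events with quadratically many candidates, 99 the choice among all triples.
  k₁ k₃ : ℕ
  k₁ = 35
  k₃ = 99

  suc-k₁ : suc k₁ ≡ 36
  suc-k₁ = refl

  suc-k₃ : suc k₃ ≡ 100
  suc-k₃ = refl

  times-2^k₁ : ∀ x → x * 2 ^ 35 ≡ 2 ^ k₁ * x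
  times-2^k₁ x = *-comm x (2 ^ 35)

  times-2^k₃ : ∀ x → x * 2 ^ 99 ≡ 2 ^ k₃ * x
  times-2^k₃ x = *-comm x (2 ^ 99)

u≤2^u : ∀ u → u ≤ 2 ^ u
u≤2^u zero = z≤n
u≤2^u (suc u) = ≤-trans (+-mono-≤ (1≤2^ u) (u≤2^u u)) (≤-reflexive (cong (2 ^ u +_) (sym (+-identityʳ (2 ^ u)))))

-- n lies between 2^50 u and (2^50 + 1) u; all parameters are multiples of powers of u.
module Large (n u : ℕ) (1≤u : 1 ≤ u) (lo : u * 2 ^ 50 ≤ n) (hi : n ≤ u * (2 ^ 50 + 1)) where

  open Triples n

  l Δ Δ₃ b τ z r r₁ σ ν σ′ σₛ ς x₀ y₀ y₁ w z₀ r₃ ω t j : ℕ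
  -- As 2^40 u is about n/1024, the factors in front of 2^40 are 1024ths of n. On this scale l is
  -- about 2^-12 n, τ is 2^-20 n, Δ is 2^-40 n² and b is 2^-99 n³.
  l = u * 2 ^ 38
  Δ = u * u * 2 ^ 60
  Δ₃ = u * u * (9 * 2 ^ 60)
  b = u * u * u * 2 ^ 51
  τ = u * 2 ^ 30
  z = u * (200 * 2 ^ 40)
  r = u * u * 2 ^ 68
  r₁ = u * 2 ^ 16
  σ = u * u * 2 ^ 70
  ν = u * 2 ^ 10
  σ′ = u * u * 2 ^ 69
  σₛ = u * (1205 * 2 ^ 40)
  ς = u * (603 * 2 ^ 40)
  -- `hLY` needs |X|² > 2|Y|², that is |X| above 0.586 n, and special events need 2 x₀ above 1.1 n.
  -- On the other side, x₀ must stay well below 2n/3 for the unbalanced case.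
  x₀ = u * (613 * 2 ^ 40)
  y₀ = u * (100 * 2 ^ 40)
  y₁ = u * (412 * 2 ^ 40)
  w = u * (190 * 2 ^ 40)
  z₀ = u * (99 * 2 ^ 40)
  r₃ = u * u * u * 2 ^ 52
  -- 1128 = 1024 + 103 + 1: the choice of the partition, the final gain t, and a remainder for
  -- constants. By `h₂` it must not exceed the 1205 of special events, and t is at least n/10
  -- because 10 * 103 > 1024.
  ω = u * (1128 * 2 ^ 40)
  t = u * (103 * 2 ^ 40)
  j = u * 2 ^ 7

  n⁺ : Poly
  n⁺ = u′ ⊗ # (2 ^ 50 + 1)

  nn : n * n ≤ ⟦ n⁺ ⊗ n⁺ ⟧ u
  nn = *-mono-≤ hi hi

  nnn : n * (n * n) ≤ ⟦ n⁺ ⊗ (n⁺ ⊗ n⁺) ⟧ u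
  nnn = *-mono-≤ hi nn

  u²≤ : u * u ≤ 2 ^ (u + u)
  u²≤ = ≤-trans (*-mono-≤ (u≤2^u u) (u≤2^u u)) (≤-reflexive (sym (^-distribˡ-+-* 2 u u)))

  u³≤ : u * u * u ≤ 2 ^ (u + u + u)
  u³≤ = ≤-trans (*-mono-≤ u²≤ (u≤2^u u)) (≤-reflexive (sym (^-distribˡ-+-* 2 (u + u) u)))

  hn3 : 3 * (n * n) ≤ 2 ^ k₁ * r
  hn3 = ≤-trans (*-monoʳ-≤ 3 nn) (≤-trans (poly-≤ (# 3 ⊗ (n⁺ ⊗ n⁺)) (u′ ⊗ u′ ⊗ # (2 ^ 68) ⊗ # (2 ^ 35)) 1≤u)
    (≤-reflexive (times-2^k₁ r)))

  hn1 : n ≤ 2 ^ k₁ * r₁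
  hn1 = ≤-trans hi (≤-trans (poly-≤ n⁺ (u′ ⊗ # (2 ^ 16) ⊗ # (2 ^ 35)) 1≤u)
    (≤-reflexive (times-2^k₁ r₁)))

  hτ : 2 * (n * n) ≤ suc (2 ^ τ)
  hτ = ≤-trans (≤-trans (*-monoʳ-≤ 2 nn) (poly-≤ (# 2 ⊗ (n⁺ ⊗ n⁺)) (u′ ⊗ u′ ⊗ # (2 ^ 103)) 1≤u))
    (≤-trans (*-monoˡ-≤ (2 ^ 103) u²≤) (≤-trans (≤-reflexive (sym (^-distribˡ-+-* 2 (u + u) 103)))
      (≤-trans (2^-mono (poly-≤ (u′ ⊕ u′ ⊕ # 103) (u′ ⊗ # (2 ^ 30)) 1≤u)) (n≤1+n (2 ^ τ)))))

  hxy : n ≤ x₀ + y₁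
  hxy = ≤-trans hi (poly-≤ n⁺ (u′ ⊗ # (613 * 2 ^ 40) ⊕ u′ ⊗ # (412 * 2 ^ 40)) 1≤u)

  hLY : 2 * (y₁ * y₁ + (suc k₁ * (Δ + Δ) + r) + σ) ≤ x₀ * x₀
  hLY = subst (λ s → 2 * (y₁ * y₁ + (s * (Δ + Δ) + r) + σ) ≤ x₀ * x₀) (sym suc-k₁)
    (poly-≤ (# 2 ⊗ (y₁′ ⊗ y₁′ ⊕ (# 36 ⊗ (Δ′ ⊕ Δ′) ⊕ u′ ⊗ u′ ⊗ # (2 ^ 68)) ⊕ u′ ⊗ u′ ⊗ # (2 ^ 70))) (u′ ⊗ # (613 * 2 ^ 40) ⊗ (u′ ⊗ # (613 * 2 ^ 40))) 1≤u)
    where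
    y₁′ Δ′ : Poly
    y₁′ = u′ ⊗ # (412 * 2 ^ 40)
    Δ′ = u′ ⊗ u′ ⊗ # (2 ^ 60)

  hLX₁ : suc k₁ * l + r₁ + y₁ + w ≤ x₀
  hLX₁ = subst (λ s → s * l + r₁ + y₁ + w ≤ x₀) (sym suc-k₁)
    (poly-≤ (# 36 ⊗ (u′ ⊗ # (2 ^ 38)) ⊕ u′ ⊗ # (2 ^ 16) ⊕ u′ ⊗ # (412 * 2 ^ 40) ⊕ u′ ⊗ # (190 * 2 ^ 40)) (u′ ⊗ # (613 * 2 ^ 40)) 1≤u)

  hLX₂ : σ + n + (suc k₁ * (Δ + Δ) + r) ≤ τ * w
  hLX₂ = subst (λ s → σ + n + (s * (Δ + Δ) + r) ≤ τ * w) (sym suc-k₁)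
    (≤-trans (+-monoˡ-≤ (36 * (Δ + Δ) + r) (+-monoʳ-≤ σ hi))
      (poly-≤ (u′ ⊗ u′ ⊗ # (2 ^ 70) ⊕ n⁺ ⊕ (# 36 ⊗ (u′ ⊗ u′ ⊗ # (2 ^ 60) ⊕ u′ ⊗ u′ ⊗ # (2 ^ 60)) ⊕ u′ ⊗ u′ ⊗ # (2 ^ 68)))
        (u′ ⊗ # (2 ^ 30) ⊗ (u′ ⊗ # (190 * 2 ^ 40))) 1≤u))

  hz₀x : 3 + z₀ ≤ x₀
  hz₀x = poly-≤ (# 3 ⊕ u′ ⊗ # (99 * 2 ^ 40)) (u′ ⊗ # (613 * 2 ^ 40)) 1≤u

  hz₀y : 3 + z₀ ≤ y₀
  hz₀y = poly-≤ (# 3 ⊕ u′ ⊗ # (99 * 2 ^ 40)) (u′ ⊗ # (100 * 2 ^ 40)) 1≤u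

  hM : 12 * (σ + (suc k₁ * Δ₃ + r)) ≤ z₀ * z₀
  hM = subst (λ s → 12 * (σ + (s * Δ₃ + r)) ≤ z₀ * z₀) (sym suc-k₁)
    (poly-≤ (# 12 ⊗ (u′ ⊗ u′ ⊗ # (2 ^ 70) ⊕ (# 36 ⊗ (u′ ⊗ u′ ⊗ # (9 * 2 ^ 60)) ⊕ u′ ⊗ u′ ⊗ # (2 ^ 68)))) (u′ ⊗ # (99 * 2 ^ 40) ⊗ (u′ ⊗ # (99 * 2 ^ 40))) 1≤u)

  hT : 2 * (σ + (suc k₁ * Δ₃ + r)) ≤ l * l
  hT = subst (λ s → 2 * (σ + (s * Δ₃ + r)) ≤ l * l) (sym suc-k₁)
    (poly-≤ (# 2 ⊗ (u′ ⊗ u′ ⊗ # (2 ^ 70) ⊕ (# 36 ⊗ (u′ ⊗ u′ ⊗ # (9 * 2 ^ 60)) ⊕ u′ ⊗ u′ ⊗ # (2 ^ 68)))) (u′ ⊗ # (2 ^ 38) ⊗ (u′ ⊗ # (2 ^ 38))) 1≤u)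

  hΔ₃ : 3 * (2 * Δ + τ * τ) ≤ Δ₃
  hΔ₃ = poly-≤ (# 3 ⊗ (# 2 ⊗ (u′ ⊗ u′ ⊗ # (2 ^ 60)) ⊕ u′ ⊗ # (2 ^ 30) ⊗ (u′ ⊗ # (2 ^ 30)))) (u′ ⊗ u′ ⊗ # (9 * 2 ^ 60)) 1≤u

  hz : 3 * z ≤ x₀
  hz = poly-≤ (# 3 ⊗ (u′ ⊗ # (200 * 2 ^ 40))) (u′ ⊗ # (613 * 2 ^ 40)) 1≤u

  hth : suc k₁ * l + r₁ + 2 * τ ≤ z
  hth = subst (λ s → s * l + r₁ + 2 * τ ≤ z) (sym suc-k₁)
    (poly-≤ (# 36 ⊗ (u′ ⊗ # (2 ^ 38)) ⊕ u′ ⊗ # (2 ^ 16) ⊕ # 2 ⊗ (u′ ⊗ # (2 ^ 30))) (u′ ⊗ # (200 * 2 ^ 40)) 1≤u)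

  hs : suc k₁ * l + r₁ + 2 * τ + ς ≤ x₀
  hs = subst (λ s → s * l + r₁ + 2 * τ + ς ≤ x₀) (sym suc-k₁)
    (poly-≤ (# 36 ⊗ (u′ ⊗ # (2 ^ 38)) ⊕ u′ ⊗ # (2 ^ 16) ⊕ # 2 ⊗ (u′ ⊗ # (2 ^ 30)) ⊕ u′ ⊗ # (603 * 2 ^ 40)) (u′ ⊗ # (613 * 2 ^ 40)) 1≤u)

  hσₛ : suc σₛ ≤ 2 * ς
  hσₛ = poly-≤ (# 1 ⊕ u′ ⊗ # (1205 * 2 ^ 40)) (# 2 ⊗ (u′ ⊗ # (603 * 2 ^ 40))) 1≤u

  hν : n + n + n * (n * n) + n * (n * n) ≤ 2 ^ ν
  hν = ≤-trans (+-mono-≤ (+-mono-≤ (+-mono-≤ hi hi) nnn) nnn)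
    (≤-trans (poly-≤ (n⁺ ⊕ n⁺ ⊕ n⁺ ⊗ (n⁺ ⊗ n⁺) ⊕ n⁺ ⊗ (n⁺ ⊗ n⁺)) (u′ ⊗ u′ ⊗ u′ ⊗ # (2 ^ 155)) 1≤u)
      (≤-trans (*-monoˡ-≤ (2 ^ 155) u³≤) (≤-trans (≤-reflexive (sym (^-distribˡ-+-* 2 (u + u + u) 155)))
        (2^-mono (poly-≤ (u′ ⊕ u′ ⊕ u′ ⊕ # 155) (u′ ⊗ # (2 ^ 10)) 1≤u)))))

  hνₛ : ν ≤ σₛ
  hνₛ = poly-≤ (u′ ⊗ # (2 ^ 10)) (u′ ⊗ # (1205 * 2 ^ 40)) 1≤u

  hσ : suc σ′ + ν ≤ σ
  hσ = poly-≤ (# 1 ⊕ u′ ⊗ u′ ⊗ # (2 ^ 69) ⊕ u′ ⊗ # (2 ^ 10)) (u′ ⊗ u′ ⊗ # (2 ^ 70)) 1≤u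

  hκ : N ≤ 2 ^ k₃ * r₃
  hκ = ≤-trans (C.edges≤n³ (replicate n true)) (≤-trans nnn (≤-trans (poly-≤ (n⁺ ⊗ (n⁺ ⊗ n⁺)) (u′ ⊗ u′ ⊗ u′ ⊗ # (2 ^ 52) ⊗ # (2 ^ 99)) 1≤u)
    (≤-reflexive (times-2^k₃ r₃))))

  κ : ℕ
  κ = suc k₃ * b + r₃

  κ⁺ : Poly
  κ⁺ = # 100 ⊗ (u′ ⊗ u′ ⊗ u′ ⊗ # (2 ^ 51)) ⊕ u′ ⊗ u′ ⊗ u′ ⊗ # (2 ^ 52)

  κ≤ : κ ≤ ⟦ κ⁺ ⟧ u
  κ≤ = subst (λ s → s * b + r₃ ≤ ⟦ κ⁺ ⟧ u) (sym suc-k₃) ≤-refl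

  hJ : κ ≤ u * σ′
  hJ = ≤-trans κ≤ (poly-≤ κ⁺ (u′ ⊗ (u′ ⊗ u′ ⊗ # (2 ^ 69))) 1≤u)

  h₁ : ω + (ν + 3) ≤ σ
  h₁ = poly-≤ (u′ ⊗ # (1128 * 2 ^ 40) ⊕ (u′ ⊗ # (2 ^ 10) ⊕ # 3)) (u′ ⊗ u′ ⊗ # (2 ^ 70)) 1≤u

  h₂ : ω + ν ≤ σₛ
  h₂ = poly-≤ (u′ ⊗ # (1128 * 2 ^ 40) ⊕ u′ ⊗ # (2 ^ 10)) (u′ ⊗ # (1205 * 2 ^ 40)) 1≤u

  hj : j * (3 * n) ≤ Δ
  hj = ≤-trans (*-monoʳ-≤ j (*-monoʳ-≤ 3 hi)) (poly-≤ (u′ ⊗ # (2 ^ 7) ⊗ (# 3 ⊗ n⁺)) (u′ ⊗ u′ ⊗ # (2 ^ 60)) 1≤u)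

  ων⁺ : Poly
  ων⁺ = u′ ⊗ # (1128 * 2 ^ 40) ⊕ u′ ⊗ # (2 ^ 10) ⊕ κ⁺

  hj₂ : 6 * (ω + ν + κ) + j * (j * (3 * n)) ≤ Δ * j
  hj₂ = ≤-trans (+-mono-≤ (*-monoʳ-≤ 6 (+-monoʳ-≤ (ω + ν) κ≤)) (*-monoʳ-≤ j (*-monoʳ-≤ j (*-monoʳ-≤ 3 hi))))
    (poly-≤ (# 6 ⊗ ων⁺ ⊕ u′ ⊗ # (2 ^ 7) ⊗ (u′ ⊗ # (2 ^ 7) ⊗ (# 3 ⊗ n⁺))) (u′ ⊗ u′ ⊗ # (2 ^ 60) ⊗ (u′ ⊗ # (2 ^ 7))) 1≤u)

  hg : ∀ g → Δ < g * n → 6 * (ω + ν + κ) ≤ g * (l * l)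
  hg g lt = ≤-trans (*-monoʳ-≤ 6 (+-monoʳ-≤ (ω + ν) κ≤))
    (≤-trans (poly-≤ (# 6 ⊗ ων⁺) (u′ ⊗ # (2 ^ 9) ⊗ (u′ ⊗ # (2 ^ 38) ⊗ (u′ ⊗ # (2 ^ 38)))) 1≤u) (*-monoˡ-≤ (l * l) many))
    where
    many : u * 2 ^ 9 ≤ g
    many = ≮⇒≥ (λ g< → <⇒≱ lt (≤-trans (*-mono-≤ (<⇒≤ g<) hi) (poly-≤ (u′ ⊗ # (2 ^ 9) ⊗ n⁺) (u′ ⊗ u′ ⊗ # (2 ^ 60)) 1≤u)))

  -- Balanced and unbalanced partitions

  target : Vec Bool n → Vec Bool N → ℕ
  target P H = ind (C.Target? P b H)

  balanced : ∀ P → x₀ + 3 * suc u < card (C.X? P) → y₀ + 3 * suc u < card (C.Y? P) → ∑ᶜ (target P) * 2 ^ ω ≤ 4 * 2 ^ card (C.Good? P)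
  balanced P x< y< = ≤-trans (≤-reflexive (sym (∑ᶜ-*ʳ (2 ^ ω) (target P)))) (C.to-good P (λ H → target P H * 2 ^ ω) 4
    (≤-trans (≤-reflexive (trans (cong (_* 2 ^ card (C.Bad? P)) (∑ᶜ-*ʳ (2 ^ ω) (target P))) (eq (∑ᶜ (target P)) (2 ^ ω) (2 ^ card (C.Bad? P)))))
      (C.Recursion.balanced-sum P l Δ Δ₃ b τ z k₁ r r₁ σ ν σ′ σₛ ς x₀ y₀ y₁ w z₀ k₃ r₃
        hn3 hn1 hτ hxy hLY hLX₁ hLX₂ hz₀x hz₀y hM hT hΔ₃ hz hth hs hσₛ hν hνₛ hσ hκ
        u ω j hJ h₁ h₂ hj hj₂ hg x< y<)))
    where
    eq : ∀ a b c → a * b * c ≡ a * c * b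
    eq = solve-∀

  rough : ∀ P → ∑ᶜ (target P) ≤ 2 ^ κ * 2 ^ card (C.Good? P)
  rough P = C.to-good P (target P) (2 ^ κ) (C.trivial-sum P b k₃ r₃ hκ)

  X+Y : ∀ P → card (C.X? P) + card (C.Y? P) ≡ n
  X+Y P = trans (cong₂ _+_ (card-sum (C.X? P)) (card-sum (C.Y? P))) (trans (sym (∑-distrib-+ (λ v → ind (C.X? P v)) (λ v → ind (C.Y? P v))))
    (C.sum-one P (λ v → go (lookup P v))))
    where
    go : ∀ c → ind (c ≟ᵇ true) + ind (c ≟ᵇ false) ≡ 1
    go true = refl
    go false = refl

  -- Roughly n/3 and 2n/3, where |Y| |X|², about twice the number of good triples, is largest.
  y* x* : ℕ
  y* = u * (341 * 2 ^ 40)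
  x* = u * (682 * 2 ^ 40)

  y*≤n : y* ≤ n
  y*≤n = ≤-trans (poly-≤ (u′ ⊗ # (341 * 2 ^ 40)) (u′ ⊗ # (2 ^ 50)) 1≤u) lo

  chosen : ∃ λ β → (∀ (v : Fin n) → β v ≡ true → v ≡ v) × card (Is? β) ≡ y*
  chosen = pick {P = λ v → v ≡ v} (λ v → v ≟ᶠ v) y* (≤-trans y*≤n (≤-reflexive (sym (trans (card-sum {P = λ v → v ≡ v} (λ (v : Fin n) → v ≟ᶠ v)) (C.sum-one (replicate n true) (λ v → ind-yes (v ≟ᶠ v) refl))))))

  β : Fin n → Bool
  β = proj₁ chosen

  P* : Vec Bool n
  P* = tabulate (λ v → not (β v))

  card-Y* : card (C.Y? P*) ≡ y*
  card-Y* = trans (card-cong (C.Y? P*) (Is? β) (λ v p → flip-not (trans (sym (lookup∘tabulate (λ v → not (β v)) v)) p))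
    (λ v p → trans (lookup∘tabulate (λ v → not (β v)) v) (cong not p))) (proj₂ (proj₂ chosen))
    where
    flip-not : ∀ {c} → not c ≡ false → c ≡ true
    flip-not {true} _ = refl

  x*<X : x* < card (C.X? P*)
  x*<X = +-cancelʳ-≤ y* _ _ (≤-trans (poly-≤ (# 1 ⊕ u′ ⊗ # (682 * 2 ^ 40) ⊕ u′ ⊗ # (341 * 2 ^ 40)) (u′ ⊗ # (2 ^ 50)) 1≤u)
    (≤-trans lo (≤-reflexive (trans (sym (X+Y P*)) (cong (card (C.X? P*) +_) card-Y*)))))

  best : y* * (x* * x*) ≤ 2 * card (C.Good? P*)
  best = ≤-trans (≤-reflexive (cong (_* (x* * x*)) (sym card-Y*))) (C.good-lower P* x* x*<X)

  -- With a = x + d: under x + y ≤ a + b and x ≤ 2b, the product x² y is at most a² b.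
  square-product : ∀ x d y b → x ≤ 2 * b → y ≤ b + d → y * (x * x) ≤ b * ((x + d) * (x + d))
  square-product x d y b x≤ y≤ = begin
    y * (x * x) ≤⟨ *-monoˡ-≤ (x * x) y≤ ⟩
    (b + d) * (x * x) ≡⟨ eq₁ b d x ⟩
    b * (x * x) + d * x * x ≤⟨ +-monoʳ-≤ (b * (x * x)) (*-monoʳ-≤ (d * x) x≤) ⟩
    b * (x * x) + d * x * (2 * b) ≤⟨ m≤m+n _ (b * (d * d)) ⟩
    b * (x * x) + d * x * (2 * b) + b * (d * d) ≡⟨ eq₂ b d x ⟩
    b * ((x + d) * (x + d)) ∎
    where
    open ≤-Reasoning
    eq₁ : ∀ b d x → (b + d) * (x * x) ≡ b * (x * x) + d * x * x
    eq₁ = solve-∀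
    eq₂ : ∀ b d x → b * (x * x) + d * x * (2 * b) + b * (d * d) ≡ b * ((x + d) * (x + d))
    eq₂ = solve-∀

  -- In units of (2^40 u)³ the product |Y| |X|² is at most about 411 * 614² if X is small, and about
  -- 101 * 1024² if Y is small. Both fall short of 341 * 682² by a multiple of u³ that absorbs κ and
  -- ω.
  unbalanced : ∀ P → ¬ (x₀ + 3 * suc u < card (C.X? P) × y₀ + 3 * suc u < card (C.Y? P)) →
    2 * (κ + ω) + card (C.Y? P) * (card (C.X? P) * card (C.X? P)) ≤ y* * (x* * x*)
  unbalanced P ¬p = case x₀ + 3 * suc u <? X of λ
    { (no ¬x) → few-X (≤-trans (≮⇒≥ ¬x) (poly-≤ (u′ ⊗ # (613 * 2 ^ 40) ⊕ # 3 ⊗ (# 1 ⊕ u′)) (u′ ⊗ # (614 * 2 ^ 40)) 1≤u))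
    ; (yes x<) → few-Y (≤-trans (≮⇒≥ (λ y< → ¬p (x< , y<))) (poly-≤ (u′ ⊗ # (100 * 2 ^ 40) ⊕ # 3 ⊗ (# 1 ⊕ u′)) (u′ ⊗ # (101 * 2 ^ 40)) 1≤u)) }
    where
    X = card (C.X? P)
    Y = card (C.Y? P)
    a b′ : ℕ
    a = u * (614 * 2 ^ 40)
    b′ = u * (411 * 2 ^ 40)
    goal⁺ : Poly
    goal⁺ = u′ ⊗ # (341 * 2 ^ 40) ⊗ (u′ ⊗ # (682 * 2 ^ 40) ⊗ (u′ ⊗ # (682 * 2 ^ 40)))
    start⁺ : Poly
    start⁺ = # 2 ⊗ (κ⁺ ⊕ u′ ⊗ # (1128 * 2 ^ 40))
    start : 2 * (κ + ω) ≤ ⟦ start⁺ ⟧ u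
    start = *-monoʳ-≤ 2 (+-monoˡ-≤ ω κ≤)
    few-X : X ≤ a → 2 * (κ + ω) + Y * (X * X) ≤ y* * (x* * x*)
    few-X X≤a = ≤-trans (+-mono-≤ start (≤-trans (square-product X (a ∸ X) Y b′ X≤2b Y≤) (≤-reflexive (cong (λ s → b′ * (s * s)) (m+[n∸m]≡n X≤a)))))
      (poly-≤ (start⁺ ⊕ u′ ⊗ # (411 * 2 ^ 40) ⊗ (u′ ⊗ # (614 * 2 ^ 40) ⊗ (u′ ⊗ # (614 * 2 ^ 40)))) goal⁺ 1≤u)
      where
      X≤2b : X ≤ 2 * b′
      X≤2b = ≤-trans X≤a (poly-≤ (u′ ⊗ # (614 * 2 ^ 40)) (# 2 ⊗ (u′ ⊗ # (411 * 2 ^ 40))) 1≤u)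
      Y≤ : Y ≤ b′ + (a ∸ X)
      Y≤ = +-cancelˡ-≤ X Y _ (begin
        X + Y ≡⟨ X+Y P ⟩
        n ≤⟨ hi ⟩
        ⟦ n⁺ ⟧ u ≤⟨ poly-≤ n⁺ (u′ ⊗ # (411 * 2 ^ 40) ⊕ u′ ⊗ # (614 * 2 ^ 40)) 1≤u ⟩
        b′ + a ≡⟨ cong (b′ +_) (m+[n∸m]≡n X≤a) ⟨
        b′ + (X + (a ∸ X)) ≡⟨ eq b′ X (a ∸ X) ⟩
        X + (b′ + (a ∸ X)) ∎)
        where
        open ≤-Reasoning
        eq : ∀ b x d → b + (x + d) ≡ x + (b + d)
        eq = solve-∀
    few-Y : Y ≤ u * (101 * 2 ^ 40) → 2 * (κ + ω) + Y * (X * X) ≤ y* * (x* * x*)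
    few-Y Y≤ = ≤-trans (+-mono-≤ start (*-mono-≤ Y≤ (*-mono-≤ X≤n X≤n)))
      (poly-≤ (start⁺ ⊕ u′ ⊗ # (101 * 2 ^ 40) ⊗ (n⁺ ⊗ n⁺)) goal⁺ 1≤u)
      where
      X≤n : X ≤ ⟦ n⁺ ⟧ u
      X≤n = ≤-trans (card≤ (C.X? P)) hi

  per-partition : ∀ P → ∑ᶜ (target P) * 2 ^ ω ≤ 4 * Defs.S n
  per-partition P = case (x₀ + 3 * suc u <? card (C.X? P)) ×-dec (y₀ + 3 * suc u <? card (C.Y? P)) of λ
    { (yes (x< , y<)) → ≤-trans (balanced P x< y<) (*-monoʳ-≤ 4 (S-lower P))
    ; (no ¬p) → begin
        ∑ᶜ (target P) * 2 ^ ω ≤⟨ *-monoˡ-≤ (2 ^ ω) (rough P) ⟩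
        2 ^ κ * 2 ^ card (C.Good? P) * 2 ^ ω ≡⟨ trans (exp-merge (2 ^ κ) (card (C.Good? P)) ω) (sym (^-distribˡ-+-* 2 κ (card (C.Good? P) + ω))) ⟩
        2 ^ (κ + (card (C.Good? P) + ω)) ≤⟨ 2^-mono (*-cancelˡ-≤ {κ + (card (C.Good? P) + ω)} {card (C.Good? P*)} 2 (begin
          2 * (κ + (card (C.Good? P) + ω)) ≡⟨ eq κ (card (C.Good? P)) ω ⟩
          2 * (κ + ω) + 2 * card (C.Good? P) ≤⟨ +-monoʳ-≤ (2 * (κ + ω)) (C.good-upper P) ⟩
          2 * (κ + ω) + card (C.Y? P) * (card (C.X? P) * card (C.X? P)) ≤⟨ unbalanced P ¬p ⟩
          y* * (x* * x*) ≤⟨ best ⟩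
          2 * card (C.Good? P*) ∎)) ⟩
        2 ^ card (C.Good? P*) ≤⟨ S-lower P* ⟩
        Defs.S n ≤⟨ m≤m+n (Defs.S n) _ ⟩
        4 * Defs.S n ∎ }
    where
    open ≤-Reasoning
    eq : ∀ a b c → 2 * (a + (b + c)) ≡ 2 * (a + c) + 2 * b
    eq = solve-∀

  bad-bound : ∀ {η} → η ℚ.≤ unit-fraction (pred (2 ^ 100)) → ∀ d → ℕtoℚ d ℚ.≤ η ℚ.* ℕtoℚ (n ^ 3) → d ≤ b
  bad-bound {η} η≤ d h = *-cancelʳ-≤ d b (2 ^ 100) (≤-trans (scaled-bound (pred (2 ^ 100)) η d (n ^ 3) η≤ h)
    (≤-trans (≤-reflexive (cong (λ z → n * (n * z)) (*-identityʳ n))) (≤-trans nnn (poly-≤ (n⁺ ⊗ (n⁺ ⊗ n⁺)) (u′ ⊗ u′ ⊗ u′ ⊗ # (2 ^ 51) ⊗ # (2 ^ 100)) 1≤u))))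

  excess : ∀ {η} → η ℚ.≤ unit-fraction (pred (2 ^ 100)) → (|Forb| n η ∸ Defs.S n) * 2 ^ t ≤ Defs.S n
  excess {η} η≤ = 2^-cancel (|Forb| n η ∸ Defs.S n) t (n + 2) ω (≤-trans (≤-reflexive (+-comm t (n + 2)))
      (≤-trans (+-monoˡ-≤ t (+-monoˡ-≤ 2 hi)) (poly-≤ (n⁺ ⊕ # 2 ⊕ u′ ⊗ # (103 * 2 ^ 40)) (u′ ⊗ # (1128 * 2 ^ 40)) 1≤u))) (begin
    (|Forb| n η ∸ Defs.S n) * 2 ^ ω ≤⟨ *-monoˡ-≤ (2 ^ ω) (m≤n+o⇒m∸n≤o (|Forb| n η) (Defs.S n) (Forb≤ b η (bad-bound η≤))) ⟩
    ∑ᶜ (λ P → ∑ᶜ (target P)) * 2 ^ ω ≡⟨ ∑ᶜ-*ʳ (2 ^ ω) (λ P → ∑ᶜ (target P)) ⟨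
    ∑ᶜ (λ P → ∑ᶜ (target P) * 2 ^ ω) ≤⟨ ∑ᶜ-mono per-partition ⟩
    ∑ᶜ {n} (λ P → 4 * Defs.S n) ≡⟨ ∑ᶜ-const n (4 * Defs.S n) ⟩
    4 * Defs.S n * 2 ^ n ≡⟨ eq (Defs.S n) (2 ^ n) ⟩
    2 ^ n * 4 * Defs.S n ≡⟨ cong (_* Defs.S n) (^-distribˡ-+-* 2 n 2) ⟨
    2 ^ (n + 2) * Defs.S n ∎)
    where
    open ≤-Reasoning
    eq : ∀ s p → 4 * s * p ≡ p * 4 * s
    eq = solve-∀

  tenth : n ≤ t * 10
  tenth = ≤-trans hi (poly-≤ n⁺ (u′ ⊗ # (103 * 2 ^ 40) ⊗ # 10) 1≤u)

  large-case : ∀ {η} → η ℚ.≤ unit-fraction (pred (2 ^ 100)) → (|Forb| n η ∸ Defs.S n) ^ 10 * 2 ^ n ≤ Defs.S n ^ 10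
  large-case {η} η≤ = begin
    E ^ 10 * 2 ^ n ≤⟨ *-monoʳ-≤ (E ^ 10) (2^-mono tenth) ⟩
    E ^ 10 * 2 ^ (t * 10) ≡⟨ cong (E ^ 10 *_) (^-*-assoc 2 t 10) ⟨
    E ^ 10 * (2 ^ t) ^ 10 ≡⟨ ^-distribʳ-* 10 E (2 ^ t) ⟨
    (E * 2 ^ t) ^ 10 ≤⟨ ^-monoˡ-≤ 10 (excess η≤) ⟩
    Defs.S n ^ 10 ∎
    where
    open ≤-Reasoning
    E = |Forb| n η ∸ Defs.S n

-- Small n and the conclusion

bounded-below : ∀ (f : ℕ → ℕ) K → ∃ λ c → ∀ n → n < K → f n ≤ c
bounded-below f zero = 0 , λ n ()
bounded-below f (suc K) = let c , h = bounded-below f K in f K + c , λ n n< → case n ≟ K of λ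
  { (yes refl) → m≤m+n (f n) c
  ; (no n≢K) → ≤-trans (h n (≤∧≢⇒< (≤-pred n<) n≢K)) (m≤n+m c (f K)) }

opaque
  c₅₀ : ℕ
  c₅₀ = 2 ^ 50

  c₅₀-value : c₅₀ ≡ 2 ^ 50
  c₅₀-value = refl

  instance
    c₅₀≢0 : NonZero c₅₀
    c₅₀≢0 = _

-- For n ≥ c₅₀² the quotient u of n by c₅₀ is at least c₅₀, hence larger than the remainder.
quotient-range : ∀ n → c₅₀ * c₅₀ ≤ n → ∃ λ u → 1 ≤ u × u * c₅₀ ≤ n × n ≤ u * (c₅₀ + 1)
quotient-range n n≥ = u , ≤-trans (>-nonZero⁻¹ c₅₀) c≤u , ≤-trans (m≤n+m (u * c₅₀) (n % c₅₀)) (≤-reflexive (sym n≡)) , (begin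
  n ≡⟨ n≡ ⟩
  n % c₅₀ + u * c₅₀ ≤⟨ +-monoˡ-≤ (u * c₅₀) (≤-trans (<⇒≤ (m%n<n n c₅₀)) c≤u) ⟩
  u + u * c₅₀ ≡⟨ eq u c₅₀ ⟩
  u * (c₅₀ + 1) ∎)
  where
  open ≤-Reasoning
  u = n / c₅₀
  n≡ : n ≡ n % c₅₀ + u * c₅₀
  n≡ = m≡m%n+[m/n]*n n c₅₀
  eq : ∀ u c → u + u * c ≡ u * (c + 1)
  eq = solve-∀
  c≤u : c₅₀ ≤ u
  c≤u = ≮⇒≥ (λ u< → <⇒≱ (begin-strict
    n ≡⟨ n≡ ⟩
    n % c₅₀ + u * c₅₀ <⟨ +-monoˡ-< (u * c₅₀) (m%n<n n c₅₀) ⟩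
    c₅₀ + u * c₅₀ ≤⟨ *-monoˡ-≤ c₅₀ u< ⟩
    c₅₀ * c₅₀ ∎) n≥)

-- The inequality |Forb| - S < C 2^(-n/10) S is raised to the tenth power, so that only natural
-- numbers occur. Truncated subtraction is harmless: for |Forb| ≤ S both forms hold as soon as C and
-- S are positive.
theorem3 : Σ ℚ (λ η₀ → (0ℚ <ℚ η₀) × ((η : ℚ) → 0ℚ <ℚ η → η ≤ℚ η₀ →
    Σ ℕ (λ C → (n : ℕ) → 1 ≤ n →
    ((|Forb| n η ∸ S n) ^ 10) *ℕ (2 ^ n) < (C *ℕ S n) ^ 10)))
-- The fraction is 2^-100. In C = 2 + c the summand c bounds |Forb| 2^n for the finitely many n
-- below c₅₀² = 2^100. For larger n the bound holds with constant 1, and the summand 2 makes it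
-- strict.
theorem3 = unit-fraction (pred (2 ^ 100)) , 0<unit-fraction (pred (2 ^ 100)) , λ η _ η≤ →
  let c , small = bounded-below (λ n → |Forb| n η * 2 ^ n) (c₅₀ * c₅₀) in 2 + c , λ n _ →
  let open Triples n in case n <? c₅₀ * c₅₀ of λ
  { (yes n<) → ≤-<-trans (begin
      (|Forb| n η ∸ S n) ^ 10 * 2 ^ n ≤⟨ *-mono-≤ (^-monoˡ-≤ 10 (m∸n≤m (|Forb| n η) (S n))) (^-monoʳ-≤ 2 (m≤m*n n 10)) ⟩
      |Forb| n η ^ 10 * 2 ^ (n * 10) ≡⟨ cong (|Forb| n η ^ 10 *_) (^-*-assoc 2 n 10) ⟨
      |Forb| n η ^ 10 * (2 ^ n) ^ 10 ≡⟨ ^-distribʳ-* 10 (|Forb| n η) (2 ^ n) ⟨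
      (|Forb| n η * 2 ^ n) ^ 10 ≤⟨ ^-monoˡ-≤ 10 (small n n<) ⟩
      c ^ 10 ∎) (^-monoˡ-< 10 (≤-trans (s≤s (n≤1+n c)) (≤-trans (≤-reflexive (sym (*-identityʳ (2 + c)))) (*-monoʳ-≤ (2 + c) 1≤S))))
  ; (no n≮) → let u , 1≤u , lo , hi = quotient-range n (≮⇒≥ n≮) in ≤-<-trans
      (Large.large-case n u 1≤u (≤-trans (≤-reflexive (cong (u *_) (sym c₅₀-value))) lo) (≤-trans hi (≤-reflexive (cong (λ z → u * (z + 1)) c₅₀-value))) η≤)
      (^-monoˡ-< 10 (≤-trans (≤-trans (+-monoˡ-≤ (S n) 1≤S) (m≤m+n (S n + S n) (c * S n))) (≤-reflexive (+-assoc (S n) (S n) (c * S n))))) }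
  where open ≤-Reasoning
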